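{- Let $h\colon\mathbb{Z}^2\to\mathbb{Z}$ be a height function, and let $f\colon\mathcal{I}\cup\mathcal{U}\to K$ be the function defined by the octahedron recurrence below. Then for every $(n,i,j)\in\mathcal{U}$, $f(n,i,j)$ lies in the ring $R=\mathbb{Z}[x(i,j)^{\pm 1},a(i,j),b(i,j),c(i,j),d(i,j)]$, and when $f(n,i,j)$ is written as a Laurent polynomial in these variables, every monomial that appears has coefficient $1$. Moreover, in every monomial appearing, the exponent of each face variable $x(i',j')$ lies between $-1$ and $3$ inclusive, and the exponent of each edge variable ($a(\cdot,\cdot)$, $b(\cdot,\cdot)$, $c(\cdot,\cdot)$ or $d(\cdot,\cdot)$) is $0$ or $1$.
   Context: Let $\mathcal{L}=\{(n,i,j)\in\mathbb{Z}^3 : n\equiv i+j \pmod 2\}$. A height function is a map $h\colon\mathbb{Z}^2\to\mathbb{Z}$ such that (1) $|h(i_1,j_1)-h(i_2,j_2)|=1$ whenever $|i_1-i_2|+|j_1-j_2|=1$; (2) $h(i,j)\equiv i+j\pmod 2$ for all $(i,j)$; (3) $h(i,j)+|i|+|j|\to\infty$ as $|i|+|j|\to\infty$. Set $\mathcal{I}=\{(n,i,j)\in\mathcal{L}: n=h(i,j)\}$ and $\mathcal{U}=\{(n,i,j)\in\mathcal{L}: n>h(i,j)\}$. Introduce formal commuting variables: face variables $x(i,j)$ for all $(i,j)\in\mathbb{Z}^2$, and edge variables $a(i,j),b(i,j),c(i,j),d(i,j)$ for all $(i,j)\in\mathbb{Z}^2$ with $i+j$ odd; let $K$ be the field of rational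 functions in all these variables over $\mathbb{Q}$. Define $f\colon\mathcal{I}\cup\mathcal{U}\to K$ by $f(n,i,j)=x(i,j)$ for $(n,i,j)\in\mathcal{I}$, and for $(n,i,j)\in\mathcal{U}$ $$f(n,i,j)=\frac{a(i+n-1,j)\,c(i-n+1,j)\,f(n-1,i,j+1)\,f(n-1,i,j-1)+b(i,j+n-1)\,d(i,j-n+1)\,f(n-1,i+1,j)\,f(n-1,i-1,j)}{f(n-2,i,j)}.$$ (Condition (3) guarantees this recursion terminates, so $f$ is well defined.) -}

module Defs where

open import Data.Bool using (Bool; true; false; if_then_else_; _∧_)
open import Data.Nat using (ℕ; zero; suc)
import Data.Nat as ℕ
open import Data.Integer using (ℤ; +_; -[1+_]; ∣_∣; _+_; _-_; _*_; _<_; _≤_; _<?_; _≟_)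
open import Data.Integer.Divisibility using (_∣_)
open import Data.List using (List; []; _∷_; _++_; map; concatMap)
open import Data.List.Relation.Unary.All using (All)
open import Data.List.Relation.Unary.AllPairs using (AllPairs)
open import Data.Product using (_×_; _,_; proj₁; proj₂; ∃; ∃-syntax)
open import Data.Sum using (_⊎_)
open import Relation.Binary.PropositionalEquality using (_≡_)
open import Relation.Nullary using (¬_)
open import Relation.Nullary.Decidable using (⌊_⌋)

record IsHeightFunction (h : ℤ → ℤ → ℤ) : Set where
  field
    adjH : ∀ i j → ∣ h i j - h (i + + 1) j ∣ ≡ 1
    adjV : ∀ i j → ∣ h i j - h i (j + + 1) ∣ ≡ 1
    parity : ∀ i j → + 2 ∣ (h i j - (i + j))
    growth : ∀ (M : ℤ) → ∃[ N ] ∀ i j → N ℕ.< ∣ i ∣ ℕ.+ ∣ j ∣ →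
               M < h i j + + ∣ i ∣ + + ∣ j ∣

InL : ℤ → ℤ → ℤ → Set
InL n i j = + 2 ∣ (n - (i + j))

InU : (ℤ → ℤ → ℤ) → ℤ → ℤ → ℤ → Set
InU h n i j = InL n i j × h i j < n

data Var : Set where
  x a b c d : ℤ → ℤ → Var

_=ℤ_ : ℤ → ℤ → Bool
m =ℤ n = ⌊ m ≟ n ⌋

_=ᵥ_ : Var → Var → Bool
x i j =ᵥ x k l = (i =ℤ k) ∧ (j =ℤ l)
a i j =ᵥ a k l = (i =ℤ k) ∧ (j =ℤ l)
b i j =ᵥ b k l = (i =ℤ k) ∧ (j =ℤ l)
c i j =ᵥ c k l = (i =ℤ k) ∧ (j =ℤ l)
d i j =ᵥ d k l = (i =ℤ k) ∧ (j =ℤ l)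
_ =ᵥ _ = false

-- a monomial is a finite list of (variable, exponent); repeated
-- variables multiply
Mono : Set
Mono = List (Var × ℤ)

expo : Mono → Var → ℤ
expo [] v = + 0
expo ((w , e) ∷ m) v = (if w =ᵥ v then e else + 0) + expo m v

MonoEq : Mono → Mono → Set
MonoEq m m' = ∀ v → expo m v ≡ expo m' v

allB : {A : Set} → (A → Bool) → List A → Bool
allB p [] = true
allB p (y ∷ ys) = p y ∧ allB p ys

-- boolean test of MonoEq: only variables occurring in m or m' matter
monoEq? : Mono → Mono → Bool
monoEq? m m' = allB (λ v → expo m v =ℤ expo m' v) (map proj₁ (m ++ m'))

-- a Laurent polynomial is a finite formal sum of (coefficient, monomial)
Poly : Set
Poly = List (ℤ × Mono)

coeff : Poly → Mono → ℤ
coeff [] m = + 0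
coeff ((k , m') ∷ p) m = (if monoEq? m m' then k else + 0) + coeff p m

_≈ₚ_ : Poly → Poly → Set
p ≈ₚ q = ∀ m → coeff p m ≡ coeff q m

_+ₚ_ : Poly → Poly → Poly
p +ₚ q = p ++ q

_*ₚ_ : Poly → Poly → Poly
p *ₚ q = concatMap (λ t → map (λ s → (proj₁ t * proj₁ s , proj₂ t ++ proj₂ s)) q) p

varₚ : Var → Poly
varₚ v = (+ 1 , (v , + 1) ∷ []) ∷ []

oneₚ : Poly
oneₚ = (+ 1 , []) ∷ []

zeroₚ : Poly
zeroₚ = []

Frac : Set
Frac = Poly × Poly

_≈_ : Frac → Frac → Set
(p , q) ≈ (r , s) = (p *ₚ s) ≈ₚ (q *ₚ r)

infixl 6 _+f_
infixl 7 _*f_ _/f_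

_+f_ : Frac → Frac → Frac
(p , q) +f (r , s) = ((p *ₚ s) +ₚ (q *ₚ r)) , (q *ₚ s)

_*f_ : Frac → Frac → Frac
(p , q) *f (r , s) = (p *ₚ r) , (q *ₚ s)

_/f_ : Frac → Frac → Frac
(p , q) /f (r , s) = (p *ₚ s) , (q *ₚ r)

varf : Var → Frac
varf v = varₚ v , oneₚ

-- The octahedron recurrence, computed with fuel.
-- fK h k n i j is f(n,i,j) whenever k is at least the recursion depth;
-- the value for fuel 0 or for points outside 𝓘 ∪ 𝓤 is irrelevant junk.

fK : (ℤ → ℤ → ℤ) → ℕ → ℤ → ℤ → ℤ → Frac
fK h zero n i j = zeroₚ , oneₚ
fK h (suc k) n i j =
  if n =ℤ h i j then varf (x i j)
  else if ⌊ h i j <? n ⌋ then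
    ((varf (a (i + n - + 1) j) *f varf (c (i - n + + 1) j)
        *f fK h k (n - + 1) i (j + + 1) *f fK h k (n - + 1) i (j - + 1))
     +f (varf (b i (j + n - + 1)) *f varf (d i (j - n + + 1))
        *f fK h k (n - + 1) (i + + 1) j *f fK h k (n - + 1) (i - + 1) j))
    /f fK h k (n - + 2) i j
  else (zeroₚ , oneₚ)

FEquals : (ℤ → ℤ → ℤ) → ℤ → ℤ → ℤ → Frac → Set
FEquals h n i j F = ∃[ N ] ∀ k → N ℕ.≤ k → fK h k n i j ≈ F

sumMonos : List Mono → Poly
sumMonos ms = map (λ m → (+ 1 , m)) ms

ExpoOK : Var → ℤ → Set
ExpoOK (x _ _) e = -[1+ 0 ] ≤ e × e ≤ + 3
ExpoOK (a _ _) e = e ≡ + 0 ⊎ e ≡ + 1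
ExpoOK (b _ _) e = e ≡ + 0 ⊎ e ≡ + 1
ExpoOK (c _ _) e = e ≡ + 0 ⊎ e ≡ + 1
ExpoOK (d _ _) e = e ≡ + 0 ⊎ e ≡ + 1

MonoOK : Mono → Set
MonoOK m = ∀ v → ExpoOK v (expo m v)

{-# OPTIONS --safe #-}
-- Weighted perfect matchings of the graph attached to a surface (Speyer's
-- crosses and wrenches) are encoded by integer functions y that agree with
-- a cone far away.  The value at a point above the surface is the sum of
-- their weights: distinct matchings have distinct weights, and exponents
-- can be read off the differences of y.  Raising the surface at a local
-- minimum substitutes B / x for the variable x of that face, where B is
-- the binomial in the exchange relation.  For the sums of weights this
-- holds because one or two local values of y merge or split at the face.
-- On a surface that is as high as possible below a point the octahedron
-- relation is immediate, and as B can be cancelled, the substitutions carry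
-- it down to any surface.

module Submission where

open import Defs
open import Algebra.Bundles using (CommutativeRing)
open import Data.Bool using (Bool; true; false; if_then_else_; _∧_)
open import Data.Empty using (⊥-elim)
open import Data.Integer hiding (suc; NonZero; pos; neg)
open import Data.Integer.Divisibility using (_∣_)
import Data.Integer.Divisibility.Signed as Signed
open import Data.Integer.Properties hiding (_≟_; pos-+; pos-*)
open import Data.Integer.Tactic.RingSolver using (solve-∀) renaming (solve to solveℤ)
open import Data.List using (List; []; _∷_; length; _++_; map; concatMap; filter; upTo; cartesianProduct)
open import Data.List using () renaming (_∷_ to _∷ˡ_)
import Data.List.Membership.DecPropositional as DecPropositional
open import Data.List.Membership.Propositional using (_∈_; lose; find)
open import Data.List.Membership.Propositional.Properties using (∈-map⁺; ∈-++⁺ˡ; ∈-++⁺ʳ; ∈-concatMap⁻; ∈-upTo⁺; ∈-filter⁻; ∈-cartesianProduct⁺; ∈-cartesianProduct⁻; ∈-map⁻; ∈-upTo⁻)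
open import Data.List.Properties using (map-++; map-cong)
open import Data.List.Relation.Unary.All as All using (All; []; _∷_)
import Data.List.Relation.Unary.All.Properties as All
open import Data.List.Relation.Unary.AllPairs as AllPairs using (AllPairs; []; _∷_)
import Data.List.Relation.Unary.AllPairs.Properties as AllPairs
open import Data.List.Relation.Unary.Any as Any using (here; there)
open import Data.List.Relation.Unary.Unique.Propositional using (Unique)
import Data.List.Relation.Unary.Unique.Propositional.Properties as Unique
open import Data.Maybe using (nothing)
open import Data.Nat as ℕ using (ℕ; zero; suc)
open import Data.Nat.Induction using (<-wellFounded)
import Data.Nat.Properties as ℕ
open import Data.Product using (_×_; _,_; proj₁; proj₂; ∃-syntax)
open import Data.Product.Properties using (≡-dec)
open import Data.Sum using (_⊎_; inj₁; inj₂; [_,_]′)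
open import Induction.WellFounded using (Acc; acc)
open import Level using (0ℓ)
open import Relation.Binary.Definitions using (tri<; tri≈; tri>)
open import Relation.Binary.PropositionalEquality using (_≡_; refl; sym; trans; cong; cong₂; subst; subst₂)
open import Relation.Nullary using (¬_; Dec; yes; no; does)
open import Relation.Nullary.Decidable using (⌊_⌋; dec-true; dec-false; _×-dec_; _→-dec_; ¬?; map′)

↑ : ℤ → ℤ
↑ i = i + + 1

-- Polynomial identities

private
  identity₁ : ∀ p q r s → p - q - (r - s) ≡ p - r + (s - q)
  identity₁ = solve-∀

  identity₂ : ∀ p q → p - q ≡ - (q - p)
  identity₂ = solve-∀

  identity₃ : ∀ p q r → p - q ≡ p - r - (q - r)
  identity₃ = solve-∀

  identity₄ : ∀ p q r s t → p - q - (r - s) ≡ p - t - (r - t) + (s - q)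
  identity₄ = solve-∀

  identity₅ : ∀ p q r s → + 1 - (p - q - (r - s)) ≡ r - p + (+ 1 - (s - q))
  identity₅ = solve-∀

  identity₆ : ∀ p q r → p - q + (q - r) - + 1 ≡ q - r - (+ 1 - (p - q))
  identity₆ = solve-∀

  identity₇ : ∀ p q r → p - q - (q - r) ≡ + 1 - (+ 1 - (p - q) + (q - r))
  identity₇ = solve-∀

  identity₈ : ∀ p q r s t → + 1 - (p - q - (r - s)) ≡ r - t - (p - t) + (+ 1 - (s - q))
  identity₈ = solve-∀

  identity₉ : ∀ p q → + 1 - (p - q) ≡ - (p - q - + 1)
  identity₉ = solve-∀

  identity₁₀ : ∀ p q r s → p - q + (q - r) - + 1 ≡ s - r - (+ 1 - (p - s))
  identity₁₀ = solve-∀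

  identity₁₁ : ∀ p q r → + 1 - (p - q) ≡ q - r - (p - r - + 1)
  identity₁₁ = solve-∀

  identity₁₂ : ∀ p q r → p - q - (q - r) ≡ + 1 - (q - r + (+ 1 - (p - q)))
  identity₁₂ = solve-∀

  identity₁₃ : ∀ p q r s t → p - q - (r - s) ≡ p - t - + 1 - (r - t - + 1) + (s - q)
  identity₁₃ = solve-∀

  identity₁₄ : ∀ p q r → p - q ≡ + 1 - (q - r) - (+ 1 - (p - r))
  identity₁₄ = solve-∀

  identity₁₅ : ∀ p q r → p - q + (r - q) - + 1 ≡ + 1 - (+ 1 - (r - q) + (+ 1 - (p - q)))
  identity₁₅ = solve-∀

  identity₁₆ : ∀ p q r s → p - q + (r - p) - (s - q + (r - s)) ≡ r - p + (p - q) - (r - s + (s - q))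
  identity₁₆ = solve-∀

  identity₁₇ : ∀ p q r s t → + 1 - (p - q - (r - s)) ≡ r - t - + 1 - (p - t - + 1) + (+ 1 - (s - q))
  identity₁₇ = solve-∀

  identity₁₈ : ∀ p q → p + + 1 + - q ≡ p + - q + + 1
  identity₁₈ = solve-∀

  identity₁₉ : ∀ p q → p - (q - + 1) ≡ + 1 - (q + - p)
  identity₁₉ = solve-∀

  identity₂₀ : ∀ p → + 0 ≡ p - p
  identity₂₀ = solve-∀

  identity₂₁ : ∀ p → + 0 ≡ + 2 * p + (p - p) - p - p
  identity₂₁ = solve-∀

  identity₂₂ : ∀ p → + 0 ≡ p + p - (+ 2 * p + (p - p))
  identity₂₂ = solve-∀

  identity₂₃ : ∀ p → p + p - p - p ≡ + 0
  identity₂₃ = solve-∀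

  identity₂₄ : ∀ p → + 1 ≡ p - (p - + 1)
  identity₂₄ = solve-∀

  identity₂₅ : ∀ p → + 0 ≡ p - + 1 - (p - + 1)
  identity₂₅ = solve-∀

  identity₂₆ : ∀ p → -[1+ 0 ] ≡ + 2 * (p - + 1) + (p - (p - + 1)) - p - p
  identity₂₆ = solve-∀

  identity₂₇ : ∀ p → + 0 ≡ p - + 1 + p - (+ 2 * (p - + 1) + (p - (p - + 1)))
  identity₂₇ = solve-∀

  identity₂₈ : ∀ p → -[1+ 0 ] ≡ p - + 1 + p - (+ 2 * p + (p - p))
  identity₂₈ = solve-∀

  identity₂₉ : ∀ p → p + p - (p - + 1) - p ≡ + 1
  identity₂₉ = solve-∀

  identity₃₀ : ∀ p → + 0 ≡ + 2 * (p - + 1) + (p - + 1 - (p - + 1)) - (p - + 1) - (p - + 1)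
  identity₃₀ = solve-∀

  identity₃₁ : ∀ p → + 1 ≡ p - + 1 + p - (+ 2 * (p - + 1) + (p - + 1 - (p - + 1)))
  identity₃₁ = solve-∀

  identity₃₂ : ∀ p → + 1 ≡ + 2 * (p - + 1) + (p - (p - + 1)) - (p - + 1) - (p - + 1)
  identity₃₂ = solve-∀

  identity₃₃ : ∀ p → p - + 1 + (p - + 1) - (p - + 1) - p ≡ -[1+ 0 ]
  identity₃₃ = solve-∀

  identity₃₄ : ∀ p → + 1 ≡ p - + 1 - (p - + 1 - + 1)
  identity₃₄ = solve-∀

  identity₃₅ : ∀ p q → + 1 - (p - (q - + 1 - + 1)) ≡ q - + 1 - p
  identity₃₅ = solve-∀

  identity₃₆ : ∀ p q → + 1 - (p - q) ≡ q - (p - + 1)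
  identity₃₆ = solve-∀

  identity₃₇ : ∀ p → + 0 ≡ p - + 1 - + 1 + p - (+ 2 * (p - + 1) + (p - + 1 - (p - + 1)))
  identity₃₇ = solve-∀

  identity₃₈ : ∀ p → p - + 1 + (p - + 1) - (p - + 1 - + 1) - p ≡ + 0
  identity₃₈ = solve-∀

  identity₃₉ : ∀ p q → + 1 + - (p + - q) ≡ q - (p - + 1)
  identity₃₉ = solve-∀

  identity₄₀ : ∀ p q → p - + 1 + - q ≡ p - + 1 - q
  identity₄₀ = solve-∀

  identity₄₁ : ∀ p → + 0 ≡ + 2 * (p - + 1) + (p - (p - + 1)) - p - (p - + 1)
  identity₄₁ = solve-∀

  identity₄₂ : ∀ p → p + (p - + 1) - (p - + 1) - p ≡ + 0
  identity₄₂ = solve-∀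

  identity₄₃ : ∀ p → + 0 ≡ + 2 * (p - + 1) + (p - (p - + 1)) - (p - + 1) - p
  identity₄₃ = solve-∀

  identity₄₄ : ∀ p → p - + 1 + p - (p - + 1) - p ≡ + 0
  identity₄₄ = solve-∀

  identity₄₅ : ∀ p q r s t u v → p - (q - r) + (s - t) - (s - (u - v)) ≡ p + + 1 + (r - v + (u - q)) - (t + + 1)
  identity₄₅ = solve-∀

  identity₄₆ : ∀ p q r s t u v → p - (q - r) + (+ 1 - (s - t)) - (t - (u - v)) ≡ p + + 1 - (v - r) - (s - (u - q))
  identity₄₆ = solve-∀

  identity₄₇ : ∀ p q r s t u v → p - (q - r) + (+ 1 - (s - t)) - (t - (u - v)) ≡ p + + 1 + (r - v) - (s + (q - u))
  identity₄₇ = solve-∀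

  identity₄₈ : ∀ p q r s t u v → p - (q - r) + (+ 1 - (s - t)) - (t - (u - v)) ≡ p - (v - r + (q - u)) - (s - + 1)
  identity₄₈ = solve-∀

  identity₄₉ : ∀ p q r s → p - q - + 1 + (+ 1 - (p - r)) - (r - s - + 1) ≡ + 1 - (q - s)
  identity₄₉ = solve-∀

  identity₅₀ : ∀ p q r s → p - q - + 1 + (r - p) - (r - s - + 1) ≡ s - q - + 0
  identity₅₀ = solve-∀

  identity₅₁ : ∀ p → p + + 1 - p ≡ + 1
  identity₅₁ = solve-∀

  identity₅₂ : ∀ p → p - + 1 - p ≡ -[1+ 0 ]
  identity₅₂ = solve-∀

  lower-identity : ∀ s11 s21 y21 y11 s12 y12 y22 s01 y01 y02 s10 y10 y20 y00 → - + 2 * (+ 1 - + 2 * (s11 - s21)) * (y21 - y11) + + 2 * (+ 1 - + 2 * (s11 - s12)) * (y12 - y11) + + 4 * (s11 - s12 - (s11 - s21)) * (y22 - y11) + (+ 1 - + 2 * (s11 - s21)) + + 1 + (- + 2 * (+ 1 - + 2 * (+ 1 - (s01 - s11))) * (y01 - y11) + + 2 * (+ 1 - + 2 * (s11 - s12)) * (y12 - y11) + + 4 * (s11 - s12 - (+ 1 - (s01 - s11))) * (y02 - y11) + (+ 1 - + 2 * (+ 1 - (s01 - s11))) + + 1) + (- + 2 * (+ 1 - + 2 * (s11 - s21)) * (y21 - y11) + + 2 * (+ 1 - + 2 * (+ 1 - (s10 - s11))) * (y10 - y11 - + 1) + + 4 * (+ 1 - (s10 - s11) - (s11 - s21)) *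 (y20 - y11 - + 1) + (+ 1 - + 2 * (s11 - s21)) + + 1) + (- + 2 * (+ 1 - + 2 * (+ 1 - (s01 - s11))) * (y01 - y11) + + 2 * (+ 1 - + 2 * (+ 1 - (s10 - s11))) * (y10 - y11 - + 1) + + 4 * (+ 1 - (s10 - s11) - (+ 1 - (s01 - s11))) * (y00 - y11 - + 1) + (+ 1 - + 2 * (+ 1 - (s01 - s11))) + + 1) ≡ + 4 * (- (+ 2 * (s21 - s11) + + 1) * y21 - (+ 2 * (s01 - s11) - + 1) * y01 + (+ 2 * (s12 - s11) + + 1) * y12 + (+ 2 * (s10 - s11) - + 1) * y10 + (s21 - s12) * y22 + (s01 - s12 - + 1) * y02 + (s21 - s10 + + 1) * y20 + (s01 - s10) * y00 - -[1+ 0 ])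
  lower-identity = solve-∀

  upper-identity : ∀ s11 s21 y21 y11 s12 y12 y22 s01 y01 y02 s10 y10 y20 y00 → + 3 - (- + 2 * (+ 1 - + 2 * (s11 - s21)) * (y21 - y11) + + 2 * (+ 1 - + 2 * (s11 - s12)) * (y12 - y11) + + 4 * (s11 - s12 - (s11 - s21)) * (y22 - y11) + (+ 1 - + 2 * (s11 - s21))) + (+ 3 - (- + 2 * (+ 1 - + 2 * (+ 1 - (s01 - s11))) * (y01 - y11) + + 2 * (+ 1 - + 2 * (s11 - s12)) * (y12 - y11) + + 4 * (s11 - s12 - (+ 1 - (s01 - s11))) * (y02 - y11) + (+ 1 - + 2 * (+ 1 - (s01 - s11))))) + (+ 3 - (- + 2 * (+ 1 - + 2 * (s11 - s21)) * (y21 - y11) + + 2 * (+ 1 - + 2 * (+ 1 - (s10 - s11))) * (y10 - y11 - + 1) + + 4 * (+ 1 - (s10 - s11) - (s11 - s21)) * (y20 - y11 - + 1) + (+ 1 - + 2 * (s11 - s21)))) + (+ 3 - (- + 2 * (+ 1 - + 2 * (+ 1 - (s01 - s11))) * (y01 - y11) + + 2 * (+ 1 - + 2 * (+ 1 - (s10 - s11))) * (y10 - y11 - + 1) + + 4 * (+ 1 - (s10 - s11) - (+ 1 - (s01 - s11))) * (y00 - y11 - + 1) + (+ 1 - + 2 * (+ 1 - (s01 - s11))))) ≡ + 4 * (+ 3 - (- (+ 2 * (s21 - s11) + + 1) * y21 - (+ 2 * (s01 - s11) - + 1) * y01 + (+ 2 * (s12 - s11) + + 1) * y12 + (+ 2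 * (s10 - s11) - + 1) * y10 + (s21 - s12) * y22 + (s01 - s12 - + 1) * y02 + (s21 - s10 + + 1) * y20 + (s01 - s10) * y00))
  upper-identity = solve-∀

  maximum-identity : ∀ m y21 y01 y12 y10 y22 y02 y20 y00 → - (+ 2 * (m - (m + + 1)) + + 1) * y21 - (+ 2 * (m + + 1 - (m + + 1)) - + 1) * y01 + (+ 2 * (m - (m + + 1)) + + 1) * y12 + (+ 2 * (m + + 1 - (m + + 1)) - + 1) * y10 + (m - m) * y22 + (m + + 1 - m - + 1) * y02 + (m - (m + + 1) + + 1) * y20 + (m + + 1 - (m + + 1)) * y00 ≡ y21 + y01 - y12 - y10
  maximum-identity = solve-∀

  cone-identity : ∀ y₁ z₂ z₁ z₀ y₂ y₀ w₂₂ w₀₂ w₂₀ w₀₀ → - (+ 2 * (y₁ - z₂ - (y₁ - z₁)) + + 1) * y₁ - (+ 2 * (y₁ - z₀ - (y₁ - z₁)) - + 1) * y₁ + (+ 2 * (y₂ - z₁ - (y₁ - z₁)) + + 1) * y₂ + (+ 2 * (y₀ - z₁ - (y₁ - z₁)) - + 1) * y₀ + (y₁ - z₂ - (y₂ - z₁)) * w₂₂ + (y₁ - z₀ - (y₂ - z₁) - + 1) * w₀₂ + (y₁ - z₂ - (y₀ - z₁) + + 1) * w₂₀ + (y₁ - z₀ - (y₀ - z₁)) * w₀₀ ≡ (z₂ - z₁ - (z₁ - z₀)) * (y₁ - y₂ - (y₀ - y₁)) + ((z₁ - z₀ - (y₀ - y₁)) * (w₀₀ - y₀) + (+ 1 -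 (z₂ - z₁) - (y₀ - y₁)) * (w₂₀ - y₀) + ((z₁ - z₀ + (y₁ - y₂) - + 1) * (w₀₂ - y₂) + (y₁ - y₂ - (z₂ - z₁)) * (w₂₂ - y₂)))
  cone-identity = solve-∀

NN : ℤ → Set
NN e = 0ℤ ≤ e

infixl 6 _⊕_
_⊕_ : ∀ {a b} → NN a → NN b → NN (a + b)
_⊕_ = +-mono-≤

by : ∀ {a b} → NN a → a ≡ b → NN b
by p refl = p

≤⇒NN : ∀ {m n} → m ≤ n → NN (n - m)
≤⇒NN = i≤j⇒0≤j-i

NN⇒≤ : ∀ {m n} → NN (n - m) → m ≤ n
NN⇒≤ = 0≤i-j⇒j≤i

absurd : ∀ {A : Set} {e k} → NN e → e ≡ -[1+ k ] → A
absurd p refl with p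
... | ()

nat : ∀ {n} → NN (+ n)
nat = +≤+ ℕ.z≤n

Bit : ℤ → Set
Bit e = NN e × NN (+ 1 - e)

bit-split : ∀ {e} → Bit e → (e ≡ + 0) ⊎ (e ≡ + 1)
bit-split {+ 0} _ = inj₁ refl
bit-split {+ 1} _ = inj₂ refl
bit-split {+ suc (suc n)} (_ , ())
bit-split { -[1+ n ]} (() , _)

bit0 : Bit (+ 0)
bit0 = nat , nat

bit1 : Bit (+ 1)
bit1 = nat , nat

bit-cong : ∀ {e f} → Bit e → e ≡ f → Bit f
bit-cong p refl = p

pos : ℤ → ℤ
pos (+ n) = + n
pos -[1+ n ] = + 0

pos-nonneg : ∀ e → NN (pos e)
pos-nonneg (+ n) = nat
pos-nonneg -[1+ n ] = nat

pos-step : ∀ e → Bit (pos (e + + 1) - pos e)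
pos-step (+ n) = bit-cong bit1 (sym (trans (cong (λ m → m - + n) (+-comm (+ n) (+ 1))) (cancel (+ n))))
  where
  cancel : ∀ m → + 1 + m - m ≡ + 1
  cancel = solve-∀
pos-step -[1+ zero ] = bit0
pos-step -[1+ suc n ] = bit0

pos-step-nonneg : ∀ {e} → NN e → pos (e + + 1) ≡ pos e + + 1
pos-step-nonneg {+ n} _ = refl

pos-of-nonneg : ∀ {e} → NN e → pos e ≡ e
pos-of-nonneg {+ n} _ = refl

pos-of-nonpos : ∀ e → NN (- e) → pos e ≡ + 0
pos-of-nonpos (+ 0) _ = refl
pos-of-nonpos -[1+ n ] _ = refl

sign-split : ∀ e → NN e ⊎ NN (- + 1 - e)
sign-split (+ n) = inj₁ nat
sign-split -[1+ n ] = inj₂ nat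

NN-antisym : ∀ {e} → NN e → NN (- e) → e ≡ + 0
NN-antisym {+ 0} _ _ = refl
NN-antisym {+ suc n} _ ()
NN-antisym { -[1+ n ]} () _

-- Finite sums

+-congˡ : ∀ k {m n} → m ≡ n → k + m ≡ k + n
+-congˡ k refl = refl

∑ : ∀ {A : Set} → List A → (A → ℤ) → ℤ
∑ [] f = + 0
∑ (t ∷ ts) f = f t + ∑ ts f

module _ {A : Set} where

  ∑-cong : ∀ (ts : List A) {f g : A → ℤ} → (∀ t → f t ≡ g t) → ∑ ts f ≡ ∑ ts g
  ∑-cong [] eq = refl
  ∑-cong (t ∷ ts) eq = cong₂ _+_ (eq t) (∑-cong ts eq)

  ∑-cong-∈ : ∀ (ts : List A) {f g : A → ℤ} → (∀ t → t ∈ ts → f t ≡ g t) → ∑ ts f ≡ ∑ ts g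
  ∑-cong-∈ [] eq = refl
  ∑-cong-∈ (t ∷ ts) eq = cong₂ _+_ (eq t (here refl)) (∑-cong-∈ ts (λ u u∈ → eq u (there u∈)))

  ∑-zero : ∀ (ts : List A) → ∑ ts (λ _ → + 0) ≡ + 0
  ∑-zero [] = refl
  ∑-zero (t ∷ ts) = trans (+-identityˡ _) (∑-zero ts)

  ∑-+ : ∀ (ts : List A) (f g : A → ℤ) → ∑ ts (λ t → f t + g t) ≡ ∑ ts f + ∑ ts g
  ∑-+ [] f g = refl
  ∑-+ (t ∷ ts) f g = trans (+-congˡ (f t + g t) (∑-+ ts f g)) (shuffle (f t) (g t) (∑ ts f) (∑ ts g))
    where
    shuffle : ∀ p q r s → p + q + (r + s) ≡ p + r + (q + s)
    shuffle = solve-∀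

  ∑-* : ∀ (ts : List A) k (f : A → ℤ) → ∑ ts (λ t → k * f t) ≡ k * ∑ ts f
  ∑-* [] k f = sym (*-zeroʳ k)
  ∑-* (t ∷ ts) k f = trans (+-congˡ (k * f t) (∑-* ts k f)) (sym (*-distribˡ-+ k (f t) (∑ ts f)))

  ∑-++ : ∀ (ts us : List A) (f : A → ℤ) → ∑ (ts ++ us) f ≡ ∑ ts f + ∑ us f
  ∑-++ [] us f = sym (+-identityˡ _)
  ∑-++ (t ∷ ts) us f = trans (+-congˡ (f t) (∑-++ ts us f)) (sym (+-assoc (f t) _ _))

module _ {A B : Set} where

  ∑-map : ∀ (g : A → B) ts (f : B → ℤ) → ∑ (map g ts) f ≡ ∑ ts (λ t → f (g t))
  ∑-map g [] f = refl
  ∑-map g (t ∷ ts) f = +-congˡ (f (g t)) (∑-map g ts f)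

  ∑-concatMap : ∀ (g : A → List B) ts (f : B → ℤ) → ∑ (concatMap g ts) f ≡ ∑ ts (λ t → ∑ (g t) f)
  ∑-concatMap g [] f = refl
  ∑-concatMap g (t ∷ ts) f = trans (∑-++ (g t) (concatMap g ts) f) (+-congˡ (∑ (g t) f) (∑-concatMap g ts f))

  ∑-swap : ∀ (ts : List A) (us : List B) (f : A → B → ℤ) →
           ∑ ts (λ t → ∑ us (f t)) ≡ ∑ us (λ u → ∑ ts (λ t → f t u))
  ∑-swap [] us f = sym (∑-zero us)
  ∑-swap (t ∷ ts) us f = trans (+-congˡ (∑ us (f t)) (∑-swap ts us f)) (sym (∑-+ us (f t) _))

module _ {A : Set} where

  ∑-filter : ∀ {P : A → Set} (P? : ∀ t → Dec (P t)) ts (f : A → ℤ) →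
             ∑ (filter P? ts) f ≡ ∑ ts (λ t → if does (P? t) then f t else + 0)
  ∑-filter P? [] f = refl
  ∑-filter P? (t ∷ ts) f with does (P? t)
  ... | true = +-congˡ (f t) (∑-filter P? ts f)
  ... | false = trans (∑-filter P? ts f) (sym (+-identityˡ _))

  ∑-vanish : ∀ (ts : List A) (f : A → ℤ) → (∀ u → u ∈ ts → f u ≡ + 0) → ∑ ts f ≡ + 0
  ∑-vanish ts f z = trans (∑-cong-∈ ts z) (∑-zero ts)

  ∑-single : ∀ {ts : List A} {t} → Unique ts → t ∈ ts → (f : A → ℤ) →
             (∀ u → u ∈ ts → ¬ (u ≡ t) → f u ≡ + 0) → ∑ ts f ≡ f t
  ∑-single {t = t} (fresh ∷ _) (here refl) f z =
    trans (+-congˡ (f t) (∑-vanish _ f (λ u u∈ → z u (there u∈) (λ eq → All.lookup fresh u∈ (sym eq)))))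
          (+-identityʳ _)
  ∑-single {ts = s ∷ ts} (fresh ∷ uniq) (there t∈) f z =
    trans (cong₂ _+_ (z s (here refl) (All.lookup fresh t∈)) (∑-single uniq t∈ f (λ u u∈ → z u (there u∈))))
          (+-identityˡ _)

+-cancelˡ : ∀ k {m n} → k + m ≡ k + n → m ≡ n
+-cancelˡ k {m} {n} eq = trans (remove m) (trans (+-congˡ (- k) eq) (sym (remove n)))
  where
  remove : ∀ m → m ≡ - k + (k + m)
  remove m = solveℤ (m ∷ˡ k ∷ˡ [])

-- Monomials

infix 4 _≃_
record _≃_ (m m' : Mono) : Set where
  constructor same-expo
  field exponents : MonoEq m m'
open _≃_ public

=ℤ-sound : ∀ m n → (m =ℤ n) ≡ true → m ≡ n
=ℤ-sound m n eq with m ≟ n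
... | yes p = p

=ℤ-refl : ∀ m → (m =ℤ m) ≡ true
=ℤ-refl m with m ≟ m
... | yes _ = refl
... | no m≢m = ⊥-elim (m≢m refl)

∧-true : ∀ {p q} → (p ∧ q) ≡ true → p ≡ true × q ≡ true
∧-true {true} {true} _ = refl , refl

=ᵥ-sound : ∀ v w → (v =ᵥ w) ≡ true → v ≡ w
=ᵥ-sound (x i j) (x k l) eq with ∧-true {i =ℤ k} eq
... | p , q = cong₂ x (=ℤ-sound i k p) (=ℤ-sound j l q)
=ᵥ-sound (a i j) (a k l) eq with ∧-true {i =ℤ k} eq
... | p , q = cong₂ a (=ℤ-sound i k p) (=ℤ-sound j l q)
=ᵥ-sound (b i j) (b k l) eq with ∧-true {i =ℤ k} eq
... | p , q = cong₂ b (=ℤ-sound i k p) (=ℤ-sound j l q)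
=ᵥ-sound (c i j) (c k l) eq with ∧-true {i =ℤ k} eq
... | p , q = cong₂ c (=ℤ-sound i k p) (=ℤ-sound j l q)
=ᵥ-sound (d i j) (d k l) eq with ∧-true {i =ℤ k} eq
... | p , q = cong₂ d (=ℤ-sound i k p) (=ℤ-sound j l q)

=ᵥ-refl : ∀ v → (v =ᵥ v) ≡ true
=ᵥ-refl (x i j) = cong₂ _∧_ (=ℤ-refl i) (=ℤ-refl j)
=ᵥ-refl (a i j) = cong₂ _∧_ (=ℤ-refl i) (=ℤ-refl j)
=ᵥ-refl (b i j) = cong₂ _∧_ (=ℤ-refl i) (=ℤ-refl j)
=ᵥ-refl (c i j) = cong₂ _∧_ (=ℤ-refl i) (=ℤ-refl j)
=ᵥ-refl (d i j) = cong₂ _∧_ (=ℤ-refl i) (=ℤ-refl j)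

expo-++ : ∀ m m' v → expo (m ++ m') v ≡ expo m v + expo m' v
expo-++ [] m' v = sym (+-identityˡ _)
expo-++ ((w , e) ∷ m) m' v = trans (+-congˡ t (expo-++ m m' v)) (sym (+-assoc t (expo m v) (expo m' v)))
  where t = if w =ᵥ v then e else + 0

recip : Mono → Mono
recip = map (λ (v , e) → v , - e)

if-neg : ∀ p e → (if p then - e else + 0) ≡ - (if p then e else + 0)
if-neg true e = refl
if-neg false e = refl

expo-recip : ∀ m v → expo (recip m) v ≡ - expo m v
expo-recip [] v = refl
expo-recip ((w , e) ∷ m) v =
  trans (cong₂ _+_ (if-neg (w =ᵥ v) e) (expo-recip m v)) (sym (neg-distrib-+ (if w =ᵥ v then e else + 0) (expo m v)))

expo-absent : ∀ m v → ¬ (v ∈ map proj₁ m) → expo m v ≡ + 0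
expo-absent [] v _ = refl
expo-absent ((w , e) ∷ m) v v∉ with w =ᵥ v in eq
... | true = ⊥-elim (v∉ (here (sym (=ᵥ-sound w v eq))))
... | false = trans (+-identityˡ _) (expo-absent m v (λ v∈ → v∉ (there v∈)))

_≟ᵥ_ : ∀ (v w : Var) → Dec (v ≡ w)
v ≟ᵥ w with v =ᵥ w in eq
... | true = yes (=ᵥ-sound v w eq)
... | false = no λ { refl → true≢false (trans (sym (=ᵥ-refl v)) eq) }
  where
  true≢false : ¬ (true ≡ false)
  true≢false ()

allB-sound : ∀ {A : Set} (p : A → Bool) ts → allB p ts ≡ true → ∀ {t} → t ∈ ts → p t ≡ true
allB-sound p (t ∷ ts) eq (here refl) = proj₁ (∧-true eq)
allB-sound p (t ∷ ts) eq (there t∈) = allB-sound p ts (proj₂ (∧-true {p t} eq)) t∈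

allB-complete : ∀ {A : Set} (p : A → Bool) ts → (∀ t → p t ≡ true) → allB p ts ≡ true
allB-complete p [] h = refl
allB-complete p (t ∷ ts) h = cong₂ _∧_ (h t) (allB-complete p ts h)

monoEq?-sound : ∀ m m' → monoEq? m m' ≡ true → m ≃ m'
monoEq?-sound m m' eq = same-expo λ v → agree v
  where
  agree : ∀ v → expo m v ≡ expo m' v
  agree v with DecPropositional._∈?_ _≟ᵥ_ v (map proj₁ (m ++ m'))
  ... | yes v∈ = =ℤ-sound _ _ (allB-sound _ (map proj₁ (m ++ m')) eq v∈)
  ... | no v∉ = trans (expo-absent m v λ v∈ → v∉ (subst (v ∈_) (sym (map-++ proj₁ m m')) (∈-++⁺ˡ v∈)))
                      (sym (expo-absent m' v λ v∈ → v∉ (subst (v ∈_) (sym (map-++ proj₁ m m')) (∈-++⁺ʳ (map proj₁ m) v∈))))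

monoEq?-complete : ∀ m m' → m ≃ m' → monoEq? m m' ≡ true
monoEq?-complete m m' eq = allB-complete _ (map proj₁ (m ++ m')) λ v →
  trans (cong (_=ℤ expo m' v) (exponents eq v)) (=ℤ-refl (expo m' v))

monoEqDec : ∀ m m' → Dec (m ≃ m')
monoEqDec m m' with monoEq? m m' in eq
... | true = yes (monoEq?-sound m m' eq)
... | false = no λ h → true≢false (trans (sym (monoEq?-complete m m' h)) eq)
  where
  true≢false : ¬ (true ≡ false)
  true≢false ()

≃-sym : ∀ {m m'} → m ≃ m' → m' ≃ m
≃-sym h = same-expo λ v → sym (exponents h v)

iff⇒≡ : ∀ {p q} → (p ≡ true → q ≡ true) → (q ≡ true → p ≡ true) → p ≡ q
iff⇒≡ {true} {true} f g = refl
iff⇒≡ {true} {false} f g = sym (f refl)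
iff⇒≡ {false} {true} f g = g refl
iff⇒≡ {false} {false} f g = refl

monoEq?-sym : ∀ m m' → monoEq? m m' ≡ monoEq? m' m
monoEq?-sym m m' = iff⇒≡ (λ e → monoEq?-complete m' m (≃-sym (monoEq?-sound m m' e)))
                         (λ e → monoEq?-complete m m' (≃-sym (monoEq?-sound m' m e)))

≃-trans : ∀ {m m' m''} → m ≃ m' → m' ≃ m'' → m ≃ m''
≃-trans h h' = same-expo λ v → trans (exponents h v) (exponents h' v)

≃-refl : ∀ {m} → m ≃ m
≃-refl = same-expo λ v → refl

++-congˡ : ∀ m {m' m''} → m' ≃ m'' → (m ++ m') ≃ (m ++ m'')
++-congˡ m h = same-expo λ v → trans (expo-++ m _ v) (trans (+-congˡ (expo m v) (exponents h v)) (sym (expo-++ m _ v)))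

++-comm : ∀ m m' → (m ++ m') ≃ (m' ++ m)
++-comm m m' = same-expo λ v → trans (expo-++ m m' v) (trans (+-comm (expo m v) _) (sym (expo-++ m' m v)))

++-congʳ : ∀ m {m' m''} → m' ≃ m'' → (m' ++ m) ≃ (m'' ++ m)
++-congʳ m {m'} {m''} h = same-expo λ v → trans (expo-++ m' m v) (trans (cong (_+ expo m v) (exponents h v)) (sym (expo-++ m'' m v)))

-- Laurent polynomials act on the functions of monomials.  Two of them
-- are identified when they act in the same way, and this turns the ring
-- laws into identities between finite sums.

record Resp (φ : Mono → ℤ) : Set where
  constructor resp
  field respects : ∀ {m m'} → m ≃ m' → φ m ≡ φ m'
open Resp public

⟨_,_⟩ : Poly → (Mono → ℤ) → ℤ
⟨ p , φ ⟩ = ∑ p (λ t → proj₁ t * φ (proj₂ t))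

infix 4 _≋_
record _≋_ (p q : Poly) : Set where
  constructor pointwise
  field on : ∀ {φ} → Resp φ → ⟨ p , φ ⟩ ≡ ⟨ q , φ ⟩
open _≋_ public

shift-resp : ∀ {φ} → Resp φ → ∀ m → Resp (λ m' → φ (m ++ m'))
shift-resp r m = resp λ h → respects r (++-congˡ m h)

⟨⟩-cong : ∀ p {φ ψ} → (∀ m → φ m ≡ ψ m) → ⟨ p , φ ⟩ ≡ ⟨ p , ψ ⟩
⟨⟩-cong p h = ∑-cong p (λ t → cong (proj₁ t *_) (h (proj₂ t)))

+-action : ∀ p q φ → ⟨ p +ₚ q , φ ⟩ ≡ ⟨ p , φ ⟩ + ⟨ q , φ ⟩
+-action p q φ = ∑-++ p q _

*-action : ∀ p q φ → ⟨ p *ₚ q , φ ⟩ ≡ ⟨ p , (λ m → ⟨ q , (λ m' → φ (m ++ m')) ⟩) ⟩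
*-action p q φ = trans (∑-concatMap _ p _) (∑-cong p λ { (k , m) →
  trans (∑-map _ q _) (trans (∑-cong q (λ { (l , m') → *-assoc k l (φ (m ++ m')) })) (∑-* q k _)) })

negₚ : Poly → Poly
negₚ = map (λ t → - proj₁ t , proj₂ t)

neg-action : ∀ p φ → ⟨ negₚ p , φ ⟩ ≡ - ⟨ p , φ ⟩
neg-action p φ = trans (∑-map _ p _) (trans (∑-cong p (λ { (k , m) → neg1 k (φ m) })) (trans (∑-* p (- + 1) _) (-1*i≡-i _)))
  where
  neg1 : ∀ k e → - k * e ≡ - + 1 * (k * e)
  neg1 = solve-∀

≋-refl : ∀ {p} → p ≋ p
≋-refl = pointwise λ r → refl

≋-sym : ∀ {p q} → p ≋ q → q ≋ p
≋-sym h = pointwise λ r → sym (on h r)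

≋-trans : ∀ {p q r} → p ≋ q → q ≋ r → p ≋ r
≋-trans h h' = pointwise λ r → trans (on h r) (on h' r)

action-resp : ∀ q {φ} → Resp φ → Resp (λ m → ⟨ q , (λ m' → φ (m ++ m')) ⟩)
action-resp q r = resp λ {m} {m'} h → ⟨⟩-cong q λ m'' → respects r (++-congʳ m'' h)

+ₚ-cong : ∀ {p p' q q'} → p ≋ p' → q ≋ q' → p +ₚ q ≋ p' +ₚ q'
+ₚ-cong {p} {p'} {q} {q'} h h' = pointwise λ {φ} r →
  trans (+-action p q φ) (trans (cong₂ _+_ (on h r) (on h' r)) (sym (+-action p' q' φ)))

*ₚ-cong : ∀ {p p' q q'} → p ≋ p' → q ≋ q' → p *ₚ q ≋ p' *ₚ q'
*ₚ-cong {p} {p'} {q} {q'} h h' = pointwise λ {φ} r →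
  trans (*-action p q φ) (trans (on h (action-resp q r))
    (trans (⟨⟩-cong p' λ m → on h' (shift-resp r m)) (sym (*-action p' q' φ))))

*ₚ-congˡ : ∀ p {q q'} → q ≋ q' → p *ₚ q ≋ p *ₚ q'
*ₚ-congˡ p h = *ₚ-cong {p} {p} ≋-refl h

negₚ-cong : ∀ {p p'} → p ≋ p' → negₚ p ≋ negₚ p'
negₚ-cong {p} {p'} h = pointwise λ {φ} r → trans (neg-action p φ) (trans (cong -_ (on h r)) (sym (neg-action p' φ)))

+ₚ-comm : ∀ p q → p +ₚ q ≋ q +ₚ p
+ₚ-comm p q = pointwise λ {φ} r → trans (+-action p q φ) (trans (+-comm ⟨ p , φ ⟩ _) (sym (+-action q p φ)))

+ₚ-assoc : ∀ p q r → (p +ₚ q) +ₚ r ≋ p +ₚ (q +ₚ r)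
+ₚ-assoc p q r = pointwise λ {φ} _ → cong (λ s → ⟨ s , φ ⟩) (Data.List.Properties.++-assoc p q r)

+ₚ-identityʳ : ∀ p → p +ₚ zeroₚ ≋ p
+ₚ-identityʳ p = pointwise λ {φ} _ → cong (λ s → ⟨ s , φ ⟩) (Data.List.Properties.++-identityʳ p)

negₚ-inverseʳ : ∀ p → p +ₚ negₚ p ≋ zeroₚ
negₚ-inverseʳ p = pointwise λ {φ} r →
  trans (+-action p (negₚ p) φ) (trans (+-congˡ ⟨ p , φ ⟩ (neg-action p φ)) (+-inverseʳ ⟨ p , φ ⟩))

⟨⟩-swap : ∀ p q (f : Mono → Mono → ℤ) → ⟨ p , (λ m → ⟨ q , f m ⟩) ⟩ ≡ ⟨ q , (λ m' → ⟨ p , (λ m → f m m') ⟩) ⟩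
⟨⟩-swap p q f =
  trans (∑-cong p (λ t → sym (∑-* q (proj₁ t) _)))
  (trans (∑-swap p q _)
  (trans (∑-cong q (λ { (l , m') → ∑-cong p (λ { (k , m) → rearrange k l (f m m') }) }))
         (∑-cong q (λ t → ∑-* p (proj₁ t) _))))
  where
  rearrange : ∀ k l e → k * (l * e) ≡ l * (k * e)
  rearrange = solve-∀

*ₚ-comm : ∀ p q → p *ₚ q ≋ q *ₚ p
*ₚ-comm p q = pointwise λ {φ} r → trans (*-action p q φ) (trans (⟨⟩-swap p q _) (trans
  (⟨⟩-cong q λ m' → ⟨⟩-cong p λ m → respects r (++-comm m m')) (sym (*-action q p φ))))

*ₚ-assoc : ∀ p q s → (p *ₚ q) *ₚ s ≋ p *ₚ (q *ₚ s)
*ₚ-assoc p q s = pointwise λ {φ} r → trans (*-action (p *ₚ q) s φ) (trans (*-action p q _)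
  (sym (trans (*-action p (q *ₚ s) φ) (⟨⟩-cong p λ m → trans (*-action q s _)
    (⟨⟩-cong q λ m' → ⟨⟩-cong s λ m'' → cong φ (sym (Data.List.Properties.++-assoc m m' m'')))))))

one-action : ∀ φ → ⟨ oneₚ , φ ⟩ ≡ φ []
one-action φ = trans (+-identityʳ _) (*-identityˡ _)

*ₚ-identityˡ : ∀ p → oneₚ *ₚ p ≋ p
*ₚ-identityˡ p = pointwise λ {φ} r → trans (*-action oneₚ p φ) (one-action (λ m → ⟨ p , (λ m' → φ (m ++ m')) ⟩))

*ₚ-distribˡ : ∀ p q s → p *ₚ (q +ₚ s) ≋ (p *ₚ q) +ₚ (p *ₚ s)
*ₚ-distribˡ p q s = pointwise λ {φ} r → trans (*-action p (q +ₚ s) φ) (trans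
  (trans (∑-cong p (λ t → trans (cong (proj₁ t *_) (+-action q s _)) (*-distribˡ-+ (proj₁ t) _ _))) (∑-+ p _ _))
  (sym (trans (+-action (p *ₚ q) (p *ₚ s) φ) (cong₂ _+_ (*-action p q φ) (*-action p s φ)))))

laurent : CommutativeRing 0ℓ 0ℓ
laurent = record
  { Carrier = Poly ; _≈_ = _≋_ ; _+_ = _+ₚ_ ; _*_ = _*ₚ_ ; -_ = negₚ ; 0# = zeroₚ ; 1# = oneₚ
  ; isCommutativeRing = record
    { isRing = record
      { +-isAbelianGroup = record
        { isGroup = record
          { isMonoid = record
            { isSemigroup = record
              { isMagma = record
                { isEquivalence = record { refl = ≋-refl ; sym = ≋-sym ; trans = ≋-trans }
                ; ∙-cong = +ₚ-cong }
              ; assoc = +ₚ-assoc }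
            ; identity = (λ p → ≋-refl) , +ₚ-identityʳ }
          ; inverse = (λ p → ≋-trans (+ₚ-comm (negₚ p) p) (negₚ-inverseʳ p)) , negₚ-inverseʳ
          ; ⁻¹-cong = negₚ-cong }
        ; comm = +ₚ-comm }
      ; *-cong = *ₚ-cong
      ; *-assoc = *ₚ-assoc
      ; *-identity = *ₚ-identityˡ , (λ p → ≋-trans (*ₚ-comm p oneₚ) (*ₚ-identityˡ p))
      ; distrib = *ₚ-distribˡ , (λ p q s → ≋-trans (*ₚ-comm (q +ₚ s) p) (≋-trans (*ₚ-distribˡ p q s) (+ₚ-cong (*ₚ-comm p q) (*ₚ-comm p s)))) }
    ; *-comm = *ₚ-comm } }

indicator : Mono → Mono → ℤ
indicator m m' = if monoEq? m' m then + 1 else + 0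

indicator-resp : ∀ m → Resp (indicator m)
indicator-resp m = resp λ {m'} {m''} h → cong (λ t → if t then + 1 else + 0) (same h)
  where
  same : ∀ {m' m''} → m' ≃ m'' → monoEq? m' m ≡ monoEq? m'' m
  same {m'} {m''} h = iff⇒≡ (λ e → monoEq?-complete m'' m (≃-trans (≃-sym h) (monoEq?-sound m' m e)))
                            (λ e → monoEq?-complete m' m (≃-trans h (monoEq?-sound m'' m e)))

indicator-sym : ∀ m m' → indicator m m' ≡ indicator m' m
indicator-sym m m' = cong (λ t → if t then + 1 else + 0) (monoEq?-sym m' m)

coeff-action : ∀ p m → coeff p m ≡ ⟨ p , indicator m ⟩
coeff-action [] m = refl
coeff-action ((k , m') ∷ p) m = cong₂ _+_ (head (monoEq? m m') (monoEq? m' m) (monoEq?-sym m m')) (coeff-action p m)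
  where
  head : ∀ s t → s ≡ t → (if s then k else + 0) ≡ k * (if t then + 1 else + 0)
  head true .true refl = sym (*-identityʳ k)
  head false .false refl = sym (*-zeroʳ k)

≋⇒≈ₚ : ∀ {p q} → p ≋ q → p ≈ₚ q
≋⇒≈ₚ {p} {q} h m = trans (coeff-action p m) (trans (on h (indicator-resp m)) (sym (coeff-action q m)))

remove : Mono → Poly → Poly
remove m [] = []
remove m ((k , m') ∷ p) = if monoEq? m' m then remove m p else (k , m') ∷ remove m p

remove-length : ∀ m p → length (remove m p) ℕ.≤ length p
remove-length m [] = ℕ.z≤n
remove-length m ((k , m') ∷ p) with monoEq? m' m
... | true = ℕ.m≤n⇒m≤1+n (remove-length m p)
... | false = ℕ.s≤s (remove-length m p)

remove-action : ∀ m p {φ} → Resp φ → ⟨ p , φ ⟩ ≡ ⟨ p , indicator m ⟩ * φ m + ⟨ remove m p , φ ⟩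
remove-action m [] r = refl
remove-action m ((k , m') ∷ p) {φ} r with monoEq? m' m in e
... | true = trans (cong₂ _+_ (cong (k *_) (respects r (monoEq?-sound m' m e))) (remove-action m p r))
                   (regroup k (φ m) ⟨ p , indicator m ⟩ ⟨ remove m p , φ ⟩)
  where
  regroup : ∀ k e s t → k * e + (s * e + t) ≡ (k * + 1 + s) * e + t
  regroup = solve-∀
... | false = trans (+-congˡ (k * φ m') (remove-action m p r))
                    (regroup k (φ m') (φ m) ⟨ p , indicator m ⟩ ⟨ remove m p , φ ⟩)
  where
  regroup : ∀ k e e' s t → k * e + (s * e' + t) ≡ (k * + 0 + s) * e' + (k * e + t)
  regroup = solve-∀

remove-same : ∀ m p → ⟨ remove m p , indicator m ⟩ ≡ + 0
remove-same m [] = refl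
remove-same m ((k , m') ∷ p) with monoEq? m' m in e
... | true = remove-same m p
... | false rewrite e = trans (cong₂ _+_ (*-zeroʳ k) (remove-same m p)) refl

vanish : ∀ p → Acc ℕ._<_ (length p) → (∀ m → ⟨ p , indicator m ⟩ ≡ + 0) → ∀ {φ} → Resp φ → ⟨ p , φ ⟩ ≡ + 0
vanish [] _ h r = refl
vanish p@((k , m) ∷ p') (acc rec) h {φ} r =
  trans (remove-action m p r) (trans (cong₂ _+_ (cong (_* φ m) (h m)) (vanish (remove m p) (rec shorter) rest r)) refl)
  where
  shorter : length (remove m p) ℕ.< length p
  shorter rewrite monoEq?-complete m m ≃-refl = ℕ.s≤s (remove-length m p')
  rest : ∀ m' → ⟨ remove m p , indicator m' ⟩ ≡ + 0
  rest m' with monoEqDec m' m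
  ... | yes eq = trans (⟨⟩-cong (remove m p) λ m'' → trans (indicator-sym m' m'') (trans (respects (indicator-resp m'') eq) (indicator-sym m'' m))) (remove-same m p)
  ... | no neq = trans (sym (trans (cong₂ _+_ (cong (λ t → ⟨ p , indicator m ⟩ * (if t then + 1 else + 0)) off) refl)
                       (trans (cong (_+ ⟨ remove m p , indicator m' ⟩) (*-zeroʳ ⟨ p , indicator m ⟩)) (+-identityˡ _))))
                       (trans (sym (remove-action m p (indicator-resp m'))) (h m'))
    where
    off : monoEq? m m' ≡ false
    off with monoEq? m m' in e
    ... | false = refl
    ... | true = ⊥-elim (neq (≃-sym (monoEq?-sound m m' e)))

≈ₚ⇒≋ : ∀ {p q} → p ≈ₚ q → p ≋ q
≈ₚ⇒≋ {p} {q} h = pointwise λ {φ} r → i-j≡0⇒i≡j _ _ (trans (sym (difference φ))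
  (vanish (p +ₚ negₚ q) (<-wellFounded _) (λ m → trans (difference (indicator m))
    (i≡j⇒i-j≡0 (trans (sym (coeff-action p m)) (trans (h m) (coeff-action q m))))) r))
  where
  difference : ∀ φ → ⟨ p +ₚ negₚ q , φ ⟩ ≡ ⟨ p , φ ⟩ - ⟨ q , φ ⟩
  difference φ = trans (+-action p (negₚ q) φ) (+-congˡ ⟨ p , φ ⟩ (neg-action q φ))

module LaurentSolver (R : CommutativeRing 0ℓ 0ℓ) where
  open CommutativeRing R using () renaming (_≈_ to _≈R_; _+_ to _+R_; _*_ to _*R_; refl to reflR)
  open import Tactic.RingSolver.Core.AlmostCommutativeRing using (fromCommutativeRing)
  open import Tactic.RingSolver.NonReflective (fromCommutativeRing R (λ _ → nothing)) renaming (_⊕_ to _:+_; _⊗_ to _:*_)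

  interchange : ∀ p q r s → ((p *R q) *R (r *R s)) ≈R ((p *R r) *R (q *R s))
  interchange = solve 4 (λ p q r s → ((p :* q) :* (r :* s)) ⊜ ((p :* r) :* (q :* s))) reflR

  factor : ∀ p e f q r → ((e *R (p *R q)) +R (f *R (p *R r))) ≈R (p *R ((e *R q) +R (f *R r)))
  factor = solve 5 (λ p e f q r → ((e :* (p :* q)) :+ (f :* (p :* r))) ⊜ (p :* ((e :* q) :+ (f :* r)))) reflR

open LaurentSolver laurent public
module laurent = CommutativeRing laurent

-- mono and B are opaque because products with explicit lists unfold,
-- which defeats unification.
opaque
  mono : Mono → Poly
  mono m = (+ 1 , m) ∷ []

  mono-action : ∀ m φ → ⟨ mono m , φ ⟩ ≡ φ m
  mono-action m φ = trans (+-identityʳ _) (*-identityˡ _)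

  mono-++ : ∀ m m' → mono (m ++ m') ≋ mono m *ₚ mono m'
  mono-++ m m' = ≋-refl

  mono-All : ∀ {P : ℤ × Mono → Set} {m} → P (+ 1 , m) → All P (mono m)
  mono-All p = p ∷ []

mono-cong : ∀ {m m'} → m ≃ m' → mono m ≋ mono m'
mono-cong {m} {m'} h = pointwise λ {φ} r → trans (mono-action m φ) (trans (respects r h) (sym (mono-action m' φ)))

⟨⟩-cong-All : ∀ p {φ ψ} → All (λ t → φ (proj₂ t) ≡ ψ (proj₂ t)) p → ⟨ p , φ ⟩ ≡ ⟨ p , ψ ⟩
⟨⟩-cong-All [] [] = refl
⟨⟩-cong-All ((k , m) ∷ p) (e ∷ es) = cong₂ _+_ (cong (k *_) e) (⟨⟩-cong-All p es)

scale : ℤ → Poly → Poly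
scale k = map (λ t → k * proj₁ t , proj₂ t)

scale-action : ∀ k p φ → ⟨ scale k p , φ ⟩ ≡ k * ⟨ p , φ ⟩
scale-action k p φ = trans (∑-map _ p _) (trans (∑-cong p λ { (l , m) → *-assoc k l (φ m) }) (∑-* p k _))

-- The substitution X ↦ (β₁ + β₂) / X, multiplied by the k-th power of
-- β₁ + β₂ in order to clear denominators; on monomials in which X has
-- exponent less than -k it is junk.

module Substitution (X : Var) (β₁ β₂ : Mono) where

  opaque
    B : Poly
    B = (+ 1 , β₁) ∷ (+ 1 , β₂) ∷ []

    B-action : ∀ φ → ⟨ B , φ ⟩ ≡ φ β₁ + φ β₂
    B-action φ = cong₂ _+_ (*-identityˡ (φ β₁)) (trans (+-identityʳ _) (*-identityˡ (φ β₂)))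

  power : ℕ → Poly
  power zero = oneₚ
  power (suc n) = B *ₚ power n

  power-+ : ∀ k l → power (k ℕ.+ l) ≋ power k *ₚ power l
  power-+ zero l = ≋-sym (*ₚ-identityˡ (power l))
  power-+ (suc k) l = ≋-trans (*ₚ-congˡ B (power-+ k l)) (≋-sym (*ₚ-assoc B (power k) (power l)))

  ψ : ℕ → Mono → Poly
  ψ k m = mono (m ++ (X , - + 2 * expo m X) ∷ []) *ₚ power ∣ + k + expo m X ∣

  ψ-cong : ∀ k {m m'} → m ≃ m' → ψ k m ≋ ψ k m'
  ψ-cong k {m} {m'} h rewrite exponents h X = *ₚ-cong (mono-cong (++-congʳ _ h)) ≋-refl

  Ψ : ℕ → Poly → Poly
  Ψ k = concatMap (λ t → scale (proj₁ t) (ψ k (proj₂ t)))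

  Ψ-action : ∀ k p φ → ⟨ Ψ k p , φ ⟩ ≡ ⟨ p , (λ m → ⟨ ψ k m , φ ⟩) ⟩
  Ψ-action k p φ = trans (∑-concatMap _ p _) (∑-cong p λ { (l , m) → scale-action l (ψ k m) φ })

  Ψ-cong : ∀ k {p q} → p ≋ q → Ψ k p ≋ Ψ k q
  Ψ-cong k {p} {q} h = pointwise λ {φ} r →
    trans (Ψ-action k p φ) (trans (on h (resp λ h' → on (ψ-cong k h') r)) (sym (Ψ-action k q φ)))

  Ψ-+ : ∀ k p q → Ψ k (p +ₚ q) ≋ Ψ k p +ₚ Ψ k q
  Ψ-+ k p q = pointwise λ {φ} r → trans (Ψ-action k (p +ₚ q) φ) (trans (+-action p q _)
    (sym (trans (+-action (Ψ k p) (Ψ k q) φ) (cong₂ _+_ (Ψ-action k p φ) (Ψ-action k q φ)))))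

  Bounded : ℕ → Poly → Set
  Bounded k = All (λ t → NN (+ k + expo (proj₂ t) X))

  ψ-* : ∀ k l m m' → NN (+ k + expo m X) → NN (+ l + expo m' X) → ψ (k ℕ.+ l) (m ++ m') ≋ ψ k m *ₚ ψ l m'
  ψ-* k l m m' p q =
    ≋-trans (*ₚ-cong (≋-trans (mono-cong monos) (mono-++ mX m'X)) powers)
            (interchange (mono mX) (mono m'X) (power ∣ + k + expo m X ∣) (power ∣ + l + expo m' X ∣))
    where
    mX = m ++ (X , - + 2 * expo m X) ∷ []
    m'X = m' ++ (X , - + 2 * expo m' X) ∷ []
    monos : (m ++ m') ++ (X , - + 2 * expo (m ++ m') X) ∷ [] ≃ mX ++ m'X
    monos = same-expo λ v → trans (expo-++ (m ++ m') _ v) (trans (cong₂ _+_ (expo-++ m m' v) (single v))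
      (trans (shuffle (expo m v) (expo m' v) (expo ((X , - + 2 * expo m X) ∷ []) v) (expo ((X , - + 2 * expo m' X) ∷ []) v))
      (sym (trans (expo-++ mX m'X v) (cong₂ _+_ (expo-++ m _ v) (expo-++ m' _ v))))))
      where
      shuffle : ∀ p q r s → p + q + (r + s) ≡ p + r + (q + s)
      shuffle = solve-∀
      single : ∀ v → expo ((X , - + 2 * expo (m ++ m') X) ∷ []) v ≡
                     expo ((X , - + 2 * expo m X) ∷ []) v + expo ((X , - + 2 * expo m' X) ∷ []) v
      single v with X =ᵥ v
      ... | true = trans (cong (λ e → - + 2 * e + + 0) (expo-++ m m' X)) (split (expo m X) (expo m' X))
        where
        split : ∀ e f → - + 2 * (e + f) + + 0 ≡ - + 2 * e + + 0 + (- + 2 * f + + 0)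
        split = solve-∀
      ... | false = refl
    powers : power ∣ + (k ℕ.+ l) + expo (m ++ m') X ∣ ≋ power ∣ + k + expo m X ∣ *ₚ power ∣ + l + expo m' X ∣
    powers = subst (λ n → power n ≋ power ∣ + k + expo m X ∣ *ₚ power ∣ + l + expo m' X ∣)
      (+-injective (trans (cong₂ _+_ (0≤i⇒+∣i∣≡i p) (0≤i⇒+∣i∣≡i q)) (trans
        (trans (shuffle (+ k) (expo m X) (+ l) (expo m' X)) (+-congˡ (+ k + + l) (sym (expo-++ m m' X))))
        (sym (0≤i⇒+∣i∣≡i (by (p ⊕ q) (trans (shuffle (+ k) (expo m X) (+ l) (expo m' X)) (+-congˡ (+ k + + l) (sym (expo-++ m m' X))))))))))
      (power-+ ∣ + k + expo m X ∣ ∣ + l + expo m' X ∣)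
      where
      shuffle : ∀ p q r s → p + q + (r + s) ≡ p + r + (q + s)
      shuffle = solve-∀

  Ψ-* : ∀ k l p q → Bounded k p → Bounded l q → Ψ (k ℕ.+ l) (p *ₚ q) ≋ Ψ k p *ₚ Ψ l q
  Ψ-* k l p q P Q = pointwise λ {φ} r →
    trans (Ψ-action (k ℕ.+ l) (p *ₚ q) φ) (trans (*-action p q _) (trans
      (⟨⟩-cong-All p (All.map (λ {t} u → trans (⟨⟩-cong-All q (All.map (λ {t'} u' →
          trans (on (ψ-* k l (proj₂ t) (proj₂ t') u u') r) (*-action (ψ k (proj₂ t)) (ψ l (proj₂ t')) φ)) Q))
        (trans (⟨⟩-swap q (ψ k (proj₂ t)) _) (⟨⟩-cong (ψ k (proj₂ t)) λ m → sym (Ψ-action l q _)))) P))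
      (sym (trans (*-action (Ψ k p) (Ψ l q) φ) (Ψ-action k p _)))))

  Bounded-* : ∀ k l p q → Bounded k p → Bounded l q → Bounded (k ℕ.+ l) (p *ₚ q)
  Bounded-* k l [] q [] Q = []
  Bounded-* k l ((e , m) ∷ p) q (u ∷ P) Q =
    All.++⁺ (All.map⁺ (All.map (λ {t} u' → by (u ⊕ u') (regroup t)) Q)) (Bounded-* k l p q P Q)
    where
    shuffle : ∀ p q r s → p + q + (r + s) ≡ p + r + (q + s)
    shuffle = solve-∀
    regroup : ∀ t → + k + expo m X + (+ l + expo (proj₂ t) X) ≡ + (k ℕ.+ l) + expo (m ++ proj₂ t) X
    regroup t = trans (shuffle (+ k) (expo m X) (+ l) (expo (proj₂ t) X)) (+-congˡ (+ k + + l) (sym (expo-++ m (proj₂ t) X)))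

  -- The coefficients of p are determined up to sign along the orbits of
  -- multiplication by β₁ / β₂, on which the exponent of v is unbounded.
  module Cancellation (v : Var) (step : expo β₁ v ≡ expo β₂ v + + 1) where

    private
      ub : Poly → ℤ
      ub [] = + 0
      ub ((k , m) ∷ p) = expo m v ⊔ ub p

      above : ∀ p m → ub p < expo m v → ⟨ p , indicator m ⟩ ≡ + 0
      above [] m lt = refl
      above ((k , m') ∷ p) m lt = trans (cong₂ _+_ (trans (cong (λ t → k * (if t then + 1 else + 0)) distinct) (*-zeroʳ k))
                                                   (above p m (≤-<-trans (i≤j⊔i (expo m' v) (ub p)) lt))) refl
        where
        distinct : monoEq? m' m ≡ false
        distinct with monoEq? m' m in e
        ... | false = refl
        ... | true = ⊥-elim (<-irrefl (exponents (monoEq?-sound m' m e) v) (≤-<-trans (i≤i⊔j (expo m' v) (ub p)) lt))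

      δ : Mono
      δ = β₁ ++ recip β₂

      δ-step : ∀ m → expo (m ++ δ) v ≡ expo m v + + 1
      δ-step m = trans (expo-++ m δ v) (+-congˡ (expo m v) (trans (expo-++ β₁ (recip β₂) v)
        (trans (cong₂ _+_ step (expo-recip β₂ v)) (cancel (expo β₂ v)))))
        where
        cancel : ∀ e → e + + 1 + - e ≡ + 1
        cancel = solve-∀

      orbit : ∀ p → B *ₚ p ≋ zeroₚ → ∀ m → ⟨ p , indicator m ⟩ ≡ - ⟨ p , indicator (m ++ δ) ⟩
      orbit p h m = trans (inverse ⟨ p , indicator m ⟩ ⟨ p , indicator (m ++ δ) ⟩ sum-zero) refl
        where
        inverse : ∀ e f → e + f ≡ + 0 → e ≡ - f
        inverse e f eq = trans (split e f) (trans (cong (_- f) eq) (+-identityˡ _))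
          where
          split : ∀ e f → e ≡ e + f - f
          split = solve-∀
        first : ∀ m' → indicator (β₁ ++ m) (β₁ ++ m') ≡ indicator m m'
        first m' = cong (λ t → if t then + 1 else + 0) (iff⇒≡
          (λ e → monoEq?-complete m' m (same-expo λ w → ++-cancel β₁ m' m w (exponents (monoEq?-sound (β₁ ++ m') (β₁ ++ m) e) w)))
          (λ e → monoEq?-complete (β₁ ++ m') (β₁ ++ m) (++-congˡ β₁ (monoEq?-sound m' m e))))
          where
          ++-cancel : ∀ n m m' w → expo (n ++ m) w ≡ expo (n ++ m') w → expo m w ≡ expo m' w
          ++-cancel n m m' w eq = +-cancelˡ (expo n w) (trans (sym (expo-++ n m w)) (trans eq (expo-++ n m' w)))
        transpose : ∀ w e₁ e₂ → expo (β₂ ++ e₁) w ≡ expo (β₁ ++ e₂) w → expo e₁ w ≡ expo (e₂ ++ δ) w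
        transpose w e₁ e₂ eq = trans (solve-for (expo β₂ w) (expo e₁ w) (expo β₁ w) (expo e₂ w) (trans (sym (expo-++ β₂ e₁ w)) (trans eq (expo-++ β₁ e₂ w))))
          (sym (trans (expo-++ e₂ δ w) (+-congˡ (expo e₂ w) (trans (expo-++ β₁ (recip β₂) w) (+-congˡ (expo β₁ w) (expo-recip β₂ w))))))
          where
          solve-for : ∀ p q r s → p + q ≡ r + s → q ≡ s + (r + - p)
          solve-for p q r s eq = trans (l1 p q) (trans (cong (_- p) eq) (l2 p r s))
            where
            l1 : ∀ p q → q ≡ p + q - p
            l1 = solve-∀
            l2 : ∀ p r s → r + s - p ≡ s + (r + - p)
            l2 = solve-∀
        untranspose : ∀ w e₁ e₂ → expo e₁ w ≡ expo (e₂ ++ δ) w → expo (β₂ ++ e₁) w ≡ expo (β₁ ++ e₂) w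
        untranspose w e₁ e₂ eq = trans (expo-++ β₂ e₁ w) (trans (+-congˡ (expo β₂ w) (trans eq (trans (expo-++ e₂ δ w)
          (+-congˡ (expo e₂ w) (trans (expo-++ β₁ (recip β₂) w) (+-congˡ (expo β₁ w) (expo-recip β₂ w)))))))
          (trans (l3 (expo β₂ w) (expo e₂ w) (expo β₁ w)) (sym (expo-++ β₁ e₂ w))))
          where
          l3 : ∀ p s r → p + (s + (r + - p)) ≡ r + s
          l3 = solve-∀
        second : ∀ m' → indicator (β₁ ++ m) (β₂ ++ m') ≡ indicator (m ++ δ) m'
        second m' = cong (λ t → if t then + 1 else + 0) (iff⇒≡
          (λ e → monoEq?-complete m' (m ++ δ) (same-expo λ w → transpose w m' m (exponents (monoEq?-sound (β₂ ++ m') (β₁ ++ m) e) w)))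
          (λ e → monoEq?-complete (β₂ ++ m') (β₁ ++ m) (same-expo λ w → untranspose w m' m (exponents (monoEq?-sound m' (m ++ δ) e) w))))
        sum-zero : ⟨ p , indicator m ⟩ + ⟨ p , indicator (m ++ δ) ⟩ ≡ + 0
        sum-zero = trans (sym (cong₂ _+_ (⟨⟩-cong p first) (⟨⟩-cong p second)))
          (trans (sym (trans (*-action B p (indicator (β₁ ++ m))) (B-action (λ m₁ → ⟨ p , (λ m' → indicator (β₁ ++ m) (m₁ ++ m')) ⟩)))) (on h (indicator-resp (β₁ ++ m))))

      far : ∀ p → B *ₚ p ≋ zeroₚ → ∀ n m → ub p < expo m v + + n → ⟨ p , indicator m ⟩ ≡ + 0
      far p h zero m lt = above p m (subst (ub p <_) (+-identityʳ _) lt)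
      far p h (suc n) m lt = trans (orbit p h m) (cong -_ (far p h n (m ++ δ)
        (subst (ub p <_) (trans (regroup (expo m v) (+ n)) (cong (_+ + n) (sym (δ-step m)))) lt)))
        where
        regroup : ∀ e f → e + (+ 1 + f) ≡ e + + 1 + f
        regroup = solve-∀

    annihilated : ∀ p → B *ₚ p ≋ zeroₚ → p ≋ zeroₚ
    annihilated p h = ≈ₚ⇒≋ λ m → trans (coeff-action p m) (far p h (suc ∣ ub p - expo m v ∣) m (close (expo m v) (ub p)))
      where
      close : ∀ e f → f < e + + suc ∣ f - e ∣
      close e f = subst (f <_) (l1 e (+ ∣ f - e ∣)) (≤-<-trans (≤-trans (≤-reflexive (l2 e f)) (+-monoʳ-≤ e (i≤∣i∣ (f - e)))) (i<1+i _))
        where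
        i≤∣i∣ : ∀ i → i ≤ + ∣ i ∣
        i≤∣i∣ (+ n) = ≤-refl
        i≤∣i∣ -[1+ n ] = -≤+
        i<1+i : ∀ i → i < + 1 + i
        i<1+i i = i≤pred[j]⇒i<j (≤-reflexive (sym (pred-suc i)))
        l1 : ∀ e n → + 1 + (e + n) ≡ e + (+ 1 + n)
        l1 = solve-∀
        l2 : ∀ e f → f ≡ e + (f - e)
        l2 = solve-∀

    cancel : ∀ {p q} → B *ₚ p ≋ B *ₚ q → p ≋ q
    cancel {p} {q} h = pointwise λ {φ} r → i-j≡0⇒i≡j _ _ (trans (sym (trans (+-action p (negₚ q) φ) (+-congˡ ⟨ p , φ ⟩ (neg-action q φ))))
      (on (annihilated (p +ₚ negₚ q) difference) r))
      where
      difference : B *ₚ (p +ₚ negₚ q) ≋ zeroₚ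
      difference = ≋-trans (*ₚ-distribˡ B p (negₚ q)) (≋-trans (+ₚ-cong h ≋-refl)
        (≋-trans (≋-sym (*ₚ-distribˡ B q (negₚ q))) (≋-trans (*ₚ-congˡ B (negₚ-inverseʳ q)) (laurent.zeroʳ B))))

    transport : ∀ {G G' H H' G₁ G₁' H₁ H₁' G₂ G₂' H₂ H₂'} e₁ e₂ → expo e₁ X ≡ + 0 → expo e₂ X ≡ + 0 →
      Bounded 1 G → Bounded 1 H → Bounded 1 G₁ → Bounded 1 H₁ → Bounded 1 G₂ → Bounded 1 H₂ →
      Ψ 1 G ≋ B *ₚ G' → Ψ 1 H ≋ B *ₚ H' → Ψ 1 G₁ ≋ B *ₚ G₁' → Ψ 1 H₁ ≋ B *ₚ H₁' → Ψ 1 G₂ ≋ B *ₚ G₂' → Ψ 1 H₂ ≋ B *ₚ H₂' →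
      G *ₚ H ≋ (mono e₁ *ₚ (G₁ *ₚ H₁)) +ₚ (mono e₂ *ₚ (G₂ *ₚ H₂)) →
      G' *ₚ H' ≋ (mono e₁ *ₚ (G₁' *ₚ H₁')) +ₚ (mono e₂ *ₚ (G₂' *ₚ H₂'))
    transport {G} {G'} {H} {H'} {G₁} {G₁'} {H₁} {H₁'} {G₂} {G₂'} {H₂} {H₂'} e₁ e₂ z₁ z₂ bG bH bG₁ bH₁ bG₂ bH₂ sG sH sG₁ sH₁ sG₂ sH₂ rel =
      cancel (cancel (≋-trans (≋-sym (*ₚ-assoc B B _)) (≋-trans (≋-sym (product G H bG bH sG sH))
        (≋-trans (Ψ-cong 2 rel) (≋-trans (Ψ-+ 2 (mono e₁ *ₚ (G₁ *ₚ H₁)) _)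
        (≋-trans (+ₚ-cong (term e₁ z₁ G₁ H₁ bG₁ bH₁ sG₁ sH₁) (term e₂ z₂ G₂ H₂ bG₂ bH₂ sG₂ sH₂))
        (≋-trans (factor (B *ₚ B) (mono e₁) (mono e₂) (G₁' *ₚ H₁') (G₂' *ₚ H₂')) (*ₚ-assoc B B _))))))))
      where
      product : ∀ G H {G' H'} → Bounded 1 G → Bounded 1 H → Ψ 1 G ≋ B *ₚ G' → Ψ 1 H ≋ B *ₚ H' → Ψ 2 (G *ₚ H) ≋ (B *ₚ B) *ₚ (G' *ₚ H')
      product G H {G'} {H'} bG bH sG sH = ≋-trans (Ψ-* 1 1 G H bG bH) (≋-trans (*ₚ-cong sG sH) (interchange B G' B H'))
      term : ∀ e → expo e X ≡ + 0 → ∀ G H {G' H'} → Bounded 1 G → Bounded 1 H → Ψ 1 G ≋ B *ₚ G' → Ψ 1 H ≋ B *ₚ H' →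
             Ψ 2 (mono e *ₚ (G *ₚ H)) ≋ mono e *ₚ ((B *ₚ B) *ₚ (G' *ₚ H'))
      term e z G H {G'} {H'} bG bH sG sH = ≋-trans (Ψ-* 0 2 (mono e) (G *ₚ H) (mono-All (by (nat {0}) (sym (trans (+-identityˡ _) z)))) (Bounded-* 1 1 G H bG bH))
        (*ₚ-cong fixed (product G H bG bH sG sH))
        where
        fixed : Ψ 0 (mono e) ≋ mono e
        fixed = pointwise λ {φ} r → trans (Ψ-action 0 (mono e) φ) (trans (mono-action e _) (on (ψ-fixed z) r))
          where
          ψ-fixed : expo e X ≡ + 0 → ψ 0 e ≋ mono e
          ψ-fixed z rewrite z = ≋-trans (laurent.*-identityʳ _) (mono-cong (same-expo λ v → trans (expo-++ e _ v)
            (trans (+-congˡ (expo e v) (unit v)) (+-identityʳ _))))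
            where
            unit : ∀ v → expo ((X , + 0) ∷ []) v ≡ + 0
            unit v with X =ᵥ v
            ... | true = refl
            ... | false = refl

Face : Set
Face = ℤ × ℤ

_≟ᶠ_ : ∀ (p q : Face) → Dec (p ≡ q)
_≟ᶠ_ = ≡-dec _≟_ _≟_

Field : Set
Field = ℤ → ℤ → ℤ

-- A height function is encoded by σ = (h - i - j) / 2, whose steps to
-- the right and upwards are 0 or -1.
record Surface (σ : Field) : Set where
  field
    right : ∀ i j → Bit (σ i j - σ (↑ i) j)
    up : ∀ i j → Bit (σ i j - σ i (↑ j))

-- A perfect matching of the crosses-and-wrenches graph of σ is encoded by
-- a height function y of its own: an edge between two adjacent faces is
-- matched according to the difference of y across it, and for two diagonal
-- faces at the same height the difference determines the edge that
-- separates them.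
record Matching (σ y : Field) (i j : ℤ) : Set where
  field
    hor : Bit ((y (↑ i) j - σ (↑ i) j) - (y i j - σ i j))
    ver : Bit (y i j - y i (↑ j))
    dne : σ (↑ i) (↑ j) ≡ σ i j - + 1 → Bit (y i j - y (↑ i) (↑ j))
    dnw : σ i (↑ j) ≡ σ (↑ i) j → Bit (y (↑ i) j - y i (↑ j))

height : Field → Field
height σ i j = + 2 * σ i j + i + j

-- The exponent of the face in the middle of a 3×3 grid with heights s and
-- matching y; the first index is the column.  In continuation-passing style
-- the ring solver sees the polynomial rather than an atom κ₉.
with-κ₉ : ∀ {ℓ} {A : Set ℓ} (s00 s10 s20 s01 s11 s21 s02 s12 s22 y00 y10 y20 y01 y11 y21 y02 y12 y22 : ℤ) → (ℤ → A) → A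
with-κ₉ s00 s10 s20 s01 s11 s21 s02 s12 s22 y00 y10 y20 y01 y11 y21 y02 y12 y22 f = f
  (- (+ 2 * (s21 - s11) + + 1) * y21 - (+ 2 * (s01 - s11) - + 1) * y01
    + (+ 2 * (s12 - s11) + + 1) * y12 + (+ 2 * (s10 - s11) - + 1) * y10
    + (s21 - s12) * y22 + (s01 - s12 - + 1) * y02 + (s21 - s10 + + 1) * y20 + (s01 - s10) * y00)

opaque
  κ₉ : (s00 s10 s20 s01 s11 s21 s02 s12 s22 y00 y10 y20 y01 y11 y21 y02 y12 y22 : ℤ) → ℤ
  κ₉ s00 s10 s20 s01 s11 s21 s02 s12 s22 y00 y10 y20 y01 y11 y21 y02 y12 y22 = with-κ₉ s00 s10 s20 s01 s11 s21 s02 s12 s22 y00 y10 y20 y01 y11 y21 y02 y12 y22 λ e → e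

  κ₉-≡ : ∀ s00 s10 s20 s01 s11 s21 s02 s12 s22 y00 y10 y20 y01 y11 y21 y02 y12 y22 (f : ℤ → ℤ) {e} →
    with-κ₉ s00 s10 s20 s01 s11 s21 s02 s12 s22 y00 y10 y20 y01 y11 y21 y02 y12 y22 (λ κ → e ≡ f κ) → e ≡ f (κ₉ s00 s10 s20 s01 s11 s21 s02 s12 s22 y00 y10 y20 y01 y11 y21 y02 y12 y22)
  κ₉-≡ s00 s10 s20 s01 s11 s21 s02 s12 s22 y00 y10 y20 y01 y11 y21 y02 y12 y22 f eq = eq

κ : Field → Field → Field
κ σ y i j = κ₉ (σ i j) (σ (↑ i) j) (σ (↑ (↑ i)) j) (σ i (↑ j)) (σ (↑ i) (↑ j)) (σ (↑ (↑ i)) (↑ j)) (σ i (↑ (↑ j))) (σ (↑ i) (↑ (↑ j))) (σ (↑ (↑ i)) (↑ (↑ j)))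
               (y i j) (y (↑ i) j) (y (↑ (↑ i)) j) (y i (↑ j)) (y (↑ i) (↑ j)) (y (↑ (↑ i)) (↑ j)) (y i (↑ (↑ j))) (y (↑ i) (↑ (↑ j))) (y (↑ (↑ i)) (↑ (↑ j)))

-- An edge that is not of the given kind gets exponent 0.
module Weights (σ y : Field) where

  face a-edge b-edge c-edge d-edge : Face → Var × ℤ
  face (i , j) = x (↑ i) (↑ j) , κ σ y i j
  a-edge (i , j) = a (i + height σ i j + + 1) j , (+ 1 - (σ i j - σ (↑ i) j)) * (y (↑ i) j - y i j)
  b-edge (i , j) = b i (j + height σ i j + + 1) , (+ 1 - (σ i j - σ i (↑ j))) * (y i j - y i (↑ j))
  c-edge (i , j) = c (i + + 1 - height σ i j) j , (σ i j - σ (↑ i) j) * (y i j - y (↑ i) j)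
  d-edge (i , j) = d i (j + + 1 - height σ i j) , (σ i j - σ i (↑ j)) * (+ 1 + y i (↑ j) - y i j)

  weight : List Face → Mono
  weight ts = map face ts ++ map a-edge ts ++ map b-edge ts ++ map c-edge ts ++ map d-edge ts

open Weights public using (weight; face; a-edge; b-edge; c-edge; d-edge)

at : Var × ℤ → Var → ℤ
at (w , e) v = if w =ᵥ v then e else + 0

expo-map : ∀ {A : Set} (f : A → Var × ℤ) ts v → expo (map f ts) v ≡ ∑ ts (λ t → at (f t) v)
expo-map f [] v = refl
expo-map f (t ∷ ts) v = +-congˡ (at (f t) v) (expo-map f ts v)

at-+ : ∀ w e f v → at (w , e + f) v ≡ at (w , e) v + at (w , f) v
at-+ w e f v with w =ᵥ v
... | true = refl
... | false = refl

at-0 : ∀ w v → at (w , + 0) v ≡ + 0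
at-0 w v with w =ᵥ v
... | true = refl
... | false = refl

-- Indicators

ι : ℤ → ℤ → ℤ
ι m i = if ⌊ i ≟ m ⌋ then + 1 else + 0

ι-same : ∀ m → ι m m ≡ + 1
ι-same m with m ≟ m
... | yes _ = refl
... | no m≢m = ⊥-elim (m≢m refl)

ι-other : ∀ {m i} → ¬ (i ≡ m) → ι m i ≡ + 0
ι-other {m} {i} ne with i ≟ m
... | yes eq = ⊥-elim (ne eq)
... | no _ = refl

↑-injective : ∀ {i j} → ↑ i ≡ ↑ j → i ≡ j
↑-injective {i} {j} eq = +-cancelˡ (+ 1) (trans (+-comm (+ 1) i) (trans eq (+-comm j (+ 1))))

↑≢ : ∀ {i} → ¬ (↑ i ≡ i)
↑≢ {i} eq = absurd {e = + 0} {k = 0} nat (trans (sym (+-inverseʳ i)) (trans (cong (λ t → i - t) (sym eq)) (cancel i)))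
  where
  cancel : ∀ i → i - (i + + 1) ≡ -[1+ 0 ]
  cancel = solve-∀

↑↑≢ : ∀ {i} → ¬ (↑ (↑ i) ≡ i)
↑↑≢ {i} eq = absurd {e = + 0} {k = 1} nat (trans (sym (+-inverseʳ i)) (trans (cong (λ t → i - t) (sym eq)) (cancel i)))
  where
  cancel : ∀ i → i - ((i + + 1) + + 1) ≡ -[1+ 1 ]
  cancel = solve-∀

ι-shift : ∀ m i → ι (↑ m) (↑ i) ≡ ι m i
ι-shift m i with i ≟ m
... | yes refl = ι-same (↑ i)
... | no ne = ι-other (λ eq → ne (↑-injective eq))

data Hot (k i : ℤ) : ℤ → ℤ → ℤ → Set where
  hot₀ : i ≡ k → Hot k i (+ 1) (+ 0) (+ 0)
  hot₁ : i ≡ ↑ k → Hot k i (+ 0) (+ 1) (+ 0)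
  hot₂ : i ≡ ↑ (↑ k) → Hot k i (+ 0) (+ 0) (+ 1)
  cold : Hot k i (+ 0) (+ 0) (+ 0)

hot : ∀ k i → Hot k i (ι k i) (ι (↑ k) i) (ι (↑ (↑ k)) i)
hot k i with i ≟ k | i ≟ ↑ k | i ≟ ↑ (↑ k)
... | yes p | no _ | no _ = hot₀ p
... | no _ | yes p | no _ = hot₁ p
... | no _ | no _ | yes p = hot₂ p
... | no _ | no _ | no _ = cold
... | yes refl | yes q | _ = ⊥-elim (↑≢ (sym q))
... | yes refl | no _ | yes q = ⊥-elim (↑↑≢ (sym q))
... | no _ | yes refl | yes q = ⊥-elim (↑≢ (sym q))

module _ {ts : List Face} (unique : Unique ts) where

  ∑-ι : ∀ {m n} → (m , n) ∈ ts → ∀ (g : Face → Var) e v →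
        ∑ ts (λ t → at (g t , e * (ι m (proj₁ t) * ι n (proj₂ t))) v) ≡ at (g (m , n) , e) v
  ∑-ι {m} {n} t∈ g e v =
    trans (∑-single unique t∈ _ away) (cong (λ f → at (g (m , n) , f) v) (trans (cong₂ (λ p q → e * (p * q)) (ι-same m) (ι-same n)) (*-identityʳ e)))
    where
    away : ∀ u → u ∈ ts → ¬ (u ≡ (m , n)) → at (g u , e * (ι m (proj₁ u) * ι n (proj₂ u))) v ≡ + 0
    away (i , j) _ ne = trans (cong (λ f → at (g (i , j) , f) v) zero-exponent) (at-0 (g (i , j)) v)
      where
      zero-exponent : e * (ι m i * ι n j) ≡ + 0
      zero-exponent with i ≟ m | j ≟ n
      ... | yes refl | yes refl = ⊥-elim (ne refl)
      ... | yes _ | no _ = *-zeroʳ e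
      ... | no _ | _ = *-zeroʳ e

-- The effect on κ₉ of raising the height by 1 and y by ε at one face of the grid

with-K : (s00 s10 s20 s01 s11 s21 s02 s12 s22 y00 y10 y20 y01 y11 y21 y02 y12 y22 α0 α1 α2 β0 β1 β2 ε : ℤ) → (ℤ → Set) → Set
with-K s00 s10 s20 s01 s11 s21 s02 s12 s22 y00 y10 y20 y01 y11 y21 y02 y12 y22 α0 α1 α2 β0 β1 β2 ε = with-κ₉
  (s00 + α0 * β0) (s10 + α1 * β0) (s20 + α2 * β0) (s01 + α0 * β1) (s11 + α1 * β1) (s21 + α2 * β1) (s02 + α0 * β2) (s12 + α1 * β2) (s22 + α2 * β2)
  (y00 + ε * (α0 * β0)) (y10 + ε * (α1 * β0)) (y20 + ε * (α2 * β0)) (y01 + ε * (α0 * β1)) (y11 + ε * (α1 * β1)) (y21 + ε * (α2 * β1)) (y02 + ε * (α0 * β2)) (y12 + ε * (α1 * β2)) (y22 + ε * (α2 * β2))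

opaque
  unfolding κ₉

  K : (s00 s10 s20 s01 s11 s21 s02 s12 s22 y00 y10 y20 y01 y11 y21 y02 y12 y22 α0 α1 α2 β0 β1 β2 ε : ℤ) → ℤ
  K s00 s10 s20 s01 s11 s21 s02 s12 s22 y00 y10 y20 y01 y11 y21 y02 y12 y22 α0 α1 α2 β0 β1 β2 ε = κ₉
      (s00 + α0 * β0) (s10 + α1 * β0) (s20 + α2 * β0) (s01 + α0 * β1) (s11 + α1 * β1) (s21 + α2 * β1) (s02 + α0 * β2) (s12 + α1 * β2) (s22 + α2 * β2)
      (y00 + ε * (α0 * β0)) (y10 + ε * (α1 * β0)) (y20 + ε * (α2 * β0)) (y01 + ε * (α0 * β1)) (y11 + ε * (α1 * β1)) (y21 + ε * (α2 * β1)) (y02 + ε * (α0 * β2)) (y12 + ε * (α1 * β2)) (y22 + ε * (α2 * β2))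

  K-raise : ∀ {s00 s10 s20 s01 s11 s21 s02 s12 s22 y00 y10 y20 y01 y11 y21 y02 y12 y22 t00 t10 t20 t01 t11 t21 t02 t12 t22 z00 z10 z20 z01 z11 z21 z02 z12 z22 α0 α1 α2 β0 β1 β2 ε} →
    s00 ≡ t00 + α0 * β0 → s10 ≡ t10 + α1 * β0 → s20 ≡ t20 + α2 * β0 → s01 ≡ t01 + α0 * β1 → s11 ≡ t11 + α1 * β1 → s21 ≡ t21 + α2 * β1 → s02 ≡ t02 + α0 * β2 → s12 ≡ t12 + α1 * β2 → s22 ≡ t22 + α2 * β2 → y00 ≡ z00 + ε * (α0 * β0) → y10 ≡ z10 + ε * (α1 * β0) → y20 ≡ z20 + ε * (α2 * β0) → y01 ≡ z01 + ε * (α0 * β1) → y11 ≡ z11 + ε * (α1 * β1) → y21 ≡ z21 + ε * (α2 * β1) → y02 ≡ z02 + ε * (α0 * β2) → y12 ≡ z12 + ε * (α1 * β2) → y22 ≡ z22 + ε * (α2 * β2) → 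
    κ₉ s00 s10 s20 s01 s11 s21 s02 s12 s22 y00 y10 y20 y01 y11 y21 y02 y12 y22 ≡ K t00 t10 t20 t01 t11 t21 t02 t12 t22 z00 z10 z20 z01 z11 z21 z02 z12 z22 α0 α1 α2 β0 β1 β2 ε
  K-raise refl refl refl refl refl refl refl refl refl refl refl refl refl refl refl refl refl refl = refl

  K-≡ : ∀ {s00 s10 s20 s01 s11 s21 s02 s12 s22 y00 y10 y20 y01 y11 y21 y02 y12 y22 α0 α1 α2 β0 β1 β2 ε e} →
    with-K s00 s10 s20 s01 s11 s21 s02 s12 s22 y00 y10 y20 y01 y11 y21 y02 y12 y22 α0 α1 α2 β0 β1 β2 ε (λ K → with-κ₉ s00 s10 s20 s01 s11 s21 s02 s12 s22 y00 y10 y20 y01 y11 y21 y02 y12 y22 (λ κ → K ≡ κ + e)) →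
    K s00 s10 s20 s01 s11 s21 s02 s12 s22 y00 y10 y20 y01 y11 y21 y02 y12 y22 α0 α1 α2 β0 β1 β2 ε ≡ κ₉ s00 s10 s20 s01 s11 s21 s02 s12 s22 y00 y10 y20 y01 y11 y21 y02 y12 y22 + e
  K-≡ eq = eq

κ-east : ∀ {s00 s10 s20 s01 s11 s21 s02 s12 s22 y00 y10 y20 y01 y11 y21 y02 y12 y22} ε → s11 ≡ s01 → s02 ≡ s01 → s00 ≡ s01 + + 1 → 
  K s00 s10 s20 s01 s11 s21 s02 s12 s22 y00 y10 y20 y01 y11 y21 y02 y12 y22 (+ 1) (+ 0) (+ 0) (+ 0) (+ 1) (+ 0) ε ≡ κ₉ s00 s10 s20 s01 s11 s21 s02 s12 s22 y00 y10 y20 y01 y11 y21 y02 y12 y22 + (y02 + y00 - (+ 2 * y01 + ε))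
κ-east {s10 = s10} {s20 = s20} {s01 = s01} {s21 = s21} {s12 = s12} {s22 = s22} {y00 = y00} {y10 = y10} {y20 = y20} {y01 = y01} {y11 = y11} {y21 = y21} {y02 = y02} {y12 = y12} {y22 = y22} ε refl refl refl = K-≡ (solveℤ (s21 ∷ˡ s01 ∷ˡ y21 ∷ˡ ε ∷ˡ y01 ∷ˡ s12 ∷ˡ y12 ∷ˡ s10 ∷ˡ y10 ∷ˡ y22 ∷ˡ y02 ∷ˡ y20 ∷ˡ y00 ∷ˡ []))

κ-west : ∀ {s00 s10 s20 s01 s11 s21 s02 s12 s22 y00 y10 y20 y01 y11 y21 y02 y12 y22} ε → s11 ≡ s21 + + 1 → s22 ≡ s21 → s20 ≡ s21 + + 1 → 
  K s00 s10 s20 s01 s11 s21 s02 s12 s22 y00 y10 y20 y01 y11 y21 y02 y12 y22 (+ 0) (+ 0) (+ 1) (+ 0) (+ 1) (+ 0) ε ≡ κ₉ s00 s10 s20 s01 s11 s21 s02 s12 s22 y00 y10 y20 y01 y11 y21 y02 y12 y22 + (y22 + y20 - (+ 2 * y21 + ε))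
κ-west {s00 = s00} {s10 = s10} {s01 = s01} {s21 = s21} {s02 = s02} {s12 = s12} {y00 = y00} {y10 = y10} {y20 = y20} {y01 = y01} {y11 = y11} {y21 = y21} {y02 = y02} {y12 = y12} {y22 = y22} ε refl refl refl = K-≡ (solveℤ (s21 ∷ˡ y21 ∷ˡ ε ∷ˡ s01 ∷ˡ y01 ∷ˡ s12 ∷ˡ y12 ∷ˡ s10 ∷ˡ y10 ∷ˡ y22 ∷ˡ y02 ∷ˡ y20 ∷ˡ y00 ∷ˡ []))

κ-north : ∀ {s00 s10 s20 s01 s11 s21 s02 s12 s22 y00 y10 y20 y01 y11 y21 y02 y12 y22} ε → s11 ≡ s10 → s20 ≡ s10 → s00 ≡ s10 + + 1 → 
  K s00 s10 s20 s01 s11 s21 s02 s12 s22 y00 y10 y20 y01 y11 y21 y02 y12 y22 (+ 0) (+ 1) (+ 0) (+ 1) (+ 0) (+ 0) ε ≡ κ₉ s00 s10 s20 s01 s11 s21 s02 s12 s22 y00 y10 y20 y01 y11 y21 y02 y12 y22 + (+ 2 * y10 + ε - y20 - y00)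
κ-north {s10 = s10} {s01 = s01} {s21 = s21} {s02 = s02} {s12 = s12} {s22 = s22} {y00 = y00} {y10 = y10} {y20 = y20} {y01 = y01} {y11 = y11} {y21 = y21} {y02 = y02} {y12 = y12} {y22 = y22} ε refl refl refl = K-≡ (solveℤ (s21 ∷ˡ s10 ∷ˡ y21 ∷ˡ ε ∷ˡ s01 ∷ˡ y01 ∷ˡ s12 ∷ˡ y12 ∷ˡ y10 ∷ˡ y22 ∷ˡ y02 ∷ˡ y20 ∷ˡ y00 ∷ˡ []))

κ-south : ∀ {s00 s10 s20 s01 s11 s21 s02 s12 s22 y00 y10 y20 y01 y11 y21 y02 y12 y22} ε → s11 ≡ s12 + + 1 → s22 ≡ s12 → s02 ≡ s12 + + 1 → 
  K s00 s10 s20 s01 s11 s21 s02 s12 s22 y00 y10 y20 y01 y11 y21 y02 y12 y22 (+ 0) (+ 1) (+ 0) (+ 0) (+ 0) (+ 1) ε ≡ κ₉ s00 s10 s20 s01 s11 s21 s02 s12 s22 y00 y10 y20 y01 y11 y21 y02 y12 y22 + (+ 2 * y12 + ε - y22 - y02)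
κ-south {s00 = s00} {s10 = s10} {s20 = s20} {s01 = s01} {s21 = s21} {s12 = s12} {y00 = y00} {y10 = y10} {y20 = y20} {y01 = y01} {y11 = y11} {y21 = y21} {y02 = y02} {y12 = y12} {y22 = y22} ε refl refl refl = K-≡ (solveℤ (s21 ∷ˡ s12 ∷ˡ y21 ∷ˡ ε ∷ˡ s01 ∷ˡ y01 ∷ˡ y12 ∷ˡ s10 ∷ˡ y10 ∷ˡ y22 ∷ˡ y02 ∷ˡ y20 ∷ˡ y00 ∷ˡ []))

κ-centre : ∀ {s00 s10 s20 s01 s11 s21 s02 s12 s22 y00 y10 y20 y01 y11 y21 y02 y12 y22} ε → s21 ≡ s11 → s12 ≡ s11 → s01 ≡ s11 + + 1 → s10 ≡ s11 + + 1 → 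
  K s00 s10 s20 s01 s11 s21 s02 s12 s22 y00 y10 y20 y01 y11 y21 y02 y12 y22 (+ 0) (+ 1) (+ 0) (+ 0) (+ 1) (+ 0) ε ≡ κ₉ s00 s10 s20 s01 s11 s21 s02 s12 s22 y00 y10 y20 y01 y11 y21 y02 y12 y22 + (+ 2 * (y21 + y01 - y12 - y10))
κ-centre {s00 = s00} {s20 = s20} {s11 = s11} {s02 = s02} {s22 = s22} {y00 = y00} {y10 = y10} {y20 = y20} {y01 = y01} {y11 = y11} {y21 = y21} {y02 = y02} {y12 = y12} {y22 = y22} ε refl refl refl refl = K-≡ (solveℤ (s11 ∷ˡ y21 ∷ˡ ε ∷ˡ y01 ∷ˡ y12 ∷ˡ y10 ∷ˡ y22 ∷ˡ y02 ∷ˡ y20 ∷ˡ y00 ∷ˡ []))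

κ-ne : ∀ {s00 s10 s20 s01 s11 s21 s02 s12 s22 y00 y10 y20 y01 y11 y21 y02 y12 y22} ε → s01 ≡ s00 → s10 ≡ s00 → 
  K s00 s10 s20 s01 s11 s21 s02 s12 s22 y00 y10 y20 y01 y11 y21 y02 y12 y22 (+ 1) (+ 0) (+ 0) (+ 1) (+ 0) (+ 0) ε ≡ κ₉ s00 s10 s20 s01 s11 s21 s02 s12 s22 y00 y10 y20 y01 y11 y21 y02 y12 y22 + + 0
κ-ne {s00 = s00} {s20 = s20} {s11 = s11} {s21 = s21} {s02 = s02} {s12 = s12} {s22 = s22} {y00 = y00} {y10 = y10} {y20 = y20} {y01 = y01} {y11 = y11} {y21 = y21} {y02 = y02} {y12 = y12} {y22 = y22} ε refl refl = K-≡ (solveℤ (s21 ∷ˡ s11 ∷ˡ y21 ∷ˡ ε ∷ˡ s00 ∷ˡ y01 ∷ˡ s12 ∷ˡ y12 ∷ˡ y10 ∷ˡ y22 ∷ˡ y02 ∷ˡ y20 ∷ˡ y00 ∷ˡ []))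

κ-sw : ∀ {s00 s10 s20 s01 s11 s21 s02 s12 s22 y00 y10 y20 y01 y11 y21 y02 y12 y22} ε → s21 ≡ s22 + + 1 → s12 ≡ s22 + + 1 → 
  K s00 s10 s20 s01 s11 s21 s02 s12 s22 y00 y10 y20 y01 y11 y21 y02 y12 y22 (+ 0) (+ 0) (+ 1) (+ 0) (+ 0) (+ 1) ε ≡ κ₉ s00 s10 s20 s01 s11 s21 s02 s12 s22 y00 y10 y20 y01 y11 y21 y02 y12 y22 + + 0
κ-sw {s00 = s00} {s10 = s10} {s20 = s20} {s01 = s01} {s11 = s11} {s02 = s02} {s22 = s22} {y00 = y00} {y10 = y10} {y20 = y20} {y01 = y01} {y11 = y11} {y21 = y21} {y02 = y02} {y12 = y12} {y22 = y22} ε refl refl = K-≡ (solveℤ (s22 ∷ˡ s11 ∷ˡ y21 ∷ˡ ε ∷ˡ s01 ∷ˡ y01 ∷ˡ y12 ∷ˡ s10 ∷ˡ y10 ∷ˡ y22 ∷ˡ y02 ∷ˡ y20 ∷ˡ y00 ∷ˡ []))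

κ-se : ∀ {s00 s10 s20 s01 s11 s21 s02 s12 s22 y00 y10 y20 y01 y11 y21 y02 y12 y22} ε → s01 ≡ s02 + + 1 → s12 ≡ s02 → 
  K s00 s10 s20 s01 s11 s21 s02 s12 s22 y00 y10 y20 y01 y11 y21 y02 y12 y22 (+ 1) (+ 0) (+ 0) (+ 0) (+ 0) (+ 1) ε ≡ κ₉ s00 s10 s20 s01 s11 s21 s02 s12 s22 y00 y10 y20 y01 y11 y21 y02 y12 y22 + + 0
κ-se {s00 = s00} {s10 = s10} {s20 = s20} {s11 = s11} {s21 = s21} {s02 = s02} {s22 = s22} {y00 = y00} {y10 = y10} {y20 = y20} {y01 = y01} {y11 = y11} {y21 = y21} {y02 = y02} {y12 = y12} {y22 = y22} ε refl refl = K-≡ (solveℤ (s21 ∷ˡ s11 ∷ˡ y21 ∷ˡ ε ∷ˡ s02 ∷ˡ y01 ∷ˡ y12 ∷ˡ s10 ∷ˡ y10 ∷ˡ y22 ∷ˡ y02 ∷ˡ y20 ∷ˡ y00 ∷ˡ []))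

κ-nw : ∀ {s00 s10 s20 s01 s11 s21 s02 s12 s22 y00 y10 y20 y01 y11 y21 y02 y12 y22} ε → s21 ≡ s20 → s10 ≡ s20 + + 1 → 
  K s00 s10 s20 s01 s11 s21 s02 s12 s22 y00 y10 y20 y01 y11 y21 y02 y12 y22 (+ 0) (+ 0) (+ 1) (+ 1) (+ 0) (+ 0) ε ≡ κ₉ s00 s10 s20 s01 s11 s21 s02 s12 s22 y00 y10 y20 y01 y11 y21 y02 y12 y22 + + 0
κ-nw {s00 = s00} {s20 = s20} {s01 = s01} {s11 = s11} {s02 = s02} {s12 = s12} {s22 = s22} {y00 = y00} {y10 = y10} {y20 = y20} {y01 = y01} {y11 = y11} {y21 = y21} {y02 = y02} {y12 = y12} {y22 = y22} ε refl refl = K-≡ (solveℤ (s20 ∷ˡ s11 ∷ˡ y21 ∷ˡ ε ∷ˡ s01 ∷ˡ y01 ∷ˡ s12 ∷ˡ y12 ∷ˡ y10 ∷ˡ y22 ∷ˡ y02 ∷ˡ y20 ∷ˡ y00 ∷ˡ []))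

κ-cold-column : ∀ {s00 s10 s20 s01 s11 s21 s02 s12 s22 y00 y10 y20 y01 y11 y21 y02 y12 y22} β0 β1 β2 ε → K s00 s10 s20 s01 s11 s21 s02 s12 s22 y00 y10 y20 y01 y11 y21 y02 y12 y22 (+ 0) (+ 0) (+ 0) β0 β1 β2 ε ≡ κ₉ s00 s10 s20 s01 s11 s21 s02 s12 s22 y00 y10 y20 y01 y11 y21 y02 y12 y22 + + 0
κ-cold-column {s00 = s00} {s10 = s10} {s20 = s20} {s01 = s01} {s11 = s11} {s21 = s21} {s02 = s02} {s12 = s12} {s22 = s22} {y00 = y00} {y10 = y10} {y20 = y20} {y01 = y01} {y11 = y11} {y21 = y21} {y02 = y02} {y12 = y12} {y22 = y22} β0 β1 β2 ε = K-≡ (solveℤ (s21 ∷ˡ β1 ∷ˡ s11 ∷ˡ y21 ∷ˡ ε ∷ˡ s01 ∷ˡ y01 ∷ˡ s12 ∷ˡ β2 ∷ˡ y12 ∷ˡ s10 ∷ˡ β0 ∷ˡ y10 ∷ˡ y22 ∷ˡ y02 ∷ˡ y20 ∷ˡ y00 ∷ˡ []))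

κ-cold-row : ∀ {s00 s10 s20 s01 s11 s21 s02 s12 s22 y00 y10 y20 y01 y11 y21 y02 y12 y22} α0 α1 α2 ε → K s00 s10 s20 s01 s11 s21 s02 s12 s22 y00 y10 y20 y01 y11 y21 y02 y12 y22 α0 α1 α2 (+ 0) (+ 0) (+ 0) ε ≡ κ₉ s00 s10 s20 s01 s11 s21 s02 s12 s22 y00 y10 y20 y01 y11 y21 y02 y12 y22 + + 0
κ-cold-row {s00 = s00} {s10 = s10} {s20 = s20} {s01 = s01} {s11 = s11} {s21 = s21} {s02 = s02} {s12 = s12} {s22 = s22} {y00 = y00} {y10 = y10} {y20 = y20} {y01 = y01} {y11 = y11} {y21 = y21} {y02 = y02} {y12 = y12} {y22 = y22} α0 α1 α2 ε = K-≡ (solveℤ (s21 ∷ˡ α2 ∷ˡ s11 ∷ˡ α1 ∷ˡ y21 ∷ˡ ε ∷ˡ s01 ∷ˡ α0 ∷ˡ y01 ∷ˡ s12 ∷ˡ y12 ∷ˡ s10 ∷ˡ y10 ∷ˡ y22 ∷ˡ y02 ∷ˡ y20 ∷ˡ y00 ∷ˡ []))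

centre-exponent : ∀ {A C} v ε e w n s → A ≡ + 2 * v + ε - e - w → C ≡ n + s - (+ 2 * v + ε) →
                  + 2 * (e + w - n - s) ≡ - + 2 * (A + C)
centre-exponent v ε e w n s refl refl = solveℤ (e ∷ˡ w ∷ˡ n ∷ˡ s ∷ˡ v ∷ˡ ε ∷ˡ [])

-- σ is obtained from σ' by raising the local minimum (k + 2 , l + 2).
-- Its coordinates are written in this form so that only ↑ is needed for
-- the surrounding faces.
record Flip (k l : ℤ) (σ σ' : Field) : Set where
  field
    raise : ∀ i j → σ i j ≡ σ' i j + ι (↑ (↑ k)) i * ι (↑ (↑ l)) j
    east : σ' (↑ (↑ (↑ k))) (↑ (↑ l)) ≡ σ' (↑ (↑ k)) (↑ (↑ l))
    north : σ' (↑ (↑ k)) (↑ (↑ (↑ l))) ≡ σ' (↑ (↑ k)) (↑ (↑ l))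
    west : σ' (↑ k) (↑ (↑ l)) ≡ σ' (↑ (↑ k)) (↑ (↑ l)) + + 1
    south : σ' (↑ (↑ k)) (↑ l) ≡ σ' (↑ (↑ k)) (↑ (↑ l)) + + 1

module KappaFlip {k l : ℤ} {σ σ' : Field} (flip : Flip k l σ σ')
  {y y' : Field} (ε : ℤ) (change : ∀ i j → y i j ≡ y' i j + ε * (ι (↑ (↑ k)) i * ι (↑ (↑ l)) j))
  (A C : ℤ)
  (A≡ : A ≡ + 2 * y' (↑ (↑ k)) (↑ (↑ l)) + ε - y' (↑ (↑ (↑ k))) (↑ (↑ l)) - y' (↑ k) (↑ (↑ l)))
  (C≡ : C ≡ y' (↑ (↑ k)) (↑ (↑ (↑ l))) + y' (↑ (↑ k)) (↑ l) - (+ 2 * y' (↑ (↑ k)) (↑ (↑ l)) + ε))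
  where
  open Flip flip

  private
    raise′ : ∀ i j {p q} → ι (↑ (↑ k)) i ≡ p → ι (↑ (↑ l)) j ≡ q → σ i j ≡ σ' i j + p * q
    raise′ i j refl refl = raise i j

    change′ : ∀ i j {p q} → ι (↑ (↑ k)) i ≡ p → ι (↑ (↑ l)) j ≡ q → y i j ≡ y' i j + ε * (p * q)
    change′ i j refl refl = change i j

    ι-shift₂ : ∀ m i → ι (↑ (↑ m)) (↑ (↑ i)) ≡ ι m i
    ι-shift₂ m i = trans (ι-shift (↑ m) (↑ i)) (ι-shift m i)

    κ-raise : ∀ i j → κ σ y i j ≡
      K (σ' i j) (σ' (↑ i) j) (σ' (↑ (↑ i)) j) (σ' i (↑ j)) (σ' (↑ i) (↑ j)) (σ' (↑ (↑ i)) (↑ j)) (σ' i (↑ (↑ j))) (σ' (↑ i) (↑ (↑ j))) (σ' (↑ (↑ i)) (↑ (↑ j)))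
        (y' i j) (y' (↑ i) j) (y' (↑ (↑ i)) j) (y' i (↑ j)) (y' (↑ i) (↑ j)) (y' (↑ (↑ i)) (↑ j)) (y' i (↑ (↑ j))) (y' (↑ i) (↑ (↑ j))) (y' (↑ (↑ i)) (↑ (↑ j)))
        (ι (↑ (↑ k)) i) (ι (↑ k) i) (ι k i) (ι (↑ (↑ l)) j) (ι (↑ l) j) (ι l j) ε
    κ-raise i j = K-raise
      (raise′ i j refl refl)
      (raise′ (↑ i) j (ι-shift (↑ k) i) refl)
      (raise′ (↑ (↑ i)) j (ι-shift₂ k i) refl)
      (raise′ i (↑ j) refl (ι-shift (↑ l) j))
      (raise′ (↑ i) (↑ j) (ι-shift (↑ k) i) (ι-shift (↑ l) j))
      (raise′ (↑ (↑ i)) (↑ j) (ι-shift₂ k i) (ι-shift (↑ l) j))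
      (raise′ i (↑ (↑ j)) refl (ι-shift₂ l j))
      (raise′ (↑ i) (↑ (↑ j)) (ι-shift (↑ k) i) (ι-shift₂ l j))
      (raise′ (↑ (↑ i)) (↑ (↑ j)) (ι-shift₂ k i) (ι-shift₂ l j))
      (change′ i j refl refl)
      (change′ (↑ i) j (ι-shift (↑ k) i) refl)
      (change′ (↑ (↑ i)) j (ι-shift₂ k i) refl)
      (change′ i (↑ j) refl (ι-shift (↑ l) j))
      (change′ (↑ i) (↑ j) (ι-shift (↑ k) i) (ι-shift (↑ l) j))
      (change′ (↑ (↑ i)) (↑ j) (ι-shift₂ k i) (ι-shift (↑ l) j))
      (change′ i (↑ (↑ j)) refl (ι-shift₂ l j))
      (change′ (↑ i) (↑ (↑ j)) (ι-shift (↑ k) i) (ι-shift₂ l j))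
      (change′ (↑ (↑ i)) (↑ (↑ j)) (ι-shift₂ k i) (ι-shift₂ l j))

    κ-step : ∀ {i j p q r p' q' r'} → Hot k i p q r → Hot l j p' q' r' →
      K (σ' i j) (σ' (↑ i) j) (σ' (↑ (↑ i)) j) (σ' i (↑ j)) (σ' (↑ i) (↑ j)) (σ' (↑ (↑ i)) (↑ j)) (σ' i (↑ (↑ j))) (σ' (↑ i) (↑ (↑ j))) (σ' (↑ (↑ i)) (↑ (↑ j)))
        (y' i j) (y' (↑ i) j) (y' (↑ (↑ i)) j) (y' i (↑ j)) (y' (↑ i) (↑ j)) (y' (↑ (↑ i)) (↑ j)) (y' i (↑ (↑ j))) (y' (↑ i) (↑ (↑ j))) (y' (↑ (↑ i)) (↑ (↑ j))) r q p r' q' p' ε ≡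
      κ σ' y' i j +
      (C * (r * q') + C * (p * q') + A * (q * r') + A * (q * p') + - + 2 * (A + C) * (q * q'))
    κ-step (hot₂ refl) (hot₁ refl) = trans (κ-east ε east north south) (+-congˡ (κ σ' y' (↑ (↑ k)) (↑ l)) (trans (sym C≡) (solveℤ (C ∷ˡ A ∷ˡ []))))
    κ-step (hot₀ refl) (hot₁ refl) = trans (κ-west ε west north south) (+-congˡ (κ σ' y' k (↑ l)) (trans (sym C≡) (solveℤ (C ∷ˡ A ∷ˡ []))))
    κ-step (hot₁ refl) (hot₂ refl) = trans (κ-north ε north east west) (+-congˡ (κ σ' y' (↑ k) (↑ (↑ l))) (trans (sym A≡) (solveℤ (A ∷ˡ C ∷ˡ []))))
    κ-step (hot₁ refl) (hot₀ refl) = trans (κ-south ε south east west) (+-congˡ (κ σ' y' (↑ k) l) (trans (sym A≡) (solveℤ (A ∷ˡ C ∷ˡ []))))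
    κ-step (hot₁ refl) (hot₁ refl) = trans (κ-centre ε east north west south) (+-congˡ (κ σ' y' (↑ k) (↑ l)) (trans (centre-exponent (y' (↑ (↑ k)) (↑ (↑ l))) ε _ _ _ _ A≡ C≡) (solveℤ (A ∷ˡ C ∷ˡ []))))
    κ-step (hot₂ refl) (hot₂ refl) = trans (κ-ne ε north east) (+-congˡ (κ σ' y' (↑ (↑ k)) (↑ (↑ l))) (solveℤ (C ∷ˡ A ∷ˡ [])))
    κ-step (hot₀ refl) (hot₀ refl) = trans (κ-sw ε south west) (+-congˡ (κ σ' y' k l) (solveℤ (C ∷ˡ A ∷ˡ [])))
    κ-step (hot₂ refl) (hot₀ refl) = trans (κ-se ε south east) (+-congˡ (κ σ' y' (↑ (↑ k)) l) (solveℤ (C ∷ˡ A ∷ˡ [])))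
    κ-step (hot₀ refl) (hot₂ refl) = trans (κ-nw ε north west) (+-congˡ (κ σ' y' k (↑ (↑ l))) (solveℤ (C ∷ˡ A ∷ˡ [])))
    κ-step {i} {j} {p' = p'} {q'} {r'} cold _ = trans (κ-cold-column _ _ _ ε) (+-congˡ (κ σ' y' i j) (solveℤ (C ∷ˡ q' ∷ˡ A ∷ˡ r' ∷ˡ p' ∷ˡ [])))
    κ-step {i} {j} (hot₀ _) cold = trans (κ-cold-row _ _ _ ε) (+-congˡ (κ σ' y' i j) (solveℤ (C ∷ˡ A ∷ˡ [])))
    κ-step {i} {j} (hot₁ _) cold = trans (κ-cold-row _ _ _ ε) (+-congˡ (κ σ' y' i j) (solveℤ (C ∷ˡ A ∷ˡ [])))
    κ-step {i} {j} (hot₂ _) cold = trans (κ-cold-row _ _ _ ε) (+-congˡ (κ σ' y' i j) (solveℤ (C ∷ˡ A ∷ˡ [])))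

  κ-flip : ∀ i j → κ σ y i j ≡ κ σ' y' i j +
    (C * (ι (↑ (↑ k)) i * ι (↑ l) j) + C * (ι k i * ι (↑ l) j) + A * (ι (↑ k) i * ι (↑ (↑ l)) j) + A * (ι (↑ k) i * ι l j)
      + - + 2 * (A + C) * (ι (↑ k) i * ι (↑ l) j))
  κ-flip i j = trans (κ-raise i j) (κ-step (hot k i) (hot l j))

-- Raising a height changes the weight

module _ {ts : List Face} (unique : Unique ts) where

  ∑-pair : ∀ {p q} → p ∈ ts → q ∈ ts → ¬ (p ≡ q) → (f : Face → ℤ) →
           (∀ t → ¬ (t ≡ p) → ¬ (t ≡ q) → f t ≡ + 0) → ∑ ts f ≡ f p + f q
  ∑-pair {p} {q} p∈ q∈ p≢q f z = trans (∑-cong ts split) (trans (∑-+ ts f₁ f₂)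
    (cong₂ _+_ (trans (∑-single unique p∈ f₁ (λ t _ → off₁ t)) on₁) (trans (∑-single unique q∈ f₂ (λ t _ → off₂ t)) on₂)))
    where
    f₁ f₂ : Face → ℤ
    f₁ t = if ⌊ t ≟ᶠ p ⌋ then f t else + 0
    f₂ t = if ⌊ t ≟ᶠ p ⌋ then + 0 else f t
    split : ∀ t → f t ≡ f₁ t + f₂ t
    split t with t ≟ᶠ p
    ... | yes _ = sym (+-identityʳ _)
    ... | no _ = sym (+-identityˡ _)
    on₁ : f₁ p ≡ f p
    on₁ with p ≟ᶠ p
    ... | yes _ = refl
    ... | no ne = ⊥-elim (ne refl)
    on₂ : f₂ q ≡ f q
    on₂ with q ≟ᶠ p
    ... | yes eq = ⊥-elim (p≢q (sym eq))
    ... | no _ = refl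
    off₁ : ∀ t → ¬ (t ≡ p) → f₁ t ≡ + 0
    off₁ t ne with t ≟ᶠ p
    ... | yes eq = ⊥-elim (ne eq)
    ... | no _ = refl
    off₂ : ∀ t → ¬ (t ≡ q) → f₂ t ≡ + 0
    off₂ t ne with t ≟ᶠ p
    ... | yes _ = refl
    ... | no ne' = z t ne' ne

  edge-move : ∀ {p q} → p ∈ ts → q ∈ ts → ¬ (p ≡ q) → (f f' : Face → Var × ℤ) →
    (∀ t → ¬ (t ≡ p) → ¬ (t ≡ q) → f t ≡ f' t) →
    ∀ {L L₁ L₂ e e'} → f p ≡ (L , e) → f' p ≡ (L₁ , + 0) → f q ≡ (L₂ , + 0) → f' q ≡ (L , e') →
    ∀ v → ∑ ts (λ t → at (f t) v) ≡ ∑ ts (λ t → at (f' t) v) + at (L , e - e') v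
  edge-move {p} {q} p∈ q∈ p≢q f f' same {L} {L₁} {L₂} {e} {e'} fp f'p fq f'q v = trans
    (trans (∑-cong ts (λ t → split (at (f t) v) (at (f' t) v))) (∑-+ ts (λ t → at (f' t) v) D))
    (+-congˡ (∑ ts (λ t → at (f' t) v)) (trans
      (∑-pair p∈ q∈ p≢q D (λ t ne ne' → trans (cong (λ r → at r v - at (f' t) v) (same t ne ne')) (+-inverseʳ (at (f' t) v))))
      (trans (cong₂ _+_ (cong₂ (λ r s → at r v - at s v) fp f'p) (cong₂ (λ r s → at r v - at s v) fq f'q))
      (trans (cong₂ (λ r s → at (L , e) v - r + (s - at (L , e') v)) (at-0 L₁ v) (at-0 L₂ v)) total))))
    where
    D : Face → ℤ
    D t = at (f t) v - at (f' t) v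
    split : ∀ m n → m ≡ n + (m - n)
    split = solve-∀
    total : at (L , e) v - + 0 + (+ 0 - at (L , e') v) ≡ at (L , e - e') v
    total with L =ᵥ v
    ... | true = difference e e'
      where
      difference : ∀ e e' → e - + 0 + (+ 0 - e') ≡ e - e'
      difference = solve-∀
    ... | false = refl

expo-weight : ∀ σ y ts v → expo (weight σ y ts) v ≡
  ∑ ts (λ t → at (face σ y t) v) + (∑ ts (λ t → at (a-edge σ y t) v) + (∑ ts (λ t → at (b-edge σ y t) v) +
    (∑ ts (λ t → at (c-edge σ y t) v) + ∑ ts (λ t → at (d-edge σ y t) v))))
expo-weight σ y ts v = trans (expo-++ (map (face σ y) ts) _ v) (cong₂ _+_ (expo-map (face σ y) ts v)
  (trans (expo-++ (map (a-edge σ y) ts) _ v) (cong₂ _+_ (expo-map (a-edge σ y) ts v)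
  (trans (expo-++ (map (b-edge σ y) ts) _ v) (cong₂ _+_ (expo-map (b-edge σ y) ts v)
  (trans (expo-++ (map (c-edge σ y) ts) _ v) (cong₂ _+_ (expo-map (c-edge σ y) ts v) (expo-map (d-edge σ y) ts v))))))))

module WeightFlip {k l : ℤ} {σ σ' : Field} (flip : Flip k l σ σ')
  {y y' : Field} (ε : ℤ) (change : ∀ i j → y i j ≡ y' i j + ε * (ι (↑ (↑ k)) i * ι (↑ (↑ l)) j))
  (A C : ℤ)
  (A≡ : A ≡ + 2 * y' (↑ (↑ k)) (↑ (↑ l)) + ε - y' (↑ (↑ (↑ k))) (↑ (↑ l)) - y' (↑ k) (↑ (↑ l)))
  (C≡ : C ≡ y' (↑ (↑ k)) (↑ (↑ (↑ l))) + y' (↑ (↑ k)) (↑ l) - (+ 2 * y' (↑ (↑ k)) (↑ (↑ l)) + ε))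
  {ts : List Face} (unique : Unique ts)
  (near : (k , l) ∈ ts × (k , ↑ l) ∈ ts × (↑ k , l) ∈ ts × (↑ k , ↑ l) ∈ ts × (↑ (↑ k) , ↑ l) ∈ ts × (↑ k , ↑ (↑ l)) ∈ ts × (↑ (↑ k) , ↑ (↑ l)) ∈ ts)
  where
  open Flip flip
  open KappaFlip flip {y} {y'} ε change A C A≡ C≡ using (κ-flip)

  private
    k₂ k₃ l₂ l₃ s v' : ℤ
    k₂ = ↑ (↑ k)
    k₃ = ↑ k₂
    l₂ = ↑ (↑ l)
    l₃ = ↑ l₂
    s = σ' k₂ l₂
    v' = y' k₂ l₂

    ι-off : ∀ i j → ¬ ((i , j) ≡ (k₂ , l₂)) → ι k₂ i * ι l₂ j ≡ + 0
    ι-off i j ne with i ≟ k₂ | j ≟ l₂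
    ... | yes refl | yes refl = ⊥-elim (ne refl)
    ... | yes _ | no _ = refl
    ... | no _ | _ = refl

    σ-off : ∀ i j → ¬ ((i , j) ≡ (k₂ , l₂)) → σ i j ≡ σ' i j
    σ-off i j ne = trans (raise i j) (trans (+-congˡ (σ' i j) (ι-off i j ne)) (+-identityʳ _))

    y-off : ∀ i j → ¬ ((i , j) ≡ (k₂ , l₂)) → y i j ≡ y' i j
    y-off i j ne = trans (change i j) (trans (+-congˡ (y' i j) (trans (cong (ε *_) (ι-off i j ne)) (*-zeroʳ ε))) (+-identityʳ _))

    ι-on : ι k₂ k₂ * ι l₂ l₂ ≡ + 1
    ι-on = cong₂ _*_ (ι-same k₂) (ι-same l₂)

    σ-on : σ k₂ l₂ ≡ s + + 1
    σ-on = trans (raise k₂ l₂) (+-congˡ s ι-on)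

    y-on : y k₂ l₂ ≡ v' + ε
    y-on = trans (change k₂ l₂) (+-congˡ v' (trans (cong (ε *_) ι-on) (*-identityʳ ε)))

    west≢ : ¬ ((↑ k , l₂) ≡ (k₂ , l₂))
    west≢ eq = ↑≢ (sym (cong proj₁ eq))

    east≢ : ¬ ((k₃ , l₂) ≡ (k₂ , l₂))
    east≢ eq = ↑≢ (cong proj₁ eq)

    south≢ : ¬ ((k₂ , ↑ l) ≡ (k₂ , l₂))
    south≢ eq = ↑≢ (sym (cong proj₂ eq))

    north≢ : ¬ ((k₂ , l₃) ≡ (k₂ , l₂))
    north≢ eq = ↑≢ (cong proj₂ eq)

    right-off : ∀ i j → ¬ ((i , j) ≡ (↑ k , l₂)) → ¬ ((↑ i , j) ≡ (k₂ , l₂))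
    right-off i j ne eq = ne (cong₂ _,_ (↑-injective (cong proj₁ eq)) (cong proj₂ eq))

    up-off : ∀ i j → ¬ ((i , j) ≡ (k₂ , ↑ l)) → ¬ ((i , ↑ j) ≡ (k₂ , l₂))
    up-off i j ne eq = ne (cong₂ _,_ (cong proj₁ eq) (↑-injective (cong proj₂ eq)))

  La Lb Lc Ld : Var
  La = a (k₂ + height σ' k₂ l₂ + + 1) l₂
  Lb = b k₂ (l₂ + height σ' k₂ l₂ + + 1)
  Lc = c (k₂ - height σ' k₂ l₂ - + 1) l₂
  Ld = d k₂ (l₂ - height σ' k₂ l₂ - + 1)

  private
    a-entry : ∀ σ y {s₁ s₂ y₁ y₂ L e} i j → σ i j ≡ s₁ → σ (↑ i) j ≡ s₂ → y i j ≡ y₁ → y (↑ i) j ≡ y₂ →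
      i + (+ 2 * s₁ + i + j) + + 1 ≡ L → (+ 1 - (s₁ - s₂)) * (y₂ - y₁) ≡ e → a-edge σ y (i , j) ≡ (a L j , e)
    a-entry σ y i j refl refl refl refl refl refl = refl

    c-entry : ∀ σ y {s₁ s₂ y₁ y₂ L e} i j → σ i j ≡ s₁ → σ (↑ i) j ≡ s₂ → y i j ≡ y₁ → y (↑ i) j ≡ y₂ →
      i + + 1 - (+ 2 * s₁ + i + j) ≡ L → (s₁ - s₂) * (y₁ - y₂) ≡ e → c-edge σ y (i , j) ≡ (c L j , e)
    c-entry σ y i j refl refl refl refl refl refl = refl

    b-entry : ∀ σ y {s₁ s₂ y₁ y₂ L e} i j → σ i j ≡ s₁ → σ i (↑ j) ≡ s₂ → y i j ≡ y₁ → y i (↑ j) ≡ y₂ →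
      j + (+ 2 * s₁ + i + j) + + 1 ≡ L → (+ 1 - (s₁ - s₂)) * (y₁ - y₂) ≡ e → b-edge σ y (i , j) ≡ (b i L , e)
    b-entry σ y i j refl refl refl refl refl refl = refl

    d-entry : ∀ σ y {s₁ s₂ y₁ y₂ L e} i j → σ i j ≡ s₁ → σ i (↑ j) ≡ s₂ → y i j ≡ y₁ → y i (↑ j) ≡ y₂ →
      j + + 1 - (+ 2 * s₁ + i + j) ≡ L → (s₁ - s₂) * (+ 1 + y₂ - y₁) ≡ e → d-edge σ y (i , j) ≡ (d i L , e)
    d-entry σ y i j refl refl refl refl refl refl = refl

    W∈ : (↑ k , l₂) ∈ ts
    W∈ = proj₁ (proj₂ (proj₂ (proj₂ (proj₂ (proj₂ near)))))
    S∈ : (k₂ , ↑ l) ∈ ts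
    S∈ = proj₁ (proj₂ (proj₂ (proj₂ (proj₂ near))))
    Q∈ : (k₂ , l₂) ∈ ts
    Q∈ = proj₂ (proj₂ (proj₂ (proj₂ (proj₂ (proj₂ near)))))

    lW : σ (↑ k) l₂ ≡ s + + 1
    lW = trans (σ-off _ _ west≢) west
    lE : σ k₃ l₂ ≡ s
    lE = trans (σ-off _ _ east≢) east
    lS : σ k₂ (↑ l) ≡ s + + 1
    lS = trans (σ-off _ _ south≢) south
    lN : σ k₂ l₃ ≡ s
    lN = trans (σ-off _ _ north≢) north

    a-flip : ∀ v → ∑ ts (λ t → at (a-edge σ y t) v) ≡ ∑ ts (λ t → at (a-edge σ' y' t) v) + at (La , A) v
    a-flip v = trans (edge-move unique W∈ Q∈ west≢ (a-edge σ y) (a-edge σ' y') same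
        (a-entry σ y (↑ k) l₂ lW σ-on (y-off _ _ west≢) y-on (label k l s) (before s (y' (↑ k) l₂) v' ε))
        (a-entry σ' y' (↑ k) l₂ west refl refl refl refl (none s (y' (↑ k) l₂) v'))
        (a-entry σ y k₂ l₂ σ-on lE refl refl refl (none s (y k₂ l₂) (y k₃ l₂)))
        (a-entry σ' y' k₂ l₂ refl east refl refl refl (after s v' (y' k₃ l₂))) v)
      (+-congˡ (∑ ts (λ t → at (a-edge σ' y' t) v)) (cong (λ e → at (La , e) v) (trans (total v' ε (y' k₃ l₂) (y' (↑ k) l₂)) (sym A≡))))
      where
      same : ∀ t → ¬ (t ≡ (↑ k , l₂)) → ¬ (t ≡ (k₂ , l₂)) → a-edge σ y t ≡ a-edge σ' y' t
      same (i , j) ne ne' = a-entry σ y i j (σ-off i j ne') (σ-off (↑ i) j (right-off i j ne)) (y-off i j ne') (y-off (↑ i) j (right-off i j ne)) refl refl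
      label : ∀ k l s → (k + + 1) + (+ 2 * (s + + 1) + (k + + 1) + ((l + + 1) + + 1)) + + 1 ≡ ((k + + 1) + + 1) + (+ 2 * s + ((k + + 1) + + 1) + ((l + + 1) + + 1)) + + 1
      label = solve-∀
      before : ∀ s w v ε → (+ 1 - (s + + 1 - (s + + 1))) * (v + ε - w) ≡ v + ε - w
      before = solve-∀
      none : ∀ s w v → (+ 1 - (s + + 1 - s)) * (v - w) ≡ + 0
      none = solve-∀
      after : ∀ s v e → (+ 1 - (s - s)) * (e - v) ≡ e - v
      after = solve-∀
      total : ∀ v ε e w → v + ε - w - (e - v) ≡ + 2 * v + ε - e - w
      total = solve-∀

    c-flip : ∀ v → ∑ ts (λ t → at (c-edge σ y t) v) ≡ ∑ ts (λ t → at (c-edge σ' y' t) v) + at (Lc , A) v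
    c-flip v = trans (edge-move unique Q∈ W∈ (λ eq → west≢ (sym eq)) (c-edge σ y) (c-edge σ' y') (λ t ne ne' → same t ne' ne)
        (c-entry σ y k₂ l₂ σ-on lE y-on (y-off _ _ east≢) (label₁ k l s) (before s v' ε (y' k₃ l₂)))
        (c-entry σ' y' k₂ l₂ refl east refl refl refl (none s v' (y' k₃ l₂)))
        (c-entry σ y (↑ k) l₂ lW σ-on refl refl refl (none′ s (y (↑ k) l₂) (y k₂ l₂)))
        (c-entry σ' y' (↑ k) l₂ west refl refl refl (label₂ k l s) (after s (y' (↑ k) l₂) v')) v)
      (+-congˡ (∑ ts (λ t → at (c-edge σ' y' t) v)) (cong (λ e → at (Lc , e) v) (trans (total v' ε (y' k₃ l₂) (y' (↑ k) l₂)) (sym A≡))))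
      where
      same : ∀ t → ¬ (t ≡ (↑ k , l₂)) → ¬ (t ≡ (k₂ , l₂)) → c-edge σ y t ≡ c-edge σ' y' t
      same (i , j) ne ne' = c-entry σ y i j (σ-off i j ne') (σ-off (↑ i) j (right-off i j ne)) (y-off i j ne') (y-off (↑ i) j (right-off i j ne)) refl refl
      label₁ : ∀ k l s → ((k + + 1) + + 1) + + 1 - (+ 2 * (s + + 1) + ((k + + 1) + + 1) + ((l + + 1) + + 1)) ≡ ((k + + 1) + + 1) - (+ 2 * s + ((k + + 1) + + 1) + ((l + + 1) + + 1)) - + 1
      label₁ = solve-∀
      label₂ : ∀ k l s → (k + + 1) + + 1 - (+ 2 * (s + + 1) + (k + + 1) + ((l + + 1) + + 1)) ≡ ((k + + 1) + + 1) - (+ 2 * s + ((k + + 1) + + 1) + ((l + + 1) + + 1)) - + 1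
      label₂ = solve-∀
      before : ∀ s v ε e → (s + + 1 - s) * (v + ε - e) ≡ v + ε - e
      before = solve-∀
      none : ∀ s v e → (s - s) * (v - e) ≡ + 0
      none = solve-∀
      none′ : ∀ s v e → (s + + 1 - (s + + 1)) * (v - e) ≡ + 0
      none′ = solve-∀
      after : ∀ s w v → (s + + 1 - s) * (w - v) ≡ w - v
      after = solve-∀
      total : ∀ v ε e w → v + ε - e - (w - v) ≡ + 2 * v + ε - e - w
      total = solve-∀

    b-flip : ∀ v → ∑ ts (λ t → at (b-edge σ y t) v) ≡ ∑ ts (λ t → at (b-edge σ' y' t) v) + at (Lb , C) v
    b-flip v = trans (edge-move unique S∈ Q∈ south≢ (b-edge σ y) (b-edge σ' y') same
        (b-entry σ y k₂ (↑ l) lS σ-on (y-off _ _ south≢) y-on (label k l s) (before s (y' k₂ (↑ l)) v' ε))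
        (b-entry σ' y' k₂ (↑ l) south refl refl refl refl (none s (y' k₂ (↑ l)) v'))
        (b-entry σ y k₂ l₂ σ-on lN refl refl refl (none s (y k₂ l₂) (y k₂ l₃)))
        (b-entry σ' y' k₂ l₂ refl north refl refl refl (after s v' (y' k₂ l₃))) v)
      (+-congˡ (∑ ts (λ t → at (b-edge σ' y' t) v)) (cong (λ e → at (Lb , e) v) (trans (total v' ε (y' k₂ l₃) (y' k₂ (↑ l))) (sym C≡))))
      where
      same : ∀ t → ¬ (t ≡ (k₂ , ↑ l)) → ¬ (t ≡ (k₂ , l₂)) → b-edge σ y t ≡ b-edge σ' y' t
      same (i , j) ne ne' = b-entry σ y i j (σ-off i j ne') (σ-off i (↑ j) (up-off i j ne)) (y-off i j ne') (y-off i (↑ j) (up-off i j ne)) refl refl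
      label : ∀ k l s → (l + + 1) + (+ 2 * (s + + 1) + ((k + + 1) + + 1) + (l + + 1)) + + 1 ≡ ((l + + 1) + + 1) + (+ 2 * s + ((k + + 1) + + 1) + ((l + + 1) + + 1)) + + 1
      label = solve-∀
      before : ∀ s w v ε → (+ 1 - (s + + 1 - (s + + 1))) * (w - (v + ε)) ≡ w - (v + ε)
      before = solve-∀
      none : ∀ s w v → (+ 1 - (s + + 1 - s)) * (w - v) ≡ + 0
      none = solve-∀
      after : ∀ s v n → (+ 1 - (s - s)) * (v - n) ≡ v - n
      after = solve-∀
      total : ∀ v ε n w → w - (v + ε) - (v - n) ≡ n + w - (+ 2 * v + ε)
      total = solve-∀

    d-flip : ∀ v → ∑ ts (λ t → at (d-edge σ y t) v) ≡ ∑ ts (λ t → at (d-edge σ' y' t) v) + at (Ld , C) v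
    d-flip v = trans (edge-move unique Q∈ S∈ (λ eq → south≢ (sym eq)) (d-edge σ y) (d-edge σ' y') (λ t ne ne' → same t ne' ne)
        (d-entry σ y k₂ l₂ σ-on lN y-on (y-off _ _ north≢) (label₁ k l s) (before s v' ε (y' k₂ l₃)))
        (d-entry σ' y' k₂ l₂ refl north refl refl refl (none s v' (y' k₂ l₃)))
        (d-entry σ y k₂ (↑ l) lS σ-on refl refl refl (none′ s (y k₂ (↑ l)) (y k₂ l₂)))
        (d-entry σ' y' k₂ (↑ l) south refl refl refl (label₂ k l s) (after s (y' k₂ (↑ l)) v')) v)
      (+-congˡ (∑ ts (λ t → at (d-edge σ' y' t) v)) (cong (λ e → at (Ld , e) v) (trans (total v' ε (y' k₂ l₃) (y' k₂ (↑ l))) (sym C≡))))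
      where
      same : ∀ t → ¬ (t ≡ (k₂ , ↑ l)) → ¬ (t ≡ (k₂ , l₂)) → d-edge σ y t ≡ d-edge σ' y' t
      same (i , j) ne ne' = d-entry σ y i j (σ-off i j ne') (σ-off i (↑ j) (up-off i j ne)) (y-off i j ne') (y-off i (↑ j) (up-off i j ne)) refl refl
      label₁ : ∀ k l s → ((l + + 1) + + 1) + + 1 - (+ 2 * (s + + 1) + ((k + + 1) + + 1) + ((l + + 1) + + 1)) ≡ ((l + + 1) + + 1) - (+ 2 * s + ((k + + 1) + + 1) + ((l + + 1) + + 1)) - + 1
      label₁ = solve-∀
      label₂ : ∀ k l s → (l + + 1) + + 1 - (+ 2 * (s + + 1) + ((k + + 1) + + 1) + (l + + 1)) ≡ ((l + + 1) + + 1) - (+ 2 * s + ((k + + 1) + + 1) + ((l + + 1) + + 1)) - + 1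
      label₂ = solve-∀
      before : ∀ s v ε n → (s + + 1 - s) * (+ 1 + n - (v + ε)) ≡ + 1 + n - (v + ε)
      before = solve-∀
      none : ∀ s v n → (s - s) * (+ 1 + n - v) ≡ + 0
      none = solve-∀
      none′ : ∀ s v n → (s + + 1 - (s + + 1)) * (+ 1 + n - v) ≡ + 0
      none′ = solve-∀
      after : ∀ s w v → (s + + 1 - s) * (+ 1 + v - w) ≡ + 1 + v - w
      after = solve-∀
      total : ∀ v ε n w → + 1 + n - (v + ε) - (+ 1 + v - w) ≡ n + w - (+ 2 * v + ε)
      total = solve-∀

  -- The two products of the exchange relation at (k + 2 , l + 2), with
  -- exponents A and C, over the 2(A + C)-th power of its face variable
  exchange : Mono
  exchange = (x k₃ l₂ , C) ∷ (x (↑ k) l₂ , C) ∷ (x k₂ l₃ , A) ∷ (x k₂ (↑ l) , A) ∷ (x k₂ l₂ , - + 2 * (A + C)) ∷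
             (La , A) ∷ (Lb , C) ∷ (Lc , A) ∷ (Ld , C) ∷ []

  private
    face-flip : ∀ v → ∑ ts (λ t → at (face σ y t) v) ≡ ∑ ts (λ t → at (face σ' y' t) v) +
      (at (x k₃ l₂ , C) v + at (x (↑ k) l₂ , C) v + at (x k₂ l₃ , A) v + at (x k₂ (↑ l) , A) v + at (x k₂ l₂ , - + 2 * (A + C)) v)
    face-flip v = trans (∑-cong ts (λ { (i , j) → expand i j }))
      (trans (∑-+ ts _ _) (+-congˡ (∑ ts (λ t → at (face σ' y' t) v))
      (trans (∑-+ ts _ _) (cong₂ _+_
      (trans (∑-+ ts _ _) (cong₂ _+_
      (trans (∑-+ ts _ _) (cong₂ _+_
      (trans (∑-+ ts _ _) (cong₂ _+_
        (∑-ι unique (proj₁ (proj₂ (proj₂ (proj₂ (proj₂ near))))) centre C v)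
        (∑-ι unique (proj₁ (proj₂ near)) centre C v)))
        (∑-ι unique (proj₁ (proj₂ (proj₂ (proj₂ (proj₂ (proj₂ near)))))) centre A v)))
        (∑-ι unique (proj₁ (proj₂ (proj₂ near))) centre A v)))
        (∑-ι unique (proj₁ (proj₂ (proj₂ (proj₂ near)))) centre (- + 2 * (A + C)) v)))))
      where
      centre : Face → Var
      centre (i , j) = x (↑ i) (↑ j)
      expand : ∀ i j → at (x (↑ i) (↑ j) , κ σ y i j) v ≡ at (x (↑ i) (↑ j) , κ σ' y' i j) v +
        (at (x (↑ i) (↑ j) , C * (ι k₂ i * ι (↑ l) j)) v + at (x (↑ i) (↑ j) , C * (ι k i * ι (↑ l) j)) v +
         at (x (↑ i) (↑ j) , A * (ι (↑ k) i * ι l₂ j)) v + at (x (↑ i) (↑ j) , A * (ι (↑ k) i * ι l j)) v +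
         at (x (↑ i) (↑ j) , - + 2 * (A + C) * (ι (↑ k) i * ι (↑ l) j)) v)
      expand i j = trans (cong (λ e → at (x (↑ i) (↑ j) , e) v) (κ-flip i j)) (trans (at-+ w _ _ v) (+-congˡ (at (w , κ σ' y' i j) v)
        (trans (at-+ w _ _ v) (cong₂ _+_ (trans (at-+ w _ _ v) (cong₂ _+_ (trans (at-+ w _ _ v) (cong₂ _+_ (at-+ w _ _ v) refl)) refl)) refl))))
        where
        w = x (↑ i) (↑ j)

  weight-flip : weight σ y ts ≃ weight σ' y' ts ++ exchange
  weight-flip = same-expo λ v → trans (expo-weight σ y ts v) (trans
    (cong₂ _+_ (face-flip v) (cong₂ _+_ (a-flip v) (cong₂ _+_ (b-flip v) (cong₂ _+_ (c-flip v) (d-flip v)))))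
    (trans (regroup (∑ ts (λ t → at (face σ' y' t) v)) (∑ ts (λ t → at (a-edge σ' y' t) v)) (∑ ts (λ t → at (b-edge σ' y' t) v))
                    (∑ ts (λ t → at (c-edge σ' y' t) v)) (∑ ts (λ t → at (d-edge σ' y' t) v))
                    (at (x k₃ l₂ , C) v) (at (x (↑ k) l₂ , C) v) (at (x k₂ l₃ , A) v) (at (x k₂ (↑ l) , A) v)
                    (at (x k₂ l₂ , - + 2 * (A + C)) v) (at (La , A) v) (at (Lb , C) v) (at (Lc , A) v) (at (Ld , C) v))
    (sym (trans (expo-++ (weight σ' y' ts) exchange v) (cong (_+ expo exchange v) (expo-weight σ' y' ts v))))))
    where
    regroup : ∀ f e₁ e₂ e₃ e₄ m₁ m₂ m₃ m₄ m₅ n₁ n₂ n₃ n₄ →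
      f + (m₁ + m₂ + m₃ + m₄ + m₅) + (e₁ + n₁ + (e₂ + n₂ + (e₃ + n₃ + (e₄ + n₄)))) ≡
      f + (e₁ + (e₂ + (e₃ + e₄))) + (m₁ + (m₂ + (m₃ + (m₄ + (m₅ + (n₁ + (n₂ + (n₃ + (n₄ + + 0)))))))))
    regroup = solve-∀

-- Bounds on the exponents

flip-bit : ∀ {e f} → Bit e → + 1 - e ≡ f → Bit f
flip-bit {e} (p , q) refl = q , by p (twice e)
  where
  twice : ∀ e → e ≡ + 1 - (+ 1 - e)
  twice = solve-∀

-- The contribution to 4κ of one of the four squares around a face.  In
-- terms of differences to the value of y at the face, P and Q belong to
-- its horizontal and vertical neighbours in the square, D to the opposite
-- corner; all four orientations are reflected to the upper right one.
corner : ∀ {r u P Q D} → Bit r → Bit u → Bit (P + r) → Bit (- Q) →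
         (r ≡ u → Bit (P - Q)) → (r + u ≡ + 1 → Bit (- D) × Bit (D - Q + r) × Bit (P - D)) →
         let T = - + 2 * (+ 1 - + 2 * r) * P + + 2 * (+ 1 - + 2 * u) * Q + + 4 * (u - r) * D + (+ 1 - + 2 * r) in
         NN (T + + 1) × NN (+ 3 - T)
corner {r} {u} {P} {Q} {D} br bu h v same diff with bit-split br | bit-split bu
... | inj₁ refl | inj₁ refl = let (p , q) = same refl in by (q ⊕ q) (l₁ P Q D) , by (p ⊕ p ⊕ nat {2}) (l₂ P Q D)
  where
  l₁ : ∀ P Q D → + 1 - (P - Q) + (+ 1 - (P - Q)) ≡ - + 2 * (+ 1 - + 2 * + 0) * P + + 2 * (+ 1 - + 2 * + 0) * Q + + 4 * (+ 0 - + 0) * D + (+ 1 - + 2 * + 0) + + 1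
  l₁ = solve-∀
  l₂ : ∀ P Q D → P - Q + (P - Q) + + 2 ≡ + 3 - (- + 2 * (+ 1 - + 2 * + 0) * P + + 2 * (+ 1 - + 2 * + 0) * Q + + 4 * (+ 0 - + 0) * D + (+ 1 - + 2 * + 0))
  l₂ = solve-∀
... | inj₂ refl | inj₂ refl = let (p , q) = same refl in by (p ⊕ p) (l₁ P Q D) , by (q ⊕ q ⊕ nat {2}) (l₂ P Q D)
  where
  l₁ : ∀ P Q D → P - Q + (P - Q) ≡ - + 2 * (+ 1 - + 2 * + 1) * P + + 2 * (+ 1 - + 2 * + 1) * Q + + 4 * (+ 1 - + 1) * D + (+ 1 - + 2 * + 1) + + 1
  l₁ = solve-∀
  l₂ : ∀ P Q D → + 1 - (P - Q) + (+ 1 - (P - Q)) + + 2 ≡ + 3 - (- + 2 * (+ 1 - + 2 * + 1) * P + + 2 * (+ 1 - + 2 * + 1) * Q + + 4 * (+ 1 - + 1) * D + (+ 1 - + 2 * + 1))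
  l₂ = solve-∀
... | inj₁ refl | inj₂ refl = let (d₀ , d₁) , (e₀ , e₁) , (f₀ , f₁) = diff refl; (h₀ , h₁) = h; (v₀ , v₁) = v in
    by (f₁ ⊕ f₁ ⊕ e₀ ⊕ e₀) (l₁ P Q D) , by (h₀ ⊕ h₀ ⊕ v₁ ⊕ v₁ ⊕ d₀ ⊕ d₀ ⊕ d₀ ⊕ d₀) (l₂ P Q D)
  where
  l₁ : ∀ P Q D → + 1 - (P - D) + (+ 1 - (P - D)) + (D - Q + + 0) + (D - Q + + 0) ≡ - + 2 * (+ 1 - + 2 * + 0) * P + + 2 * (+ 1 - + 2 * + 1) * Q + + 4 * (+ 1 - + 0) * D + (+ 1 - + 2 * + 0) + + 1
  l₁ = solve-∀
  l₂ : ∀ P Q D → P + + 0 + (P + + 0) + (+ 1 - - Q) + (+ 1 - - Q) + - D + - D + - D + - D ≡ + 3 - (- + 2 * (+ 1 - + 2 * + 0) * P + + 2 * (+ 1 - + 2 * + 1) * Q + + 4 * (+ 1 - + 0) * D + (+ 1 - + 2 * + 0)) 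
  l₂ = solve-∀
... | inj₂ refl | inj₁ refl = let (d₀ , d₁) , (e₀ , e₁) , (f₀ , f₁) = diff refl; (h₀ , h₁) = h; (v₀ , v₁) = v in
    by (f₀ ⊕ f₀ ⊕ e₁ ⊕ e₁) (l₁ P Q D) , by (h₁ ⊕ h₁ ⊕ v₀ ⊕ v₀ ⊕ d₁ ⊕ d₁ ⊕ d₁ ⊕ d₁) (l₂ P Q D)
  where
  l₁ : ∀ P Q D → P - D + (P - D) + (+ 1 - (D - Q + + 1)) + (+ 1 - (D - Q + + 1)) ≡ - + 2 * (+ 1 - + 2 * + 1) * P + + 2 * (+ 1 - + 2 * + 0) * Q + + 4 * (+ 0 - + 1) * D + (+ 1 - + 2 * + 1) + + 1
  l₁ = solve-∀
  l₂ : ∀ P Q D → + 1 - (P + + 1) + (+ 1 - (P + + 1)) + - Q + - Q + (+ 1 - - D) + (+ 1 - - D) + (+ 1 - - D) + (+ 1 - - D) ≡ + 3 - (- + 2 * (+ 1 - + 2 * + 1) * P + + 2 * (+ 1 - + 2 * + 0) * Q + + 4 * (+ 0 - + 1) * D + (+ 1 - + 2 * + 1))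
  l₂ = solve-∀

≡-by : ∀ {m n p q} → p ≡ q → m - n ≡ p - q → m ≡ n
≡-by {p = p} refl eq = i-j≡0⇒i≡j _ _ (trans eq (+-inverseʳ p))

-- Two ways around a unit square, each with two steps in {0, 1}
module Steps {p q r s : ℤ} (bp : Bit p) (bq : Bit q) (br : Bit r) (bs : Bit s) where

  opposite : p + q ≡ r + s → p + r ≡ + 1 → q ≡ r × s ≡ p
  opposite around eq with bit-split bp | bit-split bq | bit-split br | bit-split bs
  ... | inj₁ refl | inj₂ refl | inj₂ refl | inj₁ refl = refl , refl
  ... | inj₂ refl | inj₁ refl | inj₁ refl | inj₂ refl = refl , refl
  opposite _ () | inj₁ refl | _ | inj₁ refl | _
  opposite _ () | inj₂ refl | _ | inj₂ refl | _
  opposite () _ | inj₁ refl | inj₁ refl | inj₂ refl | inj₁ refl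
  opposite () _ | inj₁ refl | inj₁ refl | inj₂ refl | inj₂ refl
  opposite () _ | inj₁ refl | inj₂ refl | inj₂ refl | inj₂ refl
  opposite () _ | inj₂ refl | inj₁ refl | inj₁ refl | inj₁ refl
  opposite () _ | inj₂ refl | inj₂ refl | inj₁ refl | inj₁ refl
  opposite () _ | inj₂ refl | inj₂ refl | inj₁ refl | inj₂ refl

  parallel : p + q ≡ r + s → p ≡ q → r ≡ p × s ≡ p
  parallel around refl with bit-split bp | bit-split br | bit-split bs
  ... | inj₁ refl | inj₁ refl | inj₁ refl = refl , refl
  ... | inj₂ refl | inj₂ refl | inj₂ refl = refl , refl
  parallel () refl | inj₁ refl | inj₁ refl | inj₂ refl
  parallel () refl | inj₁ refl | inj₂ refl | inj₁ refl
  parallel () refl | inj₁ refl | inj₂ refl | inj₂ refl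
  parallel () refl | inj₂ refl | inj₁ refl | inj₁ refl
  parallel () refl | inj₂ refl | inj₁ refl | inj₂ refl
  parallel () refl | inj₂ refl | inj₂ refl | inj₁ refl

module Square {s₀₀ s₁₀ s₀₁ s₁₁ y₀₀ y₁₀ y₀₁ y₁₁ : ℤ}
  (r₀ : Bit (s₀₀ - s₁₀)) (r₁ : Bit (s₀₁ - s₁₁)) (u₀ : Bit (s₀₀ - s₀₁)) (u₁ : Bit (s₁₀ - s₁₁))
  (h₀ : Bit ((y₁₀ - s₁₀) - (y₀₀ - s₀₀))) (h₁ : Bit ((y₁₁ - s₁₁) - (y₀₁ - s₀₁))) (v₀ : Bit (y₀₀ - y₀₁)) (v₁ : Bit (y₁₀ - y₁₁))
  (dne : s₁₁ ≡ s₀₀ - + 1 → Bit (y₀₀ - y₁₁)) (dnw : s₀₁ ≡ s₁₀ → Bit (y₁₀ - y₀₁))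
  where

  private
    around : s₀₀ - s₁₀ + (s₁₀ - s₁₁) ≡ s₀₀ - s₀₁ + (s₀₁ - s₁₁)
    around = solveℤ (s₀₀ ∷ˡ s₁₀ ∷ˡ s₁₁ ∷ˡ s₀₁ ∷ˡ [])

    level-nw : s₀₀ - s₀₁ ≡ s₀₀ - s₁₀ → s₀₁ ≡ s₁₀
    level-nw eq = ≡-by (sym eq) (solveℤ (s₀₁ ∷ˡ s₁₀ ∷ˡ s₀₀ ∷ˡ []))

    level-ne : s₀₀ - s₁₀ + (s₁₀ - s₁₁) ≡ + 1 → s₁₁ ≡ s₀₀ - + 1
    level-ne eq = ≡-by (sym eq) (solveℤ (s₁₁ ∷ˡ s₀₀ ∷ˡ s₁₀ ∷ˡ []))

    module S = Steps r₀ u₁ u₀ r₁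
    module Sʳ = Steps u₁ r₀ r₁ u₀
    module Sᵘ = Steps u₀ r₁ r₀ u₁

  corner-ne = corner {s₀₀ - s₁₀} {s₀₀ - s₀₁} {y₁₀ - y₀₀} {y₀₁ - y₀₀} {y₁₁ - y₀₀} r₀ u₀
    (bit-cong h₀ (identity₁ y₁₀ s₁₀ y₀₀ s₀₀)) (bit-cong v₀ (identity₂ y₀₀ y₀₁))
    (λ eq → bit-cong (dnw (level-nw (sym eq))) (identity₃ y₁₀ y₀₁ y₀₀))
    (λ eq → let q≡r , s≡p = S.opposite around eq in
            bit-cong (dne (level-ne (trans (+-congˡ (s₀₀ - s₁₀) q≡r) eq))) (identity₂ y₀₀ y₁₁)
          , bit-cong h₁ (trans (identity₄ y₁₁ s₁₁ y₀₁ s₀₁ y₀₀) (+-congˡ (y₁₁ - y₀₀ - (y₀₁ - y₀₀)) s≡p))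
          , bit-cong v₁ (identity₃ y₁₀ y₁₁ y₀₀))

  corner-nw = corner {+ 1 - (s₀₀ - s₁₀)} {s₁₀ - s₁₁} {y₀₀ - y₁₀} {y₁₁ - y₁₀} {y₀₁ - y₁₀} (flip-bit r₀ refl) u₁
    (flip-bit h₀ (identity₅ y₁₀ s₁₀ y₀₀ s₀₀)) (bit-cong v₁ (identity₂ y₁₀ y₁₁))
    (λ eq → bit-cong (dne (level-ne (≡-by (sym eq) (identity₆ s₀₀ s₁₀ s₁₁)))) (identity₃ y₀₀ y₁₁ y₁₀))
    (λ eq → let r≡p , s≡p = S.parallel around (≡-by (sym eq) (identity₇ s₀₀ s₁₀ s₁₁)) in
            bit-cong (dnw (level-nw r≡p)) (identity₂ y₁₀ y₀₁)
          , flip-bit h₁ (trans (identity₈ y₁₁ s₁₁ y₀₁ s₀₁ y₁₀) (+-congˡ (y₀₁ - y₁₀ - (y₁₁ - y₁₀)) (cong (λ t → + 1 - t) s≡p)))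
          , bit-cong v₀ (identity₃ y₀₀ y₀₁ y₁₀))

  corner-se = corner {s₀₁ - s₁₁} {+ 1 - (s₀₀ - s₀₁)} {y₁₁ - y₀₁} {y₀₀ - y₀₁ - + 1} {y₁₀ - y₀₁ - + 1} r₁ (flip-bit u₀ refl)
    (bit-cong h₁ (identity₁ y₁₁ s₁₁ y₀₁ s₀₁)) (flip-bit v₀ (identity₉ y₀₀ y₀₁))
    (λ eq → flip-bit (dne (level-ne (≡-by eq (identity₁₀ s₀₀ s₁₀ s₁₁ s₀₁)))) (identity₁₁ y₀₀ y₁₁ y₀₁))
    (λ eq → let p≡r , _ = Sᵘ.parallel (sym around) (≡-by (sym eq) (identity₁₂ s₀₀ s₀₁ s₁₁)) in
            flip-bit (dnw (level-nw (sym p≡r))) (identity₉ y₁₀ y₀₁)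
          , bit-cong h₀ (trans (identity₁₃ y₁₀ s₁₀ y₀₀ s₀₀ y₀₁) (+-congˡ (y₁₀ - y₀₁ - + 1 - (y₀₀ - y₀₁ - + 1)) (trans p≡r (≡-by (sym eq) (identity₁₂ s₀₀ s₀₁ s₁₁)))))
          , flip-bit v₁ (identity₁₁ y₁₀ y₁₁ y₀₁))

  corner-sw = corner {+ 1 - (s₀₁ - s₁₁)} {+ 1 - (s₁₀ - s₁₁)} {y₀₁ - y₁₁} {y₁₀ - y₁₁ - + 1} {y₀₀ - y₁₁ - + 1} (flip-bit r₁ refl) (flip-bit u₁ refl)
    (flip-bit h₁ (identity₅ y₁₁ s₁₁ y₀₁ s₀₁)) (flip-bit v₁ (identity₉ y₁₀ y₁₁))
    (λ eq → flip-bit (dnw (≡-by (sym eq) (identity₁₄ s₀₁ s₁₀ s₁₁))) (identity₁₁ y₁₀ y₀₁ y₁₁))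
    (λ eq → let q+s≡1 = ≡-by {s₁₀ - s₁₁ + (s₀₁ - s₁₁)} {+ 1} (sym eq) (identity₁₅ s₁₀ s₁₁ s₀₁)
                p≡s , _ = Sʳ.opposite (≡-by around (identity₁₆ s₁₀ s₁₁ s₀₀ s₀₁)) q+s≡1 in
            flip-bit (dne (level-ne (trans (cong (_+ (s₁₀ - s₁₁)) p≡s) (trans (+-comm (s₀₁ - s₁₁) _) q+s≡1)))) (identity₉ y₀₀ y₁₁)
          , flip-bit h₀ (trans (identity₁₇ y₁₀ s₁₀ y₀₀ s₀₀ y₁₁) (+-congˡ (y₀₀ - y₁₁ - + 1 - (y₁₀ - y₁₁ - + 1)) (cong (λ t → + 1 - t) p≡s)))
          , flip-bit v₀ (identity₁₁ y₀₀ y₀₁ y₁₁))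

quarter : ∀ e → NN (+ 4 * e) → NN e
quarter (+ n) _ = nat
quarter -[1+ n ] ()

κ₉-lower : ∀ s00 s10 s20 s01 s11 s21 s02 s12 s22 y00 y10 y20 y01 y11 y21 y02 y12 y22 →
  (- + 2 * (+ 1 - + 2 * (s11 - s21)) * (y21 - y11) + + 2 * (+ 1 - + 2 * (s11 - s12)) * (y12 - y11) + + 4 * (s11 - s12 - (s11 - s21)) * (y22 - y11) + (+ 1 - + 2 * (s11 - s21)) + + 1) + (- + 2 * (+ 1 - + 2 * (+ 1 - (s01 - s11))) * (y01 - y11) + + 2 * (+ 1 - + 2 * (s11 - s12)) * (y12 - y11) + + 4 * (s11 - s12 - (+ 1 - (s01 - s11))) * (y02 - y11) + (+ 1 - + 2 * (+ 1 - (s01 - s11))) + + 1) + (- + 2 * (+ 1 - + 2 * (s11 - s21)) * (y21 - y11) + + 2 * (+ 1 - + 2 * (+ 1 - (s10 - s11))) * (y10 - y11 - + 1) + + 4 * (+ 1 - (s10 - s11) - (s11 - s21)) * (y20 - y11 - + 1) + (+ 1 - + 2 * (s11 - s21)) + + 1) + (- + 2 * (+ 1 - + 2 * (+ 1 - (s01 - s11))) * (y01 - y11) + + 2 * (+ 1 - + 2 * (+ 1 - (s10 - s11))) * (y10 - y11 - + 1) + + 4 * (+ 1 - (s10 - s11) - (+ 1 - (s01 - s11))) * (y00 - y11 - + 1) + (+ 1 - + 2 * (+ 1 - (s01 - s11))) + + 1) ≡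
  + 4 * (κ₉ s00 s10 s20 s01 s11 s21 s02 s12 s22 y00 y10 y20 y01 y11 y21 y02 y12 y22 - -[1+ 0 ])
κ₉-lower s00 s10 s20 s01 s11 s21 s02 s12 s22 y00 y10 y20 y01 y11 y21 y02 y12 y22 = κ₉-≡ s00 s10 s20 s01 s11 s21 s02 s12 s22 y00 y10 y20 y01 y11 y21 y02 y12 y22 (λ κ → + 4 * (κ - -[1+ 0 ])) (lower-identity s11 s21 y21 y11 s12 y12 y22 s01 y01 y02 s10 y10 y20 y00)

κ₉-upper : ∀ s00 s10 s20 s01 s11 s21 s02 s12 s22 y00 y10 y20 y01 y11 y21 y02 y12 y22 →
  (+ 3 - (- + 2 * (+ 1 - + 2 * (s11 - s21)) * (y21 - y11) + + 2 * (+ 1 - + 2 * (s11 - s12)) * (y12 - y11) + + 4 * (s11 - s12 - (s11 - s21)) * (y22 - y11) + (+ 1 - + 2 * (s11 - s21)))) + (+ 3 - (- + 2 * (+ 1 - + 2 * (+ 1 - (s01 - s11))) * (y01 - y11) + + 2 * (+ 1 - + 2 * (s11 - s12)) * (y12 - y11) + + 4 * (s11 - s12 - (+ 1 - (s01 - s11))) * (y02 - y11) + (+ 1 - + 2 * (+ 1 - (s01 - s11))))) + (+ 3 - (- + 2 * (+ 1 - + 2 * (s11 - s21)) * (y21 - y11) + + 2 * (+ 1 - + 2 * (+ 1 - (s10 - s11))) * (y10 - y11 - + 1) + + 4 * (+ 1 - (s10 - s11) - (s11 - s21)) * (y20 - y11 - + 1) + (+ 1 - + 2 * (s11 - s21))))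 + (+ 3 - (- + 2 * (+ 1 - + 2 * (+ 1 - (s01 - s11))) * (y01 - y11) + + 2 * (+ 1 - + 2 * (+ 1 - (s10 - s11))) * (y10 - y11 - + 1) + + 4 * (+ 1 - (s10 - s11) - (+ 1 - (s01 - s11))) * (y00 - y11 - + 1) + (+ 1 - + 2 * (+ 1 - (s01 - s11))))) ≡
  + 4 * (+ 3 - κ₉ s00 s10 s20 s01 s11 s21 s02 s12 s22 y00 y10 y20 y01 y11 y21 y02 y12 y22)
κ₉-upper s00 s10 s20 s01 s11 s21 s02 s12 s22 y00 y10 y20 y01 y11 y21 y02 y12 y22 = κ₉-≡ s00 s10 s20 s01 s11 s21 s02 s12 s22 y00 y10 y20 y01 y11 y21 y02 y12 y22 (λ κ → + 4 * (+ 3 - κ)) (upper-identity s11 s21 y21 y11 s12 y12 y22 s01 y01 y02 s10 y10 y20 y00)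

module Exponents {σ y : Field} (surface : Surface σ) (matching : ∀ i j → Matching σ y i j) where
  open Surface surface
  private
    module M i j = Matching (matching i j)
    module At (i j : ℤ) = Square {σ i j} {σ (↑ i) j} {σ i (↑ j)} {σ (↑ i) (↑ j)} {y i j} {y (↑ i) j} {y i (↑ j)} {y (↑ i) (↑ j)}
      (right i j) (right i (↑ j)) (up i j) (up (↑ i) j) (M.hor i j) (M.hor i (↑ j)) (M.ver i j) (M.ver (↑ i) j) (M.dne i j) (M.dnw i j)

  κ-bounds : ∀ i j → -[1+ 0 ] ≤ κ σ y i j × κ σ y i j ≤ + 3
  κ-bounds i j =
    NN⇒≤ (quarter _ (by (proj₁ ne ⊕ proj₁ nw ⊕ proj₁ se ⊕ proj₁ sw) (κ₉-lower _ _ _ _ _ _ _ _ _ _ _ _ _ _ _ _ _ _))) ,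
    NN⇒≤ (quarter _ (by (proj₂ ne ⊕ proj₂ nw ⊕ proj₂ se ⊕ proj₂ sw) (κ₉-upper _ _ _ _ _ _ _ _ _ _ _ _ _ _ _ _ _ _)))
    where
    ne = At.corner-ne (↑ i) (↑ j)
    nw = At.corner-nw i (↑ j)
    se = At.corner-se (↑ i) j
    sw = At.corner-sw i j

  private
    select₀ : ∀ {s e} → Bit s → (s ≡ + 0 → Bit e) → Bit ((+ 1 - s) * e)
    select₀ {e = e} bs h with bit-split bs
    ... | inj₁ refl = bit-cong (h refl) (sym (*-identityˡ e))
    ... | inj₂ refl = bit0

    select₁ : ∀ {s e} → Bit s → (s ≡ + 1 → Bit e) → Bit (s * e)
    select₁ {e = e} bs h with bit-split bs
    ... | inj₁ refl = bit0
    ... | inj₂ refl = bit-cong (h refl) (sym (*-identityˡ e))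

    shuffle : ∀ s s' y y' → (y' - s') - (y - s) ≡ y' - y + (s - s')
    shuffle = solve-∀

    drop : ∀ p q → + 1 - (p - q + + 1) ≡ q - p
    drop = solve-∀

    flip′ : ∀ p q → + 1 - (p - q) ≡ + 1 + q - p
    flip′ = solve-∀

  a-bit : ∀ t → Bit (proj₂ (a-edge σ y t))
  a-bit (i , j) = select₀ (right i j) λ eq → bit-cong (M.hor i j)
    (trans (shuffle (σ i j) (σ (↑ i) j) (y i j) (y (↑ i) j)) (trans (+-congˡ (y (↑ i) j - y i j) eq) (+-identityʳ _)))

  b-bit : ∀ t → Bit (proj₂ (b-edge σ y t))
  b-bit (i , j) = select₀ (up i j) λ _ → M.ver i j

  c-bit : ∀ t → Bit (proj₂ (c-edge σ y t))
  c-bit (i , j) = select₁ (right i j) λ eq → flip-bit (M.hor i j)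
    (trans (cong (λ e → + 1 - e) (trans (shuffle (σ i j) (σ (↑ i) j) (y i j) (y (↑ i) j)) (+-congˡ (y (↑ i) j - y i j) eq))) (drop (y (↑ i) j) (y i j)))

  d-bit : ∀ t → Bit (proj₂ (d-edge σ y t))
  d-bit (i , j) = select₁ (up i j) λ _ → flip-bit (M.ver i j) (flip′ (y i j) (y i (↑ j)))

-- A label determines its edge

module Crossing (g : ℤ → ℤ) (step : ∀ i → Bit (g (↑ i) - g i)) where

  monotone : ∀ i n → NN (g (i + + n) - g i)
  monotone i zero = by (nat {0}) (sym (trans (cong (λ t → g t - g i) (+-identityʳ i)) (+-inverseʳ (g i))))
  monotone i (suc n) = by (monotone i n ⊕ proj₁ (step (i + + n)))
    (trans (telescope (g i) (g (i + + n)) (g (↑ (i + + n)))) (cong (λ t → g t - g i) (regroup i (+ n))))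
    where
    telescope : ∀ p q r → q - p + (r - q) ≡ r - p
    telescope = solve-∀
    regroup : ∀ i n → i + n + + 1 ≡ i + (+ 1 + n)
    regroup = solve-∀

  private
    below : ∀ {i i'} → g (↑ i) ≡ g i + + 1 → i < i' → ¬ (g i ≡ g i')
    below {i} {i'} up lt eq = absurd {k = 0} (monotone (↑ i) ∣ i' - ↑ i ∣)
      (trans (cong₂ (λ p q → g p - q) reach up) (trans (cong (λ t → t - (g i + + 1)) (sym eq)) (cancel (g i))))
      where
      reach : ↑ i + + ∣ i' - ↑ i ∣ ≡ i'
      reach = trans (+-congˡ (↑ i) (0≤i⇒+∣i∣≡i (≤⇒NN (subst (_≤ i') (+-comm (+ 1) i) (i<j⇒suc[i]≤j lt))))) (l (↑ i) i')
        where
        l : ∀ p q → p + (q - p) ≡ q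
        l = solve-∀
      cancel : ∀ e → e - (e + + 1) ≡ -[1+ 0 ]
      cancel = solve-∀

  injective : ∀ {i i'} → g (↑ i) ≡ g i + + 1 → g (↑ i') ≡ g i' + + 1 → g i ≡ g i' → i ≡ i'
  injective {i} {i'} up up' eq with <-cmp i i'
  ... | tri< lt _ _ = ⊥-elim (below up lt eq)
  ... | tri≈ _ i≡i' _ = i≡i'
  ... | tri> _ _ gt = ⊥-elim (below up' gt (sym eq))

-- The monomial of a matching

at-other : ∀ {w e v} → ¬ (w ≡ v) → at (w , e) v ≡ + 0
at-other {w} {e} {v} ne with w =ᵥ v in eq
... | true = ⊥-elim (ne (=ᵥ-sound w v eq))
... | false = refl

at-same : ∀ w e → at (w , e) w ≡ e
at-same w e rewrite =ᵥ-refl w = refl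

module _ {ts : List Face} (unique : Unique ts) (f : Face → Var × ℤ) (Step : Face → Set)
  (step : ∀ t → ¬ (proj₂ (f t) ≡ + 0) → Step t)
  (injective : ∀ {t t'} → Step t → Step t' → proj₁ (f t) ≡ proj₁ (f t') → t ≡ t')
  where

  private
    at-zero : ∀ {t} u → ¬ (u ≡ t) → Step t → at (f u) (proj₁ (f t)) ≡ + 0
    at-zero {t} u ne st with proj₁ (f u) ≟ᵥ proj₁ (f t) | proj₂ (f u) ≟ + 0
    ... | no ne' | _ = at-other ne'
    ... | yes _ | yes z = trans (cong (λ e → at (proj₁ (f u) , e) (proj₁ (f t))) z) (at-0 (proj₁ (f u)) (proj₁ (f t)))
    ... | yes eq | no nz = ⊥-elim (ne (injective (step u nz) st eq))

  ∑-at : ∀ {t} → t ∈ ts → Step t → ∑ ts (λ u → at (f u) (proj₁ (f t))) ≡ proj₂ (f t)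
  ∑-at {t} t∈ st = trans (∑-single unique t∈ _ (λ u _ ne → at-zero u ne st)) (at-same (proj₁ (f t)) (proj₂ (f t)))

  ∑-at-cases : ∀ v → (∑ ts (λ u → at (f u) v) ≡ + 0) ⊎ (∃[ t ] ∑ ts (λ u → at (f u) v) ≡ proj₂ (f t))
  ∑-at-cases v with Any.any? (λ t → (proj₁ (f t) ≟ᵥ v) ×-dec (¬? (proj₂ (f t) ≟ + 0))) ts
  ... | no none = inj₁ (∑-vanish ts _ λ u u∈ → zero-at u u∈)
    where
    zero-at : ∀ u → u ∈ ts → at (f u) v ≡ + 0
    zero-at u u∈ with proj₁ (f u) ≟ᵥ v | proj₂ (f u) ≟ + 0
    ... | no ne | _ = at-other ne
    ... | yes _ | yes z = trans (cong (λ e → at (proj₁ (f u) , e) v) z) (at-0 (proj₁ (f u)) v)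
    ... | yes eq | no nz = ⊥-elim (none (lose u∈ (eq , nz)))
  ... | yes some with find some
  ...   | t , t∈ , refl , nz = inj₂ (t , ∑-at t∈ (step t nz))

face-injective : ∀ {σ y t t'} → proj₁ (face σ y t) ≡ proj₁ (face σ y t') → t ≡ t'
face-injective {t = i , j} {i' , j'} eq = cong₂ _,_ (↑-injective (first eq)) (↑-injective (second eq))
  where
  first : ∀ {i j i' j'} → x i j ≡ x i' j' → i ≡ i'
  first refl = refl
  second : ∀ {i j i' j'} → x i j ≡ x i' j' → j ≡ j'
  second refl = refl

halve : ∀ {m n p q} → p ≡ q → + 2 * m - + 2 * n ≡ p - q → m ≡ n
halve {m} {n} eq e = *-cancelˡ-≡ (+ 2) m n (≡-by eq e)

module Edges {σ : Field} (surface : Surface σ) where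
  open Surface surface

  a-step b-step c-step d-step : Face → Set
  a-step (i , j) = σ i j - σ (↑ i) j ≡ + 0
  b-step (i , j) = σ i j - σ i (↑ j) ≡ + 0
  c-step (i , j) = σ i j - σ (↑ i) j ≡ + 1
  d-step (i , j) = σ i j - σ i (↑ j) ≡ + 1

  private
    nonzero₀ : ∀ {s e} → Bit s → ¬ ((+ 1 - s) * e ≡ + 0) → s ≡ + 0
    nonzero₀ bs nz with bit-split bs
    ... | inj₁ eq = eq
    ... | inj₂ refl = ⊥-elim (nz refl)

    nonzero₁ : ∀ {s e} → Bit s → ¬ (s * e ≡ + 0) → s ≡ + 1
    nonzero₁ bs nz with bit-split bs
    ... | inj₁ refl = ⊥-elim (nz refl)
    ... | inj₂ eq = eq

    a-first : ∀ {i j i' j'} → a i j ≡ a i' j' → i ≡ i'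
    a-first refl = refl
    a-second : ∀ {i j i' j'} → a i j ≡ a i' j' → j ≡ j'
    a-second refl = refl
    b-first : ∀ {i j i' j'} → b i j ≡ b i' j' → i ≡ i'
    b-first refl = refl
    b-second : ∀ {i j i' j'} → b i j ≡ b i' j' → j ≡ j'
    b-second refl = refl
    c-first : ∀ {i j i' j'} → c i j ≡ c i' j' → i ≡ i'
    c-first refl = refl
    c-second : ∀ {i j i' j'} → c i j ≡ c i' j' → j ≡ j'
    c-second refl = refl
    d-first : ∀ {i j i' j'} → d i j ≡ d i' j' → i ≡ i'
    d-first refl = refl
    d-second : ∀ {i j i' j'} → d i j ≡ d i' j' → j ≡ j'
    d-second refl = refl

  module _ (y : Field) where

    a-nonzero : ∀ t → ¬ (proj₂ (a-edge σ y t) ≡ + 0) → a-step t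
    a-nonzero (i , j) = nonzero₀ (right i j)

    b-nonzero : ∀ t → ¬ (proj₂ (b-edge σ y t) ≡ + 0) → b-step t
    b-nonzero (i , j) = nonzero₀ (up i j)

    c-nonzero : ∀ t → ¬ (proj₂ (c-edge σ y t) ≡ + 0) → c-step t
    c-nonzero (i , j) = nonzero₁ (right i j)

    d-nonzero : ∀ t → ¬ (proj₂ (d-edge σ y t) ≡ + 0) → d-step t
    d-nonzero (i , j) = nonzero₁ (up i j)

    level⁺ : ∀ i p q → i + + 1 + p - (i + q + + 1) ≡ + 0 - (q + - p)
    level⁺ = solve-∀

    level⁻ : ∀ p q → - p - (- q + + 1) ≡ q + - p - + 1
    level⁻ = solve-∀

    twice⁺ : ∀ i s i' t j → + 2 * (i + s) - + 2 * (i' + t) ≡ i + (+ 2 * s + i + j) + + 1 - (i' + (+ 2 * t + i' + j) + + 1)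
    twice⁺ = solve-∀

    twice⁺′ : ∀ j s j' t i → + 2 * (j + s) - + 2 * (j' + t) ≡ j + (+ 2 * s + i + j) + + 1 - (j' + (+ 2 * t + i + j') + + 1)
    twice⁺′ = solve-∀

    twice⁻ : ∀ s t i j i' → + 2 * - s - + 2 * - t ≡ i + + 1 - (+ 2 * s + i + j) - (i' + + 1 - (+ 2 * t + i' + j))
    twice⁻ = solve-∀

    twice⁻′ : ∀ s t j i j' → + 2 * - s - + 2 * - t ≡ j + + 1 - (+ 2 * s + i + j) - (j' + + 1 - (+ 2 * t + i + j'))
    twice⁻′ = solve-∀

    a-injective : ∀ {t t'} → a-step t → a-step t' → proj₁ (a-edge σ y t) ≡ proj₁ (a-edge σ y t') → t ≡ t'
    a-injective {i , j} {i' , j'} st st' eq with a-first eq | a-second eq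
    ... | eq' | refl = cong (_, j) (Crossing.injective (λ i → i + σ i j) (λ i → flip-bit (right i j) (shape i (σ i j) (σ (↑ i) j)))
                                     (≡-by (sym st) (level⁺ i (σ (↑ i) j) (σ i j))) (≡-by (sym st') (level⁺ i' (σ (↑ i') j) (σ i' j))) (halve {p = i + height σ i j + + 1} {i' + height σ i' j + + 1} eq' (twice⁺ i (σ i j) i' (σ i' j) j)))
      where
      shape : ∀ i s s' → + 1 - (s - s') ≡ (i + + 1) + s' - (i + s)
      shape = solve-∀

    b-injective : ∀ {t t'} → b-step t → b-step t' → proj₁ (b-edge σ y t) ≡ proj₁ (b-edge σ y t') → t ≡ t'
    b-injective {i , j} {i' , j'} st st' eq with b-first eq | b-second eq
    ... | refl | eq' = cong (i ,_) (Crossing.injective (λ j → j + σ i j) (λ j → flip-bit (up i j) (shape j (σ i j) (σ i (↑ j))))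
                                     (≡-by (sym st) (level⁺ j (σ i (↑ j)) (σ i j))) (≡-by (sym st') (level⁺ j' (σ i (↑ j')) (σ i j'))) (halve {p = j + height σ i j + + 1} {j' + height σ i j' + + 1} eq' (twice⁺′ j (σ i j) j' (σ i j') i)))
      where
      shape : ∀ j s s' → + 1 - (s - s') ≡ (j + + 1) + s' - (j + s)
      shape = solve-∀

    c-injective : ∀ {t t'} → c-step t → c-step t' → proj₁ (c-edge σ y t) ≡ proj₁ (c-edge σ y t') → t ≡ t'
    c-injective {i , j} {i' , j'} st st' eq with c-first eq | c-second eq
    ... | eq' | refl = cong (_, j) (Crossing.injective (λ i → - σ i j) (λ i → bit-cong (right i j) (shape (σ i j) (σ (↑ i) j)))
                                     (≡-by st (level⁻ (σ (↑ i) j) (σ i j))) (≡-by st' (level⁻ (σ (↑ i') j) (σ i' j))) (halve {p = i + + 1 - height σ i j} {i' + + 1 - height σ i' j} eq' (twice⁻ (σ i j) (σ i' j) i j i')))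
      where
      shape : ∀ s s' → s - s' ≡ - s' - - s
      shape = solve-∀

    d-injective : ∀ {t t'} → d-step t → d-step t' → proj₁ (d-edge σ y t) ≡ proj₁ (d-edge σ y t') → t ≡ t'
    d-injective {i , j} {i' , j'} st st' eq with d-first eq | d-second eq
    ... | refl | eq' = cong (i ,_) (Crossing.injective (λ j → - σ i j) (λ j → bit-cong (up i j) (shape (σ i j) (σ i (↑ j))))
                                     (≡-by st (level⁻ (σ i (↑ j)) (σ i j))) (≡-by st' (level⁻ (σ i (↑ j')) (σ i j'))) (halve {p = j + + 1 - height σ i j} {j' + + 1 - height σ i j'} eq' (twice⁻′ (σ i j) (σ i j') j i j')))
      where
      shape : ∀ s s' → s - s' ≡ - s' - - s
      shape = solve-∀

module _ (σ y : Field) (ts : List Face) where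
  private
    drop : ∀ f g h k l {f' g' h' k' l'} → f ≡ f' → g ≡ g' → h ≡ h' → k ≡ k' → l ≡ l' → f + (g + (h + (k + l))) ≡ f' + (g' + (h' + (k' + l')))
    drop f g h k l refl refl refl refl refl = refl

  expo-x : ∀ i j → expo (weight σ y ts) (x i j) ≡ ∑ ts (λ t → at (face σ y t) (x i j))
  expo-x i j = trans (expo-weight σ y ts (x i j)) (trans (+-congˡ S (cong₂ _+_ (∑-vanish ts _ λ { (i , j) _ → refl })
    (cong₂ _+_ (∑-vanish ts _ λ { (i , j) _ → refl }) (cong₂ _+_ (∑-vanish ts _ λ { (i , j) _ → refl }) (∑-vanish ts _ λ { (i , j) _ → refl }))))) (+-identityʳ S))
    where S = ∑ ts (λ t → at (face σ y t) (x i j))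

  expo-a : ∀ i j → expo (weight σ y ts) (a i j) ≡ ∑ ts (λ t → at (a-edge σ y t) (a i j))
  expo-a i j = trans (expo-weight σ y ts (a i j)) (trans (cong₂ _+_ (∑-vanish ts _ λ { (i , j) _ → refl }) (+-congˡ S
    (cong₂ _+_ (∑-vanish ts _ λ { (i , j) _ → refl }) (cong₂ _+_ (∑-vanish ts _ λ { (i , j) _ → refl }) (∑-vanish ts _ λ { (i , j) _ → refl }))))) (l S))
    where
    S = ∑ ts (λ t → at (a-edge σ y t) (a i j))
    l : ∀ S → + 0 + (S + + 0) ≡ S
    l = solve-∀

  expo-b : ∀ i j → expo (weight σ y ts) (b i j) ≡ ∑ ts (λ t → at (b-edge σ y t) (b i j))
  expo-b i j = trans (expo-weight σ y ts (b i j)) (trans (cong₂ _+_ (∑-vanish ts _ λ { (i , j) _ → refl }) (cong₂ _+_ (∑-vanish ts _ λ { (i , j) _ → refl })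
    (+-congˡ S (cong₂ _+_ (∑-vanish ts _ λ { (i , j) _ → refl }) (∑-vanish ts _ λ { (i , j) _ → refl }))))) (l S))
    where
    S = ∑ ts (λ t → at (b-edge σ y t) (b i j))
    l : ∀ S → + 0 + (+ 0 + (S + + 0)) ≡ S
    l = solve-∀

  expo-c : ∀ i j → expo (weight σ y ts) (c i j) ≡ ∑ ts (λ t → at (c-edge σ y t) (c i j))
  expo-c i j = trans (expo-weight σ y ts (c i j)) (trans (cong₂ _+_ (∑-vanish ts _ λ { (i , j) _ → refl }) (cong₂ _+_ (∑-vanish ts _ λ { (i , j) _ → refl })
    (cong₂ _+_ (∑-vanish ts _ λ { (i , j) _ → refl }) (+-congˡ S (∑-vanish ts _ λ { (i , j) _ → refl }))))) (l S))
    where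
    S = ∑ ts (λ t → at (c-edge σ y t) (c i j))
    l : ∀ S → + 0 + (+ 0 + (+ 0 + (S + + 0))) ≡ S
    l = solve-∀

  expo-d : ∀ i j → expo (weight σ y ts) (d i j) ≡ ∑ ts (λ t → at (d-edge σ y t) (d i j))
  expo-d i j = trans (expo-weight σ y ts (d i j)) (trans (cong₂ _+_ (∑-vanish ts _ λ { (i , j) _ → refl }) (cong₂ _+_ (∑-vanish ts _ λ { (i , j) _ → refl })
    (cong₂ _+_ (∑-vanish ts _ λ { (i , j) _ → refl }) (cong₂ _+_ (∑-vanish ts _ λ { (i , j) _ → refl }) refl)))) (l S))
    where
    S = ∑ ts (λ t → at (d-edge σ y t) (d i j))
    l : ∀ S → + 0 + (+ 0 + (+ 0 + (+ 0 + S))) ≡ S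
    l = solve-∀

module _ {σ : Field} (surface : Surface σ) {ts : List Face} (unique : Unique ts) where
  open Edges surface
  open Surface surface

  expo-face : ∀ y {i j} → (i , j) ∈ ts → expo (weight σ y ts) (x (↑ i) (↑ j)) ≡ κ σ y i j
  expo-face y {i} {j} t∈ = trans (expo-x σ y ts (↑ i) (↑ j))
    (∑-at unique (face σ y) (λ t → t ≡ t) (λ t _ → refl) (λ {t} {t'} _ _ → face-injective {σ} {y} {t} {t'}) t∈ refl)

  weight-ok : ∀ y → (∀ i j → Matching σ y i j) → MonoOK (weight σ y ts)
  weight-ok y matching = ok
    where
    open Exponents surface matching
    bit-ok : ∀ {e e'} → Bit e' → e ≡ e' → e ≡ + 0 ⊎ e ≡ + 1
    bit-ok be refl = bit-split be
    ok : MonoOK (weight σ y ts)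
    ok (x i j) with ∑-at-cases unique (face σ y) (λ t → t ≡ t) (λ t _ → refl) (λ {t} {t'} _ _ → face-injective {σ} {y} {t} {t'}) (x i j)
    ... | inj₁ eq rewrite trans (expo-x σ y ts i j) eq = -≤+ , +≤+ ℕ.z≤n
    ... | inj₂ ((k , l) , eq) rewrite trans (expo-x σ y ts i j) eq = κ-bounds k l
    ok (a i j) with ∑-at-cases unique (a-edge σ y) a-step (a-nonzero y) (a-injective y) (a i j)
    ... | inj₁ eq = inj₁ (trans (expo-a σ y ts i j) eq)
    ... | inj₂ (t , eq) = bit-ok (a-bit t) (trans (expo-a σ y ts i j) eq)
    ok (b i j) with ∑-at-cases unique (b-edge σ y) b-step (b-nonzero y) (b-injective y) (b i j)
    ... | inj₁ eq = inj₁ (trans (expo-b σ y ts i j) eq)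
    ... | inj₂ (t , eq) = bit-ok (b-bit t) (trans (expo-b σ y ts i j) eq)
    ok (c i j) with ∑-at-cases unique (c-edge σ y) c-step (c-nonzero y) (c-injective y) (c i j)
    ... | inj₁ eq = inj₁ (trans (expo-c σ y ts i j) eq)
    ... | inj₂ (t , eq) = bit-ok (c-bit t) (trans (expo-c σ y ts i j) eq)
    ok (d i j) with ∑-at-cases unique (d-edge σ y) d-step (d-nonzero y) (d-injective y) (d i j)
    ... | inj₁ eq = inj₁ (trans (expo-d σ y ts i j) eq)
    ... | inj₂ (t , eq) = bit-ok (d-bit t) (trans (expo-d σ y ts i j) eq)

  vertical : ∀ y y' → weight σ y ts ≃ weight σ y' ts → ∀ {i j} → (i , j) ∈ ts → y i j - y i (↑ j) ≡ y' i j - y' i (↑ j)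
  vertical y y' same {i} {j} t∈ with bit-split (up i j)
  ... | inj₁ st = recover₀ st (trans (sym (exponent y)) (trans (exponents same _) (exponent y')))
    where
    exponent : ∀ y → expo (weight σ y ts) (proj₁ (b-edge σ y (i , j))) ≡ proj₂ (b-edge σ y (i , j))
    exponent y = trans (expo-b σ y ts _ _) (∑-at unique (b-edge σ y) b-step (b-nonzero y) (b-injective y) t∈ st)
    recover₀ : ∀ {s m n} → s ≡ + 0 → (+ 1 - s) * m ≡ (+ 1 - s) * n → m ≡ n
    recover₀ {m = m} {n} refl eq = trans (sym (*-identityˡ m)) (trans eq (*-identityˡ n))
  ... | inj₂ st = ≡-by (sym (recover₁ st (trans (sym (exponent y)) (trans (exponents same _) (exponent y'))))) (recombine (y i j) (y i (↑ j)) (y' i j) (y' i (↑ j)))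
    where
    exponent : ∀ y → expo (weight σ y ts) (proj₁ (d-edge σ y (i , j))) ≡ proj₂ (d-edge σ y (i , j))
    exponent y = trans (expo-d σ y ts _ _) (∑-at unique (d-edge σ y) d-step (d-nonzero y) (d-injective y) t∈ st)
    recombine : ∀ p q r s → p + - q - (r + - s) ≡ + 1 + s + - r - (+ 1 + q + - p)
    recombine = solve-∀
    recover₁ : ∀ {s m n} → s ≡ + 1 → s * m ≡ s * n → m ≡ n
    recover₁ {m = m} {n} refl eq = trans (sym (*-identityˡ m)) (trans eq (*-identityˡ n))

  -- Descends from the top row, using the vertical differences.
  weight-injective : ∀ {y y'} (Q : Face → Set) → (∀ t → Dec (Q t)) → (∀ {t} → Q t → t ∈ ts) →
    (top : ℤ) → (∀ i j → Q (i , j) → j ≤ top) → (∀ i j → ¬ Q (i , j) → y i j ≡ y' i j) →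
    weight σ y ts ≃ weight σ y' ts → ∀ i j → y i j ≡ y' i j
  weight-injective {y} {y'} Q Q? Q⊆ top bound outside same i j with Q? (i , j)
  ... | no out = outside i j out
  ... | yes inside = descend ∣ top - j ∣ j (sym (trans (+-congˡ j (0≤i⇒+∣i∣≡i (≤⇒NN (bound i j inside)))) (l j top)))
    where
    l : ∀ j top → j + (top - j) ≡ top
    l = solve-∀
    rearrange : ∀ p q r s → p - q ≡ p - r + r - (q - s + s)
    rearrange = solve-∀
    above : ∀ j → top < j → y i j ≡ y' i j
    above j lt = outside i j λ q → <-irrefl refl (<-≤-trans lt (bound i j q))
    climb : ∀ j → y i (↑ j) ≡ y' i (↑ j) → y i j ≡ y' i j
    climb j eq with Q? (i , j)
    ... | no out = outside i j out
    ... | yes inside = ≡-by (cong₂ _+_ (vertical y y' same (Q⊆ inside)) eq) (rearrange (y i j) (y' i j) (y i (↑ j)) (y' i (↑ j)))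
    descend : ∀ n j → top ≡ j + + n → y i j ≡ y' i j
    descend zero j eq = climb j (above (↑ j) (subst (_< ↑ j) (sym (trans eq (+-identityʳ j))) (subst (j <_) (+-comm (+ 1) j) (suc[i]≤j⇒i<j ≤-refl))))
    descend (suc n) j eq = climb j (descend n (↑ j) (trans eq (regroup j (+ n))))
      where
      regroup : ∀ j n → j + (+ 1 + n) ≡ (j + + 1) + n
      regroup = solve-∀

-- Matchings of the graph below a target face

matching-cong : ∀ {σ y σ' y' i j} → σ i j ≡ σ' i j → σ (↑ i) j ≡ σ' (↑ i) j → σ i (↑ j) ≡ σ' i (↑ j) → σ (↑ i) (↑ j) ≡ σ' (↑ i) (↑ j) →
  y i j ≡ y' i j → y (↑ i) j ≡ y' (↑ i) j → y i (↑ j) ≡ y' i (↑ j) → y (↑ i) (↑ j) ≡ y' (↑ i) (↑ j) →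
  Matching σ y i j → Matching σ' y' i j
matching-cong e₀₀ e₁₀ e₀₁ e₁₁ f₀₀ f₁₀ f₀₁ f₁₁ m = record
  { hor = bit-cong hor (cong₂ _-_ (cong₂ _-_ f₁₀ e₁₀) (cong₂ _-_ f₀₀ e₀₀))
  ; ver = bit-cong ver (cong₂ _-_ f₀₀ f₀₁)
  ; dne = λ eq → bit-cong (dne (trans e₁₁ (trans eq (cong (λ t → t - + 1) (sym e₀₀))))) (cong₂ _-_ f₀₀ f₁₁)
  ; dnw = λ eq → bit-cong (dnw (trans e₀₁ (trans eq (sym e₁₀)))) (cong₂ _-_ f₁₀ f₀₁)
  }
  where open Matching m

Bit? : ∀ e → Dec (Bit e)
Bit? e = (+ 0 ≤? e) ×-dec (+ 0 ≤? + 1 - e)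

matching? : ∀ σ y i j → Dec (Matching σ y i j)
matching? σ y i j = map′ (λ (h , v , p , q) → record { hor = h ; ver = v ; dne = p ; dnw = q })
  (λ m → Matching.hor m , Matching.ver m , Matching.dne m , Matching.dnw m)
  (Bit? _ ×-dec Bit? _ ×-dec ((_ ≟ _) →-dec Bit? _) ×-dec ((_ ≟ _) →-dec Bit? _))

pos-shift : ∀ i i₀ → pos (↑ i - i₀) ≡ pos (i - i₀ + + 1)
pos-shift i i₀ = cong pos (identity₁₈ i i₀)

-- The target is the point (ν , i₀ , j₀) in the coordinates σ; the cone
-- below it consists of the points on which its value can depend.
module Target (ν i₀ j₀ : ℤ) where

  Z Y : ℤ → ℤ
  Z i = pos (i - i₀) - ν
  Y j = - pos (j - j₀)

  cone y₀ : Field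
  cone i j = Y j - Z i
  y₀ i j = Y j

  private
    shift : ∀ p q r → p - q ≡ p - r - (q - r)
    shift = solve-∀

    negation : ∀ p q → p - q ≡ - q - - p
    negation = solve-∀

    reflection : ∀ p q r → p - q ≡ r - q - (r - p)
    reflection = solve-∀

    double-reflection : ∀ p q r → p - q ≡ r - (r - p) - (r - (r - q))
    double-reflection = solve-∀

  Z-step : ∀ i → Bit (Z (↑ i) - Z i)
  Z-step i = bit-cong (pos-step (i - i₀)) (trans (cong (λ t → t - pos (i - i₀)) (sym (pos-shift i i₀))) (shift (pos (↑ i - i₀)) (pos (i - i₀)) ν))

  Y-step : ∀ j → Bit (Y j - Y (↑ j))
  Y-step j = bit-cong (pos-step (j - j₀)) (trans (cong (λ t → t - pos (j - j₀)) (sym (pos-shift j j₀))) (negation (pos (↑ j - j₀)) (pos (j - j₀))))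

  cone-surface : Surface cone
  cone-surface = record
    { right = λ i j → bit-cong (Z-step i) (reflection (Z (↑ i)) (Z i) (Y j))
    ; up = λ i j → bit-cong (Y-step j) (shift (Y j) (Y (↑ j)) (Z i))
    }

  record Valid (σ y : Field) : Set where
    field
      matching : ∀ i j → Matching σ y i j
      lower : ∀ i j → NN (y i j - σ i j - Z i)
      upper : ∀ i j → NN (Y j - y i j)

  cone-valid : Valid cone y₀
  cone-valid = record
    { matching = λ i j → record
      { hor = bit-cong (Z-step i) (double-reflection (Z (↑ i)) (Z i) (Y j))
      ; ver = Y-step j
      ; dne = λ _ → Y-step j
      ; dnw = λ _ → Y-step j
      }
    ; lower = λ i j → by (nat {0}) (vanishes (Y j) (Z i))
    ; upper = λ i j → by (nat {0}) (sym (+-inverseʳ (Y j)))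
    }
    where
    vanishes : ∀ p q → + 0 ≡ p - (p - q) - q
    vanishes = solve-∀

  on-cone : ∀ {σ y} → Valid σ y → ∀ i j → σ i j ≡ cone i j → y i j ≡ Y j
  on-cone {σ} {y} valid i j eq = i-j≡0⇒i≡j _ _ (NN-antisym
    (by (lower i j) (trans (cong (λ s → y i j - s - Z i) eq) (l (y i j) (Y j) (Z i))))
    (by (upper i j) (l' (y i j) (Y j))))
    where
    open Valid valid
    l : ∀ y p q → y - (p - q) - q ≡ y - p
    l = solve-∀
    l' : ∀ y p → p - y ≡ - (y - p)
    l' = solve-∀

  module Revalue {k₀ ℓ₀ : ℤ} {σ₁ y₁ σ y : Field} (valid : Valid σ₁ y₁)
    (σ-off : ∀ i j → ¬ ((i , j) ≡ (↑ (↑ k₀) , ↑ (↑ ℓ₀))) → σ₁ i j ≡ σ i j)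
    (y-off : ∀ i j → ¬ ((i , j) ≡ (↑ (↑ k₀) , ↑ (↑ ℓ₀))) → y₁ i j ≡ y i j) where

    k₁ k₂ k₃ l₁ l₂ l₃ s E W N S NE NW SE SW v : ℤ
    k₁ = ↑ k₀
    k₂ = ↑ k₁
    k₃ = ↑ k₂
    l₁ = ↑ ℓ₀
    l₂ = ↑ l₁
    l₃ = ↑ l₂
    s = σ k₂ l₂
    v = y k₂ l₂
    E = y k₃ l₂
    W = y k₁ l₂
    N = y k₂ l₃
    S = y k₂ l₁
    NE = y k₃ l₃
    NW = y k₁ l₃
    SE = y k₃ l₁
    SW = y k₁ l₁

    private
      module V = Valid valid
      module M i j = Matching (V.matching i j)

      q : Face
      q = k₂ , l₂

      column≢ : ∀ {i j} → ¬ (i ≡ k₂) → ¬ ((i , j) ≡ q)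
      column≢ ne eq = ne (cong proj₁ eq)

      row≢ : ∀ {i j} → ¬ (j ≡ l₂) → ¬ ((i , j) ≡ q)
      row≢ ne eq = ne (cong proj₂ eq)

      k₁≢ : ¬ (k₁ ≡ k₂)
      k₁≢ eq = ↑≢ (sym eq)
      k₃≢ : ¬ (k₃ ≡ k₂)
      k₃≢ = ↑≢
      l₁≢ : ¬ (l₁ ≡ l₂)
      l₁≢ eq = ↑≢ (sym eq)
      l₃≢ : ¬ (l₃ ≡ l₂)
      l₃≢ = ↑≢

      hor-off : ∀ i j → ¬ ((i , j) ≡ q) → ¬ ((↑ i , j) ≡ q) → Bit ((y (↑ i) j - σ (↑ i) j) - (y i j - σ i j))
      hor-off i j ne ne' = bit-cong (M.hor i j) (cong₂ _-_ (cong₂ _-_ (y-off _ _ ne') (σ-off _ _ ne')) (cong₂ _-_ (y-off _ _ ne) (σ-off _ _ ne)))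

      ver-off : ∀ i j → ¬ ((i , j) ≡ q) → ¬ ((i , ↑ j) ≡ q) → Bit (y i j - y i (↑ j))
      ver-off i j ne ne' = bit-cong (M.ver i j) (cong₂ _-_ (y-off _ _ ne) (y-off _ _ ne'))

      dne-off : ∀ i j → ¬ ((i , j) ≡ q) → ¬ ((↑ i , ↑ j) ≡ q) → σ (↑ i) (↑ j) ≡ σ i j - + 1 → Bit (y i j - y (↑ i) (↑ j))
      dne-off i j ne ne' eq = bit-cong (M.dne i j (trans (σ-off _ _ ne') (trans eq (cong (λ t → t - + 1) (sym (σ-off _ _ ne)))))) (cong₂ _-_ (y-off _ _ ne) (y-off _ _ ne'))

      dnw-off : ∀ i j → ¬ ((↑ i , j) ≡ q) → ¬ ((i , ↑ j) ≡ q) → σ i (↑ j) ≡ σ (↑ i) j → Bit (y (↑ i) j - y i (↑ j))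
      dnw-off i j ne ne' eq = bit-cong (M.dnw i j (trans (σ-off _ _ ne') (trans eq (sym (σ-off _ _ ne))))) (cong₂ _-_ (y-off _ _ ne) (y-off _ _ ne'))

      lower-off : ∀ i j → ¬ ((i , j) ≡ q) → NN (y i j - σ i j - Z i)
      lower-off i j ne = by (V.lower i j) (cong₂ (λ p r → p - r - Z i) (y-off _ _ ne) (σ-off _ _ ne))

      upper-off : ∀ i j → ¬ ((i , j) ≡ q) → NN (Y j - y i j)
      upper-off i j ne = by (V.upper i j) (cong (λ p → Y j - p) (y-off _ _ ne))

    module Reassemble
      (h₁ : Bit ((v - s) - (W - σ k₁ l₂))) (h₂ : Bit ((E - σ k₃ l₂) - (v - s)))
      (v₁ : Bit (S - v)) (v₂ : Bit (v - N))
      (ne : σ k₃ l₃ ≡ s - + 1 → Bit (v - NE)) (sw : s ≡ σ k₁ l₁ - + 1 → Bit (SW - v))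
      (nw : σ k₁ l₃ ≡ s → Bit (v - NW)) (se : s ≡ σ k₃ l₁ → Bit (SE - v))
      (lo : NN (v - s - Z k₂)) (hi : NN (Y l₂ - v)) where

      revalued : Valid σ y
      revalued = record
        { matching = λ i j → record { hor = hor i j ; ver = ver i j ; dne = dne i j ; dnw = dnw i j }
        ; lower = lower ; upper = upper }
        where
        hor : ∀ i j → Bit ((y (↑ i) j - σ (↑ i) j) - (y i j - σ i j))
        hor i j with (i , j) ≟ᶠ q | (↑ i , j) ≟ᶠ q
        ... | yes refl | _ = h₂
        ... | no ne | no ne' = hor-off i j ne ne'
        ... | no _ | yes eq with ↑-injective {i} {k₁} (cong proj₁ eq) | cong proj₂ eq
        ...   | refl | refl = h₁
        ver : ∀ i j → Bit (y i j - y i (↑ j))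
        ver i j with (i , j) ≟ᶠ q | (i , ↑ j) ≟ᶠ q
        ... | yes refl | _ = v₂
        ... | no ne | no ne' = ver-off i j ne ne'
        ... | no _ | yes eq with cong proj₁ eq | ↑-injective {j} {l₁} (cong proj₂ eq)
        ...   | refl | refl = v₁
        dne : ∀ i j → σ (↑ i) (↑ j) ≡ σ i j - + 1 → Bit (y i j - y (↑ i) (↑ j))
        dne i j with (i , j) ≟ᶠ q | (↑ i , ↑ j) ≟ᶠ q
        ... | yes refl | _ = ne
        ... | no ne | no ne' = dne-off i j ne ne'
        ... | no _ | yes eq with ↑-injective {i} {k₁} (cong proj₁ eq) | ↑-injective {j} {l₁} (cong proj₂ eq)
        ...   | refl | refl = sw
        dnw : ∀ i j → σ i (↑ j) ≡ σ (↑ i) j → Bit (y (↑ i) j - y i (↑ j))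
        dnw i j with (↑ i , j) ≟ᶠ q | (i , ↑ j) ≟ᶠ q
        ... | no ne | no ne' = dnw-off i j ne ne'
        ... | no _ | yes eq with cong proj₁ eq | ↑-injective {j} {l₁} (cong proj₂ eq)
        ...   | refl | refl = se
        dnw i j | yes eq | _ with ↑-injective {i} {k₁} (cong proj₁ eq) | cong proj₂ eq
        ...   | refl | refl = nw
        lower : ∀ i j → NN (y i j - σ i j - Z i)
        lower i j with (i , j) ≟ᶠ q
        ... | yes refl = lo
        ... | no ne = lower-off i j ne
        upper : ∀ i j → NN (Y j - y i j)
        upper i j with (i , j) ≟ᶠ q
        ... | yes refl = hi
        ... | no ne = upper-off i j ne

    module Neighbours (m : ℤ) (σE : σ k₃ l₂ ≡ m) (σN : σ k₂ l₃ ≡ m) (σW : σ k₁ l₂ ≡ m + + 1) (σS : σ k₂ l₁ ≡ m + + 1) where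

      S-E : Bit (S - E)
      S-E = dne-off k₂ l₁ (row≢ l₁≢) (column≢ k₃≢) (trans σE (trans (l m) (cong (λ t → t - + 1) (sym σS))))
        where
        l : ∀ m → m ≡ m + + 1 - + 1
        l = solve-∀
      S-W : Bit (S - W)
      S-W = dnw-off k₁ l₁ (row≢ l₁≢) (column≢ k₁≢) (trans σW (sym σS))
      E-N : Bit (E - N)
      E-N = dnw-off k₂ l₂ (column≢ k₃≢) (row≢ l₃≢) (trans σN (sym σE))
      W-N : Bit (W - N)
      W-N = dne-off k₁ l₂ (column≢ k₁≢) (row≢ l₃≢) (trans σN (trans (l m) (cong (λ t → t - + 1) (sym σW))))
        where
        l : ∀ m → m ≡ m + + 1 - + 1
        l = solve-∀

      private
        E-NE : Bit (E - NE)
        E-NE = ver-off k₃ l₂ (column≢ k₃≢) (column≢ k₃≢)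
        W-NW : Bit (W - NW)
        W-NW = ver-off k₁ l₂ (column≢ k₁≢) (column≢ k₁≢)
        SW-W : Bit (SW - W)
        SW-W = ver-off k₁ l₁ (column≢ k₁≢) (column≢ k₁≢)
        SE-E : Bit (SE - E)
        SE-E = ver-off k₃ l₁ (column≢ k₃≢) (column≢ k₃≢)
        N-NE : Bit ((NE - σ k₃ l₃) - (N - σ k₂ l₃))
        N-NE = hor-off k₂ l₃ (row≢ l₃≢) (row≢ l₃≢)
        NW-N : Bit ((N - σ k₂ l₃) - (NW - σ k₁ l₃))
        NW-N = hor-off k₁ l₃ (row≢ l₃≢) (row≢ l₃≢)
        SW-S : Bit ((S - σ k₂ l₁) - (SW - σ k₁ l₁))
        SW-S = hor-off k₁ l₁ (row≢ l₁≢) (row≢ l₁≢)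
        S-SE : Bit ((SE - σ k₃ l₁) - (S - σ k₂ l₁))
        S-SE = hor-off k₂ l₁ (row≢ l₁≢) (row≢ l₁≢)

        resolve : ∀ p r {q p' q' r'} → Bit ((p - q) - (r - r')) → q ≡ p' → r' ≡ q' → Bit ((p - p') - (r - q'))
        resolve p r bs refl refl = bs

        hi : NN (S - v) → NN (+ 1 - (v - N)) → NN (Y l₂ - v)
        hi p q with sign-split (l₂ - j₀)
        ... | inj₁ nonneg = by (q ⊕ upper-off k₂ l₃ (row≢ l₃≢))
                (trans (cong (λ t → + 1 - (v - N) + (- t - N)) (trans (pos-shift l₂ j₀) (pos-step-nonneg nonneg))) (l v N (pos (l₂ - j₀))))
          where
          l : ∀ v N e → + 1 - (v - N) + (- (e + + 1) - N) ≡ - e - v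
          l = solve-∀
        ... | inj₂ neg = by (p ⊕ upper-off k₂ l₁ (row≢ l₁≢))
                (trans (cong (λ t → S - v + (- t - S)) (trans (pos-of-nonpos (l₁ - j₀) (by (neg ⊕ nat {2}) (l₀ l₁ j₀))) (sym (pos-of-nonpos (l₂ - j₀) (by (neg ⊕ nat {1}) (l₀' l₂ j₀))))))
                       (l v S (pos (l₂ - j₀))))
          where
          l : ∀ v S e → S - v + (- e - S) ≡ - e - v
          l = solve-∀
          l₀ : ∀ l j → - + 1 - ((l + + 1) - j) + + 2 ≡ - (l - j)
          l₀ = solve-∀
          l₀' : ∀ l j → - + 1 - (l - j) + + 1 ≡ - (l - j)
          l₀' = solve-∀

        Z-east : NN (k₂ - i₀) → Z k₃ ≡ Z k₂ + + 1
        Z-east nonneg = trans (cong (λ t → t - ν) (trans (pos-shift k₂ i₀) (pos-step-nonneg nonneg))) (l (pos (k₂ - i₀)) ν)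
          where
          l : ∀ e ν → e + + 1 - ν ≡ e - ν + + 1
          l = solve-∀

        Z-west : NN (- + 1 - (k₂ - i₀)) → Z k₁ ≡ Z k₂
        Z-west neg = cong (λ t → t - ν) (trans (pos-of-nonpos (k₁ - i₀) (by (neg ⊕ nat {2}) (l₀ k₁ i₀))) (sym (pos-of-nonpos (k₂ - i₀) (by (neg ⊕ nat {1}) (l₀' k₂ i₀)))))
          where
          l₀ : ∀ l j → - + 1 - ((l + + 1) - j) + + 2 ≡ - (l - j)
          l₀ = solve-∀
          l₀' : ∀ l j → - + 1 - (l - j) + + 1 ≡ - (l - j)
          l₀' = solve-∀

      private
        telescope : ∀ p q r → p - q + (q - r) ≡ p - r
        telescope = solve-∀

        gap₁ : ∀ p q r → + 1 - (p - q) + (r - q) ≡ + 1 - (p - r)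
        gap₁ = solve-∀

        gap₂ : ∀ p q r → + 1 - (p - q) + (p - r) ≡ + 1 - (r - q)
        gap₂ = solve-∀

      high : s ≡ m + + 1 → Bit (v - E) → Bit (v - W) → Bit (v - N) → Bit (S - v) → Valid σ y
      high eq (vE , Ev) (vW , Wv) (vN , Nv) (Sv , vS) = Reassemble.revalued
        (bit-cong (vW , Wv) (trans (g₁ v W (m + + 1)) (sym (cong₂ (λ p r → (v - p) - (W - r)) eq σW))))
        (flip-bit (vE , Ev) (trans (g₂ v E m) (sym (cong₂ (λ p r → (E - p) - (v - r)) σE eq))))
        (Sv , vS) (vN , Nv)
        (λ e → let σNE = trans e (trans (cong (λ t → t - + 1) eq) (g₃ m)); (p , _) = resolve NE N N-NE σNE σN in
               by (vE ⊕ proj₁ E-NE) (telescope v E NE) , by (Nv ⊕ p) (l₄ v N NE m))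
        (λ e → let σSW = trans (l₅ (σ k₁ l₁)) (cong (_+ + 1) (trans (sym e) eq)); (_ , p) = resolve S SW SW-S σS σSW in
               by (p ⊕ Sv) (l₆ v S SW m) , by (proj₂ SW-W ⊕ vW) (gap₁ SW W v))
        (λ e → let (_ , p) = resolve N NW NW-N σN (trans e eq) in
               by (vW ⊕ proj₁ W-NW) (telescope v W NW) , by (Nv ⊕ p) (l₇ v N NW m))
        (λ e → let (p , _) = resolve SE S S-SE (trans (sym e) eq) σS in
               by (p ⊕ Sv) (l₈ v S SE m) , by (proj₂ SE-E ⊕ vE) (gap₁ SE E v))
        lo (hi Sv Nv)
        where
        g₁ : ∀ v W m → v - W ≡ (v - m) - (W - m)
        g₁ = solve-∀
        g₂ : ∀ v E m → + 1 - (v - E) ≡ (E - m) - (v - (m + + 1))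
        g₂ = solve-∀
        g₃ : ∀ m → m + + 1 - + 1 ≡ m
        g₃ = solve-∀
        l₄ : ∀ v N NE m → + 1 - (v - N) + ((NE - m) - (N - m)) ≡ + 1 - (v - NE)
        l₄ = solve-∀
        l₅ : ∀ t → t ≡ t - + 1 + + 1
        l₅ = solve-∀
        l₆ : ∀ v S SW m → + 1 - ((S - (m + + 1)) - (SW - (m + + 1 + + 1))) + (S - v) ≡ SW - v
        l₆ = solve-∀
        l₇ : ∀ v N NW m → + 1 - (v - N) + (+ 1 - ((N - m) - (NW - (m + + 1)))) ≡ + 1 - (v - NW)
        l₇ = solve-∀
        l₈ : ∀ v S SE m → (SE - (m + + 1)) - (S - (m + + 1)) + (S - v) ≡ SE - v
        l₈ = solve-∀
        lo : NN (v - s - Z k₂)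
        lo with sign-split (k₂ - i₀)
        ... | inj₁ nonneg = by (vE ⊕ lower-off k₃ l₂ (column≢ k₃≢))
                (trans (cong₂ (λ p r → v - E + (E - p - r)) σE (Z-east nonneg)) (trans (l v E m (Z k₂)) (cong (λ t → v - t - Z k₂) (sym eq))))
          where
          l : ∀ v E m z → v - E + (E - m - (z + + 1)) ≡ v - (m + + 1) - z
          l = solve-∀
        ... | inj₂ neg = by (vW ⊕ lower-off k₁ l₂ (column≢ k₁≢))
                (trans (cong₂ (λ p r → v - W + (W - p - r)) σW (Z-west neg)) (trans (l v W (m + + 1) (Z k₂)) (cong (λ t → v - t - Z k₂) (sym eq))))
          where
          l : ∀ v W m z → v - W + (W - m - z) ≡ v - m - z
          l = solve-∀

      low : s ≡ m → Bit (E - v) → Bit (W - v) → Bit (v - N) → Bit (S - v) → Valid σ y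
      low eq (Ev , vE) (Wv , vW) (vN , Nv) (Sv , vS) = Reassemble.revalued
        (flip-bit (Wv , vW) (trans (g₁ v W m) (sym (cong₂ (λ p r → (v - p) - (W - r)) eq σW))))
        (bit-cong (Ev , vE) (trans (g₂ v E m) (sym (cong₂ (λ p r → (E - p) - (v - r)) σE eq))))
        (Sv , vS) (vN , Nv)
        (λ e → let (_ , p) = resolve NE N N-NE (trans e (cong (λ t → t - + 1) eq)) σN in
               by (vN ⊕ p) (l₄ v N NE m) , by (proj₂ E-NE ⊕ Ev) (gap₂ E NE v))
        (λ e → let σSW = trans (l₅ (σ k₁ l₁)) (cong (_+ + 1) (trans (sym e) eq)); (p , _) = resolve S SW SW-S σS σSW in
               by (proj₁ SW-W ⊕ Wv) (telescope SW W v) , by (vS ⊕ p) (l₆ v S SW m))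
        (λ e → let (p , _) = resolve N NW NW-N σN (trans e eq) in
               by (vN ⊕ p) (l₇ v N NW m) , by (proj₂ W-NW ⊕ Wv) (gap₂ W NW v))
        (λ e → let (_ , p) = resolve SE S S-SE (trans (sym e) eq) σS in
               by (proj₁ SE-E ⊕ Ev) (telescope SE E v) , by (vS ⊕ p) (l₈ v S SE m))
        lo (hi Sv Nv)
        where
        g₁ : ∀ v W m → + 1 - (W - v) ≡ (v - m) - (W - (m + + 1))
        g₁ = solve-∀
        g₂ : ∀ v E m → E - v ≡ (E - m) - (v - m)
        g₂ = solve-∀
        l₄ : ∀ v N NE m → v - N + (+ 1 - ((NE - (m - + 1)) - (N - m))) ≡ v - NE
        l₄ = solve-∀
        l₅ : ∀ t → t ≡ t - + 1 + + 1
        l₅ = solve-∀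
        l₆ : ∀ v S SW m → + 1 - (S - v) + ((S - (m + + 1)) - (SW - (m + + 1))) ≡ + 1 - (SW - v)
        l₆ = solve-∀
        l₇ : ∀ v N NW m → v - N + ((N - m) - (NW - m)) ≡ v - NW
        l₇ = solve-∀
        l₈ : ∀ v S SE m → + 1 - (S - v) + (+ 1 - ((SE - m) - (S - (m + + 1)))) ≡ + 1 - (SE - v)
        l₈ = solve-∀
        lo : NN (v - s - Z k₂)
        lo with sign-split (k₂ - i₀)
        ... | inj₁ nonneg = by (vE ⊕ lower-off k₃ l₂ (column≢ k₃≢))
                (trans (cong₂ (λ p r → + 1 - (E - v) + (E - p - r)) σE (Z-east nonneg)) (trans (l v E m (Z k₂)) (cong (λ t → v - t - Z k₂) (sym eq))))
          where
          l : ∀ v E m z → + 1 - (E - v) + (E - m - (z + + 1)) ≡ v - m - z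
          l = solve-∀
        ... | inj₂ neg = by (vW ⊕ lower-off k₁ l₂ (column≢ k₁≢))
                (trans (cong₂ (λ p r → + 1 - (W - v) + (W - p - r)) σW (Z-west neg)) (trans (l v W m (Z k₂)) (cong (λ t → v - t - Z k₂) (sym eq))))
          where
          l : ∀ v W m z → + 1 - (W - v) + (W - (m + + 1) - z) ≡ v - m - z
          l = solve-∀

-- Finitely many candidates for matchings, and the sum of their weights

data Near (k : ℤ) : ℤ → Set where
  near₀ : Near k k
  near₁ : Near k (↑ k)
  near₂ : Near k (↑ (↑ k))

-- Outside Q matchings are fixed; the monomials are products over ts,
-- which has to contain everything that involves a face of Q.
record Window : Set where
  field
    Q ts : List Face
    uniqueQ : Unique Q
    unique : Unique ts
    top : ℤ
    bounded : ∀ i j → (i , j) ∈ Q → j ≤ top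
    margin : ∀ {k l i j} → Near k i → Near l j → (↑ (↑ k) , ↑ (↑ l)) ∈ Q → (i , j) ∈ ts

  _∈Q? : ∀ t → Dec (t ∈ Q)
  t ∈Q? = DecPropositional._∈?_ _≟ᶠ_ t Q

  pred-↑ : ∀ i → i ≡ (i - + 1 + + 1)
  pred-↑ = solve-∀

  margin₀₀ : ∀ {i j} → (i , j) ∈ Q → (i , j) ∈ ts
  margin₀₀ {i} {j} q = back i j (i - + 1 - + 1) (j - + 1 - + 1) (pred-↑ i) (pred-↑ (i - + 1)) (pred-↑ j) (pred-↑ (j - + 1)) q
    where
    back : ∀ i j {i' j'} i'' j'' → i ≡ ↑ i' → i' ≡ ↑ i'' → j ≡ ↑ j' → j' ≡ ↑ j'' → (i , j) ∈ Q → (i , j) ∈ ts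
    back _ _ i'' j'' refl refl refl refl = margin {i''} {j''} near₂ near₂

  margin₁₀ : ∀ {i j} → (↑ i , j) ∈ Q → (i , j) ∈ ts
  margin₁₀ {i} {j} q = back i j (i - + 1) (j - + 1 - + 1) (pred-↑ i) (pred-↑ j) (pred-↑ (j - + 1)) q
    where
    back : ∀ i j {j'} i'' j'' → i ≡ ↑ i'' → j ≡ ↑ j' → j' ≡ ↑ j'' → (↑ i , j) ∈ Q → (i , j) ∈ ts
    back _ _ i'' j'' refl refl refl = margin {i''} {j''} near₁ near₂

  margin₀₁ : ∀ {i j} → (i , ↑ j) ∈ Q → (i , j) ∈ ts
  margin₀₁ {i} {j} q = back i j (i - + 1 - + 1) (j - + 1) (pred-↑ i) (pred-↑ (i - + 1)) (pred-↑ j) q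
    where
    back : ∀ i j {i'} i'' j'' → i ≡ ↑ i' → i' ≡ ↑ i'' → j ≡ ↑ j'' → (i , ↑ j) ∈ Q → (i , j) ∈ ts
    back _ _ i'' j'' refl refl refl = margin {i''} {j''} near₂ near₁

  margin₁₁ : ∀ {i j} → (↑ i , ↑ j) ∈ Q → (i , j) ∈ ts
  margin₁₁ {i} {j} q = back i j (i - + 1) (j - + 1) (pred-↑ i) (pred-↑ j) q
    where
    back : ∀ i j i'' j'' → i ≡ ↑ i'' → j ≡ ↑ j'' → (↑ i , ↑ j) ∈ Q → (i , j) ∈ ts
    back _ _ i'' j'' refl refl = margin {i''} {j''} near₁ near₁

infix 4 _≐_
_≐_ : Field → Field → Set
y ≐ y' = ∀ i j → y i j ≡ y' i j

update : Field → Face → ℤ → Field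
update y p v i j = if ⌊ (i , j) ≟ᶠ p ⌋ then v else y i j

update-same : ∀ y p v → update y p v (proj₁ p) (proj₂ p) ≡ v
update-same y p v with p ≟ᶠ p
... | yes _ = refl
... | no ne = ⊥-elim (ne refl)

update-other : ∀ y p v i j → ¬ ((i , j) ≡ p) → update y p v i j ≡ y i j
update-other y p v i j ne with (i , j) ≟ᶠ p
... | yes eq = ⊥-elim (ne eq)
... | no _ = refl

update-cong : ∀ {y y'} p v → y ≐ y' → update y p v ≐ update y' p v
update-cong p v eq i j with (i , j) ≟ᶠ p
... | yes _ = refl
... | no _ = eq i j

update-commute : ∀ y p q v w → ¬ (p ≡ q) → update (update y p v) q w ≐ update (update y q w) p v
update-commute y p q v w ne i j with (i , j) ≟ᶠ q | (i , j) ≟ᶠ p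
... | yes refl | yes refl = ⊥-elim (ne refl)
... | yes _ | no _ = refl
... | no _ | yes _ = refl
... | no _ | no _ = refl

module Configurations (R : Face → List ℤ) where

  configs : List Face → Field → List Field
  configs [] y = y ∷ []
  configs (p ∷ ps) y = concatMap (λ v → configs ps (update y p v)) (R p)

  Respects : (Field → ℤ) → Set
  Respects g = ∀ {y y'} → y ≐ y' → g y ≡ g y'

  ∑-configs-∷ : ∀ p ps y g → ∑ (configs (p ∷ ps) y) g ≡ ∑ (R p) (λ v → ∑ (configs ps (update y p v)) g)
  ∑-configs-∷ p ps y g = ∑-concatMap _ (R p) g

  ∑-configs-cong : ∀ ps {y y' g} → Respects g → y ≐ y' → ∑ (configs ps y) g ≡ ∑ (configs ps y') g
  ∑-configs-cong [] inv eq = cong (_+ + 0) (inv eq)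
  ∑-configs-cong (p ∷ ps) {y} {y'} {g} inv eq = trans (∑-configs-∷ p ps y g)
    (trans (∑-cong (R p) λ v → ∑-configs-cong ps inv (update-cong p v eq)) (sym (∑-configs-∷ p ps y' g)))

  push : ∀ q v ps y {g} → ¬ (q ∈ ps) → Respects g →
         ∑ (configs ps (update y q v)) g ≡ ∑ (configs ps y) (λ y' → g (update y' q v))
  push q v [] y q∉ inv = refl
  push q v (p ∷ ps) y {g} q∉ inv = trans (∑-configs-∷ p ps (update y q v) g) (trans
    (∑-cong (R p) λ w → trans (∑-configs-cong ps inv (update-commute y q p v w (λ eq → q∉ (here eq))))
                              (push q v ps (update y p w) (λ q∈ → q∉ (there q∈)) inv))
    (sym (∑-configs-∷ p ps y _)))

  configs-keep : ∀ p ps y → ¬ (p ∈ ps) → ∀ {y'} → y' ∈ configs ps y → y' (proj₁ p) (proj₂ p) ≡ y (proj₁ p) (proj₂ p)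
  configs-keep p [] y p∉ (here refl) = refl
  configs-keep p (r ∷ ps) y p∉ y'∈ with find (∈-concatMap⁻ (λ v → configs ps (update y r v)) {xs = R r} y'∈)
  ... | v , _ , y'∈' = trans (configs-keep p ps (update y r v) (λ p∈ → p∉ (there p∈)) y'∈') (update-other y r v _ _ λ eq → p∉ (here eq))

  module Agreement (Q : List Face) (y₀ : Field) where

    Off : Field → Set
    Off y = ∀ i j → ¬ ((i , j) ∈ Q) → y i j ≡ y₀ i j

    update-off : ∀ {y p v} → p ∈ Q → Off y → Off (update y p v)
    update-off {y} {p} {v} p∈ off i j ij∉ = trans (update-other y p v i j λ { refl → ij∉ p∈ }) (off i j ij∉)

    configs-off : ∀ ps y → (∀ {p} → p ∈ ps → p ∈ Q) → Off y → ∀ {y'} → y' ∈ configs ps y → Off y'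
    configs-off [] y ps⊆ off (here refl) = off
    configs-off (p ∷ ps) y ps⊆ off y'∈ with ∈-concatMap⁻ (λ v → configs ps (update y p v)) {xs = R p} y'∈
    ... | some with find some
    ...   | v , _ , y'∈' = configs-off ps (update y p v) (λ p∈ → ps⊆ (there p∈)) (update-off (ps⊆ (here refl)) off) y'∈'

    fibrewise : ∀ q ps y {g g'} → q ∈ ps → Unique ps → (∀ {p} → p ∈ ps → p ∈ Q) → Off y → Respects g → Respects g' →
      (∀ y → Off y → ∑ (R q) (λ v → g (update y q v)) ≡ ∑ (R q) (λ v → g' (update y q v))) →
      ∑ (configs ps y) g ≡ ∑ (configs ps y) g'
    fibrewise q (q ∷ ps) y {g} {g'} (here refl) (fresh ∷ _) ps⊆ off inv inv' h =
      trans (collect inv) (trans (∑-cong-∈ (configs ps y) λ y' y'∈ → h y' (configs-off ps y (λ p∈ → ps⊆ (there p∈)) off y'∈)) (sym (collect inv')))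
      where
      collect : ∀ {g} → Respects g → ∑ (configs (q ∷ ps) y) g ≡ ∑ (configs ps y) (λ y' → ∑ (R q) (λ v → g (update y' q v)))
      collect {g} inv = trans (∑-configs-∷ q ps y g) (trans (∑-cong (R q) λ v → push q v ps y (λ q∈ → All.lookup fresh q∈ refl) inv)
        (∑-swap (R q) (configs ps y) (λ v y' → g (update y' q v))))
    fibrewise q (p ∷ ps) y {g} {g'} (there q∈) (_ ∷ uniq) ps⊆ off inv inv' h =
      trans (∑-configs-∷ p ps y g) (trans (∑-cong (R p) λ v →
        fibrewise q ps (update y p v) q∈ uniq (λ p∈ → ps⊆ (there p∈)) (update-off (ps⊆ (here refl)) off) inv inv' h)
      (sym (∑-configs-∷ p ps y g')))

    configs-distinct : (∀ p → Unique (R p)) → ∀ ps y → Unique ps → AllPairs (λ y y' → ¬ (y ≐ y')) (configs ps y)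
    configs-distinct R! [] y _ = [] ∷ []
    configs-distinct R! (p ∷ ps) y (fresh ∷ uniq) = AllPairs.concat⁺
      (All.map⁺ (All.universal (λ v → configs-distinct R! ps (update y p v) uniq) (R p)))
      (AllPairs.map⁺ (AllPairs.map (λ {v} {w} v≢w → All.tabulate λ y₁∈ → All.tabulate λ y₂∈ eq →
         v≢w (trans (sym (value v y₁∈)) (trans (eq _ _) (value w y₂∈)))) (R! p)))
      where
      value : ∀ v {y'} → y' ∈ configs ps (update y p v) → y' (proj₁ p) (proj₂ p) ≡ v
      value v y'∈ = trans (configs-keep p ps (update y p v) (λ p∈ → All.lookup fresh p∈ refl) y'∈) (update-same y p v)

-- Summation over the value at a single face

pin : ∀ {u v} → NN (u - v) → NN (v - u) → u ≡ v
pin {u} {v} p q = i-j≡0⇒i≡j u v (NN-antisym p (by q (identity₂ v u)))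

module _ {P : ℤ → Set} (P? : ∀ u → Dec (P u)) {R : List ℤ} (uniq : Unique R) (f : ℤ → ℤ) where

  private
    term : ℤ → ℤ
    term u = if does (P? u) then f u else + 0

    term-yes : ∀ {u} → P u → term u ≡ f u
    term-yes {u} p = cong (λ t → if t then f u else + 0) (dec-true (P? u) p)

    term-no : ∀ {u} → ¬ P u → term u ≡ + 0
    term-no {u} p = cong (λ t → if t then f u else + 0) (dec-false (P? u) p)

  ∑-one : ∀ {v} → v ∈ R → P v → (∀ u → P u → u ≡ v) → ∑ R term ≡ f v
  ∑-one v∈ p only = trans (∑-single uniq v∈ term λ u _ ne → term-no λ q → ne (only u q)) (term-yes p)

  ∑-two : ∀ {v w} → v ∈ R → w ∈ R → ¬ (v ≡ w) → P v → P w → (∀ u → P u → u ≡ v ⊎ u ≡ w) → ∑ R term ≡ f v + f w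
  ∑-two {v} {w} v∈ w∈ v≢w p q only = trans (trans (∑-cong R split) (∑-+ R _ _))
    (cong₂ _+_ (trans (∑-single uniq v∈ _ λ u _ ne → off₁ u ne) (trans on₁ (term-yes p)))
               (trans (∑-single uniq w∈ _ λ u _ ne → off₂ u ne) (trans on₂ (term-yes q))))
    where
    f₁ f₂ : ℤ → ℤ
    f₁ u = if ⌊ u ≟ v ⌋ then term u else + 0
    f₂ u = if ⌊ u ≟ v ⌋ then + 0 else term u
    split : ∀ u → term u ≡ f₁ u + f₂ u
    split u with u ≟ v
    ... | yes _ = sym (+-identityʳ _)
    ... | no _ = sym (+-identityˡ _)
    on₁ : f₁ v ≡ term v
    on₁ with v ≟ v
    ... | yes _ = refl
    ... | no ne = ⊥-elim (ne refl)
    on₂ : f₂ w ≡ term w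
    on₂ with w ≟ v
    ... | yes eq = ⊥-elim (v≢w (sym eq))
    ... | no _ = refl
    off₁ : ∀ u → ¬ (u ≡ v) → f₁ u ≡ + 0
    off₁ u ne with u ≟ v
    ... | yes eq = ⊥-elim (ne eq)
    ... | no _ = refl
    off₂ : ∀ u → ¬ (u ≡ w) → f₂ u ≡ + 0
    off₂ u ne with u ≟ v
    ... | yes _ = refl
    ... | no ne' = term-no λ r → [ ne' , ne ]′ (only u r)

-- Given the values E, W, N, S at the neighbours, High and Low are the
-- values that a matching can take at a local maximum and at a local
-- minimum of the surface.
High Low : (E W N S u : ℤ) → Set
High E W N S u = Bit (u - E) × Bit (u - W) × Bit (u - N) × Bit (S - u)
Low E W N S u = Bit (E - u) × Bit (W - u) × Bit (u - N) × Bit (S - u)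

record Exponents-at (E W N S v v' A C : ℤ) : Set where
  field
    A≡ : A ≡ + 2 * v' + (v - v') - E - W
    C≡ : C ≡ N + S - (+ 2 * v' + (v - v'))

data Fibre (E W N S : ℤ) : Set where
  one : ∀ v v' → High E W N S v → (∀ u → High E W N S u → u ≡ v) → Low E W N S v' → (∀ u → Low E W N S u → u ≡ v') →
        Exponents-at E W N S v v' (+ 0) (+ 0) → E + W - N - S ≡ + 0 → Fibre E W N S
  merge : ∀ v w v' → ¬ (v ≡ w) → High E W N S v → High E W N S w → (∀ u → High E W N S u → u ≡ v ⊎ u ≡ w) →
        Low E W N S v' → (∀ u → Low E W N S u → u ≡ v') →
        Exponents-at E W N S v v' (+ 0) (+ 1) → Exponents-at E W N S w v' (+ 1) (+ 0) → E + W - N - S ≡ -[1+ 0 ] → Fibre E W N S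
  split : ∀ v v' w' → ¬ (v' ≡ w') → High E W N S v → (∀ u → High E W N S u → u ≡ v) →
        Low E W N S v' → Low E W N S w' → (∀ u → Low E W N S u → u ≡ v' ⊎ u ≡ w') →
        Exponents-at E W N S v v' -[1+ 0 ] (+ 0) → Exponents-at E W N S v w' (+ 0) -[1+ 0 ] → E + W - N - S ≡ + 1 → Fibre E W N S

private
  bit₀ : ∀ {e} → + 0 ≡ e → Bit e
  bit₀ refl = bit0

  bit₁ : ∀ {e} → + 1 ≡ e → Bit e
  bit₁ refl = bit1

  below-by : ∀ {E S} → Bit (S - E) → S ≡ E ⊎ E ≡ S - + 1
  below-by {E} {S} bs with bit-split bs
  ... | inj₁ eq = inj₁ (i-j≡0⇒i≡j S E eq)
  ... | inj₂ eq = inj₂ (≡-by (sym eq) (identity₁₉ E S))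

  s≢s-1 : ∀ {s} → ¬ (s - + 1 ≡ s)
  s≢s-1 {s} eq = absurd {k = 0} (nat {0}) (trans (sym (+-inverseʳ s)) (trans (cong (λ t → t - s) (sym eq)) (l s)))
    where
    l : ∀ s → s - + 1 - s ≡ -[1+ 0 ]
    l = solve-∀

fibre : ∀ {E W N S} → Bit (S - E) → Bit (S - W) → Bit (E - N) → Bit (W - N) → Fibre E W N S
fibre {E} {W} {N} {S} SE SW EN WN with below-by {E} {S} SE | below-by {W} {S} SW
... | inj₁ refl | inj₁ refl with below-by {N} {S} EN
...   | inj₁ refl = one S S
        (bit₀ (identity₂₀ E) , bit₀ (identity₂₀ E) , bit₀ (identity₂₀ E) , bit₀ (identity₂₀ E)) (λ { u (p , _ , _ , q) → pin (proj₁ p) (proj₁ q) })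
        (bit₀ (identity₂₀ E) , bit₀ (identity₂₀ E) , bit₀ (identity₂₀ E) , bit₀ (identity₂₀ E)) (λ { u (_ , _ , p , q) → pin (proj₁ p) (proj₁ q) })
        (record { A≡ = (identity₂₁ E) ; C≡ = (identity₂₂ E) }) (identity₂₃ E)
...   | inj₂ refl = split S (S - + 1) S s≢s-1
        (bit₀ (identity₂₀ E) , bit₀ (identity₂₀ E) , bit₁ (identity₂₄ E) , bit₀ (identity₂₀ E)) (λ { u (p , _ , _ , q) → pin (proj₁ p) (proj₁ q) })
        (bit₁ (identity₂₄ E) , bit₁ (identity₂₄ E) , bit₀ (identity₂₅ E) , bit₁ (identity₂₄ E)) (bit₀ (identity₂₀ E) , bit₀ (identity₂₀ E) , bit₁ (identity₂₄ E) , bit₀ (identity₂₀ E))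
        (λ { u (_ , _ , _ , q) → [ (λ eq → inj₂ (sym eq)) , inj₁ ]′ (below-by {u} {S} q) })
        (record { A≡ = (identity₂₆ E) ; C≡ = (identity₂₇ E) }) (record { A≡ = (identity₂₁ E) ; C≡ = (identity₂₈ E) }) (identity₂₉ E)
fibre {E} {W} {N} {S} SE SW EN WN | inj₂ refl | inj₂ refl with below-by {N} {S - + 1} EN
...   | inj₁ refl = merge (S - + 1) S (S - + 1) s≢s-1
        (bit₀ (identity₂₅ S) , bit₀ (identity₂₅ S) , bit₀ (identity₂₅ S) , bit₁ (identity₂₄ S)) (bit₁ (identity₂₄ S) , bit₁ (identity₂₄ S) , bit₁ (identity₂₄ S) , bit₀ (identity₂₀ S))
        (λ { u (_ , _ , _ , q) → [ (λ eq → inj₂ (sym eq)) , inj₁ ]′ (below-by {u} {S} q) })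
        (bit₀ (identity₂₅ S) , bit₀ (identity₂₅ S) , bit₀ (identity₂₅ S) , bit₁ (identity₂₄ S)) (λ { u (p , _ , q , _) → pin (proj₁ q) (proj₁ p) })
        (record { A≡ = (identity₃₀ S) ; C≡ = (identity₃₁ S) }) (record { A≡ = (identity₃₂ S) ; C≡ = (identity₂₇ S) }) (identity₃₃ S)
...   | inj₂ refl = one (S - + 1) (S - + 1)
        (bit₀ (identity₂₅ S) , bit₀ (identity₂₅ S) , bit₁ (identity₃₄ S) , bit₁ (identity₂₄ S)) (λ { u (p , _ , q , _) → pin (proj₁ p) (by (proj₂ q) (identity₃₅ u S)) })
        (bit₀ (identity₂₅ S) , bit₀ (identity₂₅ S) , bit₁ (identity₃₄ S) , bit₁ (identity₂₄ S)) (λ { u (p , _ , _ , q) → pin (by (proj₂ q) (identity₃₆ S u)) (proj₁ p) })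
        (record { A≡ = (identity₃₀ S) ; C≡ = (identity₃₇ S) }) (identity₃₈ S)
fibre {E} {W} {N} {S} SE SW EN WN | inj₁ refl | inj₂ refl with N≡
  where
  N≡ : N ≡ S - + 1
  N≡ = pin (by (proj₂ EN) (identity₃₉ E N)) (by (proj₁ WN) (identity₄₀ E N))
... | refl = one S (S - + 1)
        (bit₀ (identity₂₀ E) , bit₁ (identity₂₄ E) , bit₁ (identity₂₄ E) , bit₀ (identity₂₀ E)) (λ { u (p , _ , _ , q) → pin (proj₁ p) (proj₁ q) })
        (bit₁ (identity₂₄ E) , bit₀ (identity₂₅ E) , bit₀ (identity₂₅ E) , bit₁ (identity₂₄ E)) (λ { u (_ , p , _ , q) → pin (by (proj₂ q) (identity₃₆ E u)) (proj₁ p) })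
        (record { A≡ = (identity₄₁ E) ; C≡ = (identity₂₇ E) }) (identity₄₂ E)
fibre {E} {W} {N} {S} SE SW EN WN | inj₂ refl | inj₁ refl with N≡
  where
  N≡ : N ≡ S - + 1
  N≡ = pin (by (proj₂ WN) (identity₃₉ W N)) (by (proj₁ EN) (identity₄₀ W N))
... | refl = one S (S - + 1)
        (bit₁ (identity₂₄ W) , bit₀ (identity₂₀ W) , bit₁ (identity₂₄ W) , bit₀ (identity₂₀ W)) (λ { u (_ , p , _ , q) → pin (proj₁ p) (proj₁ q) })
        (bit₀ (identity₂₅ W) , bit₁ (identity₂₄ W) , bit₀ (identity₂₅ W) , bit₁ (identity₂₄ W)) (λ { u (p , _ , _ , q) → pin (by (proj₂ q) (identity₃₆ W u)) (proj₁ p) })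
        (record { A≡ = (identity₄₃ W) ; C≡ = (identity₂₇ W) }) (identity₄₄ W)

module FibreSums (X : Var) (β₁ β₂ : Mono) where
  open Substitution X β₁ β₂

  private
    X^ : ℤ → Mono
    X^ e = (X , e) ∷ []

    B≋ : B ≋ mono β₁ +ₚ mono β₂
    B≋ = pointwise λ {φ} _ → trans (B-action φ) (sym (trans (+-action (mono β₁) (mono β₂) φ) (cong₂ _+_ (mono-action β₁ φ) (mono-action β₂ φ))))

    expand : ∀ m → mono m *ₚ B ≋ mono (m ++ β₁) +ₚ mono (m ++ β₂)
    expand m = ≋-trans (*ₚ-congˡ (mono m) B≋) (≋-trans (*ₚ-distribˡ (mono m) (mono β₁) (mono β₂))
      (+ₚ-cong (≋-sym (mono-++ m β₁)) (≋-sym (mono-++ m β₂))))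

    trivial : ∀ m → m ++ X^ (+ 0) ≃ m
    trivial m = same-expo λ v → trans (expo-++ m _ v) (trans (+-congˡ (expo m v) (zero-at v)) (+-identityʳ _))
      where
      zero-at : ∀ v → expo (X^ (+ 0)) v ≡ + 0
      zero-at v with X =ᵥ v
      ... | true = refl
      ... | false = refl

  ψ-zero : ∀ {m} → expo m X ≡ + 0 → ψ 1 m ≋ mono m *ₚ B
  ψ-zero {m} eq rewrite eq = *ₚ-cong (mono-cong (trivial m)) (laurent.*-identityʳ B)

  fibre-one : ∀ {m m'} → expo m X ≡ + 0 → m ≃ m' → ψ 1 m ≋ mono m' *ₚ B
  fibre-one eq same = ≋-trans (ψ-zero eq) (laurent.*-congʳ (mono-cong same))

  fibre-merge : ∀ {m n m'} → expo m X ≡ -[1+ 0 ] → expo n X ≡ -[1+ 0 ] → m ++ X^ (+ 2) ≃ m' ++ β₂ → n ++ X^ (+ 2) ≃ m' ++ β₁ →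
                ψ 1 m +ₚ ψ 1 n ≋ mono m' *ₚ B
  fibre-merge {m} {n} {m'} eq eq' same same' rewrite eq | eq' = ≋-trans
    (+ₚ-cong (≋-trans (laurent.*-identityʳ (mono (m ++ X^ (+ 2)))) (mono-cong same)) (≋-trans (laurent.*-identityʳ (mono (n ++ X^ (+ 2)))) (mono-cong same')))
    (≋-trans (+ₚ-comm (mono (m' ++ β₂)) (mono (m' ++ β₁))) (≋-sym (expand m')))

  fibre-split : ∀ {m m' n'} → expo m X ≡ + 1 → (m ++ X^ -[1+ 1 ]) ++ β₁ ≃ m' → (m ++ X^ -[1+ 1 ]) ++ β₂ ≃ n' →
                ψ 1 m ≋ (mono m' *ₚ B) +ₚ (mono n' *ₚ B)
  fibre-split {m} {m'} {n'} eq same same' rewrite eq = ≋-trans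
    (*ₚ-congˡ (mono (m ++ X^ -[1+ 1 ])) (*ₚ-congˡ B (laurent.*-identityʳ B)))
    (≋-trans (≋-sym (*ₚ-assoc (mono (m ++ X^ -[1+ 1 ])) B B))
    (≋-trans (laurent.*-congʳ (≋-trans (expand (m ++ X^ -[1+ 1 ])) (+ₚ-cong (mono-cong same) (mono-cong same'))))
    (laurent.distribʳ B (mono m') (mono n'))))

-- The Laurent polynomial of a target

∑-if-cong : ∀ {A : Set} (ts : List A) {p p' : A → Bool} {f f' : A → ℤ} → (∀ t → p t ≡ p' t) → (∀ t → p t ≡ true → f t ≡ f' t) →
  ∑ ts (λ t → if p t then f t else + 0) ≡ ∑ ts (λ t → if p' t then f' t else + 0)
∑-if-cong ts {p} {p'} {f} {f'} h h' = ∑-cong ts λ t → step (p t) (p' t) (h t) (h' t)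
  where
  step : ∀ b b' {m n} → b ≡ b' → (b ≡ true → m ≡ n) → (if b then m else + 0) ≡ (if b' then n else + 0)
  step true .true refl e = e refl
  step false .false refl e = refl

weight-cong : ∀ {σ σ' y y'} ts → σ ≐ σ' → y ≐ y' → weight σ y ts ≡ weight σ' y' ts
weight-cong {σ} {σ'} {y} {y'} ts eσ ey = cong₂ _++_ (map-cong (λ { (i , j) → face≡ i j }) ts)
  (cong₂ _++_ (map-cong (λ { (i , j) → a≡ i j }) ts) (cong₂ _++_ (map-cong (λ { (i , j) → b≡ i j }) ts)
  (cong₂ _++_ (map-cong (λ { (i , j) → c≡ i j }) ts) (map-cong (λ { (i , j) → d≡ i j }) ts))))
  where
  face≡ : ∀ i j → face σ y (i , j) ≡ face σ' y' (i , j)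
  face≡ i j rewrite eσ i j | eσ (↑ i) j | eσ (↑ (↑ i)) j | eσ i (↑ j) | eσ (↑ i) (↑ j) | eσ (↑ (↑ i)) (↑ j) | eσ i (↑ (↑ j)) | eσ (↑ i) (↑ (↑ j)) | eσ (↑ (↑ i)) (↑ (↑ j))
    | ey i j | ey (↑ i) j | ey (↑ (↑ i)) j | ey i (↑ j) | ey (↑ i) (↑ j) | ey (↑ (↑ i)) (↑ j) | ey i (↑ (↑ j)) | ey (↑ i) (↑ (↑ j)) | ey (↑ (↑ i)) (↑ (↑ j)) = refl
  a≡ : ∀ i j → a-edge σ y (i , j) ≡ a-edge σ' y' (i , j)
  a≡ i j rewrite eσ i j | eσ (↑ i) j | ey i j | ey (↑ i) j = refl
  b≡ : ∀ i j → b-edge σ y (i , j) ≡ b-edge σ' y' (i , j)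
  b≡ i j rewrite eσ i j | eσ i (↑ j) | ey i j | ey i (↑ j) = refl
  c≡ : ∀ i j → c-edge σ y (i , j) ≡ c-edge σ' y' (i , j)
  c≡ i j rewrite eσ i j | eσ (↑ i) j | ey i j | ey (↑ i) j = refl
  d≡ : ∀ i j → d-edge σ y (i , j) ≡ d-edge σ' y' (i , j)
  d≡ i j rewrite eσ i j | eσ i (↑ j) | ey i j | ey i (↑ j) = refl

module Series (win : Window) (ν i₀ j₀ : ℤ) (floor : Field) where
  open Window win
  open Target ν i₀ j₀

  range : Face → List ℤ
  range (i , j) = map (λ n → Y j - + n) (upTo (suc ∣ cone i j - floor i j ∣))

  range! : ∀ p → Unique (range p)
  range! (i , j) = Unique.map⁺ (λ {m} {n} eq → +-injective (neg-injective (+-cancelˡ (Y j) eq))) (Unique.upTo⁺ _)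

  open Configurations range
  open Agreement Q y₀

  record Under (σ : Field) : Set where
    field
      surface : Surface σ
      below : ∀ i j → NN (cone i j - σ i j)
      floored : ∀ i j → NN (σ i j - floor i j)
      outside : ∀ i j → ¬ ((i , j) ∈ Q) → σ i j ≡ cone i j

  Check : Field → Field → Face → Set
  Check σ y (i , j) = Matching σ y i j × NN (y i j - σ i j - Z i) × NN (Y j - y i j)

  check? : ∀ σ y t → Dec (Check σ y t)
  check? σ y (i , j) = matching? σ y i j ×-dec ((+ 0 ≤? _) ×-dec (+ 0 ≤? _))

  Checked : Field → Field → Set
  Checked σ y = All (Check σ y) ts

  checked? : ∀ σ y → Dec (Checked σ y)
  checked? σ y = All.all? (check? σ y) ts

  valid⇒checked : ∀ {σ y} → Valid σ y → Checked σ y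
  valid⇒checked valid = All.tabulate λ { {i , j} _ → Valid.matching valid i j , Valid.lower valid i j , Valid.upper valid i j }

  checked⇒valid : ∀ {σ y} → Under σ → Off y → Checked σ y → Valid σ y
  checked⇒valid {σ} {y} under off checked = record { matching = λ i j → proj₁ (everywhere i j) ; lower = λ i j → proj₁ (proj₂ (everywhere i j)) ; upper = λ i j → proj₂ (proj₂ (everywhere i j)) }
    where
    open Under under
    everywhere : ∀ i j → Check σ y (i , j)
    everywhere i j with DecPropositional._∈?_ _≟ᶠ_ (i , j) ts
    ... | yes ij∈ = All.lookup checked ij∈
    ... | no ij∉ =
      matching-cong (σ= i j out₀₀) (σ= (↑ i) j out₁₀) (σ= i (↑ j) out₀₁) (σ= (↑ i) (↑ j) out₁₁)
                    (y= i j out₀₀) (y= (↑ i) j out₁₀) (y= i (↑ j) out₀₁) (y= (↑ i) (↑ j) out₁₁) (Valid.matching cone-valid i j) ,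
      by (Valid.lower cone-valid i j) (cong₂ (λ p r → p - r - Z i) (y= i j out₀₀) (σ= i j out₀₀)) ,
      by (Valid.upper cone-valid i j) (cong (λ p → Y j - p) (y= i j out₀₀))
      where
      out₀₀ = λ q → ij∉ (margin₀₀ q)
      out₁₀ = λ q → ij∉ (margin₁₀ q)
      out₀₁ = λ q → ij∉ (margin₀₁ q)
      out₁₁ = λ q → ij∉ (margin₁₁ q)
      σ= : ∀ i j → ¬ ((i , j) ∈ Q) → cone i j ≡ σ i j
      σ= i j out = sym (outside i j out)
      y= : ∀ i j → ¬ ((i , j) ∈ Q) → y₀ i j ≡ y i j
      y= i j out = sym (off i j out)

  in-range : ∀ {σ y} → Under σ → Valid σ y → ∀ i j → y i j ∈ range (i , j)
  in-range {σ} {y} under valid i j = subst (_∈ range (i , j)) value (∈-map⁺ (λ n → Y j - + n) (∈-upTo⁺ (ℕ.s≤s bound)))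
    where
    open Under under
    open Valid valid
    value : Y j - + ∣ Y j - y i j ∣ ≡ y i j
    value = trans (cong (λ t → Y j - t) (0≤i⇒+∣i∣≡i (upper i j))) (l (Y j) (y i j))
      where
      l : ∀ p q → p - (p - q) ≡ q
      l = solve-∀
    gap : NN (cone i j - floor i j - (Y j - y i j))
    gap = by (lower i j ⊕ floored i j) (l (y i j) (σ i j) (Y j) (Z i) (floor i j))
      where
      l : ∀ y s p q f → y - s - q + (s - f) ≡ p - q - f - (p - y)
      l = solve-∀
    nonneg : NN (cone i j - floor i j)
    nonneg = by (gap ⊕ upper i j) (l (cone i j - floor i j) (Y j - y i j))
      where
      l : ∀ p q → p - q + q ≡ p
      l = solve-∀
    bound : ∣ Y j - y i j ∣ ℕ.≤ ∣ cone i j - floor i j ∣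
    bound = drop‿+≤+ (subst₂ _≤_ (sym (0≤i⇒+∣i∣≡i (upper i j))) (sym (0≤i⇒+∣i∣≡i nonneg)) (NN⇒≤ gap))

  candidates : List Field
  candidates = configs Q y₀

  matchings : Field → List Field
  matchings σ = filter (checked? σ) candidates

  monos : Field → List Mono
  monos σ = map (λ y → weight σ y ts) (matchings σ)

  F : Field → Poly
  F σ = sumMonos (monos σ)

  y₀-off : Off y₀
  y₀-off i j _ = refl

  all-valid : ∀ {σ} → Under σ → ∀ {y} → y ∈ matchings σ → Valid σ y × Off y
  all-valid {σ} under y∈ with ∈-filter⁻ (checked? σ) {xs = candidates} y∈
  ... | y∈' , checked = let off = configs-off Q y₀ (λ p∈ → p∈) y₀-off y∈' in checked⇒valid under off checked , off

  F-action : ∀ σ φ → ⟨ F σ , φ ⟩ ≡ ∑ candidates (λ y → if does (checked? σ y) then φ (weight σ y ts) else + 0)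
  F-action σ φ = trans (∑-map _ (monos σ) _) (trans (∑-map _ (matchings σ) _) (trans (∑-filter (checked? σ) candidates _)
    (∑-if-cong candidates (λ _ → refl) (λ y _ → *-identityˡ (φ (weight σ y ts))))))

  F-terms : ∀ {σ} (P : ℤ × Mono → Set) → Under σ → (∀ {y} → Valid σ y → Off y → P (+ 1 , weight σ y ts)) → All P (F σ)
  F-terms {σ} P under h = All.map⁺ (All.map⁺ (All.tabulate λ y∈ → let valid , off = all-valid under y∈ in h valid off))

  monos-ok : ∀ {σ} → Under σ → All MonoOK (monos σ)
  monos-ok {σ} under = All.map⁺ (All.tabulate λ {y} y∈ → weight-ok (Under.surface under) unique y (Valid.matching (proj₁ (all-valid under y∈))))

  monos-distinct : ∀ {σ} → Under σ → AllPairs (λ m m' → ¬ MonoEq m m') (monos σ)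
  monos-distinct {σ} under = AllPairs.map⁺ (refine (matchings σ) (λ y∈ → proj₂ (all-valid under y∈)) (AllPairs.filter⁺ (checked? σ) (configs-distinct range! Q y₀ uniqueQ)))
    where
    separated : ∀ {y y'} → Off y → Off y' → ¬ (y ≐ y') → ¬ MonoEq (weight σ y ts) (weight σ y' ts)
    separated {y} {y'} off off' ne eq = ne (weight-injective (Under.surface under) unique (_∈ Q) _∈Q? margin₀₀ top bounded
      (λ i j out → trans (off i j out) (sym (off' i j out))) (same-expo eq))
    refine : ∀ ys → (∀ {y} → y ∈ ys → Off y) → AllPairs (λ y y' → ¬ (y ≐ y')) ys → AllPairs (λ y y' → ¬ MonoEq (weight σ y ts) (weight σ y' ts)) ys
    refine [] off [] = []
    refine (y ∷ ys) off (ne ∷ nes) = All.tabulate (λ y'∈ → separated (off (here refl)) (off (there y'∈)) (All.lookup ne y'∈)) ∷ refine ys (λ y∈ → off (there y∈)) nes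

  F-bounded : ∀ {σ} → Under σ → ∀ X i j β₁ β₂ → X ≡ x i j → Substitution.Bounded X β₁ β₂ 1 (F σ)
  F-bounded {σ} under X i j β₁ β₂ refl = F-terms _ under λ {y} valid _ →
    by (≤⇒NN (proj₁ (weight-ok (Under.surface under) unique y (Valid.matching valid) (x i j)))) (l (expo (weight σ y ts) (x i j)))
    where
    l : ∀ e → e - -[1+ 0 ] ≡ + 1 + e
    l = solve-∀

  checked-cong : ∀ {σ σ' y y'} → σ ≐ σ' → y ≐ y' → Checked σ y → Checked σ' y'
  checked-cong eσ ey = All.map λ { {i , j} (m , p , q) →
    matching-cong (eσ i j) (eσ (↑ i) j) (eσ i (↑ j)) (eσ (↑ i) (↑ j)) (ey i j) (ey (↑ i) j) (ey i (↑ j)) (ey (↑ i) (↑ j)) m ,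
    by p (cong₂ (λ r s → r - s - Z i) (ey i j) (eσ i j)) , by q (cong (λ r → Y j - r) (ey i j)) }

  does-cong : ∀ {P P' : Set} (P? : Dec P) (P'? : Dec P') → (P → P') → (P' → P) → does P? ≡ does P'?
  does-cong (yes p) P'? f g = sym (dec-true P'? (f p))
  does-cong (no ¬p) P'? f g = sym (dec-false P'? (λ p' → ¬p (g p')))

  checked?-cong : ∀ {σ σ' y y'} → σ ≐ σ' → y ≐ y' → does (checked? σ y) ≡ does (checked? σ' y')
  checked?-cong {σ} {σ'} {y} {y'} eσ ey = does-cong (checked? σ y) (checked? σ' y') (checked-cong eσ ey)
    (checked-cong (λ i j → sym (eσ i j)) (λ i j → sym (ey i j)))

  F-cong : ∀ {σ σ'} → σ ≐ σ' → F σ ≋ F σ'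
  F-cong {σ} {σ'} eq = pointwise λ {φ} _ → trans (F-action σ φ) (trans
    (∑-if-cong candidates (λ y → checked?-cong eq (λ i j → refl)) (λ y _ → cong φ (weight-cong ts eq (λ i j → refl))))
    (sym (F-action σ' φ)))

  respects-if : ∀ σ (φ : Mono → ℤ) → Respects (λ y → if does (checked? σ y) then φ (weight σ y ts) else + 0)
  respects-if σ φ {y} {y'} eq = step _ _ (checked?-cong {σ} (λ i j → refl) eq) (cong φ (weight-cong {σ} ts (λ i j → refl) eq))
    where
    step : ∀ p p' {m n : ℤ} → p ≡ p' → m ≡ n → (if p then m else + 0) ≡ (if p' then n else + 0)
    step p .p refl refl = refl

-- Lowering the surface at one face is a substitution

κ₉-maximum : ∀ {s00 s10 s20 s01 s11 s21 s02 s12 s22 y00 y10 y20 y01 y11 y21 y02 y12 y22} m →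
  s11 ≡ m + + 1 → s21 ≡ m → s12 ≡ m → s01 ≡ m + + 1 → s10 ≡ m + + 1 →
  κ₉ s00 s10 s20 s01 s11 s21 s02 s12 s22 y00 y10 y20 y01 y11 y21 y02 y12 y22 ≡ y21 + y01 - y12 - y10
κ₉-maximum {s00} {s20 = s20} {s02 = s02} {s22 = s22} {y00} {y10} {y20} {y01} {y11} {y21} {y02} {y12} {y22} m refl refl refl refl refl = sym (κ₉-≡ s00 _ s20 _ _ _ s02 _ s22 y00 y10 y20 y01 y11 y21 y02 y12 y22 (λ κ → κ) (sym (maximum-identity m y21 y01 y12 y10 y22 y02 y20 y00)))

-- The two terms of the exchange relation at the face (k + 2 , l + 2) when
-- its height is lowered to the one that σ-coordinate m stands for
module Binomial (k l m : ℤ) where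
  private
    k₁ k₂ k₃ l₁ l₂ l₃ h : ℤ
    k₁ = ↑ k
    k₂ = ↑ k₁
    k₃ = ↑ k₂
    l₁ = ↑ l
    l₂ = ↑ l₁
    l₃ = ↑ l₂
    h = + 2 * m + k₂ + l₂

  X : Var
  X = x k₂ l₂

  β₁ β₂ : Mono
  β₁ = (a (k₂ + h + + 1) l₂ , + 1) ∷ (c (k₂ - h - + 1) l₂ , + 1) ∷ (x k₂ l₃ , + 1) ∷ (x k₂ l₁ , + 1) ∷ []
  β₂ = (b k₂ (l₂ + h + + 1) , + 1) ∷ (d k₂ (l₂ - h - + 1) , + 1) ∷ (x k₃ l₂ , + 1) ∷ (x k₁ l₂ , + 1) ∷ []

scale-entry : ∀ w e v → at (w , e) v ≡ e * at (w , + 1) v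
scale-entry w e v with w =ᵥ v
... | true = sym (*-identityʳ e)
... | false = sym (*-zeroʳ e)

module FlipSum (win : Window) (ν i₀ j₀ : ℤ) (floor : Field) where
  open Window win
  open Target ν i₀ j₀
  open Series win ν i₀ j₀ floor
  open Configurations range
  open Agreement Q y₀

  module AtFace {k₀ ℓ₀ : ℤ} {σ σ' : Field} (flip : Flip k₀ ℓ₀ σ σ') (under : Under σ) (under' : Under σ')
    (q∈ : (↑ (↑ k₀) , ↑ (↑ ℓ₀)) ∈ Q) where

    open Flip flip
    open Binomial k₀ ℓ₀ (σ' (↑ (↑ k₀)) (↑ (↑ ℓ₀)))
    open Substitution X β₁ β₂
    open FibreSums X β₁ β₂

    private
      k₁ k₂ k₃ l₁ l₂ l₃ m : ℤ
      k₁ = ↑ k₀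
      k₂ = ↑ k₁
      k₃ = ↑ k₂
      l₁ = ↑ ℓ₀
      l₂ = ↑ l₁
      l₃ = ↑ l₂
      m = σ' k₂ l₂

      q : Face
      q = k₂ , l₂

      column≢ : ∀ {i j} → ¬ (i ≡ k₂) → ¬ ((i , j) ≡ q)
      column≢ ne eq = ne (cong proj₁ eq)

      row≢ : ∀ {i j} → ¬ (j ≡ l₂) → ¬ ((i , j) ≡ q)
      row≢ ne eq = ne (cong proj₂ eq)

      k₁≢ : ¬ (k₁ ≡ k₂)
      k₁≢ eq = ↑≢ (sym eq)
      k₃≢ : ¬ (k₃ ≡ k₂)
      k₃≢ = ↑≢
      l₁≢ : ¬ (l₁ ≡ l₂)
      l₁≢ eq = ↑≢ (sym eq)
      l₃≢ : ¬ (l₃ ≡ l₂)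
      l₃≢ = ↑≢

      ι-off : ∀ i j → ¬ ((i , j) ≡ q) → ι k₂ i * ι l₂ j ≡ + 0
      ι-off i j ne with i ≟ k₂ | j ≟ l₂
      ... | yes refl | yes refl = ⊥-elim (ne refl)
      ... | yes _ | no _ = refl
      ... | no _ | _ = refl

      ι-on : ι k₂ k₂ * ι l₂ l₂ ≡ + 1
      ι-on = cong₂ _*_ (ι-same k₂) (ι-same l₂)

      σ-off : ∀ i j → ¬ ((i , j) ≡ q) → σ i j ≡ σ' i j
      σ-off i j ne = trans (raise i j) (trans (+-congˡ (σ' i j) (ι-off i j ne)) (+-identityʳ _))

      σ-on : σ k₂ l₂ ≡ m + + 1
      σ-on = trans (raise k₂ l₂) (+-congˡ m ι-on)

      σE : σ k₃ l₂ ≡ m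
      σE = trans (σ-off _ _ (column≢ k₃≢)) east
      σN : σ k₂ l₃ ≡ m
      σN = trans (σ-off _ _ (row≢ l₃≢)) north
      σW : σ k₁ l₂ ≡ m + + 1
      σW = trans (σ-off _ _ (column≢ k₁≢)) west
      σS : σ k₂ l₁ ≡ m + + 1
      σS = trans (σ-off _ _ (row≢ l₁≢)) south

      near : (k₀ , ℓ₀) ∈ ts × (k₀ , l₁) ∈ ts × (k₁ , ℓ₀) ∈ ts × (k₁ , l₁) ∈ ts × (k₂ , l₁) ∈ ts × (k₁ , l₂) ∈ ts × (k₂ , l₂) ∈ ts
      near = margin {k₀} {ℓ₀} near₀ near₀ q∈ , margin {k₀} {ℓ₀} near₀ near₁ q∈ , margin {k₀} {ℓ₀} near₁ near₀ q∈ , margin {k₀} {ℓ₀} near₁ near₁ q∈ , margin {k₀} {ℓ₀} near₂ near₁ q∈ , margin {k₀} {ℓ₀} near₁ near₂ q∈ , margin {k₀} {ℓ₀} near₂ near₂ q∈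

    module AtConfiguration (y : Field) (off : Off y) {φ : Mono → ℤ} (r : Resp φ) where

      private
        E W N S : ℤ
        E = y k₃ l₂
        W = y k₁ l₂
        N = y k₂ l₃
        S = y k₂ l₁

        _↦_ : Field → ℤ → Field
        y ↦ u = update y q u

        yE : ∀ u → (y ↦ u) k₃ l₂ ≡ E
        yE u = update-other y q u _ _ (column≢ k₃≢)
        yW : ∀ u → (y ↦ u) k₁ l₂ ≡ W
        yW u = update-other y q u _ _ (column≢ k₁≢)
        yN : ∀ u → (y ↦ u) k₂ l₃ ≡ N
        yN u = update-other y q u _ _ (row≢ l₃≢)
        yS : ∀ u → (y ↦ u) k₂ l₁ ≡ S
        yS u = update-other y q u _ _ (row≢ l₁≢)
        yq : ∀ u → (y ↦ u) k₂ l₂ ≡ u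
        yq u = update-same y q u

        ↦-off : ∀ u w i j → ¬ ((i , j) ≡ q) → (y ↦ u) i j ≡ (y ↦ w) i j
        ↦-off u w i j ne = trans (update-other y q u i j ne) (sym (update-other y q w i j ne))

        valid-high : ∀ u → Valid σ (y ↦ u) → High E W N S u
        valid-high u valid =
          flip-bit (Matching.hor (matching k₂ l₂)) (trans (cong (λ t → + 1 - t) (cong₂ _-_ (cong₂ _-_ (yE u) σE) (cong₂ _-_ (yq u) σ-on))) (e₁ E u m)) ,
          bit-cong (Matching.hor (matching k₁ l₂)) (trans (cong₂ _-_ (cong₂ _-_ (yq u) σ-on) (cong₂ _-_ (yW u) σW)) (e₂ u W (m + + 1))) ,
          bit-cong (Matching.ver (matching k₂ l₂)) (cong₂ _-_ (yq u) (yN u)) ,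
          bit-cong (Matching.ver (matching k₂ l₁)) (cong₂ _-_ (yS u) (yq u))
          where
          open Valid valid
          e₁ : ∀ E u m → + 1 - ((E - m) - (u - (m + + 1))) ≡ u - E
          e₁ = solve-∀
          e₂ : ∀ u W m → (u - m) - (W - m) ≡ u - W
          e₂ = solve-∀

        valid-low : ∀ u → Valid σ' (y ↦ u) → Low E W N S u
        valid-low u valid =
          bit-cong (Matching.hor (matching k₂ l₂)) (trans (cong₂ _-_ (cong₂ _-_ (yE u) east) (cong (_- m) (yq u))) (e₂ E u m)) ,
          flip-bit (Matching.hor (matching k₁ l₂)) (trans (cong (λ t → + 1 - t) (cong₂ _-_ (cong (_- m) (yq u)) (cong₂ _-_ (yW u) west))) (e₁ W u m)) ,
          bit-cong (Matching.ver (matching k₂ l₂)) (cong₂ _-_ (yq u) (yN u)) ,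
          bit-cong (Matching.ver (matching k₂ l₁)) (cong₂ _-_ (yS u) (yq u))
          where
          open Valid valid
          e₁ : ∀ W u m → + 1 - ((u - m) - (W - (m + + 1))) ≡ W - u
          e₁ = solve-∀
          e₂ : ∀ u W m → (u - m) - (W - m) ≡ u - W
          e₂ = solve-∀

        φ₁ φ₂ : Mono → ℤ
        φ₁ n = ⟨ ψ 1 n , φ ⟩
        φ₂ n = ⟨ mono n *ₚ B , φ ⟩

        Goal : Set
        Goal = ∑ (range q) (λ v → if does (checked? σ (y ↦ v)) then φ₁ (weight σ (y ↦ v) ts) else + 0) ≡
               ∑ (range q) (λ v → if does (checked? σ' (y ↦ v)) then φ₂ (weight σ' (y ↦ v) ts) else + 0)

        module _ (σ₁ : Field) (σ₁-off : ∀ i j → ¬ ((i , j) ≡ q) → σ₁ i j ≡ σ i j) (v₁ : ℤ) (valid₁ : Valid σ₁ (y ↦ v₁)) where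

          module Upper u = Revalue {k₀} {ℓ₀} {σ₁} {y ↦ v₁} {σ} {y ↦ u} valid₁ σ₁-off (↦-off v₁ u)
          module Lower u = Revalue {k₀} {ℓ₀} {σ₁} {y ↦ v₁} {σ'} {y ↦ u} valid₁ (λ i j ne → trans (σ₁-off i j ne) (σ-off i j ne)) (↦-off v₁ u)
          module UpperN u = Upper.Neighbours u m σE σN σW σS
          module LowerN u = Lower.Neighbours u m east north west south

          high-valid : ∀ u → High E W N S u → Valid σ (y ↦ u)
          high-valid u (bE , bW , bN , bS) = UpperN.high u σ-on
            (bit-cong bE (sym (cong₂ _-_ (yq u) (yE u)))) (bit-cong bW (sym (cong₂ _-_ (yq u) (yW u))))
            (bit-cong bN (sym (cong₂ _-_ (yq u) (yN u)))) (bit-cong bS (sym (cong₂ _-_ (yS u) (yq u))))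

          low-valid : ∀ u → Low E W N S u → Valid σ' (y ↦ u)
          low-valid u (bE , bW , bN , bS) = LowerN.low u refl
            (bit-cong bE (sym (cong₂ _-_ (yE u) (yq u)))) (bit-cong bW (sym (cong₂ _-_ (yW u) (yq u))))
            (bit-cong bN (sym (cong₂ _-_ (yq u) (yN u)))) (bit-cong bS (sym (cong₂ _-_ (yS u) (yq u))))

          around : Fibre E W N S
          around = fibre (bit-cong (UpperN.S-E v₁) (cong₂ _-_ (yS v₁) (yE v₁))) (bit-cong (UpperN.S-W v₁) (cong₂ _-_ (yS v₁) (yW v₁)))
                         (bit-cong (UpperN.E-N v₁) (cong₂ _-_ (yE v₁) (yN v₁))) (bit-cong (UpperN.W-N v₁) (cong₂ _-_ (yW v₁) (yN v₁)))

          P : ℤ → Set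
          P u = Checked σ (y ↦ u)
          P' : ℤ → Set
          P' u = Checked σ' (y ↦ u)

          P-high : ∀ u → P u → High E W N S u
          P-high u p = valid-high u (checked⇒valid under (update-off q∈ off) p)
          P'-low : ∀ u → P' u → Low E W N S u
          P'-low u p = valid-low u (checked⇒valid under' (update-off q∈ off) p)

          high∈ : ∀ u → High E W N S u → u ∈ range q
          high∈ u h = subst (_∈ range q) (yq u) (in-range under (high-valid u h) k₂ l₂)
          low∈ : ∀ u → Low E W N S u → u ∈ range q
          low∈ u h = subst (_∈ range q) (yq u) (in-range under' (low-valid u h) k₂ l₂)

          exponent : ∀ u {e} → E + W - N - S ≡ e → expo (weight σ (y ↦ u) ts) X ≡ e
          exponent u eq = trans (expo-face (Under.surface under) unique (y ↦ u) (proj₁ (proj₂ (proj₂ (proj₂ near)))))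
            (trans (κ₉-maximum m σ-on σE σN σW σS) (trans (cong₂ _-_ (cong₂ _-_ (cong₂ _+_ (yE u) (yW u)) (yN u)) (yS u)) eq))

          module Exchange v v' {A C : ℤ} (at-exponents : Exponents-at E W N S v v' A C) where
            open Exponents-at at-exponents

            change : ∀ i j → (y ↦ v) i j ≡ (y ↦ v') i j + (v - v') * (ι k₂ i * ι l₂ j)
            change i j with (i , j) ≟ᶠ q
            ... | yes refl = trans (l v v') (+-congˡ v' (sym (trans (cong ((v - v') *_) ι-on) (*-identityʳ (v - v')))))
              where
              l : ∀ v v' → v ≡ v' + (v - v')
              l = solve-∀
            ... | no ne = sym (trans (+-congˡ (y i j) (trans (cong ((v - v') *_) (ι-off i j ne)) (*-zeroʳ (v - v')))) (+-identityʳ _))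

            open WeightFlip flip {y ↦ v} {y ↦ v'} (v - v') change A C
              (trans A≡ (sym (cong₂ _-_ (cong₂ _-_ (cong (λ t → + 2 * t + (v - v')) (yq v')) (yE v')) (yW v'))))
              (trans C≡ (sym (cong₂ _-_ (cong₂ _+_ (yN v') (yS v')) (cong (λ t → + 2 * t + (v - v')) (yq v')))))
              unique near

            exchanged : ∀ w → expo (weight σ (y ↦ v) ts) w ≡
              expo (weight σ' (y ↦ v') ts) w + (A * expo β₁ w + C * expo β₂ w + - + 2 * (A + C) * at (X , + 1) w)
            exchanged w = trans (exponents weight-flip w) (trans (expo-++ (weight σ' (y ↦ v') ts) exchange w) (+-congˡ (expo (weight σ' (y ↦ v') ts) w)
              (trans (cong₂ _+_ (scale-entry (x k₃ l₂) C w) (cong₂ _+_ (scale-entry (x k₁ l₂) C w) (cong₂ _+_ (scale-entry (x k₂ l₃) A w) (cong₂ _+_ (scale-entry (x k₂ l₁) A w)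
                (cong₂ _+_ (scale-entry X (- + 2 * (A + C)) w) (cong₂ _+_ (scale-entry La A w) (cong₂ _+_ (scale-entry Lb C w) (cong₂ _+_ (scale-entry Lc A w)
                (cong₂ _+_ (scale-entry Ld C w) refl)))))))))
              (collect A C (at (x k₃ l₂ , + 1) w) (at (x k₁ l₂ , + 1) w) (at (x k₂ l₃ , + 1) w) (at (x k₂ l₁ , + 1) w) (at (X , + 1) w)
                (at (La , + 1) w) (at (Lb , + 1) w) (at (Lc , + 1) w) (at (Ld , + 1) w)))))
              where
              collect : ∀ A C e₁ e₂ e₃ e₄ e₅ e₆ e₇ e₈ e₉ →
                C * e₁ + (C * e₂ + (A * e₃ + (A * e₄ + (- + 2 * (A + C) * e₅ + (A * e₆ + (C * e₇ + (A * e₈ + (C * e₉ + + 0)))))))) ≡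
                A * (e₆ + (e₈ + (e₃ + (e₄ + + 0)))) + C * (e₇ + (e₉ + (e₁ + (e₂ + + 0)))) + - + 2 * (A + C) * e₅
              collect = solve-∀

          X-power : ∀ n e w → expo (n ++ (X , e) ∷ []) w ≡ expo n w + e * at (X , + 1) w
          X-power n e w = trans (expo-++ n _ w) (+-congˡ (expo n w) (trans (+-identityʳ _) (scale-entry X e w)))

          split-goal : Goal
          split-goal with around
          ... | one v v' hv only lv' only' at-exponents κ≡ = trans
              (∑-one (λ u → checked? σ (y ↦ u)) (range! q) (λ u → φ₁ (weight σ (y ↦ u) ts)) (high∈ v hv) (valid⇒checked (high-valid v hv)) (λ u p → only u (P-high u p)))
              (trans (on (fibre-one (exponent v κ≡) (same-expo λ w → trans (exchanged w) (l (expo (weight σ' (y ↦ v') ts) w) (expo β₁ w) (expo β₂ w) (at (X , + 1) w)))) r)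
              (sym (∑-one (λ u → checked? σ' (y ↦ u)) (range! q) (λ u → φ₂ (weight σ' (y ↦ u) ts)) (low∈ v' lv') (valid⇒checked (low-valid v' lv')) (λ u p → only' u (P'-low u p)))))
            where
            open Exchange v v' at-exponents
            l : ∀ n b₁ b₂ e → n + (+ 0 * b₁ + + 0 * b₂ + - + 2 * (+ 0 + + 0) * e) ≡ n
            l = solve-∀
          ... | merge v w v' v≢w hv hw only lv' only' at-v at-w κ≡ = trans
              (∑-two (λ u → checked? σ (y ↦ u)) (range! q) (λ u → φ₁ (weight σ (y ↦ u) ts)) (high∈ v hv) (high∈ w hw) v≢w (valid⇒checked (high-valid v hv)) (valid⇒checked (high-valid w hw)) (λ u p → only u (P-high u p)))
              (trans (trans (sym (+-action (ψ 1 mv) (ψ 1 mw) φ)) (on (fibre-merge {mv} {mw} {m'} (exponent v κ≡) (exponent w κ≡)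
                  (same-expo λ t → trans (X-power mv (+ 2) t) (trans (cong (_+ + 2 * at (X , + 1) t) (EV.exchanged t)) (trans (l (expo m' t) (expo β₁ t) (expo β₂ t) (at (X , + 1) t)) (sym (expo-++ m' β₂ t)))))
                  (same-expo λ t → trans (X-power mw (+ 2) t) (trans (cong (_+ + 2 * at (X , + 1) t) (EW.exchanged t)) (trans (l' (expo m' t) (expo β₁ t) (expo β₂ t) (at (X , + 1) t)) (sym (expo-++ m' β₁ t)))))) r))
              (sym (∑-one (λ u → checked? σ' (y ↦ u)) (range! q) (λ u → φ₂ (weight σ' (y ↦ u) ts)) (low∈ v' lv') (valid⇒checked (low-valid v' lv')) (λ u p → only' u (P'-low u p)))))
            where
            module EV = Exchange v v' at-v
            module EW = Exchange w v' at-w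
            mv mw m' : Mono
            mv = weight σ (y ↦ v) ts
            mw = weight σ (y ↦ w) ts
            m' = weight σ' (y ↦ v') ts
            l : ∀ n b₁ b₂ e → n + (+ 0 * b₁ + + 1 * b₂ + - + 2 * (+ 0 + + 1) * e) + + 2 * e ≡ n + b₂
            l = solve-∀
            l' : ∀ n b₁ b₂ e → n + (+ 1 * b₁ + + 0 * b₂ + - + 2 * (+ 1 + + 0) * e) + + 2 * e ≡ n + b₁
            l' = solve-∀
          ... | split v v' w' v'≢w' hv only lv' lw' only' at-v' at-w' κ≡ = trans
              (∑-one (λ u → checked? σ (y ↦ u)) (range! q) (λ u → φ₁ (weight σ (y ↦ u) ts)) (high∈ v hv) (valid⇒checked (high-valid v hv)) (λ u p → only u (P-high u p)))
              (trans (trans (on (fibre-split {mv} {m'} {n'} (exponent v κ≡)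
                  (same-expo λ t → trans (expo-++ (mv ++ (X , -[1+ 1 ]) ∷ []) β₁ t) (trans (cong (_+ expo β₁ t) (trans (X-power mv -[1+ 1 ] t) (cong (_+ -[1+ 1 ] * at (X , + 1) t) (EV.exchanged t)))) (l (expo m' t) (expo β₁ t) (expo β₂ t) (at (X , + 1) t))))
                  (same-expo λ t → trans (expo-++ (mv ++ (X , -[1+ 1 ]) ∷ []) β₂ t) (trans (cong (_+ expo β₂ t) (trans (X-power mv -[1+ 1 ] t) (cong (_+ -[1+ 1 ] * at (X , + 1) t) (EW.exchanged t)))) (l' (expo n' t) (expo β₁ t) (expo β₂ t) (at (X , + 1) t))))) r)
                (+-action (mono m' *ₚ B) (mono n' *ₚ B) φ))
              (sym (∑-two (λ u → checked? σ' (y ↦ u)) (range! q) (λ u → φ₂ (weight σ' (y ↦ u) ts)) (low∈ v' lv') (low∈ w' lw') v'≢w' (valid⇒checked (low-valid v' lv')) (valid⇒checked (low-valid w' lw')) (λ u p → only' u (P'-low u p)))))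
            where
            module EV = Exchange v v' at-v'
            module EW = Exchange v w' at-w'
            mv m' n' : Mono
            mv = weight σ (y ↦ v) ts
            m' = weight σ' (y ↦ v') ts
            n' = weight σ' (y ↦ w') ts
            l : ∀ n b₁ b₂ e → n + (-[1+ 0 ] * b₁ + + 0 * b₂ + - + 2 * (-[1+ 0 ] + + 0) * e) + -[1+ 1 ] * e + b₁ ≡ n
            l = solve-∀
            l' : ∀ n b₁ b₂ e → n + (+ 0 * b₁ + -[1+ 0 ] * b₂ + - + 2 * (+ 0 + -[1+ 0 ]) * e) + -[1+ 1 ] * e + b₂ ≡ n
            l' = solve-∀

      local : Goal
      local with Any.any? (λ v → checked? σ (y ↦ v)) (range q) | Any.any? (λ v → checked? σ' (y ↦ v)) (range q)
      ... | yes some | _ with find some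
      ...   | v₁ , _ , checked = split-goal σ (λ _ _ _ → refl) v₁ (checked⇒valid under (update-off q∈ off) checked)
      local | no _ | yes some with find some
      ...   | v₁ , _ , checked = split-goal σ' (λ i j ne → sym (σ-off i j ne)) v₁ (checked⇒valid under' (update-off q∈ off) checked)
      local | no none | no none' = trans (empty none φ₁) (sym (empty none' φ₂))
        where
        empty : ∀ {σ} → ¬ Any.Any (λ v → Checked σ (y ↦ v)) (range q) → ∀ φ →
                ∑ (range q) (λ v → if does (checked? σ (y ↦ v)) then φ (weight σ (y ↦ v) ts) else + 0) ≡ + 0
        empty {σ} none φ = ∑-vanish (range q) _ λ u u∈ → cong (λ t → if t then φ (weight σ (y ↦ u) ts) else + 0) (dec-false (checked? σ (y ↦ u)) λ p → none (lose u∈ p))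

    flip-sum : Ψ 1 (F σ) ≋ F σ' *ₚ B
    flip-sum = pointwise λ {φ} r → trans (Ψ-action 1 (F σ) φ) (trans (F-action σ _)
      (trans (fibrewise q Q y₀ q∈ uniqueQ (λ p∈ → p∈) y₀-off (respects-if σ (λ n → ⟨ ψ 1 n , φ ⟩)) (respects-if σ' (λ n → ⟨ mono n *ₚ B , φ ⟩))
                (λ y off → AtConfiguration.local y off r))
      (trans (sym (F-action σ' (λ n → ⟨ mono n *ₚ B , φ ⟩)))
      (trans (⟨⟩-cong (F σ') λ n → trans (*-action (mono n) B φ) (mono-action n _)) (sym (*-action (F σ') B φ))))))
 

-- The extreme cases: the surface is the cone, or the flip lies outside it

second-difference : ∀ e → pos (↑ (↑ e)) - pos (↑ e) - (pos (↑ e) - pos e) ≡ ι -[1+ 0 ] e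
second-difference (+ n) = l (+ n)
  where
  l : ∀ n → n + + 1 + + 1 - (n + + 1) - (n + + 1 - n) ≡ + 0
  l = solve-∀
second-difference -[1+ 0 ] = refl
second-difference -[1+ 1 ] = refl
second-difference -[1+ suc (suc n) ] = refl

ι-difference : ∀ i m → ι -[1+ 0 ] (i - ↑ m) ≡ ι m i
ι-difference i m with i ≟ m
... | yes refl = cong (ι -[1+ 0 ]) (l i)
  where
  l : ∀ i → i - (i + + 1) ≡ -[1+ 0 ]
  l = solve-∀
... | no ne = ι-other λ eq → ne (≡-by eq (l i m))
  where
  l : ∀ i m → i - m ≡ i - (m + + 1) - -[1+ 0 ]
  l = solve-∀

second-difference-at : ∀ i i₀ → pos (↑ (↑ i) - i₀) - pos (↑ i - i₀) - (pos (↑ i - i₀) - pos (i - i₀)) ≡ ι (i₀ - + 1) i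
second-difference-at i i₀ = trans (cong₂ (λ p q → p - q - (q - pos (i - i₀))) (cong pos (e₂ i i₀)) (cong pos (e₁ i i₀)))
  (trans (second-difference (i - i₀)) (trans (cong (ι -[1+ 0 ]) (e₃ i i₀)) (ι-difference i (i₀ - + 1))))
  where
  e₁ : ∀ i i₀ → (i + + 1) - i₀ ≡ (i - i₀ + + 1)
  e₁ = solve-∀
  e₂ : ∀ i i₀ → ((i + + 1) + + 1) - i₀ ≡ ((i - i₀ + + 1) + + 1)
  e₂ = solve-∀
  e₃ : ∀ i i₀ → i - i₀ ≡ i - (i₀ - + 1 + + 1)
  e₃ = solve-∀

κ₉-cone : ∀ z₀ z₁ z₂ y₀ y₁ y₂ {w₀₀ w₂₀ w₀₂ w₂₂ s00 s20 s02 s22} →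
  (z₁ - z₀ - (y₀ - y₁)) * (w₀₀ - y₀) ≡ + 0 → (+ 1 - (z₂ - z₁) - (y₀ - y₁)) * (w₂₀ - y₀) ≡ + 0 →
  (z₁ - z₀ + (y₁ - y₂) - + 1) * (w₀₂ - y₂) ≡ + 0 → (y₁ - y₂ - (z₂ - z₁)) * (w₂₂ - y₂) ≡ + 0 →
  κ₉ s00 (y₀ - z₁) s20 (y₁ - z₀) (y₁ - z₁) (y₁ - z₂) s02 (y₂ - z₁) s22 w₀₀ y₀ w₂₀ y₁ y₁ y₁ w₀₂ y₂ w₂₂ ≡ (z₂ - z₁ - (z₁ - z₀)) * (y₁ - y₂ - (y₀ - y₁))
κ₉-cone z₀ z₁ z₂ y₀ y₁ y₂ {w₀₀} {w₂₀} {w₀₂} {w₂₂} {s00} {s20} {s02} {s22} e₀₀ e₂₀ e₀₂ e₂₂ =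
  trans expand (trans (cong₂ (λ p q → (z₂ - z₁ - (z₁ - z₀)) * (y₁ - y₂ - (y₀ - y₁)) + (p + q)) (cong₂ _+_ e₀₀ e₂₀) (cong₂ _+_ e₀₂ e₂₂)) (+-identityʳ _))
  where
  expand : κ₉ s00 (y₀ - z₁) s20 (y₁ - z₀) (y₁ - z₁) (y₁ - z₂) s02 (y₂ - z₁) s22 w₀₀ y₀ w₂₀ y₁ y₁ y₁ w₀₂ y₂ w₂₂ ≡
    (z₂ - z₁ - (z₁ - z₀)) * (y₁ - y₂ - (y₀ - y₁)) +
    ((z₁ - z₀ - (y₀ - y₁)) * (w₀₀ - y₀) + (+ 1 - (z₂ - z₁) - (y₀ - y₁)) * (w₂₀ - y₀) +
     ((z₁ - z₀ + (y₁ - y₂) - + 1) * (w₀₂ - y₂) + (y₁ - y₂ - (z₂ - z₁)) * (w₂₂ - y₂)))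
  expand = sym (κ₉-≡ s00 (y₀ - z₁) s20 (y₁ - z₀) (y₁ - z₁) (y₁ - z₂) s02 (y₂ - z₁) s22 w₀₀ y₀ w₂₀ y₁ y₁ y₁ w₀₂ y₂ w₂₂ (λ κ → κ) (sym (cone-identity y₁ z₂ z₁ z₀ y₂ y₀ w₂₂ w₀₂ w₂₀ w₀₀)))

κ₉-cong : ∀ {s00 s10 s20 s01 s11 s21 s02 s12 s22 y00 y10 y20 y01 y11 y21 y02 y12 y22 t10 t01 t11 t21 t12 z10 z01 z11 z21 z12} →
  s10 ≡ t10 → s01 ≡ t01 → s11 ≡ t11 → s21 ≡ t21 → s12 ≡ t12 → y10 ≡ z10 → y01 ≡ z01 → y11 ≡ z11 → y21 ≡ z21 → y12 ≡ z12 →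
  κ₉ s00 s10 s20 s01 s11 s21 s02 s12 s22 y00 y10 y20 y01 y11 y21 y02 y12 y22 ≡
  κ₉ s00 t10 s20 t01 t11 t21 s02 t12 s22 y00 z10 y20 z01 z11 z21 y02 z12 y22
κ₉-cong refl refl refl refl refl refl refl refl refl refl = refl

zero-product : ∀ {p q} → p ≡ + 0 ⊎ q ≡ + 0 → p * q ≡ + 0
zero-product (inj₁ refl) = refl
zero-product {p} (inj₂ refl) = *-zeroʳ p

difference-or-sum : ∀ {p q} → Bit p → Bit q → p - q ≡ + 0 ⊎ p + q ≡ + 1
difference-or-sum bp bq with bit-split bp | bit-split bq
... | inj₁ refl | inj₁ refl = inj₁ refl
... | inj₁ refl | inj₂ refl = inj₂ refl
... | inj₂ refl | inj₁ refl = inj₂ refl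
... | inj₂ refl | inj₂ refl = inj₁ refl

module Extremes (win : Window) (ν i₀ j₀ : ℤ) (floor : Field) where
  open Window win
  open Target ν i₀ j₀
  open Series win ν i₀ j₀ floor
  open Configurations range
  open Agreement Q y₀

  private
    concentrate : ∀ ps y {g} → (∀ {p} → p ∈ ps → p ∈ Q) → Unique ps → y ≐ y₀ → Respects g → (∀ y' i j → Off y' → ¬ (y' i j ≡ Y j) → g y' ≡ + 0) → ∑ (configs ps y) g ≡ g y₀
    concentrate [] y ps⊆ uniq eq inv vanishes = trans (+-identityʳ _) (inv eq)
    concentrate (p@(i , j) ∷ ps) y {g} ps⊆ (fresh ∷ uniq) eq inv vanishes = trans (∑-configs-∷ p ps y g) (trans
      (∑-single (range! p) (subst (_∈ range p) (+-identityʳ (Y j)) (∈-map⁺ (λ n → Y j - + n) (∈-upTo⁺ (ℕ.s≤s ℕ.z≤n)))) _ λ v _ ne →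
        ∑-vanish (configs ps (update y p v)) g λ y' y'∈ → vanishes y' i j (configs-off ps (update y p v) (λ p∈ → ps⊆ (there p∈)) (update-off (ps⊆ (here refl)) (λ k l _ → eq k l)) y'∈) λ e →
          ne (trans (sym (trans (configs-keep p ps (update y p v) (λ p∈ → All.lookup fresh p∈ refl) y'∈) (update-same y p v))) e))
      (concentrate ps (update y p (Y j)) (λ p∈ → ps⊆ (there p∈)) uniq still inv vanishes))
      where
      still : update y p (Y j) ≐ y₀
      still k l with (k , l) ≟ᶠ p
      ... | yes refl = refl
      ... | no _ = eq k l

  κ-cone : ∀ i j → κ cone y₀ i j ≡ ι (i₀ - + 1) i * ι (j₀ - + 1) j
  κ-cone i j = trans (κ₉-cone (Z i) (Z (↑ i)) (Z (↑ (↑ i))) (Y j) (Y (↑ j)) (Y (↑ (↑ j)))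
      (self (Z (↑ i) - Z i - (Y j - Y (↑ j))) (Y j)) (self (+ 1 - (Z (↑ (↑ i)) - Z (↑ i)) - (Y j - Y (↑ j))) (Y j))
      (self (Z (↑ i) - Z i + (Y (↑ j) - Y (↑ (↑ j))) - + 1) (Y (↑ (↑ j)))) (self (Y (↑ j) - Y (↑ (↑ j)) - (Z (↑ (↑ i)) - Z (↑ i))) (Y (↑ (↑ j)))))
    (cong₂ _*_ (trans (l₁ (pos (i - i₀)) (pos (↑ i - i₀)) (pos (↑ (↑ i) - i₀)) ν) (second-difference-at i i₀))
               (trans (l₂ (pos (j - j₀)) (pos (↑ j - j₀)) (pos (↑ (↑ j) - j₀))) (second-difference-at j j₀)))
    where
    self : ∀ p q → p * (q - q) ≡ + 0
    self = solve-∀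
    l₁ : ∀ z₀ z₁ z₂ ν → z₂ - ν - (z₁ - ν) - (z₁ - ν - (z₀ - ν)) ≡ z₂ - z₁ - (z₁ - z₀)
    l₁ = solve-∀
    l₂ : ∀ z₀ z₁ z₂ → - z₁ - - z₂ - (- z₀ - - z₁) ≡ z₂ - z₁ - (z₁ - z₀)
    l₂ = solve-∀

  weight-cone : (i₀ , j₀) ∈ Q → weight cone y₀ ts ≃ (x i₀ j₀ , + 1) ∷ []
  weight-cone p∈ = same-expo λ v → trans (expo-weight cone y₀ ts v) (trans (cong₂ _+_ (faces v)
      (cong₂ _+_ (∑-vanish ts _ λ { (i , j) _ → a-zero i j v }) (cong₂ _+_ (∑-vanish ts _ λ { (i , j) _ → b-zero i j v })
      (cong₂ _+_ (∑-vanish ts _ λ { (i , j) _ → c-zero i j v }) (∑-vanish ts _ λ { (i , j) _ → d-zero i j v })))))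
    refl)
    where
    i₋ j₋ : ℤ
    i₋ = i₀ - + 1
    j₋ = j₀ - + 1
    i≡ : ↑ i₋ ≡ i₀
    i≡ = sym (pred-↑ i₀)
    j≡ : ↑ j₋ ≡ j₀
    j≡ = sym (pred-↑ j₀)
    faces : ∀ v → ∑ ts (λ t → at (face cone y₀ t) v) ≡ at (x i₀ j₀ , + 1) v
    faces v = trans (∑-cong ts λ { (i , j) → cong (λ e → at (x (↑ i) (↑ j) , e) v) (trans (κ-cone i j) (sym (*-identityˡ _))) })
      (trans (∑-ι unique (margin₁₁ (subst₂ (λ i j → (i , j) ∈ Q) (sym i≡) (sym j≡) p∈)) (λ t → x (↑ (proj₁ t)) (↑ (proj₂ t))) (+ 1) v)
             (cong₂ (λ i j → at (x i j , + 1) v) i≡ j≡))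
    entry : ∀ w {e} v → e ≡ + 0 → at (w , e) v ≡ + 0
    entry w v refl = at-0 w v
    b-zero′ : ∀ {e} → Bit e → (+ 1 - e) * e ≡ + 0
    b-zero′ be with bit-split be
    ... | inj₁ refl = refl
    ... | inj₂ refl = refl
    a-zero : ∀ i j v → at (a-edge cone y₀ (i , j)) v ≡ + 0
    a-zero i j v = entry (proj₁ (a-edge cone y₀ (i , j))) v (l (cone i j - cone (↑ i) j) (Y j))
      where
      l : ∀ s y → (+ 1 - s) * (y - y) ≡ + 0
      l = solve-∀
    c-zero : ∀ i j v → at (c-edge cone y₀ (i , j)) v ≡ + 0
    c-zero i j v = entry (proj₁ (c-edge cone y₀ (i , j))) v (l (cone i j - cone (↑ i) j) (Y j))
      where
      l : ∀ s y → s * (y - y) ≡ + 0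
      l = solve-∀
    b-zero : ∀ i j v → at (b-edge cone y₀ (i , j)) v ≡ + 0
    b-zero i j v = entry (proj₁ (b-edge cone y₀ (i , j))) v (trans (l (Y j) (Y (↑ j)) (Z i)) (b-zero′ (Y-step j)))
      where
      l : ∀ p q z → (+ 1 - (p - z - (q - z))) * (p - q) ≡ (+ 1 - (p - q)) * (p - q)
      l = solve-∀
    d-zero : ∀ i j v → at (d-edge cone y₀ (i , j)) v ≡ + 0
    d-zero i j v = entry (proj₁ (d-edge cone y₀ (i , j))) v (trans (l (Y j) (Y (↑ j)) (Z i)) (b-zero′ (Y-step j)))
      where
      l : ∀ p q z → (p - z - (q - z)) * (+ 1 + q - p) ≡ (+ 1 - (p - q)) * (p - q)
      l = solve-∀

  F-cone : (i₀ , j₀) ∈ Q → ∀ {σ} → Under σ → σ ≐ cone → F σ ≋ mono ((x i₀ j₀ , + 1) ∷ [])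
  F-cone p∈ {σ} under eq = ≋-trans (F-cong eq) (pointwise λ {φ} r → trans (F-action cone φ) (trans
    (concentrate Q y₀ (λ p∈ → p∈) uniqueQ (λ i j → refl) (respects-if cone φ) (off-vanishes φ))
    (trans (cong (λ t → if t then φ (weight cone y₀ ts) else + 0) (dec-true (checked? cone y₀) (valid⇒checked cone-valid)))
    (trans (respects r (weight-cone p∈)) (sym (mono-action ((x i₀ j₀ , + 1) ∷ []) φ))))))
    where
    under-cone : Under cone
    under-cone = record
      { surface = cone-surface
      ; below = λ i j → by (nat {0}) (sym (+-inverseʳ (cone i j)))
      ; floored = λ i j → by (Under.floored under i j) (cong (λ t → t - floor i j) (eq i j))
      ; outside = λ i j _ → refl
      }
    off-vanishes : ∀ φ y' i j → Off y' → ¬ (y' i j ≡ Y j) → (if does (checked? cone y') then φ (weight cone y' ts) else + 0) ≡ + 0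
    off-vanishes φ y' i j off ne with checked? cone y'
    ... | no _ = refl
    ... | yes checked = ⊥-elim (ne (on-cone (checked⇒valid under-cone off checked) i j refl))

  module Outer {k l : ℤ} {σ : Field} (under : Under σ)
    (not-target : ¬ ((↑ (↑ k) , ↑ (↑ l)) ≡ (i₀ , j₀)))
    (at-q : σ (↑ (↑ k)) (↑ (↑ l)) ≡ cone (↑ (↑ k)) (↑ (↑ l)))
    (at-E : σ (↑ (↑ (↑ k))) (↑ (↑ l)) ≡ cone (↑ (↑ (↑ k))) (↑ (↑ l)))
    (at-W : σ (↑ k) (↑ (↑ l)) ≡ cone (↑ k) (↑ (↑ l)))
    (at-N : σ (↑ (↑ k)) (↑ (↑ (↑ l))) ≡ cone (↑ (↑ k)) (↑ (↑ (↑ l))))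
    (at-S : σ (↑ (↑ k)) (↑ l) ≡ cone (↑ (↑ k)) (↑ l))
    (at-SW : Z (↑ (↑ k)) - Z (↑ k) + (Y (↑ l) - Y (↑ (↑ l))) ≡ + 1 → σ (↑ k) (↑ l) ≡ cone (↑ k) (↑ l))
    (at-SE : Z (↑ (↑ (↑ k))) - Z (↑ (↑ k)) ≡ Y (↑ l) - Y (↑ (↑ l)) → σ (↑ (↑ (↑ k))) (↑ l) ≡ cone (↑ (↑ (↑ k))) (↑ l))
    (at-NW : Z (↑ (↑ k)) - Z (↑ k) ≡ Y (↑ (↑ l)) - Y (↑ (↑ (↑ l))) → σ (↑ k) (↑ (↑ (↑ l))) ≡ cone (↑ k) (↑ (↑ (↑ l))))
    (at-NE : Z (↑ (↑ (↑ k))) - Z (↑ (↑ k)) + (Y (↑ (↑ l)) - Y (↑ (↑ (↑ l)))) ≡ + 1 → σ (↑ (↑ (↑ k))) (↑ (↑ (↑ l))) ≡ cone (↑ (↑ (↑ k))) (↑ (↑ (↑ l))))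
    (inside : (↑ (↑ k) , ↑ (↑ l)) ∈ Q)
    where

    private
      k₁ k₂ k₃ l₁ l₂ l₃ : ℤ
      k₁ = ↑ k
      k₂ = ↑ k₁
      k₃ = ↑ k₂
      l₁ = ↑ l
      l₂ = ↑ l₁
      l₃ = ↑ l₂

      same-or : ∀ {p q} → Bit p → Bit q → p ≡ q ⊎ p + q ≡ + 1
      same-or bp bq = [ (λ eq → inj₁ (i-j≡0⇒i≡j _ _ eq)) , inj₂ ]′ (difference-or-sum bp bq)

      no-exponent : ∀ {y} → Valid σ y → κ σ y k₁ l₁ ≡ + 0
      no-exponent {y} valid = trans
        (κ₉-cong at-S at-W at-q at-E at-N (value at-S) (value at-W) (value at-q) (value at-E) (value at-N))
        (trans (κ₉-cone (Z k₁) (Z k₂) (Z k₃) (Y l₁) (Y l₂) (Y l₃)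
          (zero-product ([ (λ eq → inj₁ eq) , (λ eq → inj₂ (level (at-SW eq))) ]′ (difference-or-sum (Z-step k₁) (Y-step l₁))))
          (zero-product ([ (λ eq → inj₂ (level (at-SE eq))) , (λ eq → inj₁ (l₀ (Z k₃ - Z k₂) (Y l₁ - Y l₂) eq)) ]′ (same-or (Z-step k₂) (Y-step l₁))))
          (zero-product ([ (λ eq → inj₂ (level (at-NW eq))) , (λ eq → inj₁ (i≡j⇒i-j≡0 eq)) ]′ (same-or (Z-step k₁) (Y-step l₂))))
          (zero-product ([ (λ eq → inj₁ (trans (flipped (Y l₂ - Y l₃) (Z k₃ - Z k₂)) (cong -_ eq))) , (λ eq → inj₂ (level (at-NE eq))) ]′ (difference-or-sum (Z-step k₂) (Y-step l₂)))))
        (trans (cong₂ _*_ (trans (l₁′ (pos (k₁ - i₀)) (pos (k₂ - i₀)) (pos (k₃ - i₀)) ν) (second-difference-at k₁ i₀))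
                          (trans (l₂′ (pos (l₁ - j₀)) (pos (l₂ - j₀)) (pos (l₃ - j₀))) (second-difference-at l₁ j₀)))
               (away (k₁ ≟ i₀ - + 1) (l₁ ≟ j₀ - + 1))))
        where
        value : ∀ {i j} → σ i j ≡ cone i j → y i j ≡ Y j
        value {i} {j} = on-cone valid i j
        level : ∀ {i j} → σ i j ≡ cone i j → y i j - Y j ≡ + 0
        level {i} {j} eq = i≡j⇒i-j≡0 (value eq)
        l₀ : ∀ p q → p + q ≡ + 1 → + 1 - p - q ≡ + 0
        l₀ p q eq = trans (g p q) (cong (λ t → + 1 - t) eq)
          where
          g : ∀ p q → + 1 - p - q ≡ + 1 - (p + q)
          g = solve-∀
        flipped : ∀ p q → p - q ≡ - (q - p)
        flipped = solve-∀
        l₁′ : ∀ z₀ z₁ z₂ ν → z₂ - ν - (z₁ - ν) - (z₁ - ν - (z₀ - ν)) ≡ z₂ - z₁ - (z₁ - z₀)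
        l₁′ = solve-∀
        l₂′ : ∀ z₀ z₁ z₂ → - z₁ - - z₂ - (- z₀ - - z₁) ≡ z₂ - z₁ - (z₁ - z₀)
        l₂′ = solve-∀
        away : Dec (k₁ ≡ i₀ - + 1) → Dec (l₁ ≡ j₀ - + 1) → ι (i₀ - + 1) k₁ * ι (j₀ - + 1) l₁ ≡ + 0
        away (no ne) _ = zero-product (inj₁ (ι-other ne))
        away (yes _) (no ne) = zero-product {ι (i₀ - + 1) k₁} (inj₂ (ι-other ne))
        away (yes e) (yes e') = ⊥-elim (not-target (cong₂ _,_ (trans (cong ↑ e) (sym (pred-↑ i₀))) (trans (cong ↑ e') (sym (pred-↑ j₀)))))

    outer : ∀ β₁ β₂ → Substitution.Ψ (x k₂ l₂) β₁ β₂ 1 (F σ) ≋ F σ *ₚ Substitution.B (x k₂ l₂) β₁ β₂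
    outer β₁ β₂ = pointwise λ {φ} r → trans (Ψ-action 1 (F σ) φ) (trans
      (⟨⟩-cong-All (F σ) (F-terms (λ t → ⟨ ψ 1 (proj₂ t) , φ ⟩ ≡ ⟨ B , (λ m' → φ (proj₂ t ++ m')) ⟩) under λ {y} valid _ →
        trans (on (ψ-zero (trans (expo-face (Under.surface under) unique y (margin {k} {l} near₁ near₁ inside)) (no-exponent valid))) r)
              (trans (*-action (mono (weight σ y ts)) B φ) (mono-action (weight σ y ts) _))))
      (sym (*-action (F σ) B φ)))
      where
      open Substitution (x k₂ l₂) β₁ β₂
      open FibreSums (x k₂ l₂) β₁ β₂

-- The octahedron relation between the polynomials of different targets

min-left : ∀ {m n} → NN (n - m) → m ⊓ n ≡ m
min-left p = i≤j⇒i⊓j≡i (NN⇒≤ p)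

min-right : ∀ {m n} → NN (m - n) → m ⊓ n ≡ n
min-right p = i≥j⇒i⊓j≡j (NN⇒≤ p)

bit-min : ∀ p p' q q' → Bit (p - p') → Bit (q - q') → Bit (p ⊓ q - p' ⊓ q')
bit-min p p' q q' (u , v) (u' , v') with ≤-total p q | ≤-total p' q'
... | inj₁ le | inj₁ le' = bit-cong (u , v) (sym (cong₂ _-_ (i≤j⇒i⊓j≡i le) (i≤j⇒i⊓j≡i le')))
... | inj₂ ge | inj₂ ge' = bit-cong (u' , v') (sym (cong₂ _-_ (i≥j⇒i⊓j≡j ge) (i≥j⇒i⊓j≡j ge')))
... | inj₁ le | inj₂ ge' = bit-cong (by (u ⊕ ≤⇒NN ge') (telescope p p' q') , by (v' ⊕ ≤⇒NN le) (above p q q')) (sym (cong₂ _-_ (i≤j⇒i⊓j≡i le) (i≥j⇒i⊓j≡j ge')))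
  where
  telescope : ∀ p p' q' → p - p' + (p' - q') ≡ p - q'
  telescope = solve-∀
  above : ∀ p q q' → + 1 - (q - q') + (q - p) ≡ + 1 - (p - q')
  above = solve-∀
... | inj₂ ge | inj₁ le' = bit-cong (by (u' ⊕ ≤⇒NN le') (telescope q q' p') , by (v ⊕ ≤⇒NN ge) (above p q p')) (sym (cong₂ _-_ (i≥j⇒i⊓j≡j ge) (i≤j⇒i⊓j≡i le')))
  where
  telescope : ∀ p p' q' → p - p' + (p' - q') ≡ p - q'
  telescope = solve-∀
  above : ∀ p q p' → + 1 - (p - p') + (p - q) ≡ + 1 - (q - p')
  above = solve-∀

surface-min : ∀ {σ τ} → Surface σ → Surface τ → Surface (λ i j → σ i j ⊓ τ i j)
surface-min {σ} {τ} s t = record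
  { right = λ i j → bit-min (σ i j) (σ (↑ i) j) (τ i j) (τ (↑ i) j) (Surface.right s i j) (Surface.right t i j)
  ; up = λ i j → bit-min (σ i j) (σ i (↑ j)) (τ i j) (τ i (↑ j)) (Surface.up s i j) (Surface.up t i j)
  }

ι-zero : ∀ {k l i j} → ¬ ((i , j) ≡ (k , l)) → ι k i * ι l j ≡ + 0
ι-zero {k} {l} {i} {j} ne with i ≟ k | j ≟ l
... | yes refl | yes refl = ⊥-elim (ne refl)
... | yes _ | no _ = refl
... | no _ | _ = refl

ι-one : ∀ k l → ι k k * ι l l ≡ + 1
ι-one k l = cong₂ _*_ (ι-same k) (ι-same l)

module FlipSubstitution (k l m : ℤ) where
  open Binomial k l m
  open Substitution X β₁ β₂ public using (Ψ; B)

module Global (win : Window) (bottom : Field) where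
  open Window win

  Good : ℤ → ℤ → ℤ → Set
  Good ν i₀ j₀ = (i₀ , j₀) ∈ Q × (∀ i j → ¬ ((i , j) ∈ Q) → NN (bottom i j - Target.cone ν i₀ j₀ i j))

  record Above (η : Field) : Set where
    field
      surface : Surface η
      above : ∀ i j → NN (η i j - bottom i j)

  module For (ν i₀ j₀ : ℤ) where
    open Target ν i₀ j₀ public using (Z; Y; cone; cone-surface)

    clip : Field → Field
    clip η i j = η i j ⊓ cone i j

    open Series win ν i₀ j₀ (clip bottom) public

    F∞ : Field → Poly
    F∞ η = F (clip η)

    clipped : Good ν i₀ j₀ → ∀ {η} → Above η → Under (clip η)
    clipped (_ , good) {η} ab = record
      { surface = surface-min surface cone-surface
      ; below = λ i j → ≤⇒NN (i⊓j≤j (η i j) (cone i j))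
      ; floored = λ i j → ≤⇒NN (⊓-mono-≤ {bottom i j} {η i j} {cone i j} {cone i j} (NN⇒≤ (above i j)) ≤-refl)
      ; outside = λ i j out → min-right (by (above i j ⊕ good i j out) (telescope (η i j) (bottom i j) (cone i j)))
      }
      where
      open Above ab
      telescope : ∀ p q r → p - q + (q - r) ≡ p - r
      telescope = solve-∀

    F-top : Good ν i₀ j₀ → ∀ {η} → Above η → (∀ i j → NN (η i j - cone i j)) → F∞ η ≋ mono ((x i₀ j₀ , + 1) ∷ [])
    F-top good ab high = Extremes.F-cone win ν i₀ j₀ (clip bottom) (proj₁ good) (clipped good ab) (λ i j → min-right (high i j))

    cone-target : cone i₀ j₀ ≡ ν
    cone-target = trans (cong₂ (λ p q → - pos p - (pos q - ν)) (+-inverseʳ j₀) (+-inverseʳ i₀)) (l ν)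
      where
      l : ∀ ν → - + 0 - (+ 0 - ν) ≡ ν
      l = solve-∀

    module _ (good : Good ν i₀ j₀) {k l : ℤ} {η η' : Field} (ab : Above η) (ab' : Above η') (flip : Flip k l η η')
      (q∈ : (↑ (↑ k) , ↑ (↑ l)) ∈ Q) (reach : NN (ν - η i₀ j₀)) where

      private
        k₁ k₂ k₃ l₁ l₂ l₃ s : ℤ
        k₁ = ↑ k
        k₂ = ↑ k₁
        k₃ = ↑ k₂
        l₁ = ↑ l
        l₂ = ↑ l₁
        l₃ = ↑ l₂
        s = η' k₂ l₂
        open Flip flip
        open Surface (Above.surface ab)
        module C = Surface cone-surface

        off : ∀ i j → ¬ ((i , j) ≡ (k₂ , l₂)) → η i j ≡ η' i j
        off i j ne = trans (raise i j) (trans (+-congˡ (η' i j) (ι-zero ne)) (+-identityʳ _))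

        on-q : η k₂ l₂ ≡ s + + 1
        on-q = trans (raise k₂ l₂) (+-congˡ s (ι-one k₂ l₂))

        column≢ : ∀ {i j} → ¬ (i ≡ k₂) → ¬ ((i , j) ≡ (k₂ , l₂))
        column≢ ne eq = ne (cong proj₁ eq)

        row≢ : ∀ {i j} → ¬ (j ≡ l₂) → ¬ ((i , j) ≡ (k₂ , l₂))
        row≢ ne eq = ne (cong proj₂ eq)

        ηE : η k₃ l₂ ≡ s
        ηE = trans (off _ _ (column≢ ↑≢)) east
        ηN : η k₂ l₃ ≡ s
        ηN = trans (off _ _ (row≢ ↑≢)) north
        ηW : η k₁ l₂ ≡ s + + 1
        ηW = trans (off _ _ (column≢ λ eq → ↑≢ (sym eq))) west
        ηS : η k₂ l₁ ≡ s + + 1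
        ηS = trans (off _ _ (row≢ λ eq → ↑≢ (sym eq))) south

        inner : NN (cone k₂ l₂ - η k₂ l₂) → Flip k l (clip η) (clip η')
        inner p = record
          { raise = raised
          ; east = trans (trans (cong (_⊓ cone k₃ l₂) east) (min-left (by (p' ⊕ proj₂ (C.right k₂ l₂)) (e₁ (cone k₂ l₂) (cone k₃ l₂) s)))) (sym at-s)
          ; north = trans (trans (cong (_⊓ cone k₂ l₃) north) (min-left (by (p' ⊕ proj₂ (C.up k₂ l₂)) (e₁ (cone k₂ l₂) (cone k₂ l₃) s)))) (sym at-s)
          ; west = trans (trans (cong (_⊓ cone k₁ l₂) west) (min-left (by (p' ⊕ proj₁ (C.right k₁ l₂)) (e₂ (cone k₂ l₂) (cone k₁ l₂) s)))) (cong (_+ + 1) (sym at-s))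
          ; south = trans (trans (cong (_⊓ cone k₂ l₁) south) (min-left (by (p' ⊕ proj₁ (C.up k₂ l₁)) (e₂ (cone k₂ l₂) (cone k₂ l₁) s)))) (cong (_+ + 1) (sym at-s))
          }
          where
          p' : NN (cone k₂ l₂ - (s + + 1))
          p' = by p (cong (λ t → cone k₂ l₂ - t) on-q)
          e₁ : ∀ m m' s → m - (s + + 1) + (+ 1 - (m - m')) ≡ m' - s
          e₁ = solve-∀
          e₂ : ∀ m m' s → m - (s + + 1) + (m' - m) ≡ m' - (s + + 1)
          e₂ = solve-∀
          at-s : clip η' k₂ l₂ ≡ s
          at-s = min-left (by (p' ⊕ nat {1}) (e₃ (cone k₂ l₂) s))
            where
            e₃ : ∀ m s → m - (s + + 1) + + 1 ≡ m - s
            e₃ = solve-∀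
          raised : ∀ i j → clip η i j ≡ clip η' i j + ι k₂ i * ι l₂ j
          raised i j with (i , j) ≟ᶠ (k₂ , l₂)
          ... | yes refl = trans (min-left p) (trans on-q (sym (cong₂ _+_ at-s (ι-one k₂ l₂))))
          ... | no ne = trans (cong (_⊓ cone i j) (off i j ne)) (sym (trans (+-congˡ (clip η' i j) (ι-zero ne)) (+-identityʳ _)))

        module Far (far : NN (s - cone k₂ l₂)) where

          same : clip η ≐ clip η'
          same i j with (i , j) ≟ᶠ (k₂ , l₂)
          ... | no ne = cong (_⊓ cone i j) (off i j ne)
          ... | yes refl = trans (min-right (by (far ⊕ nat {1}) (trans (e s (cone k₂ l₂)) (cong (λ t → t - cone k₂ l₂) (sym on-q))))) (sym (min-right far))
            where
            e : ∀ s m → s - m + + 1 ≡ s + + 1 - m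
            e = solve-∀

          private
            e₀ : ∀ s ν → s - ν + (ν - (s + + 1)) ≡ -[1+ 0 ]
            e₀ = solve-∀
            e₁ : ∀ s m → s - m + + 1 ≡ s + + 1 - m
            e₁ = solve-∀
            e₂ : ∀ s m m' → s - m + (m - m') ≡ s - m'
            e₂ = solve-∀
            e₃ : ∀ s m m' → s - m + (+ 1 - (m' - m)) ≡ s + + 1 - m'
            e₃ = solve-∀
            e₄ : ∀ s y z y' z' t' {t} → t ≡ s + + 1 → z - z' + (y' - y) ≡ + 1 → s - (y - z) + (t' - t) ≡ t' - (y' - z')
            e₄ s y z y' z' t' {t} eq eq' = ≡-by (cong₂ _+_ (sym eq) eq') (identity₄₅ s y z t' t y' z')
            e₅ : ∀ s y z y' z' t' {t} → t ≡ s + + 1 → z' - z ≡ y' - y → s - (y - z) + (+ 1 - (t - t')) ≡ t' - (y' - z')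
            e₅ s y z y' z' t' {t} eq eq' = ≡-by (cong₂ _-_ (sym eq) eq') (identity₄₆ s y z t t' y' z')
            e₆ : ∀ s y z y' z' t' {t} → t ≡ s + + 1 → z - z' ≡ y - y' → s - (y - z) + (+ 1 - (t - t')) ≡ t' - (y' - z')
            e₆ s y z y' z' t' {t} eq eq' = ≡-by (cong₂ _+_ (sym eq) eq') (identity₄₇ s y z t t' y' z')
            e₇ : ∀ s y z y' z' t' {t} → t ≡ s → z' - z + (y - y') ≡ + 1 → s - (y - z) + (+ 1 - (t - t')) ≡ t' - (y' - z')
            e₇ s y z y' z' t' {t} eq eq' = ≡-by (cong₂ _-_ (sym eq) eq') (identity₄₈ s y z t t' y' z')

          open Extremes.Outer win ν i₀ j₀ (clip bottom) {k} {l} (clipped good ab)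
            (λ eq → absurd {k = 0} (far ⊕ reach) (trans (+-congˡ (s - cone k₂ l₂) (cong (λ t → ν - t) (trans (cong₂ η (sym (cong proj₁ eq)) (sym (cong proj₂ eq))) on-q)))
               (trans (cong (λ t → s - t + (ν - (s + + 1))) (trans (cong₂ cone (cong proj₁ eq) (cong proj₂ eq)) cone-target)) (e₀ s ν))))
            (min-right (by (far ⊕ nat {1}) (trans (e₁ s (cone k₂ l₂)) (cong (λ t → t - cone k₂ l₂) (sym on-q)))))
            (min-right (by (far ⊕ proj₁ (C.right k₂ l₂)) (trans (e₂ s (cone k₂ l₂) (cone k₃ l₂)) (cong (λ t → t - cone k₃ l₂) (sym ηE)))))
            (min-right (by (far ⊕ proj₂ (C.right k₁ l₂)) (trans (e₃ s (cone k₂ l₂) (cone k₁ l₂)) (cong (λ t → t - cone k₁ l₂) (sym ηW)))))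
            (min-right (by (far ⊕ proj₁ (C.up k₂ l₂)) (trans (e₂ s (cone k₂ l₂) (cone k₂ l₃)) (cong (λ t → t - cone k₂ l₃) (sym ηN)))))
            (min-right (by (far ⊕ proj₂ (C.up k₂ l₁)) (trans (e₃ s (cone k₂ l₂) (cone k₂ l₁)) (cong (λ t → t - cone k₂ l₁) (sym ηS)))))
            (λ eq → min-right (by (far ⊕ proj₁ (right k₁ l₁)) (e₄ s (Y l₂) (Z k₂) (Y l₁) (Z k₁) (η k₁ l₁) ηS eq)))
            (λ eq → min-right (by (far ⊕ proj₂ (right k₂ l₁)) (e₅ s (Y l₂) (Z k₂) (Y l₁) (Z k₃) (η k₃ l₁) ηS eq)))
            (λ eq → min-right (by (far ⊕ proj₂ (up k₁ l₂)) (e₆ s (Y l₂) (Z k₂) (Y l₃) (Z k₁) (η k₁ l₃) ηW eq)))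
            (λ eq → min-right (by (far ⊕ proj₂ (right k₂ l₃)) (e₇ s (Y l₂) (Z k₂) (Y l₃) (Z k₃) (η k₃ l₃) ηN eq)))
            q∈
            public

      substitution : FlipSubstitution.Ψ k l (η' (↑ (↑ k)) (↑ (↑ l))) 1 (F∞ η) ≋ FlipSubstitution.B k l (η' (↑ (↑ k)) (↑ (↑ l))) *ₚ F∞ η'
      substitution with sign-split (cone k₂ l₂ - η k₂ l₂)
      ... | inj₁ p = ≋-trans (transfer at-s (FlipSum.AtFace.flip-sum win ν i₀ j₀ (clip bottom) (inner p) (clipped good ab) (clipped good ab') q∈))
                             (*ₚ-comm (F∞ η') (FlipSubstitution.B k l s))
        where
        at-s : clip η' k₂ l₂ ≡ s
        at-s = min-left (by (p ⊕ nat {1}) (trans (cong (λ t → cone k₂ l₂ - t + + 1) on-q) (e₃ (cone k₂ l₂) s)))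
          where
          e₃ : ∀ m s → m - (s + + 1) + + 1 ≡ m - s
          e₃ = solve-∀
        transfer : ∀ {m n} → m ≡ n →
          FlipSubstitution.Ψ k l m 1 (F∞ η) ≋ F∞ η' *ₚ FlipSubstitution.B k l m →
          FlipSubstitution.Ψ k l n 1 (F∞ η) ≋ F∞ η' *ₚ FlipSubstitution.B k l n
        transfer refl h = h
      ... | inj₂ p = ≋-trans (Far.outer far (Binomial.β₁ k l s) (Binomial.β₂ k l s))
                     (≋-trans (*ₚ-comm (F∞ η) (FlipSubstitution.B k l s))
                     (*ₚ-congˡ (FlipSubstitution.B k l s) (F-cong (Far.same far))))
        where
        far : NN (s - cone k₂ l₂)
        far = by p (trans (cong (λ t → - + 1 - (cone k₂ l₂ - t)) on-q) (e (cone k₂ l₂) s))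
          where
          e : ∀ m s → - + 1 - (m - (s + + 1)) ≡ s - m
          e = solve-∀

-- Descending from the lowest surface above which the relation is trivial

bit-max : ∀ p p' q q' → Bit (p - p') → Bit (q - q') → Bit ((p ⊔ q) - (p' ⊔ q'))
bit-max p p' q q' (u , v) (u' , v') with ≤-total p q | ≤-total p' q'
... | inj₁ le | inj₁ le' = bit-cong (u' , v') (sym (cong₂ _-_ (i≤j⇒i⊔j≡j le) (i≤j⇒i⊔j≡j le')))
... | inj₂ ge | inj₂ ge' = bit-cong (u , v) (sym (cong₂ _-_ (i≥j⇒i⊔j≡i ge) (i≥j⇒i⊔j≡i ge')))
... | inj₁ le | inj₂ ge' = bit-cong (by (u ⊕ ≤⇒NN le) (telescope p p' q) , by (v' ⊕ ≤⇒NN ge') (below q q' p')) (sym (cong₂ _-_ (i≤j⇒i⊔j≡j le) (i≥j⇒i⊔j≡i ge')))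
  where
  telescope : ∀ p p' q → p - p' + (q - p) ≡ q - p'
  telescope = solve-∀
  below : ∀ q q' p' → + 1 - (q - q') + (p' - q') ≡ + 1 - (q - p')
  below = solve-∀
... | inj₂ ge | inj₁ le' = bit-cong (by (u' ⊕ ≤⇒NN ge) (telescope q q' p) , by (v ⊕ ≤⇒NN le') (below p p' q')) (sym (cong₂ _-_ (i≥j⇒i⊔j≡i ge) (i≤j⇒i⊔j≡j le')))
  where
  telescope : ∀ p p' q → p - p' + (q - p) ≡ q - p'
  telescope = solve-∀
  below : ∀ q q' p' → + 1 - (q - q') + (p' - q') ≡ + 1 - (q - p')
  below = solve-∀

surface-max : ∀ {σ τ} → Surface σ → Surface τ → Surface (λ i j → σ i j ⊔ τ i j)
surface-max {σ} {τ} s t = record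
  { right = λ i j → bit-max (σ i j) (σ (↑ i) j) (τ i j) (τ (↑ i) j) (Surface.right s i j) (Surface.right t i j)
  ; up = λ i j → bit-max (σ i j) (σ i (↑ j)) (τ i j) (τ i (↑ j)) (Surface.up s i j) (Surface.up t i j)
  }

pos-nonzero : ∀ e → ¬ (e ≡ + 0) → pos (e - + 1) ≡ pos e - + 1 ⊎ pos (e + + 1) ≡ pos e
pos-nonzero (+ 0) ne = ⊥-elim (ne refl)
pos-nonzero (+ suc n) _ = inj₁ refl
pos-nonzero -[1+ 0 ] _ = inj₂ refl
pos-nonzero -[1+ suc n ] _ = inj₂ refl

least : ∀ {A : Set} {P : A → Set} (P? : ∀ t → Dec (P t)) (f : A → ℤ) ts →
        (∀ t → t ∈ ts → ¬ P t) ⊎ (∃[ t ] t ∈ ts × P t × (∀ u → u ∈ ts → P u → f t ≤ f u))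
least P? f [] = inj₁ λ _ ()
least {P = P} P? f (t ∷ ts) with P? t | least P? f ts
... | no ¬p | inj₁ none = inj₁ λ { _ (here refl) → ¬p ; u (there u∈) → none u u∈ }
... | no ¬p | inj₂ (u , u∈ , p , small) = inj₂ (u , there u∈ , p , λ { _ (here refl) q → ⊥-elim (¬p q) ; w (there w∈) q → small w w∈ q })
... | yes p | inj₁ none = inj₂ (t , here refl , p , λ { _ (here refl) _ → ≤-refl ; w (there w∈) q → ⊥-elim (none w w∈ q) })
... | yes p | inj₂ (u , u∈ , q , small) with ≤-total (f t) (f u)
...   | inj₁ le = inj₂ (t , here refl , p , λ { _ (here refl) _ → ≤-refl ; w (there w∈) r → ≤-trans le (small w w∈ r) })
...   | inj₂ ge = inj₂ (u , there u∈ , q , λ { _ (here refl) _ → ge ; w (there w∈) r → small w w∈ r })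

-- Raising a surface at a local minimum
module Raise {η : Field} (surface : Surface η) (k l : ℤ)
  (east : η (↑ (↑ (↑ k))) (↑ (↑ l)) ≡ η (↑ (↑ k)) (↑ (↑ l))) (north : η (↑ (↑ k)) (↑ (↑ (↑ l))) ≡ η (↑ (↑ k)) (↑ (↑ l)))
  (west : η (↑ k) (↑ (↑ l)) ≡ η (↑ (↑ k)) (↑ (↑ l)) + + 1) (south : η (↑ (↑ k)) (↑ l) ≡ η (↑ (↑ k)) (↑ (↑ l)) + + 1) where
  open Surface surface

  raised : Field
  raised i j = η i j + ι (↑ (↑ k)) i * ι (↑ (↑ l)) j

  raise-flip : Flip k l raised η
  raise-flip = record { raise = λ i j → refl ; east = east ; north = north ; west = west ; south = south }

  private
    q : Face
    q = ↑ (↑ k) , ↑ (↑ l)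

  raised-off : ∀ {i j} → ¬ ((i , j) ≡ q) → raised i j ≡ η i j
  raised-off {i} {j} ne = trans (+-congˡ (η i j) (ι-zero ne)) (+-identityʳ _)

  raised-on : raised (↑ (↑ k)) (↑ (↑ l)) ≡ η (↑ (↑ k)) (↑ (↑ l)) + + 1
  raised-on = +-congˡ (η (↑ (↑ k)) (↑ (↑ l))) (ι-one (↑ (↑ k)) (↑ (↑ l)))

  raised-≥ : ∀ i j → NN (raised i j - η i j)
  raised-≥ i j with (i , j) ≟ᶠ q
  ... | yes refl = by (nat {1}) (trans (e (η i j)) (cong (λ t → t - η i j) (sym raised-on)))
    where
    e : ∀ s → + 1 ≡ s + + 1 - s
    e = solve-∀
  ... | no ne = by (nat {0}) (trans (sym (+-inverseʳ (η i j))) (cong (λ t → t - η i j) (sym (raised-off ne))))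

  raised-surface : Surface raised
  raised-surface = record { right = right′ ; up = up′ }
    where
    one′ : ∀ s → + 1 ≡ s + + 1 - s
    one′ = solve-∀
    right′ : ∀ i j → Bit (raised i j - raised (↑ i) j)
    right′ i j with (i , j) ≟ᶠ q | (↑ i , j) ≟ᶠ q
    ... | yes refl | _ = bit-cong bit1 (trans (one′ (η i j)) (sym (cong₂ _-_ raised-on (trans (raised-off (λ eq → ↑≢ (cong proj₁ eq))) east))))
    ... | no ne | no ne' = bit-cong (right i j) (sym (cong₂ _-_ (raised-off ne) (raised-off ne')))
    ... | no ne | yes eq with ↑-injective {i} {↑ k} (cong proj₁ eq) | cong proj₂ eq
    ...   | refl | refl = bit-cong bit0 (trans (sym (+-inverseʳ (η (↑ (↑ k)) (↑ (↑ l)) + + 1))) (sym (cong₂ _-_ (trans (raised-off ne) west) raised-on)))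
    up′ : ∀ i j → Bit (raised i j - raised i (↑ j))
    up′ i j with (i , j) ≟ᶠ q | (i , ↑ j) ≟ᶠ q
    ... | yes refl | _ = bit-cong bit1 (trans (one′ (η i j)) (sym (cong₂ _-_ raised-on (trans (raised-off (λ eq → ↑≢ (cong proj₂ eq))) north))))
    ... | no ne | no ne' = bit-cong (up i j) (sym (cong₂ _-_ (raised-off ne) (raised-off ne')))
    ... | no ne | yes eq with cong proj₁ eq | ↑-injective {j} {↑ l} (cong proj₂ eq)
    ...   | refl | refl = bit-cong bit0 (trans (sym (+-inverseʳ (η (↑ (↑ k)) (↑ (↑ l)) + + 1))) (sym (cong₂ _-_ (trans (raised-off ne) south) raised-on)))

module BinomialFacts (k l m : ℤ) where
  open Binomial k l m
  open Substitution X β₁ β₂ public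
  open FibreSums X β₁ β₂ public

  private
    k₂ l₂ : ℤ
    k₂ = ↑ (↑ k)
    l₂ = ↑ (↑ l)

  step : expo β₁ (x k₂ (↑ l₂)) ≡ expo β₂ (x k₂ (↑ l₂)) + + 1
  step = trans (cong₂ (λ p q → + 0 + (+ 0 + (p + (q + + 0)))) (at-same (x k₂ (↑ l₂)) (+ 1)) (at-other {x k₂ (↑ l)} {+ 1} λ eq → ↑↑≢ (sym (second eq))))
    (sym (cong₂ (λ p q → + 0 + (+ 0 + (p + (q + + 0))) + + 1) (at-other {x (↑ k₂) l₂} {+ 1} λ eq → ↑≢ (first eq)) (at-other {x (↑ k) l₂} {+ 1} λ eq → ↑≢ (sym (first eq)))))
    where
    first : ∀ {i j i' j'} → x i j ≡ x i' j' → i ≡ i'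
    first refl = refl
    second : ∀ {i j i' j'} → x i j ≡ x i' j' → j ≡ j'
    second refl = refl

  open Cancellation (x k₂ (↑ l₂)) step public

  B≋ : B ≋ mono β₁ +ₚ mono β₂
  B≋ = pointwise λ {φ} _ → trans (B-action φ) (sym (trans (+-action (mono β₁) (mono β₂) φ) (cong₂ _+_ (mono-action β₁ φ) (mono-action β₂ φ))))

  exchange-relation : ∀ {G} → Ψ 1 (mono ((X , + 1) ∷ [])) ≋ B *ₚ G → G *ₚ mono ((X , + 1) ∷ []) ≋ B
  exchange-relation {G} h = ≋-trans (*ₚ-cong G≋ ≋-refl) (≋-trans (*ₚ-assoc B (mono X⁻) (mono X⁺))
      (≋-trans (*ₚ-congˡ B (≋-trans (≋-sym (mono-++ X⁻ X⁺)) (≋-trans (mono-cong unit) one≋))) (laurent.*-identityʳ B)))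
    where
    X⁺ X⁻ : Mono
    X⁺ = (X , + 1) ∷ []
    X⁻ = (X , + 1) ∷ (X , -[1+ 1 ]) ∷ []
    exponent : expo X⁺ X ≡ + 1
    exponent = trans (+-identityʳ _) (at-same X (+ 1))
    unit : X⁻ ++ X⁺ ≃ []
    unit = same-expo λ v → balance v
      where
      balance : ∀ v → expo (X⁻ ++ X⁺) v ≡ + 0
      balance v with X =ᵥ v
      ... | true = refl
      ... | false = refl
    one≋ : mono [] ≋ oneₚ
    one≋ = pointwise λ {φ} _ → trans (mono-action [] φ) (sym (one-action φ))
    ψ≋ : ∀ {m} → expo m X ≡ + 1 → ψ 1 m ≋ mono (m ++ (X , -[1+ 1 ]) ∷ []) *ₚ (B *ₚ B)
    ψ≋ {m} eq rewrite eq = *ₚ-congˡ (mono (m ++ (X , -[1+ 1 ]) ∷ [])) (*ₚ-congˡ B (laurent.*-identityʳ B))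
    Ψ≋ : Ψ 1 (mono X⁺) ≋ ψ 1 X⁺
    Ψ≋ = pointwise λ {φ} r → trans (Ψ-action 1 (mono X⁺) φ) (mono-action X⁺ _)
    G≋ : G ≋ B *ₚ mono X⁻
    G≋ = cancel (≋-trans (≋-sym h) (≋-trans Ψ≋ (≋-trans (ψ≋ {X⁺} exponent) (≋-trans (*ₚ-comm (mono X⁻) (B *ₚ B)) (*ₚ-assoc B B (mono X⁻))))))

module Relation (win : Window) (bottom : Field) (k l ν : ℤ) where
  open Window win
  open Global win bottom

  private
    k₁ k₂ k₃ l₁ l₂ l₃ n : ℤ
    k₁ = ↑ k
    k₂ = ↑ k₁
    k₃ = ↑ k₂
    l₁ = ↑ l
    l₂ = ↑ l₁
    l₃ = ↑ l₂
    n = + 2 * ν + k₂ + l₂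
    module T = For ν k₂ l₂
    module T⁻ = For (ν - + 1) k₂ l₂
    module TE = For (ν - + 1) k₃ l₂
    module TW = For ν k₁ l₂
    module TN = For (ν - + 1) k₂ l₃
    module TS = For ν k₂ l₁

  e₁ e₂ : Mono
  e₁ = (a (k₂ + n - + 1) l₂ , + 1) ∷ (c (k₂ - n + + 1) l₂ , + 1) ∷ []
  e₂ = (b k₂ (l₂ + n - + 1) , + 1) ∷ (d k₂ (l₂ - n + + 1) , + 1) ∷ []

  Octahedron : Field → Set
  Octahedron η = T.F∞ η *ₚ T⁻.F∞ η ≋ (mono e₁ *ₚ (TN.F∞ η *ₚ TS.F∞ η)) +ₚ (mono e₂ *ₚ (TE.F∞ η *ₚ TW.F∞ η))

  module _ (good : Good ν k₂ l₂) (good⁻ : Good (ν - + 1) k₂ l₂) (goodE : Good (ν - + 1) k₃ l₂) (goodW : Good ν k₁ l₂)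
           (goodN : Good (ν - + 1) k₂ l₃) (goodS : Good ν k₂ l₁) where

    module Base {η : Field} (ab : Above η) (reach : NN (ν - + 1 - η k₂ l₂))
      (≥E : ∀ i j → NN (η i j - TE.cone i j)) (≥W : ∀ i j → NN (η i j - TW.cone i j))
      (≥N : ∀ i j → NN (η i j - TN.cone i j)) (≥S : ∀ i j → NN (η i j - TS.cone i j)) where
      open Above ab
      open Surface surface

      private
        at-p : η k₂ l₂ ≡ ν - + 1
        at-p = pin (by (≥E k₂ l₂) (cong (λ t → η k₂ l₂ - t) cone-E)) reach
          where
          cone-E : TE.cone k₂ l₂ ≡ ν - + 1
          cone-E = trans (cong₂ (λ p q → - pos p - (pos q - (ν - + 1))) (+-inverseʳ l₂) (e k₂)) (e' ν)
            where
            e : ∀ k → k - (k + + 1) ≡ -[1+ 0 ]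
            e = solve-∀
            e' : ∀ ν → - + 0 - (+ 0 - (ν - + 1)) ≡ ν - + 1
            e' = solve-∀
        s≡ : ∀ s → s - + 1 + + 1 ≡ s
        s≡ = solve-∀
        at-E : η k₃ l₂ ≡ η k₂ l₂
        at-E = pin (by (≥E k₃ l₂) (cong (λ t → η k₃ l₂ - t) (trans TE.cone-target (sym at-p)))) (proj₁ (right k₂ l₂))
        at-N : η k₂ l₃ ≡ η k₂ l₂
        at-N = pin (by (≥N k₂ l₃) (cong (λ t → η k₂ l₃ - t) (trans TN.cone-target (sym at-p)))) (proj₁ (up k₂ l₂))
        at-W : η k₁ l₂ ≡ η k₂ l₂ + + 1
        at-W = pin (by (≥W k₁ l₂) (cong (λ t → η k₁ l₂ - t) (trans TW.cone-target (trans (sym (s≡ ν)) (cong (_+ + 1) (sym at-p))))))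
                   (by (proj₂ (right k₁ l₂)) (e (η k₁ l₂) (η k₂ l₂)))
          where
          e : ∀ w s → + 1 - (w - s) ≡ s + + 1 - w
          e = solve-∀
        at-S : η k₂ l₁ ≡ η k₂ l₂ + + 1
        at-S = pin (by (≥S k₂ l₁) (cong (λ t → η k₂ l₁ - t) (trans TS.cone-target (trans (sym (s≡ ν)) (cong (_+ + 1) (sym at-p))))))
                   (by (proj₂ (up k₂ l₁)) (e (η k₂ l₁) (η k₂ l₂)))
          where
          e : ∀ w s → + 1 - (w - s) ≡ s + + 1 - w
          e = solve-∀

        open Raise surface k l at-E at-N at-W at-S

        above⁺ : Above raised
        above⁺ = record { surface = raised-surface ; above = λ i j → by (raised-≥ i j ⊕ above i j) (e (raised i j) (η i j) (bottom i j)) }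
          where
          e : ∀ p q r → p - q + (q - r) ≡ p - r
          e = solve-∀

        high⁺ : ∀ i j → NN (raised i j - T.cone i j)
        high⁺ i j with (i , j) ≟ᶠ (k₂ , l₂)
        ... | yes refl = by (nat {0}) (sym (trans (cong₂ _-_ (trans raised-on (trans (cong (_+ + 1) at-p) (s≡ ν))) T.cone-target) (+-inverseʳ ν)))
        ... | no ne = by (raised-≥ i j ⊕ lower) (e (raised i j) (η i j) (T.cone i j))
          where
          e : ∀ p q r → p - q + (q - r) ≡ p - r
          e = solve-∀
          nonzero : ∀ {m n} → ¬ (m ≡ n) → ¬ (m - n ≡ + 0)
          nonzero ne eq = ne (i-j≡0⇒i≡j _ _ eq)
          back : ∀ m n → m - (n + + 1) ≡ m - n - + 1
          back = solve-∀
          forth : ∀ m n → m - n ≡ m - (n + + 1) + + 1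
          forth = solve-∀
          lower : NN (η i j - T.cone i j)
          lower with i ≟ k₂ | j ≟ l₂
          ... | yes refl | yes refl = ⊥-elim (ne refl)
          ... | no i≢ | _ with pos-nonzero (i - k₂) (nonzero i≢)
          ...   | inj₁ eq = by (≥E i j) (cong (λ t → η i j - t) (trans (cong (λ t → - pos (j - l₂) - (t - (ν - + 1))) (trans (cong pos (back i k₂)) eq)) (g (- pos (j - l₂)) (pos (i - k₂)) ν)))
            where
            g : ∀ y e ν → y - (e - + 1 - (ν - + 1)) ≡ y - (e - ν)
            g = solve-∀
          ...   | inj₂ eq = by (≥W i j) (cong (λ t → η i j - (- pos (j - l₂) - (t - ν))) (trans (cong pos (forth i k₁)) eq))
          lower | yes refl | no j≢ with pos-nonzero (j - l₂) (nonzero j≢)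
          ...   | inj₁ eq = by (≥N i j) (cong (λ t → η i j - t) (trans (cong (λ t → - t - (pos (i - k₂) - (ν - + 1))) (trans (cong pos (back j l₂)) eq)) (g (pos (j - l₂)) (pos (i - k₂)) ν)))
            where
            g : ∀ y e ν → - (y - + 1) - (e - (ν - + 1)) ≡ - y - (e - ν)
            g = solve-∀
          ...   | inj₂ eq = by (≥S i j) (cong (λ t → η i j - (- t - (pos (i - k₂) - ν))) (trans (cong pos (forth j l₁)) eq))

        high⁻ : ∀ i j → NN (η i j - T⁻.cone i j)
        high⁻ i j = by (≥E i j ⊕ proj₁ (pos-step (i - k₃)))
          (trans (cong (λ t → η i j - TE.cone i j + (pos t - pos (i - k₃))) (sym (forth i k₂))) (g (η i j) (pos (j - l₂)) (pos (i - k₃)) (pos (i - k₂)) ν))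
          where
          forth : ∀ m n → m - n ≡ m - (n + + 1) + + 1
          forth = solve-∀
          g : ∀ h y e e' ν → h - (- y - (e - (ν - + 1))) + (e' - e) ≡ h - (- y - (e' - (ν - + 1)))
          g = solve-∀

        open BinomialFacts k l (η k₂ l₂)
        open Binomial k l (η k₂ l₂) using (X; β₁; β₂)

        lowered : T.F∞ η *ₚ mono ((X , + 1) ∷ []) ≋ B
        lowered = exchange-relation (≋-trans (Ψ-cong 1 (≋-sym (T.F-top good above⁺ high⁺)))
          (T.substitution good above⁺ ab raise-flip (proj₁ good) (by (nat {0}) (sym (trans (cong (λ t → ν - t) (trans raised-on (trans (cong (_+ + 1) at-p) (s≡ ν)))) (+-inverseʳ ν))))))

        gather : ∀ e u v → mono (e ++ ((u , + 1) ∷ (v , + 1) ∷ [])) ≋ mono e *ₚ (mono ((u , + 1) ∷ []) *ₚ mono ((v , + 1) ∷ []))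
        gather e u v = ≋-trans (mono-++ e _) (*ₚ-congˡ (mono e) (mono-++ ((u , + 1) ∷ []) ((v , + 1) ∷ [])))

        labels₁ : β₁ ≡ e₁ ++ ((x k₂ l₃ , + 1) ∷ (x k₂ l₁ , + 1) ∷ [])
        labels₁ = cong₂ (λ p q → (a p l₂ , + 1) ∷ (c q l₂ , + 1) ∷ (x k₂ l₃ , + 1) ∷ (x k₂ l₁ , + 1) ∷ [])
          (trans (cong (λ t → k₂ + (+ 2 * t + k₂ + l₂) + + 1) at-p) (g k₂ l₂ ν)) (trans (cong (λ t → k₂ - (+ 2 * t + k₂ + l₂) - + 1) at-p) (g' k₂ l₂ ν))
          where
          g : ∀ k l ν → k + (+ 2 * (ν - + 1) + k + l) + + 1 ≡ k + (+ 2 * ν + k + l) - + 1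
          g = solve-∀
          g' : ∀ k l ν → k - (+ 2 * (ν - + 1) + k + l) - + 1 ≡ k - (+ 2 * ν + k + l) + + 1
          g' = solve-∀

        labels₂ : β₂ ≡ e₂ ++ ((x k₃ l₂ , + 1) ∷ (x k₁ l₂ , + 1) ∷ [])
        labels₂ = cong₂ (λ p q → (b k₂ p , + 1) ∷ (d k₂ q , + 1) ∷ (x k₃ l₂ , + 1) ∷ (x k₁ l₂ , + 1) ∷ [])
          (trans (cong (λ t → l₂ + (+ 2 * t + k₂ + l₂) + + 1) at-p) (g k₂ l₂ ν)) (trans (cong (λ t → l₂ - (+ 2 * t + k₂ + l₂) - + 1) at-p) (g' k₂ l₂ ν))
          where
          g : ∀ k l ν → l + (+ 2 * (ν - + 1) + k + l) + + 1 ≡ l + (+ 2 * ν + k + l) - + 1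
          g = solve-∀
          g' : ∀ k l ν → l - (+ 2 * (ν - + 1) + k + l) - + 1 ≡ l - (+ 2 * ν + k + l) + + 1
          g' = solve-∀

      base : Octahedron η
      base = ≋-trans (*ₚ-congˡ (T.F∞ η) (T⁻.F-top good⁻ ab high⁻)) (≋-trans lowered (≋-trans B≋ (+ₚ-cong
        (≋-trans (mono-≡ labels₁) (≋-trans (gather e₁ (x k₂ l₃) (x k₂ l₁)) (*ₚ-congˡ (mono e₁) (*ₚ-cong (≋-sym (TN.F-top goodN ab ≥N)) (≋-sym (TS.F-top goodS ab ≥S))))))
        (≋-trans (mono-≡ labels₂) (≋-trans (gather e₂ (x k₃ l₂) (x k₁ l₂)) (*ₚ-congˡ (mono e₂) (*ₚ-cong (≋-sym (TE.F-top goodE ab ≥E)) (≋-sym (TW.F-top goodW ab ≥W)))))))))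
        where
        mono-≡ : ∀ {m m'} → m ≡ m' → mono m ≋ mono m'
        mono-≡ refl = ≋-refl

    lid : Field
    lid i j = (TE.cone i j ⊔ TW.cone i j) ⊔ (TN.cone i j ⊔ TS.cone i j)

    private
      lid-surface : Surface lid
      lid-surface = surface-max (surface-max TE.cone-surface TW.cone-surface) (surface-max TN.cone-surface TS.cone-surface)

      ≥lid : ∀ i j t → NN (t - lid i j) → NN (t - TE.cone i j) × NN (t - TW.cone i j) × NN (t - TN.cone i j) × NN (t - TS.cone i j)
      ≥lid i j t p = part (i≤i⊔j (E ⊔ W) (N ⊔ S)) (i≤i⊔j E W) , part (i≤i⊔j (E ⊔ W) (N ⊔ S)) (i≤j⊔i E W) ,
                       part (i≤j⊔i (E ⊔ W) (N ⊔ S)) (i≤i⊔j N S) , part (i≤j⊔i (E ⊔ W) (N ⊔ S)) (i≤j⊔i N S)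
        where
        E W N S : ℤ
        E = TE.cone i j
        W = TW.cone i j
        N = TN.cone i j
        S = TS.cone i j
        part : ∀ {m r} → r ≤ lid i j → m ≤ r → NN (t - m)
        part le le' = ≤⇒NN (≤-trans le' (≤-trans le (NN⇒≤ {lid i j} {t} p)))

      lid-p : lid k₂ l₂ ≤ ν - + 1
      lid-p = ⊔-lub (⊔-lub (≤-reflexive cE) (≤-reflexive cW)) (⊔-lub (≤-reflexive cN) (≤-reflexive cS))
        where
        down : ∀ k → k - (k + + 1) ≡ -[1+ 0 ]
        down = solve-∀
        up : ∀ k → (k + + 1) - k ≡ + 1
        up = solve-∀
        cE : TE.cone k₂ l₂ ≡ ν - + 1
        cE = trans (cong₂ (λ p q → - pos p - (pos q - (ν - + 1))) (+-inverseʳ l₂) (down k₂)) (g ν)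
          where
          g : ∀ ν → - + 0 - (+ 0 - (ν - + 1)) ≡ ν - + 1
          g = solve-∀
        cW : TW.cone k₂ l₂ ≡ ν - + 1
        cW = trans (cong₂ (λ p q → - pos p - (pos q - ν)) (+-inverseʳ l₂) (up k₁)) (g ν)
          where
          g : ∀ ν → - + 0 - (+ 1 - ν) ≡ ν - + 1
          g = solve-∀
        cN : TN.cone k₂ l₂ ≡ ν - + 1
        cN = trans (cong₂ (λ p q → - pos p - (pos q - (ν - + 1))) (down l₂) (+-inverseʳ k₂)) (g ν)
          where
          g : ∀ ν → - + 0 - (+ 0 - (ν - + 1)) ≡ ν - + 1
          g = solve-∀
        cS : TS.cone k₂ l₂ ≡ ν - + 1
        cS = trans (cong₂ (λ p q → - pos p - (pos q - ν)) (up l₁) (+-inverseʳ k₂)) (g ν)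
          where
          g : ∀ ν → - + 1 - (+ 0 - ν) ≡ ν - + 1
          g = solve-∀

      defect : Field → ℤ
      defect η = ∑ Q (λ t → pos (lid (proj₁ t) (proj₂ t) - η (proj₁ t) (proj₂ t)))

      Deep : Field → Face → Set
      Deep η (i , j) = NN (lid i j - η i j - + 1)

      module Step {η : Field} (ab : Above η) where
        open Above ab
        open Surface surface
        module L = Surface lid-surface

        outside : ∀ i j → ¬ ((i , j) ∈ Q) → NN (η i j - lid i j)
        outside i j out = ≤⇒NN (⊔-lub (⊔-lub (over (proj₂ goodE i j out)) (over (proj₂ goodW i j out))) (⊔-lub (over (proj₂ goodN i j out)) (over (proj₂ goodS i j out))))
          where
          over : ∀ {m} → NN (bottom i j - m) → m ≤ η i j
          over {m} p = NN⇒≤ (by (p ⊕ above i j) (e (bottom i j) m (η i j)))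
            where
            e : ∀ p q r → p - q + (r - p) ≡ r - q
            e = solve-∀

        deep-inside : ∀ {i j} → Deep η (i , j) → (i , j) ∈ Q
        deep-inside {i} {j} deep with (i , j) ∈Q?
        ... | yes ∈Q = ∈Q
        ... | no out = absurd {k = 0} (deep ⊕ outside i j out) (e (lid i j) (η i j))
          where
          e : ∀ p q → p - q - + 1 + (q - p) ≡ -[1+ 0 ]
          e = solve-∀

        -- A lowest face below the lid is a local minimum.
        module Lowest (i j : ℤ) (deep : Deep η (↑ i , ↑ j)) (low : ∀ u → u ∈ Q → Deep η u → height η (↑ i) (↑ j) ≤ height η (proj₁ u) (proj₂ u)) where
          private
            i₁ i₂ j₁ j₂ s : ℤ
            i₁ = ↑ i
            i₂ = ↑ i₁
            j₁ = ↑ j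
            j₂ = ↑ j₁
            s = η i₁ j₁

          private
            rise : ∀ p q → p - (q + + 1) ≡ p - q - + 1
            rise = solve-∀
            forward : ∀ p q r t → r - t ≡ + 1 → p - r - + 1 + (+ 1 - (p - q)) ≡ q - t - + 1
            forward p q r t eq = ≡-by (sym eq) (identity₄₉ p r q t)
            falls : ∀ r t i j → r - t ≡ + 1 → (+ 2 * t + ↑ i + j) - (+ 2 * r + i + j) ≡ -[1+ 0 ]
            falls r t i j eq = ≡-by (cong (λ u → + 2 * u) (sym eq)) (e r t i j)
              where
              e : ∀ r t i j → + 2 * t + (i + + 1) + j - (+ 2 * r + i + j) - -[1+ 0 ] ≡ + 2 * + 1 - + 2 * (r - t)
              e = solve-∀
            falls′ : ∀ r t i j → r - t ≡ + 1 → (+ 2 * t + i + ↑ j) - (+ 2 * r + i + j) ≡ -[1+ 0 ]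
            falls′ r t i j eq = ≡-by (cong (λ u → + 2 * u) (sym eq)) (e r t i j)
              where
              e : ∀ r t i j → + 2 * t + i + (j + + 1) - (+ 2 * r + i + j) - -[1+ 0 ] ≡ + 2 * + 1 - + 2 * (r - t)
              e = solve-∀
            drops : ∀ r t i j → t - r ≡ + 0 → (+ 2 * t + i + j) - (+ 2 * r + ↑ i + j) ≡ -[1+ 0 ]
            drops r t i j eq = ≡-by (cong (λ u → + 2 * u) eq) (e r t i j)
              where
              e : ∀ r t i j → + 2 * t + i + j - (+ 2 * r + (i + + 1) + j) - -[1+ 0 ] ≡ + 2 * (t - r) - + 2 * + 0
              e = solve-∀
            drops′ : ∀ r t i j → t - r ≡ + 0 → (+ 2 * t + i + j) - (+ 2 * r + i + ↑ j) ≡ -[1+ 0 ]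
            drops′ r t i j eq = ≡-by (cong (λ u → + 2 * u) eq) (e r t i j)
              where
              e : ∀ r t i j → + 2 * t + i + j - (+ 2 * r + i + (j + + 1)) - -[1+ 0 ] ≡ + 2 * (t - r) - + 2 * + 0
              e = solve-∀
            backward : ∀ p q r t → t - r ≡ + 0 → p - r - + 1 + (q - p) ≡ q - t - + 1
            backward p q r t eq = ≡-by eq (identity₅₀ p r q t)

          lowest-east : η i₂ j₁ ≡ s
          lowest-east with bit-split (right i₁ j₁)
          ... | inj₁ eq = sym (i-j≡0⇒i≡j _ _ eq)
          ... | inj₂ eq = absurd {k = 0} (≤⇒NN (low (i₂ , j₁) (deep-inside deep′) deep′)) (falls s (η i₂ j₁) i₁ j₁ eq)
            where
            deep′ : Deep η (i₂ , j₁)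
            deep′ = by (deep ⊕ proj₂ (L.right i₁ j₁)) (forward (lid i₁ j₁) (lid i₂ j₁) s (η i₂ j₁) eq)
          lowest-north : η i₁ j₂ ≡ s
          lowest-north with bit-split (up i₁ j₁)
          ... | inj₁ eq = sym (i-j≡0⇒i≡j _ _ eq)
          ... | inj₂ eq = absurd {k = 0} (≤⇒NN (low (i₁ , j₂) (deep-inside deep′) deep′)) (falls′ s (η i₁ j₂) i₁ j₁ eq)
            where
            deep′ : Deep η (i₁ , j₂)
            deep′ = by (deep ⊕ proj₂ (L.up i₁ j₁)) (forward (lid i₁ j₁) (lid i₁ j₂) s (η i₁ j₂) eq)
          lowest-west : η i j₁ ≡ s + + 1
          lowest-west with bit-split (right i j₁)
          ... | inj₂ eq = ≡-by eq (rise (η i (↑ j)) (η (↑ i) (↑ j)))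
          ... | inj₁ eq = absurd {k = 0} (≤⇒NN (low (i , j₁) (deep-inside deep′) deep′)) (drops s (η i j₁) i j₁ eq)
            where
            deep′ : Deep η (i , j₁)
            deep′ = by (deep ⊕ proj₁ (L.right i j₁)) (backward (lid i₁ j₁) (lid i j₁) s (η i j₁) eq)
          lowest-south : η i₁ j ≡ s + + 1
          lowest-south with bit-split (up i₁ j)
          ... | inj₂ eq = ≡-by eq (rise (η (↑ i) j) (η (↑ i) (↑ j)))
          ... | inj₁ eq = absurd {k = 0} (≤⇒NN (low (i₁ , j) (deep-inside deep′) deep′)) (drops′ s (η i₁ j) i₁ j eq)
            where
            deep′ : Deep η (i₁ , j)
            deep′ = by (deep ⊕ proj₁ (L.up i₁ j)) (backward (lid i₁ j₁) (lid i₁ j) s (η i₁ j) eq)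

      defect-nonneg : ∀ η → NN (defect η)
      defect-nonneg η = total Q
        where
        total : ∀ ts → NN (∑ ts (λ t → pos (lid (proj₁ t) (proj₂ t) - η (proj₁ t) (proj₂ t))))
        total [] = nat
        total (t ∷ ts) = pos-nonneg (lid (proj₁ t) (proj₂ t) - η (proj₁ t) (proj₂ t)) ⊕ total ts

    octahedron : ∀ fuel {η} → Above η → NN (ν - + 1 - η k₂ l₂) → NN (+ fuel - defect η) → Octahedron η
    octahedron fuel {η} ab reach enough with least {P = Deep η} (λ _ → + 0 ≤? _) (λ t → height η (proj₁ t) (proj₂ t)) Q
    ... | inj₁ none = Base.base ab reach (λ i j → proj₁ (≥lid i j (η i j) (shallow i j))) (λ i j → proj₁ (proj₂ (≥lid i j (η i j) (shallow i j))))
                        (λ i j → proj₁ (proj₂ (proj₂ (≥lid i j (η i j) (shallow i j))))) (λ i j → proj₂ (proj₂ (proj₂ (≥lid i j (η i j) (shallow i j)))))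
      where
      open Step ab
      shallow : ∀ i j → NN (η i j - lid i j)
      shallow i j with (i , j) ∈Q? | sign-split (lid i j - η i j - + 1)
      ... | no out | _ = outside i j out
      ... | yes ∈Q | inj₁ deep = ⊥-elim (none (i , j) ∈Q deep)
      ... | yes ∈Q | inj₂ p = by p (e (lid i j) (η i j))
        where
        e : ∀ p q → - + 1 - (p - q - + 1) ≡ q - p
        e = solve-∀
    ... | inj₂ ((i , j) , q∈ , deep , low) = lift (i - + 1 - + 1) (j - + 1 - + 1) (pred-↑ i) (pred-↑ (i - + 1)) (pred-↑ j) (pred-↑ (j - + 1)) q∈ deep low
      where
      open Above ab
      lift : ∀ {i j i' j'} i'' j'' → i ≡ ↑ i' → i' ≡ ↑ i'' → j ≡ ↑ j' → j' ≡ ↑ j'' → (i , j) ∈ Q → Deep η (i , j) →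
             (∀ u → u ∈ Q → Deep η u → height η i j ≤ height η (proj₁ u) (proj₂ u)) → Octahedron η
      lift i j'' refl refl refl refl q∈ deep low = descend fuel enough
        where
        module S = Step ab
        open S.Lowest (↑ i) (↑ j'') deep low
        open Raise surface i j'' lowest-east lowest-north lowest-west lowest-south
        q : Face
        q = ↑ (↑ i) , ↑ (↑ j'')

        above⁺ : Above raised
        above⁺ = record { surface = raised-surface ; above = λ i j → by (raised-≥ i j ⊕ above i j) (e (raised i j) (η i j) (bottom i j)) }
          where
          e : ∀ p q r → p - q + (q - r) ≡ p - r
          e = solve-∀

        reach⁺ : NN (ν - + 1 - raised k₂ l₂)
        reach⁺ with (k₂ , l₂) ≟ᶠ q
        ... | no ne = by reach (cong (λ t → ν - + 1 - t) (sym (raised-off ne)))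
        ... | yes eq = by (subst₂ (λ i j → NN (lid i j - η i j - + 1)) (sym (cong proj₁ eq)) (sym (cong proj₂ eq)) deep ⊕ ≤⇒NN lid-p)
              (trans (e (lid k₂ l₂) (η k₂ l₂) (ν - + 1)) (cong (λ t → ν - + 1 - t) (sym (raised-at eq))))
          where
          e : ∀ p q r → p - q - + 1 + (r - p) ≡ r - (q + + 1)
          e = solve-∀
          raised-at : (k₂ , l₂) ≡ q → raised k₂ l₂ ≡ η k₂ l₂ + + 1
          raised-at eq = subst₂ (λ i j → raised i j ≡ η i j + + 1) (sym (cong proj₁ eq)) (sym (cong proj₂ eq)) raised-on

        defect⁺ : defect raised ≡ defect η - + 1
        defect⁺ = trans (∑-cong Q λ { (i , j) → drop i j }) (trans (∑-+ Q _ _) (+-congˡ (defect η)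
          (trans (∑-single uniqueQ q∈ _ λ { (i , j) _ ne → cong -_ (ι-zero ne) }) (cong -_ (ι-one (↑ (↑ i)) (↑ (↑ j'')))))))
          where
          drop : ∀ i' j' → pos (lid i' j' - raised i' j') ≡ pos (lid i' j' - η i' j') + - (ι (↑ (↑ i)) i' * ι (↑ (↑ j'')) j')
          drop i' j' with (i' , j') ≟ᶠ q
          ... | no ne = trans (cong (λ t → pos (lid i' j' - t)) (raised-off ne)) (sym (trans (+-congˡ (pos (lid i' j' - η i' j')) (cong -_ (ι-zero ne))) (+-identityʳ _)))
          ... | yes refl = trans (cong pos (trans (cong (λ t → lid i' j' - t) raised-on) (e (lid i' j') (η i' j'))))
                (trans (pos-of-nonneg deep) (trans (cong (λ t → t - + 1) (sym (pos-of-nonneg (by (deep ⊕ nat {1}) (e' (lid i' j' - η i' j'))))))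
                       (+-congˡ (pos (lid i' j' - η i' j')) (cong -_ (sym (ι-one (↑ (↑ i)) (↑ (↑ j''))))))))
            where
            e : ∀ p q → p - (q + + 1) ≡ p - q - + 1
            e = solve-∀
            e' : ∀ p → p - + 1 + + 1 ≡ p
            e' = solve-∀

        module R⁺ = Surface raised-surface
        outwards : ∀ m p q → m - p + (p - q) ≡ m - q
        outwards = solve-∀
        inwards : ∀ m w p → m - + 1 - p + (+ 1 - (w - p)) ≡ m - w
        inwards = solve-∀
        weaken : ∀ m p → m - + 1 - p + + 1 ≡ m - p
        weaken = solve-∀
        reach-E : NN (ν - + 1 - raised k₃ l₂)
        reach-E = by (reach⁺ ⊕ proj₁ (R⁺.right k₂ l₂)) (outwards (ν - + 1) (raised k₂ l₂) (raised k₃ l₂))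
        reach-N : NN (ν - + 1 - raised k₂ l₃)
        reach-N = by (reach⁺ ⊕ proj₁ (R⁺.up k₂ l₂)) (outwards (ν - + 1) (raised k₂ l₂) (raised k₂ l₃))
        reach-W : NN (ν - raised k₁ l₂)
        reach-W = by (reach⁺ ⊕ proj₂ (R⁺.right k₁ l₂)) (inwards ν (raised k₁ l₂) (raised k₂ l₂))
        reach-S : NN (ν - raised k₂ l₁)
        reach-S = by (reach⁺ ⊕ proj₂ (R⁺.up k₂ l₁)) (inwards ν (raised k₂ l₁) (raised k₂ l₂))
        reach-p : NN (ν - raised k₂ l₂)
        reach-p = by (reach⁺ ⊕ nat {1}) (weaken ν (raised k₂ l₂))

        open BinomialFacts i j'' (η (↑ (↑ i)) (↑ (↑ j'')))
        open Binomial i j'' (η (↑ (↑ i)) (↑ (↑ j''))) using (X; β₁; β₂)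

        lower : Octahedron raised → Octahedron η
        lower = transport e₁ e₂ refl refl
          (T.F-bounded (T.clipped good above⁺) X _ _ β₁ β₂ refl) (T⁻.F-bounded (T⁻.clipped good⁻ above⁺) X _ _ β₁ β₂ refl)
          (TN.F-bounded (TN.clipped goodN above⁺) X _ _ β₁ β₂ refl) (TS.F-bounded (TS.clipped goodS above⁺) X _ _ β₁ β₂ refl)
          (TE.F-bounded (TE.clipped goodE above⁺) X _ _ β₁ β₂ refl) (TW.F-bounded (TW.clipped goodW above⁺) X _ _ β₁ β₂ refl)
          (T.substitution good above⁺ ab raise-flip q∈ reach-p) (T⁻.substitution good⁻ above⁺ ab raise-flip q∈ reach⁺)
          (TN.substitution goodN above⁺ ab raise-flip q∈ reach-N) (TS.substitution goodS above⁺ ab raise-flip q∈ reach-S)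
          (TE.substitution goodE above⁺ ab raise-flip q∈ reach-E) (TW.substitution goodW above⁺ ab raise-flip q∈ reach-W)

        descend : ∀ fuel → NN (+ fuel - defect η) → Octahedron η
        descend zero enough = absurd {k = 0} (enough ⊕ defect-nonneg raised) (trans (cong (λ t → + 0 - defect η + t) defect⁺) (e (defect η)))
          where
          e : ∀ p → + 0 - p + (p - + 1) ≡ -[1+ 0 ]
          e = solve-∀
        descend (suc fuel) enough = lower (octahedron fuel above⁺ reach⁺ (by enough (trans (e (+ fuel) (defect η)) (cong (λ t → + fuel - t) (sym defect⁺)))))
          where
          e : ∀ p q → + 1 + p - q ≡ p - (q - + 1)
          e = solve-∀

    relation : ∀ {η} → Above η → NN (ν - + 1 - η k₂ l₂) → Octahedron η
    relation {η} ab reach = octahedron ∣ defect η ∣ ab reach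
      (by (nat {0}) (sym (trans (cong (λ t → t - defect η) (0≤i⇒+∣i∣≡i (defect-nonneg η))) (+-inverseʳ (defect η)))))

-- Fractions

record Represents (f : Frac) (G : Poly) : Set where
  constructor represents
  field numerator : proj₁ f ≋ proj₂ f *ₚ G
open Represents

module FractionAlgebra (R : CommutativeRing 0ℓ 0ℓ) where
  open CommutativeRing R using () renaming (_≈_ to _≈R_; _+_ to _+R_; _*_ to _*R_; refl to reflR; trans to transR; sym to symR; *-cong to *R-cong; +-cong to +R-cong; 1# to oneR; *-assoc to *R-assoc; distribˡ to *R-distribˡ; *-identityˡ to *R-identityˡ)
  open import Algebra.Properties.CommutativeSemigroup (CommutativeRing.*-commutativeSemigroup R) using (x∙yz≈y∙xz; xy∙z≈xz∙y) renaming (interchange to exchangeR)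

  private
    combine : ∀ v r g q g' → (v *R (r *R g)) *R (q *R g') ≈R (r *R q) *R (v *R (g *R g'))
    combine v r g q g' = transR (*R-cong (x∙yz≈y∙xz v r g) reflR) (transR (exchangeR r (v *R g) q g') (*R-cong reflR (*R-assoc v g g')))

    clear : ∀ v v' r₁ q₂ r₃ q₄ q₅ g₁ g₂ g₃ g₄ →
      ((((v *R (r₁ *R g₁)) *R (q₂ *R g₂)) *R (r₃ *R q₄)) +R ((r₁ *R q₂) *R ((v' *R (r₃ *R g₃)) *R (q₄ *R g₄)))) *R q₅ ≈R
      (((r₁ *R q₂) *R (r₃ *R q₄)) *R q₅) *R ((v *R (g₁ *R g₂)) +R (v' *R (g₃ *R g₄)))
    clear v v' r₁ q₂ r₃ q₄ q₅ g₁ g₂ g₃ g₄ = transR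
      (*R-cong (transR (+R-cong (transR (*R-cong (combine v r₁ g₁ q₂ g₂) reflR) (xy∙z≈xz∙y (r₁ *R q₂) (v *R (g₁ *R g₂)) (r₃ *R q₄)))
                                (transR (*R-cong reflR (combine v' r₃ g₃ q₄ g₄)) (symR (*R-assoc (r₁ *R q₂) (r₃ *R q₄) (v' *R (g₃ *R g₄))))))
                       (symR (*R-distribˡ _ _ _))) reflR)
      (xy∙z≈xz∙y _ _ q₅)

    collect : ∀ D q₅ g₅ g → (D *R q₅) *R (g *R g₅) ≈R (D *R (q₅ *R g₅)) *R g
    collect D q₅ g₅ g = transR (exchangeR D q₅ g g₅) (xy∙z≈xz∙y D g (q₅ *R g₅))

    pad : ∀ {p q g} → p ≈R q *R g → p ≈R ((oneR *R oneR) *R q) *R g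
    pad h = transR h (*R-cong (symR (transR (*R-cong (*R-identityˡ oneR) reflR) (*R-identityˡ _))) reflR)

  quotient : ∀ {va vc vb vd p₁ p₂ p₃ p₄ p₅ q₁ q₂ q₃ q₄ q₅ g₁ g₂ g₃ g₄ g₅ g} →
    p₁ ≈R q₁ *R g₁ → p₂ ≈R q₂ *R g₂ → p₃ ≈R q₃ *R g₃ → p₄ ≈R q₄ *R g₄ → p₅ ≈R q₅ *R g₅ →
    g *R g₅ ≈R ((va *R vc) *R (g₁ *R g₂)) +R ((vb *R vd) *R (g₃ *R g₄)) →
    (((((va *R vc) *R p₁) *R p₂) *R (((oneR *R oneR) *R q₃) *R q₄)) +R ((((oneR *R oneR) *R q₁) *R q₂) *R (((vb *R vd) *R p₃) *R p₄))) *R q₅ ≈R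
    (((((oneR *R oneR) *R q₁) *R q₂) *R (((oneR *R oneR) *R q₃) *R q₄)) *R p₅) *R g
  quotient h₁ h₂ h₃ h₄ h₅ rel = transR
    (*R-cong (+R-cong (*R-cong (*R-cong (*R-cong reflR (pad h₁)) h₂) reflR) (*R-cong reflR (*R-cong (*R-cong reflR (pad h₃)) h₄))) reflR)
    (transR (clear _ _ _ _ _ _ _ _ _ _ _) (transR (*R-cong reflR (symR rel)) (transR (collect _ _ _ _) (*R-cong (*R-cong reflR (symR h₅)) reflR))))

quotient-represents : ∀ {va vc vb vd : Var} {f₁ f₂ f₃ f₄ f₅ G₁ G₂ G₃ G₄ G₅ G} →
  Represents f₁ G₁ → Represents f₂ G₂ → Represents f₃ G₃ → Represents f₄ G₄ → Represents f₅ G₅ →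
  G *ₚ G₅ ≋ ((varₚ va *ₚ varₚ vc) *ₚ (G₁ *ₚ G₂)) +ₚ ((varₚ vb *ₚ varₚ vd) *ₚ (G₃ *ₚ G₄)) →
  Represents (((varf va *f varf vc *f f₁ *f f₂) +f (varf vb *f varf vd *f f₃ *f f₄)) /f f₅) G
quotient-represents {va} {vc} {vb} {vd} {f₁} {f₂} {f₃} {f₄} {f₅} {G₁} {G₂} {G₃} {G₄} {G₅} {G} h₁ h₂ h₃ h₄ h₅ rel = represents
  (FractionAlgebra.quotient laurent {varₚ va} {varₚ vc} {varₚ vb} {varₚ vd} {proj₁ f₁} {proj₁ f₂} {proj₁ f₃} {proj₁ f₄} {proj₁ f₅} {proj₂ f₁} {proj₂ f₂} {proj₂ f₃} {proj₂ f₄} {proj₂ f₅} {G₁} {G₂} {G₃} {G₄} {G₅} {G}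
    (numerator h₁) (numerator h₂) (numerator h₃) (numerator h₄) (numerator h₅) rel)

opaque
  unfolding mono

  mono-varₚ : ∀ v → mono ((v , + 1) ∷ []) ≋ varₚ v
  mono-varₚ v = ≋-refl

interval : ℕ → List ℤ
interval m = map (λ t → + t - + m) (upTo (suc (m ℕ.+ m)))

∈-interval : ∀ m {i} → NN (i + + m) → NN (+ m - i) → i ∈ interval m
∈-interval m {i} p q = subst (_∈ interval m) value (∈-map⁺ (λ t → + t - + m) (∈-upTo⁺ (ℕ.s≤s bound)))
  where
  abs : + ∣ i + + m ∣ ≡ i + + m
  abs = 0≤i⇒+∣i∣≡i p
  value : + ∣ i + + m ∣ - + m ≡ i
  value = trans (cong (λ t → t - + m) abs) (e i (+ m))
    where
    e : ∀ i m → i + m - m ≡ i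
    e = solve-∀
  bound : ∣ i + + m ∣ ℕ.≤ m ℕ.+ m
  bound = drop‿+≤+ (subst (_≤ + m + + m) (sym abs) (+-monoˡ-≤ (+ m) (NN⇒≤ {i} {+ m} q)))

interval-∈ : ∀ m {i} → i ∈ interval m → NN (i + + m) × NN (+ m - i)
interval-∈ m i∈ with ∈-map⁻ (λ t → + t - + m) i∈
... | t , t∈ , refl = by (nat {t}) (e (+ t) (+ m)) , by (≤⇒NN (+≤+ (ℕ.≤-pred (∈-upTo⁻ t∈)))) (e' (+ t) (+ m))
  where
  e : ∀ t m → t ≡ t - m + m
  e = solve-∀
  e' : ∀ t m → m + m - t ≡ m - (t - m)
  e' = solve-∀

interval! : ∀ m → Unique (interval m)
interval! m = Unique.map⁺ (λ {s} {t} eq → +-injective (≡-by eq (e (+ s) (+ t) (+ m)))) (Unique.upTo⁺ _)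
  where
  e : ∀ s t m → s - t ≡ s - m - (t - m)
  e = solve-∀

box : ℕ → List Face
box m = cartesianProduct (interval m) (interval m)

near-bound : ∀ {k i} m → Near k i → ↑ (↑ k) ∈ interval m → i ∈ interval (2 ℕ.+ m)
near-bound {k} m near k∈ with interval-∈ m k∈
near-bound {k} m near₀ k∈ | p , q = ∈-interval (2 ℕ.+ m) (by p (e k (+ m))) (by (q ⊕ nat {4}) (e' k (+ m)))
  where
  e : ∀ k m → ((k + + 1) + + 1) + m ≡ k + (+ 2 + m)
  e = solve-∀
  e' : ∀ k m → m - ((k + + 1) + + 1) + + 4 ≡ + 2 + m - k
  e' = solve-∀
near-bound {k} m near₁ k∈ | p , q = ∈-interval (2 ℕ.+ m) (by (p ⊕ nat {1}) (e k (+ m))) (by (q ⊕ nat {3}) (e' k (+ m)))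
  where
  e : ∀ k m → ((k + + 1) + + 1) + m + + 1 ≡ (k + + 1) + (+ 2 + m)
  e = solve-∀
  e' : ∀ k m → m - ((k + + 1) + + 1) + + 3 ≡ + 2 + m - (k + + 1)
  e' = solve-∀
near-bound {k} m near₂ k∈ | p , q = ∈-interval (2 ℕ.+ m) (by (p ⊕ nat {2}) (e k (+ m))) (by (q ⊕ nat {2}) (e' k (+ m)))
  where
  e : ∀ k m → ((k + + 1) + + 1) + m + + 2 ≡ ((k + + 1) + + 1) + (+ 2 + m)
  e = solve-∀
  e' : ∀ k m → m - ((k + + 1) + + 1) + + 2 ≡ + 2 + m - ((k + + 1) + + 1)
  e' = solve-∀

box-window : ℕ → Window
box-window m = record
  { Q = box m
  ; ts = box (2 ℕ.+ m)
  ; uniqueQ = Unique.cartesianProduct⁺ (interval! m) (interval! m)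
  ; unique = Unique.cartesianProduct⁺ (interval! (2 ℕ.+ m)) (interval! (2 ℕ.+ m))
  ; top = + m
  ; bounded = λ i j ij∈ → NN⇒≤ (proj₂ (interval-∈ m (proj₂ (∈-cartesianProduct⁻ (interval m) (interval m) ij∈))))
  ; margin = λ near near' q∈ → let k∈ , l∈ = ∈-cartesianProduct⁻ (interval m) (interval m) q∈ in
      ∈-cartesianProduct⁺ (near-bound m near k∈) (near-bound m near' l∈)
  }

∣∣≡ : ∀ e → + ∣ e ∣ ≡ + 2 * pos e - e
∣∣≡ (+ n) = e (+ n)
  where
  e : ∀ n → n ≡ + 2 * n - n
  e = solve-∀
∣∣≡ -[1+ n ] = e (+ suc n)
  where
  e : ∀ n → n ≡ + 0 - (- n)
  e = solve-∀

∣∣-≥ : ∀ e → NN (+ ∣ e ∣ - e)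
∣∣-≥ (+ n) = by (nat {0}) (sym (+-inverseʳ (+ n)))
∣∣-≥ -[1+ n ] = nat {suc n} ⊕ nat {suc n}

∣∣-≥- : ∀ e → NN (+ ∣ e ∣ + e)
∣∣-≥- (+ n) = nat {n} ⊕ nat {n}
∣∣-≥- -[1+ n ] = by (nat {0}) (sym (+-inverseʳ (+ suc n)))

triangle : ∀ i i₀ → NN (+ ∣ i₀ ∣ + + ∣ i - i₀ ∣ - + ∣ i ∣)
triangle i i₀ = ≤⇒NN (subst (λ t → + ∣ t ∣ ≤ + ∣ i₀ ∣ + + ∣ i - i₀ ∣) (e i i₀) (+≤+ (∣i+j∣≤∣i∣+∣j∣ i₀ (i - i₀))))
  where
  e : ∀ i i₀ → i₀ + (i - i₀) ≡ i
  e = solve-∀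

half-nonneg : ∀ e → NN (+ 2 * e) → NN e
half-nonneg (+ n) _ = nat
half-nonneg -[1+ n ] ()

fK-on : ∀ h k n i j → n ≡ h i j → fK h (suc k) n i j ≡ varf (x i j)
fK-on h k n i j eq with n ≟ h i j
... | yes _ = refl
... | no ne = ⊥-elim (ne eq)

fK-above : ∀ h k n i j → ¬ (n ≡ h i j) → h i j < n → fK h (suc k) n i j ≡
  ((varf (a (i + n - + 1) j) *f varf (c (i - n + + 1) j) *f fK h k (n - + 1) i (j + + 1) *f fK h k (n - + 1) i (j - + 1))
   +f (varf (b i (j + n - + 1)) *f varf (d i (j - n + + 1)) *f fK h k (n - + 1) (i + + 1) j *f fK h k (n - + 1) (i - + 1) j))
  /f fK h k (n - + 2) i j
fK-above h k n i j ne lt with n ≟ h i j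
... | yes eq = ⊥-elim (ne eq)
... | no _ with h i j <? n
...   | yes _ = refl
...   | no ge = ⊥-elim (ge lt)

module Main (h : ℤ → ℤ → ℤ) (isHeight : IsHeightFunction h) (n₀ i₀ j₀ : ℤ) where
  open IsHeightFunction isHeight

  private
    half : ∀ e → + 2 ∣ e → ℤ
    half e div = Signed._∣_.quotient (Signed.∣ᵤ⇒∣ {+ 2} {e} div)

    half-eq : ∀ e (div : + 2 ∣ e) → e ≡ + 2 * half e div
    half-eq e div = trans (Signed._∣_.equality (Signed.∣ᵤ⇒∣ {+ 2} {e} div)) (*-comm (half e div) (+ 2))

    solve : ∀ n q i j → n - (i + j) ≡ + 2 * q → n ≡ + 2 * q + i + j
    solve n q i j eq = ≡-by eq (e n q i j)
      where
      e : ∀ n q i j → n - (+ 2 * q + i + j) ≡ n - (i + j) - + 2 * q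
      e = solve-∀

  opaque
    η : Field
    η i j = half (h i j - (i + j)) (parity i j)

    h≡ : ∀ i j → h i j ≡ + 2 * η i j + i + j
    h≡ i j = solve (h i j) (η i j) i j (half-eq (h i j - (i + j)) (parity i j))

  private
    unit-split : ∀ e → ∣ e ∣ ≡ 1 → e ≡ + 1 ⊎ e ≡ -[1+ 0 ]
    unit-split (+ 1) refl = inj₁ refl
    unit-split -[1+ 0 ] refl = inj₂ refl

    step-bit : ∀ p q {r} → p - q ≡ r → ∀ s t → r ≡ + 2 * (s - t) - + 1 → ∣ p - q ∣ ≡ 1 → Bit (s - t)
    step-bit p q refl s t eq unit with unit-split (p - q) unit
    ... | inj₁ one′ = bit-cong bit1 (sym (*-cancelˡ-≡ (+ 2) (s - t) (+ 1) (≡-by {p = p - q} {+ 1} one′ (trans (cong (λ u → u - + 2) (u≡ (s - t))) (trans (cong (λ u → u + + 1 - + 2) (sym eq)) (g (p - q)))))))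
      where
      u≡ : ∀ u → + 2 * u ≡ + 2 * u - + 1 + + 1
      u≡ = solve-∀
      g : ∀ u → u + + 1 - + 2 ≡ u - + 1
      g = solve-∀
    ... | inj₂ minus = bit-cong bit0 (sym (*-cancelˡ-≡ (+ 2) (s - t) (+ 0) (≡-by {p = p - q} { -[1+ 0 ]} minus (trans (cong (λ u → u - + 0) (u≡ (s - t))) (trans (cong (λ u → u + + 1 - + 0) (sym eq)) (g (p - q)))))))
      where
      u≡ : ∀ u → + 2 * u ≡ + 2 * u - + 1 + + 1
      u≡ = solve-∀
      g : ∀ u → u + + 1 - + 0 ≡ u - -[1+ 0 ]
      g = solve-∀

  η-surface : Surface η
  η-surface = record
    { right = λ i j → step-bit (h i j) (h (↑ i) j) refl (η i j) (η (↑ i) j) (trans (cong₂ _-_ (h≡ i j) (h≡ (↑ i) j)) (g (η i j) (η (↑ i) j) i j)) (adjH i j)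
    ; up = λ i j → step-bit (h i j) (h i (↑ j)) refl (η i j) (η i (↑ j)) (trans (cong₂ _-_ (h≡ i j) (h≡ i (↑ j))) (g' (η i j) (η i (↑ j)) i j)) (adjV i j)
    }
    where
    g : ∀ s t i j → + 2 * s + i + j - (+ 2 * t + (i + + 1) + j) ≡ + 2 * (s - t) - + 1
    g = solve-∀
    g' : ∀ s t i j → + 2 * s + i + j - (+ 2 * t + i + (j + + 1)) ≡ + 2 * (s - t) - + 1
    g' = solve-∀

  M : ℤ
  M = n₀ + + ∣ i₀ ∣ + + ∣ j₀ ∣

  radius : ℕ
  radius = proj₁ (growth M)

  win : Window
  win = box-window radius

  open Window win
  open Global win η

  private
    Q-size : ∀ i j → ¬ ((i , j) ∈ Q) → M < h i j + + ∣ i ∣ + + ∣ j ∣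
    Q-size i j out with radius ℕ.<? ∣ i ∣ ℕ.+ ∣ j ∣
    ... | yes big = proj₂ (growth M) i j big
    ... | no small = ⊥-elim (out (∈-cartesianProduct⁺ (within i (ℕ.m≤m+n ∣ i ∣ ∣ j ∣)) (within j (ℕ.m≤n+m ∣ j ∣ ∣ i ∣))))
      where
      within : ∀ e → ∣ e ∣ ℕ.≤ ∣ i ∣ ℕ.+ ∣ j ∣ → e ∈ interval radius
      within e le = ∈-interval radius (by (∣∣-≥- e ⊕ gap) (g (+ ∣ e ∣) e (+ radius))) (by (∣∣-≥ e ⊕ gap) (g' (+ ∣ e ∣) e (+ radius)))
        where
        gap : NN (+ radius - + ∣ e ∣)
        gap = ≤⇒NN (+≤+ (ℕ.≤-trans le (ℕ.≮⇒≥ small)))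
        g : ∀ p e r → p + e + (r - p) ≡ e + r
        g = solve-∀
        g' : ∀ p e r → p - e + (r - p) ≡ r - e
        g' = solve-∀

  -- The points of 𝓘 ∪ 𝓤 that the recursion from (n₀ , i₀ , j₀) can reach
  record Reachable (ν i j : ℤ) : Set where
    field
      on-or-above : NN (ν - η i j)
      in-cone : NN (M - (+ 2 * ν + i + j + + ∣ i ∣ + + ∣ j ∣))

  good : ∀ {ν i j} → Reachable ν i j → Good ν i j
  good {ν} {i} {j} reach = inside , outside
    where
    open Reachable reach
    inside : (i , j) ∈ Q
    inside with (i , j) ∈Q?
    ... | yes ∈Q = ∈Q
    ... | no out = ⊥-elim (<-irrefl refl (<-≤-trans (Q-size i j out) (NN⇒≤ (by (on-or-above ⊕ on-or-above ⊕ in-cone)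
        (trans (g (η i j) ν i j (+ ∣ i ∣) (+ ∣ j ∣) M) (cong (λ t → M - (t + + ∣ i ∣ + + ∣ j ∣)) (sym (h≡ i j))))))))
      where
      g : ∀ s ν i j p q M → ν - s + (ν - s) + (M - (+ 2 * ν + i + j + p + q)) ≡ M - (+ 2 * s + i + j + p + q)
      g = solve-∀
    outside : ∀ k l → ¬ ((k , l) ∈ Q) → NN (η k l - Target.cone ν i j k l)
    outside k l out = half-nonneg _ (by (≤⇒NN (<⇒≤ (Q-size k l out)) ⊕ in-cone ⊕ triangle k i ⊕ triangle l j)
      (trans (cong₂ (λ p q → h k l + + ∣ k ∣ + + ∣ l ∣ - M + (M - (+ 2 * ν + i + j + + ∣ i ∣ + + ∣ j ∣)) + (+ ∣ i ∣ + p - + ∣ k ∣) + (+ ∣ j ∣ + q - + ∣ l ∣)) (∣∣≡ (k - i)) (∣∣≡ (l - j)))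
      (trans (cong (λ t → t + + ∣ k ∣ + + ∣ l ∣ - M + (M - (+ 2 * ν + i + j + + ∣ i ∣ + + ∣ j ∣)) + (+ ∣ i ∣ + (+ 2 * pos (k - i) - (k - i)) - + ∣ k ∣) + (+ ∣ j ∣ + (+ 2 * pos (l - j) - (l - j)) - + ∣ l ∣)) (h≡ k l))
             (g (η k l) ν i j k l (+ ∣ i ∣) (+ ∣ j ∣) (+ ∣ k ∣) (+ ∣ l ∣) M (pos (k - i)) (pos (l - j))))))
      where
      g : ∀ s ν i j k l p q p' q' M z y →
        + 2 * s + k + l + p' + q' - M + (M - (+ 2 * ν + i + j + p + q)) + (p + (+ 2 * z - (k - i)) - p') + (q + (+ 2 * y - (l - j)) - q') ≡ + 2 * (s - (- y - (z - ν)))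
      g = solve-∀

  above-itself : Above η
  above-itself = record { surface = η-surface ; above = λ i j → by (nat {0}) (sym (+-inverseʳ (η i j))) }

  opaque
    value : ℤ → ℤ → ℤ → Poly
    value ν i j = For.F∞ ν i j η

    value≡ : ∀ ν i j → value ν i j ≡ For.F∞ ν i j η
    value≡ ν i j = refl

  private
    slope : ∀ (f : ℤ → ℤ) → (∀ i → Bit (f i - f (↑ i))) → ∀ i k → NN (f k - f i + pos (k - i))
    slope f step i k with sign-split (k - i)
    ... | inj₁ p = by (Crossing.monotone (λ i → f i + i) (λ i → flip-bit (step i) (g (f i) (f (↑ i)) i)) i ∣ k - i ∣)
        (trans (cong (λ t → f t + t - (f i + i)) reach) (trans (g' (f k) (f i) k i) (+-congˡ (f k - f i) (sym (pos-of-nonneg p)))))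
      where
      g : ∀ p q i → + 1 - (p - q) ≡ q + (i + + 1) - (p + i)
      g = solve-∀
      g' : ∀ p q k i → p + k - (q + i) ≡ p - q + (k - i)
      g' = solve-∀
      reach : i + + ∣ k - i ∣ ≡ k
      reach = trans (+-congˡ i (0≤i⇒+∣i∣≡i p)) (g″ i k)
        where
        g″ : ∀ i k → i + (k - i) ≡ k
        g″ = solve-∀
    ... | inj₂ p = by (Crossing.monotone (λ i → - f i) (λ i → bit-cong (step i) (g (f i) (f (↑ i)))) k ∣ i - k ∣ ⊕ pos-nonneg (k - i))
        (cong (_+ pos (k - i)) (trans (cong (λ t → - f t - - f k) reach) (g' (f k) (f i))))
      where
      g : ∀ p q → p - q ≡ - q - - p
      g = solve-∀
      g' : ∀ p q → - q - - p ≡ p - q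
      g' = solve-∀
      reach : k + + ∣ i - k ∣ ≡ i
      reach = trans (+-congˡ k (0≤i⇒+∣i∣≡i (by (p ⊕ nat {1}) (g‴ i k)))) (g″ i k)
        where
        g″ : ∀ i k → k + (i - k) ≡ i
        g″ = solve-∀
        g‴ : ∀ i k → - + 1 - (k - i) + + 1 ≡ i - k
        g‴ = solve-∀

  opaque
    unfolding value

    value-on-surface : ∀ {ν i j} → Reachable ν i j → ν ≡ η i j → value ν i j ≋ mono ((x i j , + 1) ∷ [])
    value-on-surface {i = i} {j} reach refl = For.F-top (η i j) i j (good reach) above-itself high
      where
      open Surface η-surface
      high : ∀ k l → NN (η k l - Target.cone (η i j) i j k l)
      high k l = by (slope (λ i → η i l) (λ i → right i l) i k ⊕ slope (η i) (up i) j l) (g (η k l) (η i l) (η i j) (pos (k - i)) (pos (l - j)))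
        where
        g : ∀ p q r z y → p - q + z + (q - r + y) ≡ p - (- y - (z - r))
        g = solve-∀

    exchange : ∀ ν i j {i' i″ j' j″} → i ≡ ↑ i' → i' ≡ ↑ i″ → j ≡ ↑ j' → j' ≡ ↑ j″ →
      Good ν i j → Good (ν - + 1) i j → Good (ν - + 1) (↑ i) j → Good ν i' j → Good (ν - + 1) i (↑ j) → Good ν i j' →
      NN (ν - + 1 - η i j) → let n = + 2 * ν + i + j in
      value ν i j *ₚ value (ν - + 1) i j ≋
      ((varₚ (a (i + n - + 1) j) *ₚ varₚ (c (i - n + + 1) j)) *ₚ (value (ν - + 1) i (↑ j) *ₚ value ν i j')) +ₚ
      ((varₚ (b i (j + n - + 1)) *ₚ varₚ (d i (j - n + + 1))) *ₚ (value (ν - + 1) (↑ i) j *ₚ value ν i' j))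
    exchange ν i j {i″ = k} {j″ = l} refl refl refl refl g g⁻ gE gW gN gS reach =
      ≋-trans (Relation.relation win η k l ν g g⁻ gE gW gN gS above-itself reach)
        (+ₚ-cong (laurent.*-congʳ (pair (a (i + n - + 1) j) (c (i - n + + 1) j))) (laurent.*-congʳ (pair (b i (j + n - + 1)) (d i (j - n + + 1)))))
      where
      n : ℤ
      n = + 2 * ν + i + j
      pair : ∀ u v → mono ((u , + 1) ∷ (v , + 1) ∷ []) ≋ varₚ u *ₚ varₚ v
      pair u v = ≋-trans (mono-++ ((u , + 1) ∷ []) ((v , + 1) ∷ [])) (*ₚ-cong (mono-varₚ u) (mono-varₚ v))

  private
    depth : ℤ
    depth = ∑ Q (λ t → + ∣ h (proj₁ t) (proj₂ t) ∣)

    total-≥ : ∀ ts {t} → t ∈ ts → NN (∑ ts (λ t → + ∣ h (proj₁ t) (proj₂ t) ∣) - + ∣ h (proj₁ t) (proj₂ t) ∣)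
    total-≥ (t ∷ ts) (here refl) = by (nonneg ts) (g (+ ∣ h (proj₁ t) (proj₂ t) ∣) (∑ ts (λ t → + ∣ h (proj₁ t) (proj₂ t) ∣)))
      where
      g : ∀ p q → q ≡ p + q - p
      g = solve-∀
      nonneg : ∀ ts → NN (∑ ts (λ t → + ∣ h (proj₁ t) (proj₂ t) ∣))
      nonneg [] = nat
      nonneg (t ∷ ts) = nat {∣ h (proj₁ t) (proj₂ t) ∣} ⊕ nonneg ts
    total-≥ (t ∷ ts) {u} (there u∈) = by (nat {∣ h (proj₁ t) (proj₂ t) ∣} ⊕ total-≥ ts u∈)
      (g (+ ∣ h (proj₁ t) (proj₂ t) ∣) (∑ ts (λ t → + ∣ h (proj₁ t) (proj₂ t) ∣)) (+ ∣ h (proj₁ u) (proj₂ u) ∣))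
      where
      g : ∀ p q r → p + (q - r) ≡ p + q - r
      g = solve-∀

    depth-bound : ∀ {ν i j} → Reachable ν i j → NN (+ 2 * ν + i + j + depth)
    depth-bound {ν} {i} {j} reach = by (total-≥ Q (proj₁ (good reach)) ⊕ ∣∣-≥- (h i j) ⊕ on-or-above ⊕ on-or-above)
      (trans (cong (λ t → depth - + ∣ h i j ∣ + (+ ∣ h i j ∣ + t) + (ν - η i j) + (ν - η i j)) (h≡ i j)) (g depth (+ ∣ h i j ∣) (η i j) ν i j))
      where
      open Reachable reach
      g : ∀ D p s ν i j → D - p + (p + (+ 2 * s + i + j)) + (ν - s) + (ν - s) ≡ + 2 * ν + i + j + D
      g = solve-∀

    beside : ∀ i i' → ∣ i' - i ∣ ≡ 1 → NN (+ ∣ i ∣ + + 1 - + ∣ i' ∣)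
    beside i i' eq = by (triangle i' i) (cong (λ t → + ∣ i ∣ + + t - + ∣ i' ∣) eq)

    forth : ∀ i → ∣ ↑ i - i ∣ ≡ 1
    forth i = cong ∣_∣ {x = ↑ i - i} {+ 1} (identity₅₁ i)

    back : ∀ i → ∣ i - + 1 - i ∣ ≡ 1
    back i = cong ∣_∣ {x = i - + 1 - i} { -[1+ 0 ]} (identity₅₂ i)

    module Below {ν i j} (reach : Reachable ν i j) (deep : NN (ν - η i j - + 1)) where
      open Reachable reach
      open Surface η-surface

      under : Reachable (ν - + 1) i j
      under = record { on-or-above = by deep (g₁ ν (η i j)) ; in-cone = by (in-cone ⊕ nat {2}) (g₂ ν i j (+ ∣ i ∣) (+ ∣ j ∣) M) }
        where
        g₁ : ∀ p q → p - q - + 1 ≡ p - + 1 - q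
        g₁ = solve-∀
        g₂ : ∀ ν i j p q M → M - (+ 2 * ν + i + j + p + q) + + 2 ≡ M - (+ 2 * (ν - + 1) + i + j + p + q)
        g₂ = solve-∀

      east : Reachable (ν - + 1) (↑ i) j
      east = record
        { on-or-above = by (deep ⊕ proj₁ (right i j)) (g₁ ν (η i j) (η (↑ i) j))
        ; in-cone = by (in-cone ⊕ beside i (↑ i) (forth i)) (g₂ ν i j (+ ∣ i ∣) (+ ∣ j ∣) (+ ∣ ↑ i ∣) M) }
        where
        g₁ : ∀ p q r → p - q - + 1 + (q - r) ≡ p - + 1 - r
        g₁ = solve-∀
        g₂ : ∀ ν i j p q p' M → M - (+ 2 * ν + i + j + p + q) + (p + + 1 - p') ≡ M - (+ 2 * (ν - + 1) + (i + + 1) + j + p' + q)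
        g₂ = solve-∀

      north : Reachable (ν - + 1) i (↑ j)
      north = record
        { on-or-above = by (deep ⊕ proj₁ (up i j)) (g₁ ν (η i j) (η i (↑ j)))
        ; in-cone = by (in-cone ⊕ beside j (↑ j) (forth j)) (g₂ ν i j (+ ∣ i ∣) (+ ∣ j ∣) (+ ∣ ↑ j ∣) M) }
        where
        g₁ : ∀ p q r → p - q - + 1 + (q - r) ≡ p - + 1 - r
        g₁ = solve-∀
        g₂ : ∀ ν i j p q q' M → M - (+ 2 * ν + i + j + p + q) + (q + + 1 - q') ≡ M - (+ 2 * (ν - + 1) + i + (j + + 1) + p + q')
        g₂ = solve-∀

      west : Reachable ν (i - + 1) j
      west = record
        { on-or-above = by (deep ⊕ proj₂ (right (i - + 1) j)) (trans (cong (λ t → ν - η i j - + 1 + (+ 1 - (η (i - + 1) j - η t j))) (sym (pred-↑ i))) (g₁ ν (η i j) (η (i - + 1) j)))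
        ; in-cone = by (in-cone ⊕ beside i (i - + 1) (back i)) (g₂ ν i j (+ ∣ i ∣) (+ ∣ j ∣) (+ ∣ i - + 1 ∣) M) }
        where
        g₁ : ∀ p q r → p - q - + 1 + (+ 1 - (r - q)) ≡ p - r
        g₁ = solve-∀
        g₂ : ∀ ν i j p q p' M → M - (+ 2 * ν + i + j + p + q) + (p + + 1 - p') ≡ M - (+ 2 * ν + (i - + 1) + j + p' + q)
        g₂ = solve-∀

      south : Reachable ν i (j - + 1)
      south = record
        { on-or-above = by (deep ⊕ proj₂ (up i (j - + 1))) (trans (cong (λ t → ν - η i j - + 1 + (+ 1 - (η i (j - + 1) - η i t))) (sym (pred-↑ j))) (g₁ ν (η i j) (η i (j - + 1))))
        ; in-cone = by (in-cone ⊕ beside j (j - + 1) (back j)) (g₂ ν i j (+ ∣ i ∣) (+ ∣ j ∣) (+ ∣ j - + 1 ∣) M) }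
        where
        g₁ : ∀ p q r → p - q - + 1 + (+ 1 - (r - q)) ≡ p - r
        g₁ = solve-∀
        g₂ : ∀ ν i j p q q' M → M - (+ 2 * ν + i + j + p + q) + (q + + 1 - q') ≡ M - (+ 2 * ν + i + (j - + 1) + p + q')
        g₂ = solve-∀

  -- Fractions need not be reduced, as only numerators that are multiples
  -- of their denominators are combined.
  represented : ∀ k {ν i j} n → n ≡ + 2 * ν + i + j → Reachable ν i j → NN (+ k - (n + depth) - + 1) → Represents (fK h k n i j) (value ν i j)
  represented zero {ν} {i} {j} _ refl reach fuel = absurd {k = 0} (fuel ⊕ depth-bound reach) (g (+ 2 * ν + i + j + depth))
    where
    g : ∀ p → + 0 - p - + 1 + p ≡ -[1+ 0 ]
    g = solve-∀
  represented (suc k) {ν} {i} {j} _ refl reach fuel = cases (+ 2 * ν + i + j ≟ h i j)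
    where
    open Reachable reach
    n : ℤ
    n = + 2 * ν + i + j
    Goal : Frac → Set
    Goal f = Represents f (value ν i j)
    fuel′ : ∀ {e} → + suc k - (n + depth) - + 1 ≡ e → NN e
    fuel′ = by fuel
    g : ∀ k n D → + 1 + k - (n + D) - + 1 ≡ k - (n - + 1 + D) - + 1
    g = solve-∀
    g′ : ∀ k n D → + 1 + k - (n + D) - + 1 + + 1 ≡ k - (n - + 2 + D) - + 1
    g′ = solve-∀
    g₁ : ∀ ν i j → + 2 * ν + i + j - + 1 ≡ + 2 * (ν - + 1) + i + (j + + 1)
    g₁ = solve-∀
    g₂ : ∀ ν i j → + 2 * ν + i + j - + 1 ≡ + 2 * ν + i + (j - + 1)
    g₂ = solve-∀
    g₃ : ∀ ν i j → + 2 * ν + i + j - + 1 ≡ + 2 * (ν - + 1) + (i + + 1) + j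
    g₃ = solve-∀
    g₄ : ∀ ν i j → + 2 * ν + i + j - + 1 ≡ + 2 * ν + (i - + 1) + j
    g₄ = solve-∀
    g₅ : ∀ ν i j → + 2 * ν + i + j - + 2 ≡ + 2 * (ν - + 1) + i + j
    g₅ = solve-∀
    g₆ : ∀ p q → p - q - + 1 ≡ p - + 1 - q
    g₆ = solve-∀

    on-surface : n ≡ h i j → ν ≡ η i j
    on-surface eq = *-cancelˡ-≡ (+ 2) ν (η i j) (≡-by (trans eq (h≡ i j)) (e ν (η i j) i j))
      where
      e : ∀ p q i j → + 2 * p - + 2 * q ≡ + 2 * p + i + j - (+ 2 * q + i + j)
      e = solve-∀

    module Interior (above : ¬ (n ≡ h i j)) where
      below : h i j < n
      below = ≤∧≢⇒< (NN⇒≤ (by (on-or-above ⊕ on-or-above) (trans (e ν (η i j) i j) (cong (λ t → n - t) (sym (h≡ i j)))))) (λ eq → above (sym eq))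
        where
        e : ∀ p q i j → p - q + (p - q) ≡ + 2 * p + i + j - (+ 2 * q + i + j)
        e = solve-∀

      deep : NN (ν - η i j - + 1)
      deep with sign-split (ν - η i j - + 1)
      ... | inj₁ p = p
      ... | inj₂ p = ⊥-elim (above (trans (cong (λ t → + 2 * t + i + j) (pin {ν} {η i j} on-or-above (by p (e ν (η i j))))) (sym (h≡ i j))))
        where
        e : ∀ p q → - + 1 - (p - q - + 1) ≡ q - p
        e = solve-∀

      module B = Below reach deep

    cases : Dec (n ≡ h i j) → Goal (fK h (suc k) n i j)
    cases (yes eq) = subst Goal (sym (fK-on h k n i j eq))
      (represents (≋-trans (≋-sym (mono-varₚ (x i j))) (≋-trans (≋-sym (value-on-surface reach (on-surface eq))) (≋-sym (*ₚ-identityˡ (value ν i j))))))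
    cases (no above) = subst Goal (sym (fK-above h k n i j above below))
      (quotient-represents {a (i + n - + 1) j} {c (i - n + + 1) j} {b i (j + n - + 1)} {d i (j - n + + 1)} {f₅ = fK h k (n - + 2) i j}
        (represented k (n - + 1) (g₁ ν i j) B.north (fuel′ (g (+ k) n depth)))
        (represented k (n - + 1) (g₂ ν i j) B.south (fuel′ (g (+ k) n depth)))
        (represented k (n - + 1) (g₃ ν i j) B.east (fuel′ (g (+ k) n depth)))
        (represented k (n - + 1) (g₄ ν i j) B.west (fuel′ (g (+ k) n depth)))
        (represented k (n - + 2) (g₅ ν i j) B.under (by (fuel ⊕ nat {1}) (g′ (+ k) n depth)))
        (exchange ν i j {i″ = i - + 1 - + 1} {j″ = j - + 1 - + 1} (pred-↑ i) (pred-↑ (i - + 1)) (pred-↑ j) (pred-↑ (j - + 1))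
          (good reach) (good B.under) (good B.east) (good B.west) (good B.north) (good B.south) (by deep (g₆ ν (η i j)))))
      where
      open Interior above

  module _ (inU : InU h n₀ i₀ j₀) where
    private
      opaque
        ν₀ : ℤ
        ν₀ = half (n₀ - (i₀ + j₀)) (proj₁ inU)

        n₀≡ : n₀ ≡ + 2 * ν₀ + i₀ + j₀
        n₀≡ = solve n₀ ν₀ i₀ j₀ (half-eq (n₀ - (i₀ + j₀)) (proj₁ inU))

      reach₀ : Reachable ν₀ i₀ j₀
      reach₀ = record
        { on-or-above = half-nonneg (ν₀ - η i₀ j₀) (by (≤⇒NN (<⇒≤ (proj₂ inU))) (trans (cong₂ _-_ n₀≡ (h≡ i₀ j₀)) (g ν₀ (η i₀ j₀) i₀ j₀)))
        ; in-cone = by (nat {0}) (trans (sym (+-inverseʳ M)) (cong (λ t → M - (t + + ∣ i₀ ∣ + + ∣ j₀ ∣)) n₀≡))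
        }
        where
        g : ∀ p q i j → + 2 * p + i + j - (+ 2 * q + i + j) ≡ + 2 * (p - q)
        g = solve-∀

      bound : ℕ
      bound = suc ∣ n₀ + depth ∣

      enough : ∀ k → bound ℕ.≤ k → NN (+ k - (n₀ + depth) - + 1)
      enough k le = by (≤⇒NN (+≤+ le) ⊕ ∣∣-≥ (n₀ + depth)) (g (+ k) (+ ∣ n₀ + depth ∣) (n₀ + depth))
        where
        g : ∀ k p q → k - (+ 1 + p) + (p - q) ≡ k - q - + 1
        g = solve-∀

    laurent-expansion : ∃[ ms ] (AllPairs (λ m m' → ¬ MonoEq m m') ms × All MonoOK ms × FEquals h n₀ i₀ j₀ (sumMonos ms , oneₚ))
    laurent-expansion = monos (clip η) , monos-distinct under , monos-ok under , bound , λ k le →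
      ≋⇒≈ₚ (≋-trans (laurent.*-identityʳ (proj₁ (fK h k n₀ i₀ j₀))) (numerator (subst (Represents (fK h k n₀ i₀ j₀)) (value≡ ν₀ i₀ j₀) (represented k n₀ n₀≡ reach₀ (enough k le)))))
      where
      open For ν₀ i₀ j₀
      under : Under (clip η)
      under = clipped (good reach₀) above-itself

mainTheorem1 : (h : ℤ → ℤ → ℤ) → IsHeightFunction h →
    (n i j : ℤ) → InU h n i j →
    ∃[ ms ] (AllPairs (λ m m' → ¬ MonoEq m m') ms × All MonoOK ms
    × FEquals h n i j (sumMonos ms , oneₚ))
mainTheorem1 h isHeight n i j inU = Main.laurent-expansion h isHeight n i j inU
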